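{- Let $b\ge2$ be an integer. There are constants $\mu_d$ and $\sigma_d^2$ (depending only on $b$) such that the number of distinct parts in a random composition of $1$ into $m=(b-1)n+1$ parts (powers of $b$) is asymptotically normally distributed (as $n\to\infty$) with mean $\mu_d n+O(1)$ and variance $\sigma_d^2 n+O(1)$.
   Context: For an integer $n\ge0$ and $m=(b-1)n+1$, a composition of $1$ into $m$ powers of $b$ is an $m$-tuple $\mathbf{k}=(k_1,\ldots,k_m)$ of nonnegative integers with $b^{ -k_1}+b^{ -k_2}+\cdots+b^{ -k_m}=1$. There are finitely many such compositions for each $n$, and a random composition is one chosen uniformly at random among them. The number of distinct parts of $\mathbf{k}$ is the number of distinct values among $k_1,\ldots,k_m$. A sequence of random variables $X_n$ is asymptotically normally distributed if $(X_n-\mathbb{E}X_n)/\sqrt{\mathrm{Var}\,X_n}$ converges in distribution to the standard normal distribution. -}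

module Defs where

open import Data.Bool using (if_then_else_)
open import Data.Integer as ℤ using (ℤ; +_)
import Data.Integer.Properties as ℤ
open import Data.List
  using (List; []; _∷_; _++_; map; foldr; filter; length; replicate; upTo; deduplicate; cartesianProductWith)
open import Data.List.Membership.Propositional using (_∈_)
open import Data.List.Membership.Propositional.Properties
  using (∈-cartesianProductWith⁺; ∈-filter⁺; ∈-filter⁻; ∈-upTo⁺)
open import Data.List.Properties using (length-++; length-map; length-replicate)
open import Data.List.Relation.Unary.All using ([])
open import Data.List.Relation.Unary.Any using (here; there)
open import Data.List.Relation.Unary.Unique.Propositional using (Unique; []; _∷_)
open import Data.List.Relation.Unary.Unique.Propositional.Properties using (cartesianProductWith⁺; filter⁺; upTo⁺)
open import Data.Nat as ℕ using (ℕ; zero; suc)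
import Data.Nat.Properties as ℕ
open import Data.Product using (∃-syntax; _×_; _,_; proj₁; proj₂)
open import Data.Rational
open import Data.Rational.Properties
import Data.Rational.Solver as ℚSolver
import Data.Rational.Unnormalised as ℚᵘ
import Data.Rational.Unnormalised.Properties as ℚᵘ
open import Data.Sum using (_⊎_; inj₁; inj₂)
open import Data.Vec using (Vec; []; _∷_; toList; fromList; cast)
open import Data.Vec.Properties using (∷-injective; length-toList; toList-cast; toList∘fromList)
open import Function using (_∘_)
open import Relation.Binary.PropositionalEquality
  using (_≡_; refl; sym; trans; cong; cong₂; subst; subst₂; module ≡-Reasoning)
open import Relation.Nullary using (yes; no; ¬_; does; contradiction)
open import Relation.Unary using (Decidable)

open ℚSolver.+-*-Solver using (solve; _:=_; _:+_; _:*_; :-_; _:-_; con)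

fromℚᵘ-mono-≤ : ∀ {p q} → p ℚᵘ.≤ q → fromℚᵘ p ≤ fromℚᵘ q
fromℚᵘ-mono-≤ {p} {q} p≤q = toℚᵘ-cancel-≤
  (ℚᵘ.≤-respˡ-≃ (ℚᵘ.≃-sym (toℚᵘ-fromℚᵘ p)) (ℚᵘ.≤-respʳ-≃ (ℚᵘ.≃-sym (toℚᵘ-fromℚᵘ q)) p≤q))

fromℚᵘ-homo-+ : ∀ p q → fromℚᵘ (p ℚᵘ.+ q) ≡ fromℚᵘ p + fromℚᵘ q
fromℚᵘ-homo-+ p q = toℚᵘ-injective (ℚᵘ.≃-trans (toℚᵘ-fromℚᵘ (p ℚᵘ.+ q))
  (ℚᵘ.≃-trans (ℚᵘ.+-cong (ℚᵘ.≃-sym (toℚᵘ-fromℚᵘ p)) (ℚᵘ.≃-sym (toℚᵘ-fromℚᵘ q)))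
    (ℚᵘ.≃-sym (toℚᵘ-homo-+ (fromℚᵘ p) (fromℚᵘ q)))))

fromℚᵘ-homo-* : ∀ p q → fromℚᵘ (p ℚᵘ.* q) ≡ fromℚᵘ p * fromℚᵘ q
fromℚᵘ-homo-* p q = toℚᵘ-injective (ℚᵘ.≃-trans (toℚᵘ-fromℚᵘ (p ℚᵘ.* q))
  (ℚᵘ.≃-trans (ℚᵘ.*-cong (ℚᵘ.≃-sym (toℚᵘ-fromℚᵘ p)) (ℚᵘ.≃-sym (toℚᵘ-fromℚᵘ q)))
    (ℚᵘ.≃-sym (toℚᵘ-homo-* (fromℚᵘ p) (fromℚᵘ q)))))

ι : ℕ → ℚ
ι n = + n / 1

ι-homo-+ : ∀ m n → ι (m ℕ.+ n) ≡ ι m + ι n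
ι-homo-+ m n = trans (fromℚᵘ-cong {ℚᵘ.mkℚᵘ (+ (m ℕ.+ n)) 0} {ℚᵘ.mkℚᵘ (+ m) 0 ℚᵘ.+ ℚᵘ.mkℚᵘ (+ n) 0} (ℚᵘ.*≡* (cong (ℤ._* + 1) (sym (cong₂ ℤ._+_ (ℤ.*-identityʳ (+ m)) (ℤ.*-identityʳ (+ n)))))))
                     (fromℚᵘ-homo-+ (ℚᵘ.mkℚᵘ (+ m) 0) (ℚᵘ.mkℚᵘ (+ n) 0))

ι-homo-* : ∀ m n → ι (m ℕ.* n) ≡ ι m * ι n
ι-homo-* m n = trans (fromℚᵘ-cong {ℚᵘ.mkℚᵘ (+ (m ℕ.* n)) 0} {ℚᵘ.mkℚᵘ (+ m) 0 ℚᵘ.* ℚᵘ.mkℚᵘ (+ n) 0} (ℚᵘ.*≡* (cong (ℤ._* + 1) (ℤ.pos-* m n))))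
                     (fromℚᵘ-homo-* (ℚᵘ.mkℚᵘ (+ m) 0) (ℚᵘ.mkℚᵘ (+ n) 0))

ι-mono : ∀ {m n} → m ℕ.≤ n → ι m ≤ ι n
ι-mono {m} {n} m≤n = fromℚᵘ-mono-≤ {ℚᵘ.mkℚᵘ (+ m) 0} {ℚᵘ.mkℚᵘ (+ n) 0}
  (ℚᵘ.*≤* (ℤ.*-monoʳ-≤-nonNeg (+ 1) (ℤ.+≤+ m≤n)))

0≤ι : ∀ n → 0ℚ ≤ ι n
0≤ι n = ι-mono {0} {n} ℕ.z≤n

-- Shifted: inv k = 1 / (k + 1).
inv : ℕ → ℚ
inv k = + 1 / suc k

0≤inv : ∀ k → 0ℚ ≤ inv k
0≤inv k = fromℚᵘ-mono-≤ {ℚᵘ.mkℚᵘ (+ 0) 0} {ℚᵘ.mkℚᵘ (+ 1) k} (ℚᵘ.*≤* (ℤ.+≤+ ℕ.z≤n))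

inv*ι : ∀ k → inv k * ι (suc k) ≡ 1ℚ
inv*ι k = trans (sym (fromℚᵘ-homo-* (ℚᵘ.mkℚᵘ (+ 1) k) (ℚᵘ.mkℚᵘ (+ suc k) 0)))
                (fromℚᵘ-cong {ℚᵘ.mkℚᵘ (+ 1) k ℚᵘ.* ℚᵘ.mkℚᵘ (+ suc k) 0} {ℚᵘ.mkℚᵘ (+ 1) 0}
                  (ℚᵘ.*≡* (cong (λ t → + suc t) (ℕ-eq k))))
  where
  ℕ-eq : ∀ k → (k ℕ.+ 0) ℕ.* 1 ≡ k ℕ.* 1 ℕ.+ 0
  ℕ-eq k = trans (ℕ.*-identityʳ (k ℕ.+ 0)) (cong (ℕ._+ 0) (sym (ℕ.*-identityʳ k)))

*-mono-≤ : ∀ {p q r s} → 0ℚ ≤ r → 0ℚ ≤ q → p ≤ q → r ≤ s → p * r ≤ q * s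
*-mono-≤ {p} {q} {r} {s} 0≤r 0≤q p≤q r≤s =
  ≤-trans (*-monoʳ-≤-nonNeg r {{nonNegative 0≤r}} p≤q) (*-monoˡ-≤-nonNeg q {{nonNegative 0≤q}} r≤s)

0≤* : ∀ {p q} → 0ℚ ≤ p → 0ℚ ≤ q → 0ℚ ≤ p * q
0≤* {p} {q} 0≤p 0≤q = subst (_≤ p * q) (*-zeroˡ 0ℚ) (*-mono-≤ ≤-refl 0≤p 0≤p 0≤q)

0<* : ∀ {p q} → 0ℚ < p → 0ℚ < q → 0ℚ < p * q
0<* {p} {q} 0<p 0<q = positive⁻¹ _ {{pos*pos⇒pos p {{positive 0<p}} q {{positive 0<q}}}}

recip : ∀ {p} → 0ℚ < p → ∃[ r ] 0ℚ < r × p * r ≡ 1ℚ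
recip {p} 0<p = 1/ p , positive⁻¹ _ {{1/pos⇒pos p}} , *-inverseʳ p
  where instance
  _ : Positive p
  _ = positive 0<p
  _ : NonZero p
  _ = pos⇒nonZero p

0≤-+ : ∀ {p q} → 0ℚ ≤ p → 0ℚ ≤ q → 0ℚ ≤ p + q
0≤-+ {p} {q} 0≤p 0≤q = subst (_≤ p + q) (+-identityˡ 0ℚ) (+-mono-≤ 0≤p 0≤q)

p≤p+q : ∀ {p q} → 0ℚ ≤ q → p ≤ p + q
p≤p+q {p} {q} 0≤q = subst (_≤ p + q) (+-identityʳ p) (+-monoʳ-≤ p 0≤q)

p≤q+p : ∀ {p q} → 0ℚ ≤ q → p ≤ q + p
p≤q+p {p} {q} 0≤q = subst (p ≤_) (+-comm p q) (p≤p+q 0≤q)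

archimedean : ∀ q → ∃[ n ] q ≤ ι n
archimedean q@(mkℚ i d-1 _) = ℤ.∣ i ∣ , toℚᵘ-cancel-≤
  (ℚᵘ.≤-respʳ-≃ (ℚᵘ.≃-sym (toℚᵘ-fromℚᵘ (ℚᵘ.mkℚᵘ (+ ℤ.∣ i ∣) 0)))
    (ℚᵘ.*≤* (ℤ.≤-trans (ℤ.≤-reflexive (ℤ.*-identityʳ i))
      (ℤ.≤-trans (ℤ.≤-trans (i≤∣i∣ i) (ℤ.+≤+ (ℕ.m≤m*n ℤ.∣ i ∣ (suc d-1)))) (ℤ.≤-reflexive (ℤ.pos-* ℤ.∣ i ∣ (suc d-1)))))))
  where
  i≤∣i∣ : ∀ i → i ℤ.≤ + ℤ.∣ i ∣
  i≤∣i∣ (+ n)          = ℤ.≤-refl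
  i≤∣i∣ (ℤ.-[1+_] n) = ℤ.-≤+

eventually-small : ∀ C → 0ℚ ≤ C → ∀ ε → 0ℚ < ε → ∃[ N ] ∀ k → N ℕ.≤ k → C * inv k ≤ ε
eventually-small C 0≤C ε 0<ε with recip 0<ε
... | r , 0<r , εr≡1 with archimedean (C * r)
... | N , Cr≤N = N , λ k N≤k → begin
  C * inv k                        ≡⟨ cong (_* inv k) (sym (trans (cong (C *_) (trans (*-comm r ε) εr≡1)) (*-identityʳ C))) ⟩
  C * (r * ε) * inv k              ≡⟨ cong (_* inv k) (sym (*-assoc C r ε)) ⟩
  C * r * ε * inv k                ≤⟨ *-monoʳ-≤-nonNeg (inv k) {{nonNegative (0≤inv k)}}
                                        (*-monoʳ-≤-nonNeg ε {{nonNegative (<⇒≤ 0<ε)}}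
                                          (≤-trans Cr≤N (ι-mono (ℕ.≤-trans N≤k (ℕ.n≤1+n k))))) ⟩
  ι (suc k) * ε * inv k            ≡⟨ solve 3 (λ a b c → a :* b :* c := c :* a :* b) refl (ι (suc k)) ε (inv k) ⟩
  inv k * ι (suc k) * ε            ≡⟨ cong (_* ε) (inv*ι k) ⟩
  1ℚ * ε                           ≡⟨ *-identityˡ ε ⟩
  ε                                ∎
  where open ≤-Reasoning

∣p-q∣≡∣q-p∣ : ∀ p q → ∣ p - q ∣ ≡ ∣ q - p ∣
∣p-q∣≡∣q-p∣ p q = trans (sym (∣-p∣≡∣p∣ (p - q)))
  (cong ∣_∣ (solve 2 (λ p q → :- (p :- q) := q :- p) refl p q))

∣p-r∣≤∣p-q∣+∣q-r∣ : ∀ p q r → ∣ p - r ∣ ≤ ∣ p - q ∣ + ∣ q - r ∣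
∣p-r∣≤∣p-q∣+∣q-r∣ p q r = subst (λ t → ∣ t ∣ ≤ ∣ p - q ∣ + ∣ q - r ∣)
  (solve 3 (λ p q r → (p :- q) :+ (q :- r) := p :- r) refl p q r)
  (∣p+q∣≤∣p∣+∣q∣ (p - q) (q - r))

p≤q+r⇒p-q≤r : ∀ {p q r} → p ≤ q + r → p - q ≤ r
p≤q+r⇒p-q≤r {p} {q} {r} h = subst (p - q ≤_)
  (solve 2 (λ q r → q :+ r :- q := r) refl q r) (+-monoˡ-≤ (- q) h)

p-q≤r⇒p≤q+r : ∀ {p q r} → p - q ≤ r → p ≤ q + r
p-q≤r⇒p≤q+r {p} {q} {r} h = subst (_≤ q + r)
  (solve 2 (λ p q → q :+ (p :- q) := p) refl p q) (+-monoʳ-≤ q h)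

p≤∣p∣ : ∀ p → p ≤ ∣ p ∣
p≤∣p∣ p with ≤-total 0ℚ p
... | inj₁ 0≤p = ≤-reflexive (sym (0≤p⇒∣p∣≡p 0≤p))
... | inj₂ p≤0 = ≤-trans p≤0 (0≤∣p∣ p)

∣p∣≤q : ∀ {p q} → p ≤ q → - p ≤ q → ∣ p ∣ ≤ q
∣p∣≤q {p} p≤q -p≤q with ∣p∣≡p∨∣p∣≡-p p
... | inj₁ e = subst (_≤ _) (sym e) p≤q
... | inj₂ e = subst (_≤ _) (sym e) -p≤q

∣p-q∣≤r : ∀ {p q r} → p ≤ q + r → q ≤ p + r → ∣ p - q ∣ ≤ r
∣p-q∣≤r {p} {q} {r} h k = ∣p∣≤q (p≤q+r⇒p-q≤r h)
  (subst (_≤ r) (solve 2 (λ p q → q :- p := :- (p :- q)) refl p q) (p≤q+r⇒p-q≤r k))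

∣∣p∣-∣q∣∣≤∣p-q∣ : ∀ p q → ∣ ∣ p ∣ - ∣ q ∣ ∣ ≤ ∣ p - q ∣
∣∣p∣-∣q∣∣≤∣p-q∣ p q = ∣p-q∣≤r (half p q) (subst (λ t → ∣ q ∣ ≤ ∣ p ∣ + t) (∣p-q∣≡∣q-p∣ q p) (half q p))
  where
  half : ∀ p q → ∣ p ∣ ≤ ∣ q ∣ + ∣ p - q ∣
  half p q = subst (λ t → ∣ t ∣ ≤ ∣ q ∣ + ∣ p - q ∣)
    (solve 2 (λ p q → q :+ (p :- q) := p) refl p q) (∣p+q∣≤∣p∣+∣q∣ q (p - q))

halve : ∀ {ε} → 0ℚ < ε → 0ℚ < ½ * ε
halve 0<ε = 0<* (positive⁻¹ ½) 0<ε

½+½ : ∀ ε → ½ * ε + ½ * ε ≡ ε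
½+½ ε = trans (sym (*-distribʳ-+ ε ½ ½)) (*-identityˡ ε)

IsCauchy : (ℕ → ℚ) → Set
IsCauchy f = ∀ ε → 0ℚ < ε → ∃[ N ] ∀ i j → N ℕ.≤ i → N ℕ.≤ j → ∣ f i - f j ∣ ≤ ε

record ℝ : Set where
  no-eta-equality
  field
    approx : ℕ → ℚ
    cauchy : IsCauchy approx

open ℝ public

infix 4 _≤ᴿ_ _≃ᴿ_

_≤ᴿ_ : ℝ → ℝ → Set
x ≤ᴿ y = ∀ ε → 0ℚ < ε → ∃[ N ] ∀ k → N ℕ.≤ k → approx x k ≤ approx y k + ε

_≃ᴿ_ : ℝ → ℝ → Set
x ≃ᴿ y = x ≤ᴿ y × y ≤ᴿ x

fromℚ : ℚ → ℝ
approx (fromℚ q) _ = q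
cauchy (fromℚ q) ε 0<ε = 0 , λ _ _ _ _ → ≤-trans (≤-reflexive (cong ∣_∣ (+-inverseʳ q))) (<⇒≤ 0<ε)

infixl 6 _+ᴿ_ _-ᴿ_
infixl 7 _*ᴿ_
infix  8 -ᴿ_

both : ∀ {M N i} → M ℕ.⊔ N ℕ.≤ i → M ℕ.≤ i × N ℕ.≤ i
both {M} {N} h = ℕ.≤-trans (ℕ.m≤m⊔n M N) h , ℕ.≤-trans (ℕ.m≤n⊔m M N) h

+-cauchy : ∀ {f g} → IsCauchy f → IsCauchy g → IsCauchy (λ k → f k + g k)
+-cauchy {f} {g} cf cg ε 0<ε =
  let M , hf = cf (½ * ε) (halve 0<ε)
      N , hg = cg (½ * ε) (halve 0<ε)
  in M ℕ.⊔ N , λ i j M⊔N≤i M⊔N≤j →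
     let M≤i , N≤i = both M⊔N≤i
         M≤j , N≤j = both M⊔N≤j
     in begin
       ∣ f i + g i - (f j + g j) ∣       ≡⟨ cong ∣_∣ (solve 4 (λ a b c d → a :+ b :- (c :+ d) := (a :- c) :+ (b :- d)) refl (f i) (g i) (f j) (g j)) ⟩
       ∣ (f i - f j) + (g i - g j) ∣     ≤⟨ ∣p+q∣≤∣p∣+∣q∣ (f i - f j) (g i - g j) ⟩
       ∣ f i - f j ∣ + ∣ g i - g j ∣     ≤⟨ +-mono-≤ (hf i j M≤i M≤j) (hg i j N≤i N≤j) ⟩
       ½ * ε + ½ * ε                     ≡⟨ ½+½ ε ⟩
       ε                                 ∎
  where open ≤-Reasoning

_+ᴿ_ : ℝ → ℝ → ℝ
approx (x +ᴿ y) k = approx x k + approx y k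
cauchy (x +ᴿ y)   = +-cauchy {approx x} {approx y} (cauchy x) (cauchy y)

-‿cauchy : ∀ {f} → IsCauchy f → IsCauchy (λ k → - f k)
-‿cauchy {f} cf ε 0<ε =
  let N , hf = cf ε 0<ε
  in N , λ i j N≤i N≤j → subst (_≤ ε)
       (trans (sym (∣-p∣≡∣p∣ (f i - f j))) (cong ∣_∣ (solve 2 (λ a b → :- (a :- b) := :- a :- :- b) refl (f i) (f j))))
       (hf i j N≤i N≤j)

-ᴿ_ : ℝ → ℝ
approx (-ᴿ x) k = - approx x k
cauchy (-ᴿ x)   = -‿cauchy {approx x} (cauchy x)

_-ᴿ_ : ℝ → ℝ → ℝ
x -ᴿ y = x +ᴿ -ᴿ y

∣∣-cauchy : ∀ {f} → IsCauchy f → IsCauchy (λ k → ∣ f k ∣)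
∣∣-cauchy {f} cf ε 0<ε =
  let N , hf = cf ε 0<ε
  in N , λ i j N≤i N≤j → ≤-trans (∣∣p∣-∣q∣∣≤∣p-q∣ (f i) (f j)) (hf i j N≤i N≤j)

∣_∣ᴿ : ℝ → ℝ
approx ∣ x ∣ᴿ k = ∣ approx x k ∣
cauchy ∣ x ∣ᴿ   = ∣∣-cauchy {approx x} (cauchy x)

cauchy⇒bounded : ∀ {f} → IsCauchy f → ∃[ B ] 0ℚ < B × ∀ k → ∣ f k ∣ ≤ B
cauchy⇒bounded {f} cf with cf 1ℚ (positive⁻¹ 1ℚ)
... | N , hf = partial N + 1ℚ , 0<B , bound
  where
  partial : ℕ → ℚ
  partial zero    = ∣ f 0 ∣
  partial (suc n) = partial n + ∣ f (suc n) ∣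

  0≤partial : ∀ n → 0ℚ ≤ partial n
  0≤partial zero    = 0≤∣p∣ _
  0≤partial (suc n) = 0≤-+ (0≤partial n) (0≤∣p∣ _)

  last≤ : ∀ n → ∣ f n ∣ ≤ partial n
  last≤ zero    = ≤-refl
  last≤ (suc n) = p≤q+p (0≤partial n)

  initial : ∀ {k n} → k ℕ.≤′ n → ∣ f k ∣ ≤ partial n
  initial ℕ.≤′-refl         = last≤ _
  initial (ℕ.≤′-step k≤n) = ≤-trans (initial k≤n) (p≤p+q (0≤∣p∣ _))

  0<B : 0ℚ < partial N + 1ℚ
  0<B = <-≤-trans (positive⁻¹ 1ℚ) (p≤q+p (0≤partial N))

  bound : ∀ k → ∣ f k ∣ ≤ partial N + 1ℚ
  bound k with ℕ.≤-total k N
  ... | inj₁ k≤N = ≤-trans (initial (ℕ.≤⇒≤′ k≤N)) (p≤p+q (<⇒≤ (positive⁻¹ 1ℚ)))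
  ... | inj₂ N≤k = begin
    ∣ f k ∣                          ≡⟨ cong ∣_∣ (solve 2 (λ a b → a := b :+ (a :- b)) refl (f k) (f N)) ⟩
    ∣ f N + (f k - f N) ∣            ≤⟨ ∣p+q∣≤∣p∣+∣q∣ (f N) (f k - f N) ⟩
    ∣ f N ∣ + ∣ f k - f N ∣          ≤⟨ +-mono-≤ (last≤ N) (hf k N N≤k ℕ.≤-refl) ⟩
    partial N + 1ℚ                   ∎
    where open ≤-Reasoning

*-cauchy : ∀ {f g} → IsCauchy f → IsCauchy g → IsCauchy (λ k → f k * g k)
*-cauchy {f} {g} cf cg ε 0<ε =
  let A , 0<A , ∣f∣≤A = cauchy⇒bounded {f} cf
      B , 0<B , ∣g∣≤B = cauchy⇒bounded {g} cg
      r , 0<r , A+B*r≡1 = recip (<-≤-trans 0<A (p≤p+q (<⇒≤ 0<B)))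
      M , hf = cf (r * ε) (0<* 0<r 0<ε)
      N , hg = cg (r * ε) (0<* 0<r 0<ε)
  in M ℕ.⊔ N , λ i j M⊔N≤i M⊔N≤j →
     let M≤i , N≤i = both M⊔N≤i
         M≤j , N≤j = both M⊔N≤j
     in begin
       ∣ f i * g i - f j * g j ∣
         ≡⟨ cong ∣_∣ (solve 4 (λ a b c d → a :* b :- c :* d := a :* (b :- d) :+ (a :- c) :* d) refl (f i) (g i) (f j) (g j)) ⟩
       ∣ f i * (g i - g j) + (f i - f j) * g j ∣
         ≤⟨ ∣p+q∣≤∣p∣+∣q∣ (f i * (g i - g j)) ((f i - f j) * g j) ⟩
       ∣ f i * (g i - g j) ∣ + ∣ (f i - f j) * g j ∣
         ≡⟨ cong₂ _+_ (∣p*q∣≡∣p∣*∣q∣ (f i) (g i - g j)) (∣p*q∣≡∣p∣*∣q∣ (f i - f j) (g j)) ⟩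
       ∣ f i ∣ * ∣ g i - g j ∣ + ∣ f i - f j ∣ * ∣ g j ∣
         ≤⟨ +-mono-≤ (*-mono-≤ (0≤∣p∣ (g i - g j)) (<⇒≤ 0<A) (∣f∣≤A i) (hg i j N≤i N≤j))
                     (*-mono-≤ (0≤∣p∣ (g j)) (<⇒≤ (0<* 0<r 0<ε)) (hf i j M≤i M≤j) (∣g∣≤B j)) ⟩
       A * (r * ε) + r * ε * B
         ≡⟨ solve 4 (λ a b r e → a :* (r :* e) :+ r :* e :* b := (a :+ b) :* r :* e) refl A B r ε ⟩
       (A + B) * r * ε
         ≡⟨ cong (_* ε) A+B*r≡1 ⟩
       1ℚ * ε
         ≡⟨ *-identityˡ ε ⟩
       ε ∎
  where open ≤-Reasoning

_*ᴿ_ : ℝ → ℝ → ℝ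
approx (x *ᴿ y) k = approx x k * approx y k
cauchy (x *ᴿ y)   = *-cauchy {approx x} {approx y} (cauchy x) (cauchy y)

-- ⌊√n⌋
isqrt : ℕ → ℕ
isqrt zero    = 0
isqrt (suc n) with suc (isqrt n) ℕ.* suc (isqrt n) ℕ.≤? suc n
... | yes _ = suc (isqrt n)
... | no  _ = isqrt n

isqrt-lower : ∀ n → isqrt n ℕ.* isqrt n ℕ.≤ n
isqrt-lower zero    = ℕ.z≤n
isqrt-lower (suc n) with suc (isqrt n) ℕ.* suc (isqrt n) ℕ.≤? suc n
... | yes h = h
... | no  _ = ℕ.≤-trans (isqrt-lower n) (ℕ.n≤1+n n)

isqrt-upper : ∀ n → n ℕ.< suc (isqrt n) ℕ.* suc (isqrt n)
isqrt-upper zero    = ℕ.s≤s ℕ.z≤n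
isqrt-upper (suc n) with suc (isqrt n) ℕ.* suc (isqrt n) ℕ.≤? suc n
... | yes _ = ℕ.≤-<-trans (isqrt-upper n) (ℕ.*-mono-< (ℕ.n<1+n (suc (isqrt n))) (ℕ.n<1+n (suc (isqrt n))))
... | no  h = ℕ.≰⇒> h

square-reflects-≤ : ∀ {a b} → a ℕ.* a ℕ.≤ b ℕ.* b → a ℕ.≤ b
square-reflects-≤ {a} {b} h with a ℕ.≤? b
... | yes a≤b = a≤b
... | no  a≰b = contradiction h (ℕ.<⇒≱ (ℕ.*-mono-< (ℕ.≰⇒> a≰b) (ℕ.≰⇒> a≰b)))

isqrt-scaled : ∀ n i j → isqrt (n ℕ.* (i ℕ.* i)) ℕ.* j ℕ.≤ suc (isqrt (n ℕ.* (j ℕ.* j))) ℕ.* i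
isqrt-scaled n i j = square-reflects-≤ (begin
  (a ℕ.* j) ℕ.* (a ℕ.* j)                ≡⟨ ℕ.[m*n]*[o*p]≡[m*o]*[n*p] a j a j ⟩
  (a ℕ.* a) ℕ.* (j ℕ.* j)                ≤⟨ ℕ.*-monoˡ-≤ (j ℕ.* j) (isqrt-lower (n ℕ.* (i ℕ.* i))) ⟩
  (n ℕ.* (i ℕ.* i)) ℕ.* (j ℕ.* j)        ≡⟨ ℕ.*-assoc n _ _ ⟩
  n ℕ.* ((i ℕ.* i) ℕ.* (j ℕ.* j))        ≡⟨ cong (n ℕ.*_) (ℕ.*-comm (i ℕ.* i) _) ⟩
  n ℕ.* ((j ℕ.* j) ℕ.* (i ℕ.* i))        ≡⟨ sym (ℕ.*-assoc n _ _) ⟩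
  (n ℕ.* (j ℕ.* j)) ℕ.* (i ℕ.* i)        ≤⟨ ℕ.*-monoˡ-≤ (i ℕ.* i) (ℕ.<⇒≤ (isqrt-upper (n ℕ.* (j ℕ.* j)))) ⟩
  (suc b ℕ.* suc b) ℕ.* (i ℕ.* i)        ≡⟨ ℕ.[m*n]*[o*p]≡[m*o]*[n*p] (suc b) (suc b) i i ⟩
  (suc b ℕ.* i) ℕ.* (suc b ℕ.* i)        ∎)
  where
  open ℕ.≤-Reasoning
  a = isqrt (n ℕ.* (i ℕ.* i))
  b = isqrt (n ℕ.* (j ℕ.* j))

frac-≤ : ∀ a b i j → a ℕ.* suc j ℕ.≤ suc b ℕ.* suc i → + a / suc i ≤ + b / suc j + inv j
frac-≤ a b i j h = begin
  + a / suc i           ≤⟨ fromℚᵘ-mono-≤ {ℚᵘ.mkℚᵘ (+ a) i} {ℚᵘ.mkℚᵘ (+ suc b) j}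
                             (ℚᵘ.*≤* (subst₂ ℤ._≤_ (ℤ.pos-* a (suc j)) (ℤ.pos-* (suc b) (suc i)) (ℤ.+≤+ h))) ⟩
  + suc b / suc j       ≡⟨ fromℚᵘ-cong {ℚᵘ.mkℚᵘ (+ suc b) j} {ℚᵘ.mkℚᵘ (+ b) j ℚᵘ.+ ℚᵘ.mkℚᵘ (+ 1) j} (ℚᵘ.*≡* eq) ⟩
  fromℚᵘ (ℚᵘ.mkℚᵘ (+ b) j ℚᵘ.+ ℚᵘ.mkℚᵘ (+ 1) j)
                        ≡⟨ fromℚᵘ-homo-+ (ℚᵘ.mkℚᵘ (+ b) j) (ℚᵘ.mkℚᵘ (+ 1) j) ⟩
  + b / suc j + inv j   ∎
  where
  open ≤-Reasoning
  eq : + suc b ℤ.* + (suc j ℕ.* suc j) ≡ (+ b ℤ.* + suc j ℤ.+ + 1 ℤ.* + suc j) ℤ.* + suc j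
  eq = trans (cong (+ suc b ℤ.*_) (ℤ.pos-* (suc j) (suc j)))
    (trans (sym (ℤ.*-assoc (+ suc b) (+ suc j) (+ suc j)))
      (cong (ℤ._* + suc j) (trans (cong (λ t → + t ℤ.* + suc j) (ℕ.+-comm 1 b)) (ℤ.*-distribʳ-+ (+ suc j) (+ b) (+ 1)))))

eventually-inv : ∀ ε → 0ℚ < ε → ∃[ N ] ∀ k → N ℕ.≤ k → inv k ≤ ε
eventually-inv ε 0<ε = proj₁ small , λ k N≤k →
  ≤-trans (≤-reflexive (sym (*-identityˡ (inv k)))) (proj₂ small k N≤k)
  where
  small : ∃[ N ] ∀ k → N ℕ.≤ k → 1ℚ * inv k ≤ ε
  small = eventually-small 1ℚ (<⇒≤ (positive⁻¹ 1ℚ)) ε 0<ε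

close⇒cauchy : ∀ {f} → (∀ i j → f i ≤ f j + inv j) → IsCauchy f
close⇒cauchy {f} close ε 0<ε = proj₁ small , λ i j N≤i N≤j → ∣p-q∣≤r {f i} {f j} {ε}
  (≤-trans (close i j) (+-monoʳ-≤ (f j) (proj₂ small j N≤j)))
  (≤-trans (close j i) (+-monoʳ-≤ (f i) (proj₂ small i N≤i)))
  where
  small : ∃[ N ] ∀ k → N ℕ.≤ k → inv k ≤ ε
  small = eventually-inv ε 0<ε

√ℕ : ℕ → ℝ
approx (√ℕ n) k = + isqrt (n ℕ.* (suc k ℕ.* suc k)) / suc k
cauchy (√ℕ n)   = close⇒cauchy {approx (√ℕ n)} λ i j →
  frac-≤ (isqrt (n ℕ.* (suc i ℕ.* suc i))) (isqrt (n ℕ.* (suc j ℕ.* suc j))) i j (isqrt-scaled n (suc i) (suc j))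

-- For p ≥ 0, via √(m / d) = √(m d) / d.
√ : ℚ → ℝ
√ p = √ℕ (ℤ.∣ ↥ p ∣ ℕ.* ↧ₙ p) *ᴿ fromℚ (+ 1 / ↧ₙ p)

-- q ^ k / k !
expTerm : ℚ → ℕ → ℚ
expTerm q zero    = 1ℚ
expTerm q (suc k) = expTerm q k * q * inv k

expSum : ℚ → ℕ → ℚ
expSum q zero    = 0ℚ
expSum q (suc k) = expSum q k + expTerm q k

expTerm-nonNeg : ∀ {q} → 0ℚ ≤ q → ∀ k → 0ℚ ≤ expTerm q k
expTerm-nonNeg 0≤q zero    = <⇒≤ (positive⁻¹ 1ℚ)
expTerm-nonNeg 0≤q (suc k) = 0≤* (0≤* (expTerm-nonNeg 0≤q k) 0≤q) (0≤inv k)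

expSum-mono : ∀ {q} → 0ℚ ≤ q → ∀ {i j} → i ℕ.≤′ j → expSum q i ≤ expSum q j
expSum-mono 0≤q ℕ.≤′-refl         = ≤-refl
expSum-mono 0≤q (ℕ.≤′-step {n = j} i≤j) = ≤-trans (expSum-mono 0≤q i≤j) (p≤p+q (expTerm-nonNeg 0≤q j))

expTerm-bound : ∀ {B q} → ∣ q ∣ ≤ B → ∀ k → ∣ expTerm q k ∣ ≤ expTerm B k
expTerm-bound {B} {q} q≤B zero    = ≤-refl
expTerm-bound {B} {q} q≤B (suc k) = begin
  ∣ expTerm q k * q * inv k ∣          ≡⟨ ∣p*q∣≡∣p∣*∣q∣ (expTerm q k * q) (inv k) ⟩
  ∣ expTerm q k * q ∣ * ∣ inv k ∣      ≡⟨ cong₂ _*_ (∣p*q∣≡∣p∣*∣q∣ (expTerm q k) q) (0≤p⇒∣p∣≡p (0≤inv k)) ⟩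
  ∣ expTerm q k ∣ * ∣ q ∣ * inv k      ≤⟨ *-monoʳ-≤-nonNeg (inv k) {{nonNegative (0≤inv k)}}
                                            (*-mono-≤ (0≤∣p∣ q) (expTerm-nonNeg (≤-trans (0≤∣p∣ q) q≤B) k) (expTerm-bound q≤B k) q≤B) ⟩
  expTerm B k * B * inv k              ∎
  where open ≤-Reasoning

expSum-tail : ∀ {B q} → ∣ q ∣ ≤ B → ∀ {i j} → i ℕ.≤′ j → ∣ expSum q j - expSum q i ∣ ≤ expSum B j - expSum B i
expSum-tail {B} {q} q≤B {i} ℕ.≤′-refl = ≤-reflexive
  (trans (cong ∣_∣ (+-inverseʳ (expSum q i))) (sym (+-inverseʳ (expSum B i))))
expSum-tail {B} {q} q≤B {i} (ℕ.≤′-step {n = j} i≤j) = begin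
  ∣ expSum q j + expTerm q j - expSum q i ∣      ≡⟨ cong ∣_∣ (swap (expSum q j) (expTerm q j) (expSum q i)) ⟩
  ∣ expSum q j - expSum q i + expTerm q j ∣      ≤⟨ ∣p+q∣≤∣p∣+∣q∣ (expSum q j - expSum q i) (expTerm q j) ⟩
  ∣ expSum q j - expSum q i ∣ + ∣ expTerm q j ∣  ≤⟨ +-mono-≤ (expSum-tail q≤B i≤j) (expTerm-bound q≤B j) ⟩
  expSum B j - expSum B i + expTerm B j          ≡⟨ sym (swap (expSum B j) (expTerm B j) (expSum B i)) ⟩
  expSum B j + expTerm B j - expSum B i          ∎
  where
  open ≤-Reasoning
  swap : ∀ a b c → a + b - c ≡ a - c + b
  swap = solve 3 (λ a b c → a :+ b :- c := a :- c :+ b) refl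

expTerm-lipschitz : ∀ {B p q} → ∣ p ∣ ≤ B → ∣ q ∣ ≤ B → ∀ k →
                    ∣ expTerm p (suc k) - expTerm q (suc k) ∣ ≤ ∣ p - q ∣ * expTerm B k
expTerm-lipschitz {B} {p} {q} p≤B q≤B zero = ≤-reflexive (begin-equality
  ∣ 1ℚ * p * 1ℚ - 1ℚ * q * 1ℚ ∣    ≡⟨ cong ∣_∣ (cong₂ _-_ (trans (*-identityʳ (1ℚ * p)) (*-identityˡ p)) (trans (*-identityʳ (1ℚ * q)) (*-identityˡ q))) ⟩
  ∣ p - q ∣                        ≡⟨ sym (*-identityʳ _) ⟩
  ∣ p - q ∣ * 1ℚ                   ∎)
  where open ≤-Reasoning
expTerm-lipschitz {B} {p} {q} p≤B q≤B (suc k) = begin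
  ∣ P * p * v - Q * q * v ∣
    ≡⟨ cong ∣_∣ (solve 5 (λ P Q p q v → P :* p :* v :- Q :* q :* v := ((p :- q) :* P :+ q :* (P :- Q)) :* v) refl P Q p q v) ⟩
  ∣ ((p - q) * P + q * (P - Q)) * v ∣
    ≡⟨ trans (∣p*q∣≡∣p∣*∣q∣ ((p - q) * P + q * (P - Q)) v) (cong (∣ (p - q) * P + q * (P - Q) ∣ *_) (0≤p⇒∣p∣≡p (0≤inv (suc k)))) ⟩
  ∣ (p - q) * P + q * (P - Q) ∣ * v
    ≤⟨ *-monoʳ-≤-nonNeg v {{nonNegative (0≤inv (suc k))}} (begin
         ∣ (p - q) * P + q * (P - Q) ∣
           ≤⟨ ∣p+q∣≤∣p∣+∣q∣ ((p - q) * P) (q * (P - Q)) ⟩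
         ∣ (p - q) * P ∣ + ∣ q * (P - Q) ∣
           ≡⟨ cong₂ _+_ (∣p*q∣≡∣p∣*∣q∣ (p - q) P) (∣p*q∣≡∣p∣*∣q∣ q (P - Q)) ⟩
         D * ∣ P ∣ + ∣ q ∣ * ∣ P - Q ∣
           ≤⟨ +-mono-≤ (*-monoˡ-≤-nonNeg D {{nonNegative (0≤∣p∣ (p - q))}} (expTerm-bound p≤B (suc k)))
                       (*-mono-≤ (0≤∣p∣ (P - Q)) 0≤B q≤B (expTerm-lipschitz p≤B q≤B k)) ⟩
         D * (T * B * inv k) + B * (D * T) ∎) ⟩
  (D * (T * B * inv k) + B * (D * T)) * v
    ≡⟨ cong (_* v) (cong (λ t → D * (T * B * inv k) + t) (sym (trans (cong ((B * (D * T)) *_) (inv*ι k)) (*-identityʳ (B * (D * T)))))) ⟩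
  (D * (T * B * inv k) + B * (D * T) * (inv k * ι (suc k))) * v
    ≡⟨ solve 6 (λ D T B u n v → (D :* (T :* B :* u) :+ B :* (D :* T) :* (u :* n)) :* v := D :* (T :* B :* u) :* (v :* (con 1ℚ :+ n))) refl D T B (inv k) (ι (suc k)) v ⟩
  D * (T * B * inv k) * (v * (1ℚ + ι (suc k)))
    ≡⟨ cong (λ t → D * (T * B * inv k) * (v * t)) (sym (ι-homo-+ 1 (suc k))) ⟩
  D * (T * B * inv k) * (v * ι (suc (suc k)))
    ≡⟨ trans (cong (λ t → D * (T * B * inv k) * t) (inv*ι (suc k))) (*-identityʳ (D * (T * B * inv k))) ⟩
  D * (T * B * inv k) ∎
  where
  open ≤-Reasoning
  P = expTerm p (suc k)
  Q = expTerm q (suc k)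
  T = expTerm B k
  D = ∣ p - q ∣
  v = inv (suc k)
  0≤B = ≤-trans (0≤∣p∣ q) q≤B

expSum-lipschitz : ∀ {B p q} → ∣ p ∣ ≤ B → ∣ q ∣ ≤ B → ∀ k →
                   ∣ expSum p (suc k) - expSum q (suc k) ∣ ≤ ∣ p - q ∣ * expSum B k
expSum-lipschitz {B} {p} {q} p≤B q≤B zero    = ≤-reflexive (sym (*-zeroʳ ∣ p - q ∣))
expSum-lipschitz {B} {p} {q} p≤B q≤B (suc k) = begin
  ∣ expSum p (suc k) + expTerm p (suc k) - (expSum q (suc k) + expTerm q (suc k)) ∣
    ≡⟨ cong ∣_∣ (solve 4 (λ a b c d → a :+ b :- (c :+ d) := (a :- c) :+ (b :- d)) refl (expSum p (suc k)) (expTerm p (suc k)) (expSum q (suc k)) (expTerm q (suc k))) ⟩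
  ∣ (expSum p (suc k) - expSum q (suc k)) + (expTerm p (suc k) - expTerm q (suc k)) ∣
    ≤⟨ ∣p+q∣≤∣p∣+∣q∣ (expSum p (suc k) - expSum q (suc k)) (expTerm p (suc k) - expTerm q (suc k)) ⟩
  ∣ expSum p (suc k) - expSum q (suc k) ∣ + ∣ expTerm p (suc k) - expTerm q (suc k) ∣
    ≤⟨ +-mono-≤ (expSum-lipschitz p≤B q≤B k) (expTerm-lipschitz p≤B q≤B k) ⟩
  ∣ p - q ∣ * expSum B k + ∣ p - q ∣ * expTerm B k
    ≡⟨ sym (*-distribˡ-+ ∣ p - q ∣ (expSum B k) (expTerm B k)) ⟩
  ∣ p - q ∣ * expSum B (suc k) ∎
  where open ≤-Reasoning

-- From the index N ≥ 2B on, the terms at least halve, so the tail beyond i is at most twice the i-th term.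
module ExpTail {B} (0≤B : 0ℚ ≤ B) where
  N : ℕ
  N = proj₁ (archimedean (B + B))

  term : ℕ → ℚ
  term = expTerm B

  halving : ∀ k → N ℕ.≤ k → term (suc k) + term (suc k) ≤ term k
  halving k N≤k = begin
    term k * B * inv k + term k * B * inv k  ≡⟨ solve 3 (λ t b v → t :* b :* v :+ t :* b :* v := t :* (v :* (b :+ b))) refl (term k) B (inv k) ⟩
    term k * (inv k * (B + B))               ≤⟨ *-monoˡ-≤-nonNeg (term k) {{nonNegative (expTerm-nonNeg 0≤B k)}}
                                                  (*-monoˡ-≤-nonNeg (inv k) {{nonNegative (0≤inv k)}}
                                                    (≤-trans (proj₂ (archimedean (B + B))) (ι-mono (ℕ.≤-trans N≤k (ℕ.n≤1+n k))))) ⟩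
    term k * (inv k * ι (suc k))             ≡⟨ trans (cong (term k *_) (inv*ι k)) (*-identityʳ (term k)) ⟩
    term k                                   ∎
    where open ≤-Reasoning

  cap : ℕ → ℚ
  cap k = expSum B k + (term k + term k)

  cap-antitone : ∀ {i j} → N ℕ.≤ i → i ℕ.≤′ j → cap j ≤ cap i
  cap-antitone N≤i ℕ.≤′-refl = ≤-refl
  cap-antitone {i} N≤i (ℕ.≤′-step {n = j} i≤j) = ≤-trans
    (≤-trans (+-monoʳ-≤ (expSum B (suc j)) (halving j (ℕ.≤-trans N≤i (ℕ.≤′⇒≤ i≤j))))
             (≤-reflexive (+-assoc (expSum B j) (term j) (term j))))
    (cap-antitone N≤i i≤j)

  sum≤cap : ∀ k → expSum B k ≤ cap k
  sum≤cap k = p≤p+q (0≤-+ (expTerm-nonNeg 0≤B k) (expTerm-nonNeg 0≤B k))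

  sum≤capN : ∀ k → expSum B k ≤ cap N
  sum≤capN k with ℕ.≤-total k N
  ... | inj₁ k≤N = ≤-trans (expSum-mono 0≤B (ℕ.≤⇒≤′ k≤N)) (sum≤cap N)
  ... | inj₂ N≤k = ≤-trans (sum≤cap k) (cap-antitone ℕ.≤-refl (ℕ.≤⇒≤′ N≤k))

  expSum-nonNeg : ∀ k → 0ℚ ≤ expSum B k
  expSum-nonNeg k = expSum-mono 0≤B (ℕ.≤⇒≤′ (ℕ.z≤n {k}))

  0≤capN : 0ℚ ≤ cap N
  0≤capN = sum≤capN 0

  term≤capN : ∀ k → term k ≤ cap N
  term≤capN k = ≤-trans (p≤q+p (expSum-nonNeg k)) (sum≤capN (suc k))

  C : ℚ
  C = cap N * B + cap N * B

  tail : ∀ {i j} → N ℕ.≤ i → i ℕ.≤ j → expSum B (suc j) - expSum B (suc i) ≤ C * inv i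
  tail {i} {j} N≤i i≤j = begin
    expSum B (suc j) - expSum B (suc i)
      ≤⟨ p≤q+r⇒p-q≤r (≤-trans (sum≤cap (suc j)) (cap-antitone (ℕ.≤-trans N≤i (ℕ.n≤1+n i)) (ℕ.≤⇒≤′ (ℕ.s≤s i≤j)))) ⟩
    term i * B * inv i + term i * B * inv i
      ≡⟨ sym (*-distribʳ-+ (inv i) (term i * B) (term i * B)) ⟩
    (term i * B + term i * B) * inv i
      ≤⟨ *-monoʳ-≤-nonNeg (inv i) {{nonNegative (0≤inv i)}} (+-mono-≤ h h) ⟩
    C * inv i ∎
    where
    open ≤-Reasoning
    h : term i * B ≤ cap N * B
    h = *-monoʳ-≤-nonNeg B {{nonNegative 0≤B}} (term≤capN i)

  0≤C : 0ℚ ≤ C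
  0≤C = 0≤-+ (0≤* 0≤capN 0≤B) (0≤* 0≤capN 0≤B)

module _ {f} (cf : IsCauchy f) where
  private
    bounded = cauchy⇒bounded {f} cf
    B   = proj₁ bounded
    0<B = proj₁ (proj₂ bounded)
    f≤B = proj₂ (proj₂ bounded)

    open ExpTail (<⇒≤ 0<B)

  tail′ : ∀ q → ∣ q ∣ ≤ B → ∀ i j → N ℕ.≤ i → i ℕ.≤ j → ∣ expSum q (suc i) - expSum q (suc j) ∣ ≤ C * inv i
  tail′ q q≤B i j N≤i i≤j = subst (_≤ C * inv i) (∣p-q∣≡∣q-p∣ (expSum q (suc j)) (expSum q (suc i)))
    (≤-trans (expSum-tail q≤B (ℕ.≤⇒≤′ (ℕ.s≤s i≤j))) (tail N≤i i≤j))

  K : ℚ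
  K = cap N + 1ℚ

  0<K : 0ℚ < K
  0<K = <-≤-trans (positive⁻¹ 1ℚ) (p≤q+p 0≤capN)

  exp-cauchy : IsCauchy (λ k → expSum (f k) (suc k))
  exp-cauchy ε 0<ε =
    let r , 0<r , K*r≡1 = recip 0<K
        N₁ , h₁ = eventually-small C 0≤C (½ * ε) (halve 0<ε)
        N₂ , h₂ = cf (r * (½ * ε)) (0<* 0<r (halve 0<ε))

        ordered : ∀ i j → N ℕ.⊔ (N₁ ℕ.⊔ N₂) ℕ.≤ i → i ℕ.≤ j → ∣ expSum (f i) (suc i) - expSum (f j) (suc j) ∣ ≤ ε
        ordered i j M≤i i≤j =
          let N≤i , N′≤i = both {N} M≤i
              N₁≤i , N₂≤i = both {N₁} N′≤i
          in begin
            ∣ expSum (f i) (suc i) - expSum (f j) (suc j) ∣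
              ≤⟨ ∣p-r∣≤∣p-q∣+∣q-r∣ (expSum (f i) (suc i)) (expSum (f i) (suc j)) (expSum (f j) (suc j)) ⟩
            ∣ expSum (f i) (suc i) - expSum (f i) (suc j) ∣ + ∣ expSum (f i) (suc j) - expSum (f j) (suc j) ∣
              ≤⟨ +-mono-≤ (≤-trans (tail′ (f i) (f≤B i) i j N≤i i≤j) (h₁ i N₁≤i))
                   (≤-trans (expSum-lipschitz (f≤B i) (f≤B j) j)
                     (*-mono-≤ (expSum-nonNeg j) (<⇒≤ (0<* 0<r (halve 0<ε))) (h₂ i j N₂≤i (ℕ.≤-trans N₂≤i i≤j))
                       (≤-trans (sum≤capN j) (p≤p+q (<⇒≤ (positive⁻¹ 1ℚ)))))) ⟩
            ½ * ε + r * (½ * ε) * K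
              ≡⟨ cong (λ t → ½ * ε + t) (solve 3 (λ r e k → r :* e :* k := k :* r :* e) refl r (½ * ε) K) ⟩
            ½ * ε + K * r * (½ * ε)
              ≡⟨ cong (λ t → ½ * ε + t) (trans (cong (_* (½ * ε)) K*r≡1) (*-identityˡ (½ * ε))) ⟩
            ½ * ε + ½ * ε
              ≡⟨ ½+½ ε ⟩
            ε ∎
    in N ℕ.⊔ (N₁ ℕ.⊔ N₂) , λ i j M≤i M≤j → case-order ordered i j M≤i M≤j (ℕ.≤-total i j)
    where
    open ≤-Reasoning
    case-order : ∀ {M} → (∀ i j → M ℕ.≤ i → i ℕ.≤ j → ∣ expSum (f i) (suc i) - expSum (f j) (suc j) ∣ ≤ ε) →
                 ∀ i j → M ℕ.≤ i → M ℕ.≤ j → (i ℕ.≤ j ⊎ j ℕ.≤ i) → ∣ expSum (f i) (suc i) - expSum (f j) (suc j) ∣ ≤ ε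
    case-order h i j M≤i M≤j (inj₁ i≤j) = h i j M≤i i≤j
    case-order h i j M≤i M≤j (inj₂ j≤i) = subst (_≤ ε) (∣p-q∣≡∣q-p∣ (expSum (f j) (suc j)) (expSum (f i) (suc i))) (h j i M≤j j≤i)

exp : ℝ → ℝ
approx (exp x) k = expSum (approx x k) (suc k)
cauchy (exp x)   = exp-cauchy {approx x} (cauchy x)

-- Uniform distribution on a finite list: every entry of the list Ω has weight 1 / length Ω

sumℚ : List ℚ → ℚ
sumℚ = foldr _+_ 0ℚ

-- The empty list is never averaged here: see compositions-nonEmpty.
average : List ℚ → ℚ
average []          = 0ℚ
average qs@(_ ∷ _) = sumℚ qs * (+ 1 / length qs)

module _ {A : Set} (Ω : List A) where

  𝔼 : (A → ℚ) → ℚ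
  𝔼 X = average (map X Ω)

  Var : (A → ℚ) → ℚ
  Var X = 𝔼 λ ω → (X ω - 𝔼 X) * (X ω - 𝔼 X)

  Pr : {P : A → Set} → Decidable P → ℚ
  Pr P? = 𝔼 λ ω → if does (P? ω) then 1ℚ else 0ℚ

-- Totalised by 0 ⁻¹ = 0, which matters only where the variance vanishes.
_⁻¹ : ℚ → ℚ
p ⁻¹ with p ≟ 0ℚ
... | yes _  = 0ℚ
... | no p≢0 = (1/ p) {{≢-nonZero p≢0}}

-- (X − 𝔼 X) / √(Var X)
standardise : {A : Set} → List A → (A → ℚ) → A → ℝ
standardise Ω X ω = fromℚ (X ω - 𝔼 Ω X) *ᴿ √ (Var Ω X ⁻¹)

-- RiemannSum f δ a b s: s is the Riemann sum of f for some tagged partition of [a , b] of mesh at most δ.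
data RiemannSum (f : ℝ → ℝ) (δ : ℚ) : ℝ → ℝ → ℝ → Set where
  end  : ∀ {a b} → a ≃ᴿ b → RiemannSum f δ a b (fromℚ 0ℚ)
  cell : ∀ {a b c s} (t : ℝ) → a ≤ᴿ t → t ≤ᴿ c → c -ᴿ a ≤ᴿ fromℚ δ →
         RiemannSum f δ c b s → RiemannSum f δ a b (f t *ᴿ (c -ᴿ a) +ᴿ s)

HasIntegral : (ℝ → ℝ) → ℝ → ℝ → ℝ → Set
HasIntegral f a b I = ∀ ε → 0ℚ < ε → ∃[ δ ] 0ℚ < δ ×
  (∀ s → RiemannSum f δ a b s → ∣ s -ᴿ I ∣ᴿ ≤ᴿ fromℚ ε)

-- The limits at ±∞ determine c, namely c = 1 / √(2π).
record IsStandardNormalCDF (Φ : ℝ → ℝ) : Set where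
  field
    c       : ℝ
    density : ∀ a b → a ≤ᴿ b →
              HasIntegral (λ t → c *ᴿ exp (-ᴿ (fromℚ ½ *ᴿ (t *ᴿ t)))) a b (Φ b -ᴿ Φ a)
    at-−∞   : ∀ ε → 0ℚ < ε → ∃[ M ] ∀ x → x ≤ᴿ fromℚ M → ∣ Φ x ∣ᴿ ≤ᴿ fromℚ ε
    at-+∞   : ∀ ε → 0ℚ < ε → ∃[ M ] ∀ x → fromℚ M ≤ᴿ x → ∣ Φ x -ᴿ fromℚ 1ℚ ∣ᴿ ≤ᴿ fromℚ ε

IsO[1] : (ℕ → ℝ) → Set
IsO[1] f = ∃[ C ] ∃[ N ] ∀ n → N ℕ.≤ n → ∣ f n ∣ᴿ ≤ᴿ fromℚ C

-- Pointwise convergence of distribution functions to F everywhere, hence for continuous F convergence in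
-- distribution.  The event Y n ω ≤ x compares real numbers, so its probability is formed from a decision
-- procedure; classically there always is one, and any two give the same probability.
ConvergesInDistribution : {A : ℕ → Set} → (∀ n → List (A n)) → (∀ n → A n → ℝ) → (ℝ → ℝ) → Set
ConvergesInDistribution Ω Y F =
  ∀ x ε → 0ℚ < ε → ∃[ N ] ∀ n → N ℕ.≤ n →
  (Y≤x? : Decidable (λ ω → Y n ω ≤ᴿ x)) → ∣ fromℚ (Pr (Ω n) Y≤x?) -ᴿ F x ∣ᴿ ≤ᴿ fromℚ ε

AsymptoticallyNormal : {A : ℕ → Set} → (∀ n → List (A n)) → (∀ n → A n → ℚ) → Set
AsymptoticallyNormal Ω X = ∃[ Φ ] IsStandardNormalCDF Φ ×
  ConvergesInDistribution Ω (λ n → standardise (Ω n) (X n)) Φ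

infix 8 _^-_

_^-_ : (b : ℕ) .{{_ : ℕ.NonTrivial b}} → ℕ → ℚ
b ^- k = (+ 1 / b ℕ.^ k) {{ℕ.m^n≢0 b k {{ℕ.nonTrivial⇒nonZero b}}}}

parts : ℕ → ℕ → ℕ
parts b n = (b ℕ.∸ 1) ℕ.* n ℕ.+ 1

powerSum : (b : ℕ) .{{_ : ℕ.NonTrivial b}} → List ℕ → ℚ
powerSum b ks = sumℚ (map (b ^-_) ks)

IsComposition : (b : ℕ) .{{_ : ℕ.NonTrivial b}} → ∀ {m} → Vec ℕ m → Set
IsComposition b k = powerSum b (toList k) ≡ 1ℚ

vectors : {A : Set} → List A → ∀ m → List (Vec A m)
vectors xs zero    = [] ∷ []
vectors xs (suc m) = cartesianProductWith _∷_ xs (vectors xs m)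

-- All compositions of 1 into parts b n powers of b, each once: their entries are at most n, see ∈-compositions⁺.
compositions : (b : ℕ) .{{_ : ℕ.NonTrivial b}} → ∀ n → List (Vec ℕ (parts b n))
compositions b n = filter (λ k → powerSum b (toList k) ≟ 1ℚ) (vectors (upTo (suc n)) (parts b n))

distinctParts : ∀ {m} → Vec ℕ m → ℚ
distinctParts k = ι (length (deduplicate ℕ._≟_ (toList k)))

vectors-! : {A : Set} {xs : List A} → Unique xs → ∀ m → Unique (vectors xs m)
vectors-! xs! zero    = [] ∷ []
vectors-! xs! (suc m) = cartesianProductWith⁺ _∷_ ∷-injective xs! (vectors-! xs! m)

∈-vectors : {A : Set} {xs : List A} → ∀ {m} (v : Vec A m) → (∀ {x} → x ∈ toList v → x ∈ xs) → v ∈ vectors xs m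
∈-vectors []      _ = here refl
∈-vectors (x ∷ v) h = ∈-cartesianProductWith⁺ _∷_ (h (here refl)) (∈-vectors v (h ∘ there))

1/d*d : ∀ d .{{_ : ℕ.NonZero d}} → + 1 / d * ι d ≡ 1ℚ
1/d*d (suc d) = inv*ι d

ι-cancel-≤ : ∀ {m n} → ι m ≤ ι n → m ℕ.≤ n
ι-cancel-≤ {m} {n} ιm≤ιn with m ℕ.≤? n
... | yes m≤n = m≤n
... | no  m≰n = contradiction (≤-trans (≤-trans (≤-reflexive (sym (ι-homo-+ 1 n))) (ι-mono {suc n} {m} (ℕ.≰⇒> m≰n))) ιm≤ιn)
                  (<⇒≱ (subst (_< 1ℚ + ι n) (+-identityˡ (ι n)) (+-monoˡ-< (ι n) (positive⁻¹ 1ℚ))))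
  where
  <⇒≱ : ∀ {p q} → p < q → ¬ (q ≤ p)
  <⇒≱ p<q q≤p = <-irrefl refl (<-≤-trans p<q q≤p)

module _ (b : ℕ) .{{b>1 : ℕ.NonTrivial b}} where

  private instance
    b≢0 : ℕ.NonZero b
    b≢0 = ℕ.nonTrivial⇒nonZero b

  ^-suc : ∀ k → ι b * b ^- suc k ≡ b ^- k
  ^-suc k = begin
    ι b * P                   ≡⟨ sym (trans (cong (λ t → ι b * P * t) (trans (*-comm (ι d) Q) (1/d*d d))) (*-identityʳ (ι b * P))) ⟩
    ι b * P * (ι d * Q)       ≡⟨ solve 4 (λ b p d q → b :* p :* (d :* q) := p :* (b :* d) :* q) refl (ι b) P (ι d) Q ⟩
    P * (ι b * ι d) * Q       ≡⟨ cong (λ t → P * t * Q) (sym (ι-homo-* b d)) ⟩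
    P * ι (b ℕ.* d) * Q       ≡⟨ cong (_* Q) (1/d*d (b ℕ.* d)) ⟩
    1ℚ * Q                    ≡⟨ *-identityˡ Q ⟩
    Q                         ∎
    where
    open ≡-Reasoning
    instance
      bᵏ≢0 : ℕ.NonZero (b ℕ.^ k)
      bᵏ≢0 = ℕ.m^n≢0 b k
      bᵏ⁺¹≢0 : ℕ.NonZero (b ℕ.* b ℕ.^ k)
      bᵏ⁺¹≢0 = ℕ.m^n≢0 b (suc k)
    d = b ℕ.^ k
    P = + 1 / (b ℕ.* d)
    Q = + 1 / d

  ^-pos : ∀ k → 0ℚ < b ^- k
  ^-pos k = positive⁻¹ (b ^- k) {{normalize-pos 1 (b ℕ.^ k) {{ℕ.m^n≢0 b k}}}}

  1≤b : ι 1 ≤ ι b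
  1≤b = ι-mono {1} {b} (ℕ.<⇒≤ (ℕ.nonTrivial⇒n>1 b))

  ^-≤1 : ∀ k → b ^- k ≤ 1ℚ
  ^-≤1 zero    = ≤-refl
  ^-≤1 (suc k) = begin
    b ^- suc k          ≡⟨ sym (*-identityˡ (b ^- suc k)) ⟩
    1ℚ * b ^- suc k     ≤⟨ *-monoʳ-≤-nonNeg (b ^- suc k) {{nonNegative (<⇒≤ (^-pos (suc k)))}} 1≤b ⟩
    ι b * b ^- suc k    ≡⟨ ^-suc k ⟩
    b ^- k              ≤⟨ ^-≤1 k ⟩
    1ℚ                  ∎
    where open ≤-Reasoning

  powerSum-nonNeg : ∀ ks → 0ℚ ≤ powerSum b ks
  powerSum-nonNeg []       = ≤-refl
  powerSum-nonNeg (k ∷ ks) = 0≤-+ {b ^- k} {powerSum b ks} (<⇒≤ (^-pos k)) (powerSum-nonNeg ks)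

  powerSum-pos : ∀ {K ks} → K ∈ ks → 0ℚ < powerSum b ks
  powerSum-pos {K} {k ∷ ks} _ = <-≤-trans (^-pos k) (p≤p+q {b ^- k} {powerSum b ks} (powerSum-nonNeg ks))

  powerSum-≤-length : ∀ ks → powerSum b ks ≤ ι (length ks)
  powerSum-≤-length []       = ≤-refl
  powerSum-≤-length (k ∷ ks) = ≤-trans (+-mono-≤ (^-≤1 k) (powerSum-≤-length ks))
                                       (≤-reflexive (sym (ι-homo-+ 1 (length ks))))

  zeros : List ℕ → ℕ
  zeros []           = 0
  zeros (zero  ∷ ks) = suc (zeros ks)
  zeros (suc _ ∷ ks) = zeros ks

  lower : List ℕ → List ℕ
  lower []           = []
  lower (zero  ∷ ks) = lower ks
  lower (suc k ∷ ks) = k ∷ lower ks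

  length-lower : ∀ ks → length ks ≡ zeros ks ℕ.+ length (lower ks)
  length-lower []           = refl
  length-lower (zero  ∷ ks) = cong suc (length-lower ks)
  length-lower (suc _ ∷ ks) = trans (cong suc (length-lower ks)) (sym (ℕ.+-suc (zeros ks) (length (lower ks))))

  ∈-lower : ∀ {K ks} → suc K ∈ ks → K ∈ lower ks
  ∈-lower {ks = zero  ∷ ks} (there h)   = ∈-lower h
  ∈-lower {ks = suc _ ∷ ks} (here refl) = here refl
  ∈-lower {ks = suc _ ∷ ks} (there h)   = there (∈-lower h)

  powerSum-lower : ∀ ks → ι b * powerSum b ks ≡ ι (b ℕ.* zeros ks) + powerSum b (lower ks)
  powerSum-lower [] = trans (*-zeroʳ (ι b)) (sym (trans (cong (λ t → ι t + 0ℚ) (ℕ.*-zeroʳ b)) (+-identityˡ 0ℚ)))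
  powerSum-lower (zero ∷ ks) = begin
    ι b * (1ℚ + S)                          ≡⟨ *-distribˡ-+ (ι b) 1ℚ S ⟩
    ι b * 1ℚ + ι b * S                      ≡⟨ cong₂ _+_ (*-identityʳ (ι b)) (powerSum-lower ks) ⟩
    ι b + (ι (b ℕ.* z) + L)                 ≡⟨ sym (+-assoc (ι b) (ι (b ℕ.* z)) L) ⟩
    ι b + ι (b ℕ.* z) + L                   ≡⟨ cong (_+ L) (sym (ι-homo-+ b (b ℕ.* z))) ⟩
    ι (b ℕ.+ b ℕ.* z) + L                   ≡⟨ cong (λ t → ι t + L) (sym (ℕ.*-suc b z)) ⟩
    ι (b ℕ.* suc z) + L                     ∎
    where
    open ≡-Reasoning
    S = powerSum b ks
    L = powerSum b (lower ks)
    z = zeros ks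
  powerSum-lower (suc k ∷ ks) = begin
    ι b * (b ^- suc k + S)                  ≡⟨ *-distribˡ-+ (ι b) (b ^- suc k) S ⟩
    ι b * b ^- suc k + ι b * S              ≡⟨ cong₂ _+_ (^-suc k) (powerSum-lower ks) ⟩
    b ^- k + (ι (b ℕ.* z) + L)              ≡⟨ solve 3 (λ p q r → p :+ (q :+ r) := q :+ (p :+ r)) refl (b ^- k) (ι (b ℕ.* z)) L ⟩
    ι (b ℕ.* z) + (b ^- k + L)              ∎
    where
    open ≡-Reasoning
    S = powerSum b ks
    L = powerSum b (lower ks)
    z = zeros ks

  length-bound : ∀ K {ks} s → powerSum b ks ≡ ι s → K ∈ ks → s ℕ.+ (b ℕ.∸ 1) ℕ.* K ℕ.≤ length ks
  length-bound zero {ks} s eq _ = subst (ℕ._≤ length ks)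
    (sym (trans (cong (s ℕ.+_) (ℕ.*-zeroʳ (b ℕ.∸ 1))) (ℕ.+-identityʳ s)))
    (ι-cancel-≤ (subst (_≤ ι (length ks)) eq (powerSum-≤-length ks)))
  length-bound (suc K) {ks} s eq K∈ks = begin
    s ℕ.+ b′ ℕ.* suc K                  ≡⟨ cong₂ ℕ._+_ (sym z+t≡s) (ℕ.*-suc b′ K) ⟩
    z ℕ.+ t ℕ.+ (b′ ℕ.+ b′ ℕ.* K)       ≡⟨ ℕ.+-assoc z t _ ⟩
    z ℕ.+ (t ℕ.+ (b′ ℕ.+ b′ ℕ.* K))     ≡⟨ cong (z ℕ.+_) (sym (ℕ.+-assoc t b′ _)) ⟩
    z ℕ.+ (t ℕ.+ b′ ℕ.+ b′ ℕ.* K)       ≤⟨ ℕ.+-monoʳ-≤ z (ℕ.+-monoˡ-≤ (b′ ℕ.* K) t+b′≤b*t) ⟩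
    z ℕ.+ (b ℕ.* t ℕ.+ b′ ℕ.* K)        ≤⟨ ℕ.+-monoʳ-≤ z (length-bound K (b ℕ.* t) sum-lower (∈-lower K∈ks)) ⟩
    z ℕ.+ length (lower ks)             ≡⟨ sym (length-lower ks) ⟩
    length ks                           ∎
    where
    open ℕ.≤-Reasoning
    b′ = b ℕ.∸ 1
    z  = zeros ks
    t  = s ℕ.∸ z
    L  = powerSum b (lower ks)

    b*s≡ : ι (b ℕ.* s) ≡ ι (b ℕ.* z) + L
    b*s≡ = trans (ι-homo-* b s) (trans (cong (ι b *_) (sym eq)) (powerSum-lower ks))

    z<s : z ℕ.< s
    z<s = ℕ.≰⇒> λ s≤z → <-irrefl refl
      (<-≤-trans (subst (_< ι (b ℕ.* z) + L) (+-identityʳ (ι (b ℕ.* z))) (+-monoʳ-< (ι (b ℕ.* z)) (powerSum-pos {K} (∈-lower K∈ks))))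
        (≤-trans (≤-reflexive (sym b*s≡)) (ι-mono {b ℕ.* s} {b ℕ.* z} (ℕ.*-monoʳ-≤ b s≤z))))

    z+t≡s : z ℕ.+ t ≡ s
    z+t≡s = ℕ.m+[n∸m]≡n (ℕ.<⇒≤ z<s)

    1≤t : 1 ℕ.≤ t
    1≤t = ℕ.m<n⇒0<n∸m z<s

    b≡ : b ≡ suc b′
    b≡ = sym (ℕ.suc-pred b)

    t+b′≤b*t : t ℕ.+ b′ ℕ.≤ b ℕ.* t
    t+b′≤b*t = subst (λ c → t ℕ.+ b′ ℕ.≤ c ℕ.* t) (sym b≡)
      (ℕ.+-monoʳ-≤ t (subst (ℕ._≤ b′ ℕ.* t) (ℕ.*-identityʳ b′) (ℕ.*-monoʳ-≤ b′ 1≤t)))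

    sum-lower : L ≡ ι (b ℕ.* t)
    sum-lower = +-cancelˡ (ι (b ℕ.* z)) (trans (sym b*s≡)
      (trans (cong ι (trans (cong (b ℕ.*_) (sym z+t≡s)) (ℕ.*-distribˡ-+ b z t))) (ι-homo-+ (b ℕ.* z) (b ℕ.* t))))
      where
      +-cancelˡ : ∀ p {q r} → p + q ≡ p + r → q ≡ r
      +-cancelˡ p {q} {r} h = trans (sym (drop q)) (trans (cong (λ t → - p + t) h) (drop r))
        where
        drop : ∀ q → - p + (p + q) ≡ q
        drop q = solve 2 (λ p q → :- p :+ (p :+ q) := q) refl p q

  entries-≤ : ∀ n (k : Vec ℕ (parts b n)) → IsComposition b k → ∀ {K} → K ∈ toList k → K ℕ.≤ n
  entries-≤ n k k-comp {K} K∈k = ℕ.*-cancelˡ-≤ (b ℕ.∸ 1) {{b∸1≢0}} (ℕ.s≤s⁻¹ (subst (suc ((b ℕ.∸ 1) ℕ.* K) ℕ.≤_)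
    (trans (length-toList k) (ℕ.+-comm ((b ℕ.∸ 1) ℕ.* n) 1)) (length-bound K 1 k-comp K∈k)))
    where
    b∸1≢0 : ℕ.NonZero (b ℕ.∸ 1)
    b∸1≢0 = ℕ.>-nonZero (ℕ.m<n⇒0<n∸m (ℕ.nonTrivial⇒n>1 b))

  ∈-compositions⁺ : ∀ n {k} → IsComposition b k → k ∈ compositions b n
  ∈-compositions⁺ n {k} k-comp = ∈-filter⁺ (λ k → powerSum b (toList k) ≟ 1ℚ)
    (∈-vectors k λ K∈k → ∈-upTo⁺ (ℕ.s≤s (entries-≤ n k k-comp K∈k))) k-comp

  ∈-compositions⁻ : ∀ n {k} → k ∈ compositions b n → IsComposition b k
  ∈-compositions⁻ n k∈ = proj₂ (∈-filter⁻ (λ k → powerSum b (toList k) ≟ 1ℚ) {xs = vectors (upTo (suc n)) (parts b n)} k∈)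

  compositions-! : ∀ n → Unique (compositions b n)
  compositions-! n = filter⁺ (λ k → powerSum b (toList k) ≟ 1ℚ) (vectors-! (upTo⁺ (suc n)) (parts b n))

  caterpillar : ℕ → List ℕ
  caterpillar zero    = 0 ∷ []
  caterpillar (suc n) = replicate (b ℕ.∸ 1) 1 ++ map suc (caterpillar n)

  length-caterpillar : ∀ n → length (caterpillar n) ≡ parts b n
  length-caterpillar zero    = sym (cong (ℕ._+ 1) (ℕ.*-zeroʳ (b ℕ.∸ 1)))
  length-caterpillar (suc n) = begin
    length (replicate b′ 1 ++ map suc (caterpillar n))         ≡⟨ length-++ (replicate b′ 1) ⟩
    length (replicate b′ 1) ℕ.+ length (map suc (caterpillar n)) ≡⟨ cong₂ ℕ._+_ (length-replicate b′) (trans (length-map suc (caterpillar n)) (length-caterpillar n)) ⟩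
    b′ ℕ.+ (b′ ℕ.* n ℕ.+ 1)                                     ≡⟨ sym (ℕ.+-assoc b′ (b′ ℕ.* n) 1) ⟩
    b′ ℕ.+ b′ ℕ.* n ℕ.+ 1                                       ≡⟨ cong (ℕ._+ 1) (sym (ℕ.*-suc b′ n)) ⟩
    b′ ℕ.* suc n ℕ.+ 1                                          ∎
    where
    open ≡-Reasoning
    b′ = b ℕ.∸ 1

  powerSum-++ : ∀ js ks → powerSum b (js ++ ks) ≡ powerSum b js + powerSum b ks
  powerSum-++ []       ks = sym (+-identityˡ (powerSum b ks))
  powerSum-++ (j ∷ js) ks = trans (cong (λ t → b ^- j + t) (powerSum-++ js ks)) (sym (+-assoc (b ^- j) (powerSum b js) (powerSum b ks)))

  powerSum-suc : ∀ ks → powerSum b (map suc ks) ≡ b ^- 1 * powerSum b ks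
  powerSum-suc []       = sym (*-zeroʳ (b ^- 1))
  powerSum-suc (k ∷ ks) = trans (cong₂ _+_ step (powerSum-suc ks)) (sym (*-distribˡ-+ (b ^- 1) (b ^- k) (powerSum b ks)))
    where
    step : b ^- suc k ≡ b ^- 1 * b ^- k
    step = begin
      b ^- suc k                          ≡⟨ sym (*-identityˡ (b ^- suc k)) ⟩
      1ℚ * b ^- suc k                     ≡⟨ cong (_* b ^- suc k) (sym (^-suc 0)) ⟩
      ι b * b ^- 1 * b ^- suc k           ≡⟨ solve 3 (λ a p q → a :* p :* q := p :* (a :* q)) refl (ι b) (b ^- 1) (b ^- suc k) ⟩
      b ^- 1 * (ι b * b ^- suc k)         ≡⟨ cong (b ^- 1 *_) (^-suc k) ⟩
      b ^- 1 * b ^- k                     ∎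
      where open ≡-Reasoning

  powerSum-replicate : ∀ m → powerSum b (replicate m 1) ≡ ι m * b ^- 1
  powerSum-replicate zero    = sym (*-zeroˡ (b ^- 1))
  powerSum-replicate (suc m) = begin
    b ^- 1 + powerSum b (replicate m 1)   ≡⟨ cong₂ _+_ (sym (*-identityˡ (b ^- 1))) (powerSum-replicate m) ⟩
    1ℚ * b ^- 1 + ι m * b ^- 1            ≡⟨ sym (*-distribʳ-+ (b ^- 1) 1ℚ (ι m)) ⟩
    (1ℚ + ι m) * b ^- 1                   ≡⟨ cong (_* b ^- 1) (sym (ι-homo-+ 1 m)) ⟩
    ι (suc m) * b ^- 1                    ∎
    where open ≡-Reasoning

  powerSum-caterpillar : ∀ n → powerSum b (caterpillar n) ≡ 1ℚ
  powerSum-caterpillar zero    = refl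
  powerSum-caterpillar (suc n) = begin
    powerSum b (replicate b′ 1 ++ map suc (caterpillar n))           ≡⟨ powerSum-++ (replicate b′ 1) (map suc (caterpillar n)) ⟩
    powerSum b (replicate b′ 1) + powerSum b (map suc (caterpillar n)) ≡⟨ cong₂ _+_ (powerSum-replicate b′) (trans (powerSum-suc (caterpillar n)) (cong (b ^- 1 *_) (powerSum-caterpillar n))) ⟩
    ι b′ * b ^- 1 + b ^- 1 * 1ℚ                                       ≡⟨ solve 2 (λ p q → p :* q :+ q :* con 1ℚ := (con 1ℚ :+ p) :* q) refl (ι b′) (b ^- 1) ⟩
    (1ℚ + ι b′) * b ^- 1                                              ≡⟨ cong (_* b ^- 1) (trans (sym (ι-homo-+ 1 b′)) (cong ι (ℕ.suc-pred b))) ⟩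
    ι b * b ^- 1                                                      ≡⟨ ^-suc 0 ⟩
    1ℚ                                                                ∎
    where
    open ≡-Reasoning
    b′ = b ℕ.∸ 1

  compositions-nonEmpty : ∀ n → ∃[ k ] k ∈ compositions b n
  compositions-nonEmpty n = cast (length-caterpillar n) v , ∈-compositions⁺ n
    (trans (cong (powerSum b) (trans (toList-cast (length-caterpillar n) v) (toList∘fromList (caterpillar n)))) (powerSum-caterpillar n))
    where v = fromList (caterpillar n)

-- Removing the zeros of a composition and lowering its other entries cuts it into levels, and the number of distinct
-- parts is the number of levels at which there are zeros.  With the exponential weight 1 / m! for m parts, the choice of the
-- positions of the zeros becomes a convolution, so that the levels form a Markov chain in the number of inner nodes.
-- Cut at the levels with a single inner node, this chain is a renewal process with rewards: blocks of length 1 and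
-- reward 1 have weight 1, all block weights are bounded, and hence the mass of the process grows exponentially.
-- Coupling two copies of the backward renewal chain shows that it forgets its starting point exponentially fast; the
-- increments of the mean and of the variance therefore converge exponentially fast, to μ and σ².  The variance grows
-- linearly because blocks of two lengths with the same reward compete.  For the limit law, the distribution function is
-- replaced by Gaussian ones along the blocks as in Lindeberg's proof: a smooth function F with F″ = - y F′ makes the
-- errors of order one and two cancel, and those of order three sum up to o(1).
module Submission where

-- No generating function is analysed and no growth rate is computed: the constants exist because
-- certain rational sequences are Cauchy. What takes the place of a dominant pole is a gap between
-- two rates. The blocks have bounded weight because `y ↑ j * fac⁻¹ j` is a supersolution for
-- passing from one level to the next among the widths at least 2; the normalisation by
-- `x = (b - 1)!` per inner node gives the step from width 1 to width 1 the weight 1. So the mass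
-- never decreases, and the second block 1, b, 1 makes it grow by a fixed factor over each stretch
-- of b + 1 inner nodes. Long blocks are then exponentially improbable, which gives all moments. The
-- other obstacle is that only rationals can be computed with. The Gaussian integral enters through
-- its truncated power series, whose error bounds depend on the range of the argument, whereas
-- Lindeberg's argument needs, on a range that grows with n, a Taylor constant that does not. The
-- powers (1 - y² / 2M)^M supply it.

open import Defs
open import Data.Bool as Bool using (if_then_else_; true; false)
import Data.Integer as ℤ
import Data.Integer.Properties as ℤ
open import Data.List using (List; []; _∷_; _++_; map; filter; length; upTo; deduplicate; cartesianProductWith)
open import Data.List.Membership.Propositional using (_∈_)
open import Data.List.Membership.Propositional.Properties using (∈-deduplicate⁺; ∈-deduplicate⁻; ∈-map⁺; ∈-map⁻)
open import Data.List.Membership.Propositional.Properties.WithK using (unique∧set⇒bag)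
open import Data.List.Properties using (map-upTo; length-map; length-filter)
open import Data.List.Relation.Binary.BagAndSetEquality using (∼bag⇒↭)
open import Data.List.Relation.Binary.Permutation.Propositional.Properties using (↭-length)
open import Data.List.Relation.Unary.All as All using (All; []; _∷_)
open import Data.List.Relation.Unary.All.Properties using (++⁺)
open import Data.List.Relation.Unary.Any using (here; there)
open import Data.List.Relation.Unary.Unique.Propositional using (Unique; _∷_)
import Data.List.Relation.Unary.Unique.Propositional.Properties as Unique
open import Data.Maybe using (is-just; to-witness-T)
open import Data.Nat as ℕ using (ℕ; zero; suc; NonTrivial)
import Data.Nat.Properties as ℕ
open import Data.Product using (∃-syntax; _×_; _,_; proj₁; proj₂)
open import Data.Rational
open import Data.Rational.Properties
import Data.Rational.Solver as ℚSolver
import Data.Rational.Unnormalised as ℚᵘ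
open import Data.Sum using (inj₁; inj₂; [_,_]′)
open import Data.Vec as Vec using (Vec; []; _∷_; toList)
import Data.Vec.N-ary as N-ary
open import Data.Vec.Properties using (length-toList)
open import Function using (_∘_; mk⇔; _⇔_)
open import Relation.Binary.PropositionalEquality
  using (_≡_; refl; sym; trans; cong; cong₂; subst; subst₂; module ≡-Reasoning)
open import Relation.Nullary using (yes; no; ¬_; does; contradiction; Dec)
open import Relation.Nullary.Decidable using (does-⇔; dec-true; dec-false; from-yes)
open import Relation.Unary using (Decidable)
open import Data.List.Relation.Unary.Unique.DecPropositional.Properties ℕ._≟_ using (deduplicate-!)

open ℚSolver.+-*-Solver using (Polynomial; con; _:+_; _:*_; :-_; _:-_; _:=_; ⟦_⟧; normalise; _≟N_; ⟦_⟧N-cong; correct)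

-- Ordered-field arithmetic in ℚ

-- Unlike solve from Data.Rational.Solver, this compares normal forms by a computed Boolean, which keeps them out of
-- the proof terms.
ring : ∀ n (f : N-ary.N-ary n (Polynomial n) (Polynomial n × Polynomial n)) →
  let (l , r) = f N-ary.$ⁿ Vec.map ℚSolver.+-*-Solver.var (Vec.allFin n) in
  {_ : Bool.T (is-just (normalise l ≟N normalise r))} → N-ary.Eq n _≡_ (N-ary.curryⁿ ⟦ l ⟧) (N-ary.curryⁿ ⟦ r ⟧)
ring n f {t} = N-ary.curryⁿ-cong _≡_ ⟦ l ⟧ ⟦ r ⟧ λ ρ →
  trans (sym (correct l ρ)) (trans (⟦ to-witness-T (normalise l ≟N normalise r) t ⟧N-cong ρ) (correct r ρ))
  where
  l r : Polynomial n
  l = proj₁ (f N-ary.$ⁿ Vec.map ℚSolver.+-*-Solver.var (Vec.allFin n))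
  r = proj₂ (f N-ary.$ⁿ Vec.map ℚSolver.+-*-Solver.var (Vec.allFin n))

0≤1 : 0ℚ ≤ 1ℚ
0≤1 = <⇒≤ (positive⁻¹ 1ℚ)

0<1 : 0ℚ < 1ℚ
0<1 = positive⁻¹ 1ℚ

gap : ∀ {p q} → p ≤ q → 0ℚ ≤ q - p
gap {p} {q} p≤q = subst (_≤ q - p) (+-inverseʳ p) (+-monoˡ-≤ (- p) p≤q)

gap< : ∀ {p q} → p < q → 0ℚ < q - p
gap< {p} {q} p<q = subst (_< q - p) (+-inverseʳ p) (+-monoˡ-< (- p) p<q)

-- An inequality certified by exhibiting the difference of its sides as a visibly nonnegative expression.
by : ∀ {p q r} → 0ℚ ≤ r → q ≡ p + r → p ≤ q
by 0≤r refl = p≤p+q 0≤r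

by< : ∀ {p q r} → 0ℚ < r → q ≡ p + r → p < q
by< {p} {r = r} 0<r refl = subst (_< p + r) (+-identityʳ p) (+-monoʳ-< p 0<r)

0<-+ : ∀ {p q} → 0ℚ < p → 0ℚ ≤ q → 0ℚ < p + q
0<-+ 0<p 0≤q = <-≤-trans 0<p (p≤p+q 0≤q)

*-monoˡ : ∀ {p q r} → 0ℚ ≤ r → p ≤ q → r * p ≤ r * q
*-monoˡ {r = r} 0≤r = *-monoˡ-≤-nonNeg r {{nonNegative 0≤r}}

*-monoʳ : ∀ {p q r} → 0ℚ ≤ r → p ≤ q → p * r ≤ q * r
*-monoʳ {r = r} 0≤r = *-monoʳ-≤-nonNeg r {{nonNegative 0≤r}}

*-cancelˡ : ∀ {p q r} → 0ℚ < r → r * p ≤ r * q → p ≤ q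
*-cancelˡ {r = r} 0<r = *-cancelˡ-≤-pos r {{positive 0<r}}

0≤sq : ∀ p → 0ℚ ≤ p * p
0≤sq p with ≤-total 0ℚ p
... | inj₁ 0≤p = 0≤* 0≤p 0≤p
... | inj₂ p≤0 = subst (0ℚ ≤_) (ring 1 (λ p → (:- p) :* (:- p) := p :* p) p)
                   (0≤* (neg-antimono-≤ p≤0) (neg-antimono-≤ p≤0))

-- Absolute values

∣∣-≤ : ∀ {p q} → ∣ p ∣ ≤ q → p ≤ q × - p ≤ q
∣∣-≤ {p} h = ≤-trans (p≤∣p∣ p) h , ≤-trans (≤-trans (p≤∣p∣ (- p)) (≤-reflexive (∣-p∣≡∣p∣ p))) h

∣+∣ : ∀ {p q a b} → ∣ p ∣ ≤ a → ∣ q ∣ ≤ b → ∣ p + q ∣ ≤ a + b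
∣+∣ {p} {q} hp hq = ≤-trans (∣p+q∣≤∣p∣+∣q∣ p q) (+-mono-≤ hp hq)

∣neg∣ : ∀ {p a} → ∣ p ∣ ≤ a → ∣ - p ∣ ≤ a
∣neg∣ {p} = subst (_≤ _) (sym (∣-p∣≡∣p∣ p))

∣-∣ : ∀ {p q a b} → ∣ p ∣ ≤ a → ∣ q ∣ ≤ b → ∣ p - q ∣ ≤ a + b
∣-∣ {p} {q} hp hq = ∣+∣ {p} { - q} hp (∣neg∣ {q} hq)

∣*∣ : ∀ {p q a b} → ∣ p ∣ ≤ a → ∣ q ∣ ≤ b → ∣ p * q ∣ ≤ a * b
∣*∣ {p} {q} hp hq = subst (_≤ _) (sym (∣p*q∣≡∣p∣*∣q∣ p q))
  (*-mono-≤ (0≤∣p∣ q) (≤-trans (0≤∣p∣ p) hp) hp hq)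

∣≥0∣ : ∀ {p a} → 0ℚ ≤ p → p ≤ a → ∣ p ∣ ≤ a
∣≥0∣ 0≤p = subst (_≤ _) (sym (0≤p⇒∣p∣≡p 0≤p))

∣∣-self : ∀ {p} → 0ℚ ≤ p → ∣ p ∣ ≤ p
∣∣-self 0≤p = ∣≥0∣ 0≤p ≤-refl

≤∣∣ : ∀ {p a} → ∣ p ∣ ≤ a → 0ℚ ≤ a
≤∣∣ {p} = ≤-trans (0≤∣p∣ p)

∣∣*∣∣ : ∀ {p a} → ∣ p ∣ ≤ a → p * p ≤ a * a
∣∣*∣∣ {p} h = ≤-trans (p≤∣p∣ (p * p)) (∣*∣ {p} {p} h h)

∣sum∣ : ∀ {p q r a b} → ∣ p - q ∣ ≤ a → ∣ q - r ∣ ≤ b → ∣ p - r ∣ ≤ a + b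
∣sum∣ {p} {q} {r} hp hq = ≤-trans (∣p-r∣≤∣p-q∣+∣q-r∣ p q r) (+-mono-≤ hp hq)

∣flip∣ : ∀ {p q a} → ∣ p - q ∣ ≤ a → ∣ q - p ∣ ≤ a
∣flip∣ {p} {q} = subst (_≤ _) (∣p-q∣≡∣q-p∣ p q)

∣refl∣ : ∀ p → ∣ p - p ∣ ≤ 0ℚ
∣refl∣ p = ≤-reflexive (cong ∣_∣ (+-inverseʳ p))

-- Inverses

*-⁻¹ : ∀ {p} → 0ℚ < p → p * p ⁻¹ ≡ 1ℚ
*-⁻¹ {p} 0<p with p ≟ 0ℚ
... | yes refl = contradiction 0<p (<-irrefl refl)
... | no p≢0   = *-inverseʳ p {{≢-nonZero p≢0}}

⁻¹-pos : ∀ {p} → 0ℚ < p → 0ℚ < p ⁻¹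
⁻¹-pos {p} 0<p with p ≟ 0ℚ
... | yes refl = contradiction 0<p (<-irrefl refl)
... | no p≢0   = positive⁻¹ _ {{1/pos⇒pos p {{positive 0<p}}}}

0≤⁻¹ : ∀ {p} → 0ℚ < p → 0ℚ ≤ p ⁻¹
0≤⁻¹ 0<p = <⇒≤ (⁻¹-pos 0<p)

⁻¹-unique : ∀ {p r} → 0ℚ < p → p * r ≡ 1ℚ → r ≡ p ⁻¹
⁻¹-unique {p} {r} 0<p pr≡1 = begin
  r                  ≡⟨ sym (*-identityʳ r) ⟩
  r * 1ℚ             ≡⟨ cong (r *_) (sym (*-⁻¹ 0<p)) ⟩
  r * (p * p ⁻¹)     ≡⟨ ring 3 (λ r p i → r :* (p :* i) := p :* r :* i) r p (p ⁻¹) ⟩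
  p * r * p ⁻¹       ≡⟨ cong (_* p ⁻¹) pr≡1 ⟩
  1ℚ * p ⁻¹          ≡⟨ *-identityˡ (p ⁻¹) ⟩
  p ⁻¹               ∎
  where open ≡-Reasoning

/-cancel : ∀ {p} q → 0ℚ < p → p * (q * p ⁻¹) ≡ q
/-cancel {p} q 0<p = trans (ring 3 (λ p q i → p :* (q :* i) := q :* (p :* i)) p q (p ⁻¹))
  (trans (cong (q *_) (*-⁻¹ 0<p)) (*-identityʳ q))

≤/ : ∀ {p q r} → 0ℚ < r → p * r ≤ q → p ≤ q * r ⁻¹
≤/ {p} {q} {r} 0<r h = *-cancelˡ 0<r (subst₂ _≤_ (*-comm p r) (sym (/-cancel q 0<r)) h)

/≤ : ∀ {p q r} → 0ℚ < r → q ≤ p * r → q * r ⁻¹ ≤ p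
/≤ {p} {q} {r} 0<r h = *-cancelˡ 0<r (subst₂ _≤_ (sym (/-cancel q 0<r)) (*-comm p r) h)

≤⁻¹ : ∀ {p r} → 0ℚ < r → p * r ≤ 1ℚ → p ≤ r ⁻¹
≤⁻¹ {p} {r} 0<r h = subst (p ≤_) (*-identityˡ (r ⁻¹)) (≤/ {p} {1ℚ} {r} 0<r h)

⁻¹-anti : ∀ {p q} → 0ℚ < p → p ≤ q → q ⁻¹ ≤ p ⁻¹
⁻¹-anti {p} {q} 0<p p≤q = subst (_≤ p ⁻¹) (*-identityˡ (q ⁻¹)) (/≤ 0<q (subst (_≤ p ⁻¹ * q)
  (trans (*-comm (p ⁻¹) p) (*-⁻¹ 0<p)) (*-monoˡ (0≤⁻¹ 0<p) p≤q)))
  where 0<q = <-≤-trans 0<p p≤q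

⁻¹-difference : ∀ {p q} → 0ℚ < p → 0ℚ < q → p ⁻¹ - q ⁻¹ ≡ p ⁻¹ * q ⁻¹ * (q - p)
⁻¹-difference {p} {q} 0<p 0<q = begin
  p ⁻¹ - q ⁻¹                                      ≡⟨ cong₂ _-_ (sym (trans (cong (p ⁻¹ *_) (*-⁻¹ 0<q)) (*-identityʳ (p ⁻¹)))) (sym (trans (cong (q ⁻¹ *_) (*-⁻¹ 0<p)) (*-identityʳ (q ⁻¹)))) ⟩
  p ⁻¹ * (q * q ⁻¹) - q ⁻¹ * (p * p ⁻¹)            ≡⟨ ring 4 (λ i j p q → i :* (q :* j) :- j :* (p :* i) := i :* j :* (q :- p)) (p ⁻¹) (q ⁻¹) p q ⟩
  p ⁻¹ * q ⁻¹ * (q - p)                            ∎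
  where open ≡-Reasoning

-- Powers

infixr 8 _↑_

_↑_ : ℚ → ℕ → ℚ
x ↑ zero  = 1ℚ
x ↑ suc n = x * x ↑ n

↑-+ : ∀ x m n → x ↑ (m ℕ.+ n) ≡ x ↑ m * x ↑ n
↑-+ x zero    n = sym (*-identityˡ (x ↑ n))
↑-+ x (suc m) n = trans (cong (x *_) (↑-+ x m n)) (sym (*-assoc x (x ↑ m) (x ↑ n)))

↑-distrib : ∀ x y n → (x * y) ↑ n ≡ x ↑ n * y ↑ n
↑-distrib x y zero    = refl
↑-distrib x y (suc n) = trans (cong (x * y *_) (↑-distrib x y n))
  (ring 4 (λ x y a b → x :* y :* (a :* b) := x :* a :* (y :* b)) x y (x ↑ n) (y ↑ n))

↑-* : ∀ x m n → x ↑ (m ℕ.* n) ≡ (x ↑ n) ↑ m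
↑-* x zero    n = refl
↑-* x (suc m) n = trans (↑-+ x n (m ℕ.* n)) (cong (x ↑ n *_) (↑-* x m n))

1↑ : ∀ n → 1ℚ ↑ n ≡ 1ℚ
1↑ zero    = refl
1↑ (suc n) = trans (*-identityˡ (1ℚ ↑ n)) (1↑ n)

0≤↑ : ∀ {x} → 0ℚ ≤ x → ∀ n → 0ℚ ≤ x ↑ n
0≤↑ 0≤x zero    = 0≤1
0≤↑ 0≤x (suc n) = 0≤* 0≤x (0≤↑ 0≤x n)

0<↑ : ∀ {x} → 0ℚ < x → ∀ n → 0ℚ < x ↑ n
0<↑ 0<x zero    = 0<1
0<↑ 0<x (suc n) = 0<* 0<x (0<↑ 0<x n)

↑-mono : ∀ {x y} → 0ℚ ≤ x → x ≤ y → ∀ n → x ↑ n ≤ y ↑ n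
↑-mono 0≤x x≤y zero    = ≤-refl
↑-mono 0≤x x≤y (suc n) = *-mono-≤ (0≤↑ 0≤x n) (≤-trans 0≤x x≤y) x≤y (↑-mono 0≤x x≤y n)

↑≤1 : ∀ {x} → 0ℚ ≤ x → x ≤ 1ℚ → ∀ n → x ↑ n ≤ 1ℚ
↑≤1 {x} 0≤x x≤1 n = subst (x ↑ n ≤_) (1↑ n) (↑-mono 0≤x x≤1 n)

1≤↑ : ∀ {x} → 1ℚ ≤ x → ∀ n → 1ℚ ≤ x ↑ n
1≤↑ {x} 1≤x n = subst (_≤ x ↑ n) (1↑ n) (↑-mono 0≤1 1≤x n)

↑-mono-exp : ∀ {x} → 1ℚ ≤ x → ∀ {m n} → m ℕ.≤ n → x ↑ m ≤ x ↑ n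
↑-mono-exp 1≤x {n = n} ℕ.z≤n = 1≤↑ 1≤x n
↑-mono-exp 1≤x (ℕ.s≤s m≤n)   = *-monoˡ (≤-trans 0≤1 1≤x) (↑-mono-exp 1≤x m≤n)

↑-anti-exp : ∀ {x} → 0ℚ ≤ x → x ≤ 1ℚ → ∀ {m n} → m ℕ.≤ n → x ↑ n ≤ x ↑ m
↑-anti-exp 0≤x x≤1 {n = n} ℕ.z≤n = ↑≤1 0≤x x≤1 n
↑-anti-exp 0≤x x≤1 (ℕ.s≤s m≤n)   = *-monoˡ 0≤x (↑-anti-exp 0≤x x≤1 m≤n)

∣↑∣ : ∀ x n → ∣ x ↑ n ∣ ≡ ∣ x ∣ ↑ n
∣↑∣ x zero    = refl
∣↑∣ x (suc n) = trans (∣p*q∣≡∣p∣*∣q∣ x (x ↑ n)) (cong (∣ x ∣ *_) (∣↑∣ x n))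

ι-suc : ∀ n → ι (suc n) ≡ 1ℚ + ι n
ι-suc n = ι-homo-+ 1 n

0<ι : ∀ n → 0ℚ < ι (suc n)
0<ι n = subst (0ℚ <_) (sym (ι-suc n)) (0<-+ 0<1 (0≤ι n))

0<inv : ∀ k → 0ℚ < inv k
0<inv k = subst (0ℚ <_) (sym (⁻¹-unique {ι (suc k)} {inv k} (0<ι k) (trans (*-comm (ι (suc k)) (inv k)) (inv*ι k)))) (⁻¹-pos (0<ι k))

bernoulli : ∀ {t} → 0ℚ ≤ t → ∀ n → 1ℚ + ι n * t ≤ (1ℚ + t) ↑ n
bernoulli {t} 0≤t zero    = ≤-reflexive (ring 1 (λ t → con 1ℚ :+ con 0ℚ :* t := con 1ℚ) t)
bernoulli {t} 0≤t (suc n) = ≤-trans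
  (by (0≤* (0≤ι n) (0≤* 0≤t 0≤t))
    (trans (ring 2 (λ t n → (con 1ℚ :+ t) :* (con 1ℚ :+ n :* t) := con 1ℚ :+ (con 1ℚ :+ n) :* t :+ n :* (t :* t)) t (ι n))
           (cong (λ z → 1ℚ + z * t + ι n * (t * t)) (sym (ι-suc n)))))
  (*-monoˡ (0≤-+ 0≤1 0≤t) (bernoulli 0≤t n))

-- Convolution sums over the pairs (a , c) with a + c = n

conv : ℕ → (ℕ → ℕ → ℚ) → ℚ
conv zero    f = f 0 0
conv (suc n) f = f 0 (suc n) + conv n (λ a c → f (suc a) c)

conv-cong : ∀ n {f g} → (∀ a c → a ℕ.+ c ≡ n → f a c ≡ g a c) → conv n f ≡ conv n g
conv-cong zero    h = h 0 0 refl
conv-cong (suc n) h = cong₂ _+_ (h 0 (suc n) refl) (conv-cong n λ a c e → h (suc a) c (cong suc e))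

conv-mono : ∀ n {f g} → (∀ a c → a ℕ.+ c ≡ n → f a c ≤ g a c) → conv n f ≤ conv n g
conv-mono zero    h = h 0 0 refl
conv-mono (suc n) h = +-mono-≤ (h 0 (suc n) refl) (conv-mono n λ a c e → h (suc a) c (cong suc e))

conv-+ : ∀ n f g → conv n (λ a c → f a c + g a c) ≡ conv n f + conv n g
conv-+ zero    f g = refl
conv-+ (suc n) f g = trans (cong (f 0 (suc n) + g 0 (suc n) +_) (conv-+ n (λ a → f (suc a)) (λ a → g (suc a))))
  (ring 4 (λ a b c d → a :+ b :+ (c :+ d) := a :+ c :+ (b :+ d)) (f 0 (suc n)) (g 0 (suc n)) _ _)

conv-* : ∀ n x f → conv n (λ a c → x * f a c) ≡ x * conv n f
conv-* zero    x f = refl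
conv-* (suc n) x f = trans (cong (x * f 0 (suc n) +_) (conv-* n x (λ a → f (suc a))))
  (sym (*-distribˡ-+ x (f 0 (suc n)) _))

conv-*ʳ : ∀ n x f → conv n (λ a c → f a c * x) ≡ conv n f * x
conv-*ʳ n x f = trans (conv-cong n λ a c _ → *-comm (f a c) x) (trans (conv-* n x f) (*-comm x _))

conv-neg : ∀ n f → conv n (λ a c → - f a c) ≡ - conv n f
conv-neg zero    f = refl
conv-neg (suc n) f = trans (cong (- f 0 (suc n) +_) (conv-neg n (λ a → f (suc a))))
  (sym (neg-distrib-+ (f 0 (suc n)) _))

conv-- : ∀ n f g → conv n (λ a c → f a c - g a c) ≡ conv n f - conv n g
conv-- n f g = trans (conv-+ n f (λ a c → - g a c)) (cong (conv n f +_) (conv-neg n g))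

conv-0 : ∀ n → conv n (λ _ _ → 0ℚ) ≡ 0ℚ
conv-0 zero    = refl
conv-0 (suc n) = trans (cong (0ℚ +_) (conv-0 n)) (+-identityˡ 0ℚ)

conv-zero : ∀ n {f} → (∀ a c → a ℕ.+ c ≡ n → f a c ≡ 0ℚ) → conv n f ≡ 0ℚ
conv-zero n h = trans (conv-cong n h) (conv-0 n)

0≤conv : ∀ n {f} → (∀ a c → a ℕ.+ c ≡ n → 0ℚ ≤ f a c) → 0ℚ ≤ conv n f
0≤conv n h = subst (_≤ conv n _) (conv-0 n) (conv-mono n h)

conv-abs : ∀ n {f g} → (∀ a c → a ℕ.+ c ≡ n → ∣ f a c ∣ ≤ g a c) → ∣ conv n f ∣ ≤ conv n g
conv-abs zero    h = h 0 0 refl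
conv-abs (suc n) {f} h = ∣+∣ {f 0 (suc n)} (h 0 (suc n) refl) (conv-abs n λ a c e → h (suc a) c (cong suc e))

conv-snoc : ∀ n f → conv (suc n) f ≡ conv n (λ a c → f a (suc c)) + f (suc n) 0
conv-snoc zero    f = refl
conv-snoc (suc n) f = trans (cong (f 0 (suc (suc n)) +_) (conv-snoc n (λ a → f (suc a))))
  (sym (+-assoc (f 0 (suc (suc n))) _ _))

conv-term : ∀ n {f} → (∀ a c → a ℕ.+ c ≡ n → 0ℚ ≤ f a c) → ∀ a c → a ℕ.+ c ≡ n → f a c ≤ conv n f
conv-term zero    h zero    zero    _    = ≤-refl
conv-term (suc n) h zero    (suc c) refl = p≤p+q (0≤conv n λ a c e → h (suc a) c (cong suc e))
conv-term (suc n) h (suc a) c       e    = ≤-trans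
  (conv-term n (λ a c e → h (suc a) c (cong suc e)) a c (ℕ.suc-injective e)) (p≤q+p (h 0 (suc n) refl))

-- Both sides run over the triples with k + s + t = n; the right one groups the first two.
conv-assoc : ∀ n (F : ℕ → ℕ → ℕ → ℚ) →
  conv n (λ k m → conv m (F k)) ≡ conv n (λ u t → conv u (λ k s → F k s t))
conv-assoc zero    F = refl
conv-assoc (suc n) F = begin
  F 0 0 (suc n) + conv n (λ s t → F 0 (suc s) t) + conv n (λ k m → conv m (F (suc k)))
    ≡⟨ +-assoc (F 0 0 (suc n)) _ _ ⟩
  F 0 0 (suc n) + (conv n (λ s t → F 0 (suc s) t) + conv n (λ k m → conv m (F (suc k))))
    ≡⟨ cong (λ z → F 0 0 (suc n) + (conv n (λ s t → F 0 (suc s) t) + z)) (conv-assoc n (λ k → F (suc k))) ⟩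
  F 0 0 (suc n) + (conv n (λ s t → F 0 (suc s) t) + conv n (λ u t → conv u (λ k s → F (suc k) s t)))
    ≡⟨ cong (F 0 0 (suc n) +_) (sym (conv-+ n (λ s t → F 0 (suc s) t) _)) ⟩
  F 0 0 (suc n) + conv n (λ u t → F 0 (suc u) t + conv u (λ k s → F (suc k) s t)) ∎
  where open ≡-Reasoning

conv-geometric : ∀ {x} → 0ℚ ≤ x → ∀ n → (1ℚ - x) * conv n (λ a _ → x ↑ a) ≤ 1ℚ
conv-geometric {x} 0≤x n = by (0≤↑ 0≤x (suc n)) (sym (identity n))
  where
  open ≡-Reasoning
  identity : ∀ n → (1ℚ - x) * conv n (λ a _ → x ↑ a) + x ↑ suc n ≡ 1ℚ
  identity zero    = ring 1 (λ x → (con 1ℚ :- x) :* con 1ℚ :+ x :* con 1ℚ := con 1ℚ) x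
  identity (suc n) = begin
    (1ℚ - x) * (1ℚ + conv n (λ a _ → x * x ↑ a)) + x * x ↑ suc n
      ≡⟨ cong (λ z → (1ℚ - x) * (1ℚ + z) + x * x ↑ suc n) (conv-* n x (λ a _ → x ↑ a)) ⟩
    (1ℚ - x) * (1ℚ + x * conv n (λ a _ → x ↑ a)) + x * x ↑ suc n
      ≡⟨ ring 3 (λ x c y → (con 1ℚ :- x) :* (con 1ℚ :+ x :* c) :+ x :* y := con 1ℚ :- x :+ x :* ((con 1ℚ :- x) :* c :+ y)) x _ (x ↑ suc n) ⟩
    1ℚ - x + x * ((1ℚ - x) * conv n (λ a _ → x ↑ a) + x ↑ suc n)
      ≡⟨ cong (λ z → 1ℚ - x + x * z) (identity n) ⟩
    1ℚ - x + x * 1ℚ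
      ≡⟨ ring 1 (λ x → con 1ℚ :- x :+ x :* con 1ℚ := con 1ℚ) x ⟩
    1ℚ ∎

conv-geometric-≤ : ∀ {x} → 0ℚ ≤ x → x < 1ℚ → ∀ n → conv n (λ a _ → x ↑ a) ≤ (1ℚ - x) ⁻¹
conv-geometric-≤ {x} 0≤x x<1 n = ≤⁻¹ {conv n (λ a _ → x ↑ a)} (gap< x<1)
  (subst (_≤ 1ℚ) (*-comm (1ℚ - x) (conv n (λ a _ → x ↑ a))) (conv-geometric 0≤x n))

-- Geometric decay

module _ {r} (0≤r : 0ℚ ≤ r) (r<1 : r < 1ℚ) where

  -- With t = 1 - r, Bernoulli's inequality gives (n + 1) t ≤ 1 + n t ≤ (1 + t)^n, and (1 + t) r = 1
  -- - t² is at most 1.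
  suc*↑-≤ : ∀ n → ι (suc n) * r ↑ n ≤ (1ℚ - r) ⁻¹
  suc*↑-≤ n = ≤⁻¹ {ι (suc n) * r ↑ n} (gap< r<1) (begin
    ι (suc n) * r ↑ n * t              ≡⟨ cong (λ z → z * r ↑ n * t) (ι-suc n) ⟩
    (1ℚ + ι n) * r ↑ n * t             ≤⟨ by (0≤* 0≤r (0≤↑ 0≤r n)) (ring 3 (λ r n y → (con 1ℚ :+ n :* (con 1ℚ :- r)) :* y := (con 1ℚ :+ n) :* y :* (con 1ℚ :- r) :+ r :* y) r (ι n) (r ↑ n)) ⟩
    (1ℚ + ι n * t) * r ↑ n             ≤⟨ *-monoʳ (0≤↑ 0≤r n) (bernoulli 0≤t n) ⟩
    (1ℚ + t) ↑ n * r ↑ n               ≡⟨ sym (↑-distrib (1ℚ + t) r n) ⟩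
    ((1ℚ + t) * r) ↑ n                 ≤⟨ ↑≤1 (0≤* (0≤-+ 0≤1 0≤t) 0≤r) (by (0≤sq t) (ring 1 (λ r → con 1ℚ := (con 1ℚ :+ (con 1ℚ :- r)) :* r :+ (con 1ℚ :- r) :* (con 1ℚ :- r)) r)) n ⟩
    1ℚ                                 ∎)
    where
    open ≤-Reasoning
    t = 1ℚ - r
    0≤t = <⇒≤ (gap< r<1)

  ↑-≤-inv : ∀ n → r ↑ n ≤ (1ℚ - r) ⁻¹ * inv n
  ↑-≤-inv n = begin
    r ↑ n                            ≡⟨ sym (*-identityˡ (r ↑ n)) ⟩
    1ℚ * r ↑ n                       ≡⟨ cong (_* r ↑ n) (sym (inv*ι n)) ⟩
    inv n * ι (suc n) * r ↑ n        ≡⟨ *-assoc (inv n) (ι (suc n)) (r ↑ n) ⟩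
    inv n * (ι (suc n) * r ↑ n)      ≤⟨ *-monoˡ (0≤inv n) (suc*↑-≤ n) ⟩
    inv n * (1ℚ - r) ⁻¹              ≡⟨ *-comm (inv n) _ ⟩
    (1ℚ - r) ⁻¹ * inv n              ∎
    where open ≤-Reasoning

  ↑-eventually-≤ : ∀ {c} → 0ℚ ≤ c → ∀ ε → 0ℚ < ε → ∃[ N ] ∀ n → N ℕ.≤ n → c * r ↑ n ≤ ε
  ↑-eventually-≤ {c} 0≤c ε 0<ε =
    let N , h = eventually-small (c * (1ℚ - r) ⁻¹) (0≤* 0≤c (0≤⁻¹ (gap< r<1))) ε 0<ε
    in N , λ n N≤n → ≤-trans
      (subst (c * r ↑ n ≤_) (sym (*-assoc c ((1ℚ - r) ⁻¹) (inv n))) (*-monoˡ 0≤c (↑-≤-inv n)))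
      (h n N≤n)

  -- The square of the mean of 1 and r is at least r, which leaves a geometric factor to absorb ι (suc n).
  slower : ℚ
  slower = ½ * (1ℚ + r)

  0≤slower : 0ℚ ≤ slower
  0≤slower = 0≤* (<⇒≤ (positive⁻¹ ½)) (0≤-+ 0≤1 0≤r)

  slower<1 : slower < 1ℚ
  slower<1 = by< (0<* (positive⁻¹ ½) (gap< r<1)) (ring 1 (λ r → con 1ℚ := con ½ :* (con 1ℚ :+ r) :+ con ½ :* (con 1ℚ :- r)) r)

  r≤slower : r ≤ slower
  r≤slower = by (0≤* (<⇒≤ (positive⁻¹ ½)) (<⇒≤ (gap< r<1))) (ring 1 (λ r → con ½ :* (con 1ℚ :+ r) := r :+ con ½ :* (con 1ℚ :- r)) r)

  r≤slower² : r ≤ slower * slower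
  r≤slower² = by (0≤sq (½ * (1ℚ - r))) (ring 1 (λ r → con ½ :* (con 1ℚ :+ r) :* (con ½ :* (con 1ℚ :+ r)) := r :+ con ½ :* (con 1ℚ :- r) :* (con ½ :* (con 1ℚ :- r))) r)

absorb : ∀ {r} (0≤r : 0ℚ ≤ r) (r<1 : r < 1ℚ) → ∀ n →
  ι (suc n) * r ↑ n ≤ (1ℚ - slower 0≤r r<1) ⁻¹ * slower 0≤r r<1 ↑ n
absorb {r} 0≤r r<1 n = begin
  ι (suc n) * r ↑ n              ≤⟨ *-monoˡ (0≤ι (suc n)) (↑-mono 0≤r (r≤slower² 0≤r r<1) n) ⟩
  ι (suc n) * (s * s) ↑ n        ≡⟨ cong (ι (suc n) *_) (↑-distrib s s n) ⟩
  ι (suc n) * (s ↑ n * s ↑ n)    ≡⟨ sym (*-assoc (ι (suc n)) _ _) ⟩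
  ι (suc n) * s ↑ n * s ↑ n      ≤⟨ *-monoʳ (0≤↑ 0≤s n) (suc*↑-≤ 0≤s (slower<1 0≤r r<1) n) ⟩
  (1ℚ - s) ⁻¹ * s ↑ n            ∎
  where
  open ≤-Reasoning
  s = slower 0≤r r<1
  0≤s = 0≤slower 0≤r r<1

-- Coupling for renewal chains

-- From n the chain jumps down to t with probability π s t, where s + t = n, and dies with the missing probability.
record Chain : Set where
  field
    π        : ℕ → ℕ → ℚ
    0≤π      : ∀ s t → 0ℚ ≤ π s t
    π-moves  : ∀ t → π 0 t ≡ 0ℚ
    π-total  : ∀ n → conv n π ≤ 1ℚ
    δ        : ℚ
    0<δ      : 0ℚ < δ
    δ≤π      : ∀ t → δ ≤ π 1 t
    l        : ℚ
    1<l      : 1ℚ < l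
    D        : ℚ
    π-moment : ∀ n → conv n (λ s t → π s t * (l ↑ s * l ↑ s)) ≤ D

module Coupling (𝒞 : Chain) where
  open Chain 𝒞

  δ≤1 : δ ≤ 1ℚ
  δ≤1 = ≤-trans (δ≤π 0) (≤-trans (conv-term 1 {π} (λ s t _ → 0≤π s t) 1 0 refl) (π-total 1))

  1≤l : 1ℚ ≤ l
  1≤l = <⇒≤ 1<l

  0<l : 0ℚ < l
  0<l = <-≤-trans 0<1 1≤l

  0≤D : 0ℚ ≤ D
  0≤D = ≤-trans (0≤conv 0 λ s t _ → 0≤* (0≤π s t) (0≤sq (l ↑ s))) (π-moment 0)

  l⁻ : ℚ
  l⁻ = l ⁻¹

  0≤l⁻ : 0ℚ ≤ l⁻
  0≤l⁻ = 0≤⁻¹ 0<l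

  l⁻<1 : l⁻ < 1ℚ
  l⁻<1 = subst₂ _<_ (*-identityʳ l⁻) (trans (*-comm l⁻ l) (*-⁻¹ 0<l)) (*-monoʳ-<-pos l⁻ {{positive (⁻¹-pos 0<l)}} 1<l)

  l⁻↑*l↑ : ∀ j → l⁻ ↑ j * l ↑ j ≡ 1ℚ
  l⁻↑*l↑ j = trans (sym (↑-distrib l⁻ l j)) (trans (cong (_↑ j) (trans (*-comm l⁻ l) (*-⁻¹ 0<l))) (1↑ j))

  ρ q : ℚ
  ρ = 1ℚ - l⁻
  q = ½ * δ

  0<ρ : 0ℚ < ρ
  0<ρ = gap< l⁻<1

  0<q : 0ℚ < q
  0<q = halve 0<δ

  q≤1 : q ≤ 1ℚ
  q≤1 = ≤-trans (by (0≤* (<⇒≤ (positive⁻¹ ½)) (<⇒≤ 0<δ)) (ring 1 (λ d → d := con ½ :* d :+ con ½ :* d) δ)) δ≤1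

  private
    J-spec : ∃[ N ] ∀ n → N ℕ.≤ n → D * l⁻ ↑ n ≤ ½ * ρ
    J-spec = ↑-eventually-≤ 0≤l⁻ l⁻<1 0≤D (½ * ρ) (halve 0<ρ)

  J : ℕ
  J = proj₁ J-spec

  -- From `J` on, the jump term `D * l⁻ ↑ j` is paid by half of the drift `ρ * l ↑ j`; below `J` it
  -- is paid by `L * q ↑ j`, which is at least `D` there. Then `ε` is small enough for the other
  -- half of the drift to cover `ε * (L + l ↑ j)`.
  L ε : ℚ
  L = D * (q ↑ J) ⁻¹
  ε = ½ * ρ * (L + 1ℚ) ⁻¹

  0≤L : 0ℚ ≤ L
  0≤L = 0≤* 0≤D (0≤⁻¹ (0<↑ 0<q J))

  0<L+1 : 0ℚ < L + 1ℚ
  0<L+1 = subst (0ℚ <_) (+-comm 1ℚ L) (0<-+ 0<1 0≤L)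

  0<ε : 0ℚ < ε
  0<ε = 0<* (halve 0<ρ) (⁻¹-pos 0<L+1)

  -- A supersolution for the gap between two coupled chains: the first summand gains from the mass at s = 1 when the
  -- gap is small, the second one from the drift when it is large.
  v : ℕ → ℚ
  v j = L * (1ℚ - q ↑ j) + l ↑ j

  0≤1-q↑ : ∀ j → 0ℚ ≤ 1ℚ - q ↑ j
  0≤1-q↑ j = gap (↑≤1 (<⇒≤ 0<q) q≤1 j)

  1≤v : ∀ j → 1ℚ ≤ v j
  1≤v j = ≤-trans (1≤↑ 1≤l j) (p≤q+p (0≤* 0≤L (0≤1-q↑ j)))

  0≤v : ∀ j → 0ℚ ≤ v j
  0≤v j = ≤-trans 0≤1 (1≤v j)

  v-mono : ∀ {i j} → i ℕ.≤ j → v i ≤ v j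
  v-mono i≤j = +-mono-≤ (*-monoˡ 0≤L (+-monoʳ-≤ 1ℚ (neg-antimono-≤ (↑-anti-exp (<⇒≤ 0<q) q≤1 i≤j)))) (↑-mono-exp 1≤l i≤j)

  v≤ : ∀ j → v j ≤ (L + 1ℚ) * l ↑ j
  v≤ j = by (0≤-+ (0≤* 0≤L (gap (1≤↑ 1≤l j))) (0≤* 0≤L (0≤↑ (<⇒≤ 0<q) j)))
    (ring 3 (λ L q l → (L :+ con 1ℚ) :* l := L :* (con 1ℚ :- q) :+ l :+ (L :* (l :- con 1ℚ) :+ L :* q)) L (q ↑ j) (l ↑ j))

  ε-bound : ∀ j → ε * (L + l ↑ j) ≤ ½ * ρ * l ↑ j
  ε-bound j = begin
    ε * (L + l ↑ j)                              ≤⟨ *-monoˡ (<⇒≤ 0<ε) (by (0≤* 0≤L (gap (1≤↑ 1≤l j)))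
                                                      (ring 2 (λ L l → (L :+ con 1ℚ) :* l := L :+ l :+ L :* (l :- con 1ℚ)) L (l ↑ j))) ⟩
    ε * ((L + 1ℚ) * l ↑ j)                       ≡⟨ ring 4 (λ h i m l → h :* i :* (m :* l) := h :* (m :* i) :* l) (½ * ρ) ((L + 1ℚ) ⁻¹) (L + 1ℚ) (l ↑ j) ⟩
    ½ * ρ * ((L + 1ℚ) * (L + 1ℚ) ⁻¹) * l ↑ j     ≡⟨ cong (λ z → ½ * ρ * z * l ↑ j) (*-⁻¹ 0<L+1) ⟩
    ½ * ρ * 1ℚ * l ↑ j                           ≡⟨ cong (_* l ↑ j) (*-identityʳ (½ * ρ)) ⟩
    ½ * ρ * l ↑ j                                ∎
    where open ≤-Reasoning

  tail-bound : ∀ j → D * l⁻ ↑ j ≤ L * q ↑ j + ½ * ρ * l ↑ j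
  tail-bound j = [ far , near ]′ (ℕ.≤-total J j)
    where
    far : J ℕ.≤ j → D * l⁻ ↑ j ≤ L * q ↑ j + ½ * ρ * l ↑ j
    far J≤j = ≤-trans (proj₂ J-spec j J≤j) (≤-trans
      (subst (_≤ ½ * ρ * l ↑ j) (*-identityʳ (½ * ρ)) (*-monoˡ (<⇒≤ (halve 0<ρ)) (1≤↑ 1≤l j)))
      (p≤q+p (0≤* 0≤L (0≤↑ (<⇒≤ 0<q) j))))
    near : j ℕ.≤ J → D * l⁻ ↑ j ≤ L * q ↑ j + ½ * ρ * l ↑ j
    near j≤J = ≤-trans (subst (D * l⁻ ↑ j ≤_) (*-identityʳ D) (*-monoˡ 0≤D (↑≤1 0≤l⁻ (<⇒≤ l⁻<1) j)))
      (≤-trans (≤-trans (≤-reflexive (sym (trans (*-comm L (q ↑ J)) (/-cancel D (0<↑ 0<q J)))))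
                        (*-monoˡ 0≤L (↑-anti-exp (<⇒≤ 0<q) q≤1 j≤J)))
               (p≤p+q (0≤* (<⇒≤ (halve 0<ρ)) (0≤↑ (<⇒≤ 0<l) j))))

  -- Halving `δ` in `q` leaves a surplus `L * q ↑ suc j`: the left side has `δ * q ↑ j`, which is
  -- twice the `q ↑ suc j` in `v (suc j)`. Together with the drift
  -- `l ↑ suc j - l ↑ j = ρ * l ↑ suc j` it covers both the jump term and the factor `1ℚ - ε`.
  super : ∀ j → L * (1ℚ - δ * q ↑ j) + l ↑ j + D * l⁻ ↑ suc j ≤ (1ℚ - ε) * v (suc j)
  super j = by (0≤-+ (0≤-+ (gap (ε-bound (suc j))) (gap (tail-bound (suc j)))) (0≤* (<⇒≤ 0<ε) (0≤* 0≤L (0≤↑ (<⇒≤ 0<q) (suc j)))))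
    (begin
      (1ℚ - ε) * (L * (1ℚ - q * q ↑ j) + l * l ↑ j)
        ≡⟨ ring 9 (λ e L d Q D i P l l⁻ → (con 1ℚ :- e) :* (L :* (con 1ℚ :- con ½ :* d :* Q) :+ l :* P)
               := L :* (con 1ℚ :- d :* Q) :+ l :* l⁻ :* P :+ D :* i :+ (con ½ :* (con 1ℚ :- l⁻) :* (l :* P) :- e :* (L :+ l :* P) :+ (L :* (con ½ :* d :* Q) :+ con ½ :* (con 1ℚ :- l⁻) :* (l :* P) :- D :* i) :+ e :* (L :* (con ½ :* d :* Q)))) ε L δ (q ↑ j) D (l⁻ ↑ suc j) (l ↑ j) l l⁻ ⟩
      L * (1ℚ - δ * q ↑ j) + l * l⁻ * l ↑ j + D * l⁻ ↑ suc j + R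
        ≡⟨ cong (λ z → L * (1ℚ - δ * q ↑ j) + z + D * l⁻ ↑ suc j + R) (trans (cong (_* l ↑ j) (*-⁻¹ 0<l)) (*-identityˡ (l ↑ j))) ⟩
      L * (1ℚ - δ * q ↑ j) + l ↑ j + D * l⁻ ↑ suc j + R ∎)
    where
    open ≡-Reasoning
    R = ½ * ρ * l ↑ suc j - ε * (L + l ↑ suc j) + (L * q ↑ suc j + ½ * ρ * l ↑ suc j - D * l⁻ ↑ suc j) + ε * (L * q ↑ suc j)


  v-step : ∀ j → v j ≤ (1ℚ - ε) * v (suc j)
  v-step j = ≤-trans (≤-trans step (p≤p+q (0≤* 0≤D (0≤↑ 0≤l⁻ (suc j))))) (super j)
    where
    step : v j ≤ L * (1ℚ - δ * q ↑ j) + l ↑ j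
    step = by (0≤* 0≤L (0≤* (gap δ≤1) (0≤↑ (<⇒≤ 0<q) j)))
      (ring 4 (λ L d Q P → L :* (con 1ℚ :- d :* Q) :+ P := L :* (con 1ℚ :- Q) :+ P :+ L :* ((con 1ℚ :- d) :* Q)) L δ (q ↑ j) (l ↑ j))

  -- Two chains stand at `suc n` and at `a` with `i + a ≡ n`. Once the upper one has jumped down by
  -- `s`, both are at most `n`, and the lower of them is at distance s - 1 or i from `n`.
  gap-after : ℕ → ℕ → ℕ
  gap-after s i = ℕ.pred (s ℕ.⊔ suc i)

  -- If the jump overtakes the other chain, then `s` is at least `suc i`, and one factor `l ↑ s`
  -- buys `l⁻ ↑ suc i`, as in Markov's inequality. This is why the moment of `l ↑ s * l ↑ s` is
  -- assumed.
  gap-after-≤ : ∀ s i → l ↑ gap-after s i ≤ l ↑ i + l⁻ ↑ suc i * (l ↑ s * l ↑ s)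
  gap-after-≤ s i = [ stay , jump ]′ (ℕ.≤-total s (suc i))
    where
    0≤rest = 0≤* (0≤↑ 0≤l⁻ (suc i)) (0≤sq (l ↑ s))
    stay : s ℕ.≤ suc i → l ↑ gap-after s i ≤ l ↑ i + l⁻ ↑ suc i * (l ↑ s * l ↑ s)
    stay s≤ = subst (λ j → l ↑ ℕ.pred j ≤ l ↑ i + l⁻ ↑ suc i * (l ↑ s * l ↑ s)) (sym (ℕ.m≤n⇒m⊔n≡n s≤)) (p≤p+q 0≤rest)
    jump : suc i ℕ.≤ s → l ↑ gap-after s i ≤ l ↑ i + l⁻ ↑ suc i * (l ↑ s * l ↑ s)
    jump i<s = begin
      l ↑ gap-after s i                        ≤⟨ ↑-mono-exp 1≤l (ℕ.≤-trans ℕ.pred[n]≤n (ℕ.≤-reflexive (ℕ.m≥n⇒m⊔n≡m i<s))) ⟩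
      l ↑ s                                    ≡⟨ sym (*-identityˡ (l ↑ s)) ⟩
      1ℚ * l ↑ s                               ≡⟨ cong (_* l ↑ s) (sym (l⁻↑*l↑ (suc i))) ⟩
      l⁻ ↑ suc i * l ↑ suc i * l ↑ s           ≡⟨ *-assoc (l⁻ ↑ suc i) (l ↑ suc i) (l ↑ s) ⟩
      l⁻ ↑ suc i * (l ↑ suc i * l ↑ s)         ≤⟨ *-monoˡ (0≤↑ 0≤l⁻ (suc i)) (*-monoʳ (0≤↑ (<⇒≤ 0<l) s) (↑-mono-exp 1≤l i<s)) ⟩
      l⁻ ↑ suc i * (l ↑ s * l ↑ s)             ≤⟨ p≤q+p (0≤↑ (<⇒≤ 0<l) i) ⟩
      l ↑ i + l⁻ ↑ suc i * (l ↑ s * l ↑ s)     ∎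
      where open ≤-Reasoning

  drift : ∀ n i → conv (suc n) (λ s t → π s t * v (gap-after s i)) ≤ (1ℚ - ε) * v (suc i)
  drift n i = ≤-trans (begin
    conv (suc n) (λ s t → π s t * v (gap-after s i))
      ≤⟨ conv-mono (suc n) (λ s t _ → *-monoˡ (0≤π s t) (+-monoʳ-≤ (L * (1ℚ - Q s)) (gap-after-≤ s i))) ⟩
    conv (suc n) (λ s t → π s t * (L * (1ℚ - Q s) + (l ↑ i + l⁻ ↑ suc i * M s)))
      ≡⟨ conv-cong (suc n) (λ s t _ → ring 6 (λ p L Q a b M → p :* (L :* (con 1ℚ :- Q) :+ (a :+ b :* M)) := (L :* p :- L :* (p :* Q)) :+ (a :* p :+ b :* (p :* M)))
           (π s t) L (Q s) (l ↑ i) (l⁻ ↑ suc i) (M s)) ⟩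
    conv (suc n) (λ s t → (L * π s t - L * (π s t * Q s)) + (l ↑ i * π s t + l⁻ ↑ suc i * (π s t * M s)))
      ≡⟨ trans (conv-+ (suc n) (λ s t → L * π s t - L * (π s t * Q s)) (λ s t → l ↑ i * π s t + l⁻ ↑ suc i * (π s t * M s)))
           (cong₂ _+_ (trans (conv-- (suc n) (λ s t → L * π s t) (λ s t → L * (π s t * Q s)))
                        (cong₂ _-_ (conv-* (suc n) L π) (conv-* (suc n) L (λ s t → π s t * Q s))))
                      (trans (conv-+ (suc n) (λ s t → l ↑ i * π s t) (λ s t → l⁻ ↑ suc i * (π s t * M s)))
                        (cong₂ _+_ (conv-* (suc n) (l ↑ i) π) (conv-* (suc n) (l⁻ ↑ suc i) (λ s t → π s t * M s))))) ⟩
    (L * conv (suc n) π - L * conv (suc n) (λ s t → π s t * Q s)) + (l ↑ i * conv (suc n) π + l⁻ ↑ suc i * conv (suc n) (λ s t → π s t * M s))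
      ≤⟨ +-mono-≤ (+-mono-≤ (*-monoˡ 0≤L (π-total (suc n))) (neg-antimono-≤ (*-monoˡ 0≤L hit)))
                  (+-mono-≤ (*-monoˡ (0≤↑ (<⇒≤ 0<l) i) (π-total (suc n))) (*-monoˡ (0≤↑ 0≤l⁻ (suc i)) (π-moment (suc n)))) ⟩
    (L * 1ℚ - L * (δ * q ↑ i)) + (l ↑ i * 1ℚ + l⁻ ↑ suc i * D)
      ≡⟨ ring 5 (λ L x a b D → (L :* con 1ℚ :- L :* x) :+ (a :* con 1ℚ :+ b :* D) := L :* (con 1ℚ :- x) :+ a :+ D :* b) L (δ * q ↑ i) (l ↑ i) (l⁻ ↑ suc i) D ⟩
    L * (1ℚ - δ * q ↑ i) + l ↑ i + D * l⁻ ↑ suc i ∎) (super i)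
    where
    open ≤-Reasoning
    Q M : ℕ → ℚ
    Q s = q ↑ gap-after s i
    M s = l ↑ s * l ↑ s
    -- A jump of length 1 keeps the gap, as `gap-after 1 i` is `i`.
    hit : δ * q ↑ i ≤ conv (suc n) (λ s t → π s t * Q s)
    hit = ≤-trans (*-monoʳ (0≤↑ (<⇒≤ 0<q) i) (δ≤π n))
      (conv-term (suc n) {λ s t → π s t * Q s} (λ s t _ → 0≤* (0≤π s t) (0≤↑ (<⇒≤ 0<q) (gap-after s i))) 1 n refl)

  rate : ∀ r₁ → 0ℚ ≤ r₁ → r₁ < 1ℚ → ∃[ r ] r₁ ≤ r × 1ℚ - ε < r × 0ℚ ≤ r × r < 1ℚ
  rate r₁ 0≤r₁ r₁<1 = slower 0≤m m<1
    , ≤-trans (p≤p⊔q r₁ (1ℚ - ε)) (r≤slower 0≤m m<1)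
    , ≤-<-trans (p≤q⊔p r₁ (1ℚ - ε)) (by< (halve (gap< m<1)) (ring 1 (λ m → con ½ :* (con 1ℚ :+ m) := m :+ con ½ :* (con 1ℚ :- m)) m))
    , 0≤slower 0≤m m<1 , slower<1 0≤m m<1
    where
    m = r₁ ⊔ (1ℚ - ε)
    0≤m : 0ℚ ≤ m
    0≤m = ≤-trans 0≤r₁ (p≤p⊔q r₁ (1ℚ - ε))
    m<1 : m < 1ℚ
    m<1 = [ (λ e → subst (_< 1ℚ) (sym e) r₁<1)
          , (λ e → subst (_< 1ℚ) (sym e) (by< 0<ε (ring 1 (λ e → con 1ℚ := con 1ℚ :- e :+ e) ε))) ]′ (⊔-sel r₁ (1ℚ - ε))

  module Contraction (r : ℚ) (1-ε<r : 1ℚ - ε < r) (r≤1 : r ≤ 1ℚ) (0≤r : 0ℚ ≤ r)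
                     (y : ℕ → ℚ) (c : ℚ) (0≤c : 0ℚ ≤ c)
                     -- The second summand accounts for the missing probability, with which the
                     -- upper chain dies and leaves `y k` without a partner.
                     (source : ∀ n k → k ℕ.≤ n →
                       ∣ y (suc n) - conv (suc n) (λ s t → π s t * y t) ∣ + (1ℚ - conv (suc n) π) * ∣ y k ∣ ≤ c * r ↑ n)
    where

    -- The fixed point of the error recursion: `A * r` equals `A * (1ℚ - ε) + c`.
    A : ℚ
    A = c * (r - (1ℚ - ε)) ⁻¹

    0≤A : 0ℚ ≤ A
    0≤A = 0≤* 0≤c (0≤⁻¹ (gap< 1-ε<r))

    -- The gap `j` is measured from `n` and not from `e`. So the pairs with `e ≤ n` pass from `n` to
    -- `suc n` by `v-step` alone, and a jump has to be made only from the new argument `suc n`.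
    Bounded : ℕ → Set
    Bounded n = ∀ j a e → j ℕ.+ a ≡ n → a ℕ.≤ e → e ℕ.≤ n → ∣ y e - y a ∣ ≤ A * r ↑ n * v j

    0≤bound : ∀ n j → 0ℚ ≤ A * r ↑ n * v j
    0≤bound n j = 0≤* (0≤* 0≤A (0≤↑ 0≤r n)) (0≤v j)

    module Step (n : ℕ) (IH : Bounded n) where

      old : ∀ j a e → j ℕ.+ a ≡ n → a ℕ.≤ e → e ℕ.≤ n → ∣ y e - y a ∣ ≤ A * r ↑ suc n * v (suc j)
      old j a e j+a≡n a≤e e≤n = begin
        ∣ y e - y a ∣                  ≤⟨ IH j a e j+a≡n a≤e e≤n ⟩
        A * r ↑ n * v j                ≤⟨ *-monoˡ (0≤* 0≤A (0≤↑ 0≤r n)) (≤-trans (v-step j) (*-monoʳ (0≤v (suc j)) (<⇒≤ 1-ε<r))) ⟩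
        A * r ↑ n * (r * v (suc j))    ≡⟨ ring 4 (λ A x r v → A :* x :* (r :* v) := A :* (r :* x) :* v) A (r ↑ n) r (v (suc j)) ⟩
        A * r ↑ suc n * v (suc j)      ∎
        where open ≤-Reasoning

      near : ∀ i a → i ℕ.+ a ≡ n → ∀ s t → s ℕ.+ t ≡ suc n → ∣ π s t * (y t - y a) ∣ ≤ A * r ↑ n * (π s t * v (gap-after s i))
      near i a i+a≡n zero t _ = ≤-reflexive (trans (cong ∣_∣ (trans (cong (_* (y t - y a)) (π-moves t)) (*-zeroˡ (y t - y a))))
        (sym (trans (cong (λ z → A * r ↑ n * (z * v (gap-after 0 i))) (π-moves t)) (ring 2 (λ a v → a :* (con 0ℚ :* v) := con 0ℚ) (A * r ↑ n) (v (gap-after 0 i))))))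
      near i a i+a≡n (suc s) t s+t≡ = ≤-trans
        (∣*∣ {π (suc s) t} {y t - y a} (∣∣-self (0≤π (suc s) t)) ([ up , down ]′ (ℕ.≤-total a t)))
        (≤-reflexive (ring 3 (λ p A v → p :* (A :* v) := A :* (p :* v)) (π (suc s) t) (A * r ↑ n) (v (s ℕ.⊔ i))))
        where
        s+t≡n = ℕ.suc-injective s+t≡
        up : a ℕ.≤ t → ∣ y t - y a ∣ ≤ A * r ↑ n * v (s ℕ.⊔ i)
        up a≤t = ≤-trans (IH i a t i+a≡n a≤t (subst (t ℕ.≤_) s+t≡n (ℕ.m≤n+m t s)))
          (*-monoˡ (0≤* 0≤A (0≤↑ 0≤r n)) (v-mono (ℕ.m≤n⊔m s i)))
        down : t ℕ.≤ a → ∣ y t - y a ∣ ≤ A * r ↑ n * v (s ℕ.⊔ i)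
        down t≤a = ≤-trans (∣flip∣ {y a} {y t} (IH s t a s+t≡n t≤a (subst (a ℕ.≤_) i+a≡n (ℕ.m≤n+m a i))))
          (*-monoˡ (0≤* 0≤A (0≤↑ 0≤r n)) (v-mono (ℕ.m≤m⊔n s i)))

      new : ∀ i a → i ℕ.+ a ≡ n → ∣ y (suc n) - y a ∣ ≤ A * r ↑ suc n * v (suc i)
      new i a i+a≡n = begin
        ∣ y (suc n) - y a ∣
          ≡⟨ cong ∣_∣ split ⟩
        ∣ (y (suc n) - conv (suc n) (λ s t → π s t * y t)) + (conv (suc n) (λ s t → π s t * (y t - y a)) - (1ℚ - conv (suc n) π) * y a) ∣
          ≤⟨ ∣+∣ {y (suc n) - conv (suc n) (λ s t → π s t * y t)} ≤-refl
               (∣-∣ {conv (suc n) (λ s t → π s t * (y t - y a))} {(1ℚ - conv (suc n) π) * y a}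
                 (conv-abs (suc n) (near i a i+a≡n)) (∣*∣ {1ℚ - conv (suc n) π} {y a} (∣∣-self (gap (π-total (suc n)))) ≤-refl)) ⟩
        η + (conv (suc n) (λ s t → A * r ↑ n * (π s t * v (gap-after s i))) + (1ℚ - conv (suc n) π) * ∣ y a ∣)
          ≡⟨ ring 3 (λ a b c → a :+ (b :+ c) := b :+ (a :+ c)) η (conv (suc n) (λ s t → A * r ↑ n * (π s t * v (gap-after s i)))) _ ⟩
        conv (suc n) (λ s t → A * r ↑ n * (π s t * v (gap-after s i))) + (η + (1ℚ - conv (suc n) π) * ∣ y a ∣)
          ≤⟨ +-mono-≤ (≤-trans (≤-reflexive (conv-* (suc n) (A * r ↑ n) (λ s t → π s t * v (gap-after s i))))
                               (*-monoˡ (0≤* 0≤A (0≤↑ 0≤r n)) (drift n i)))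
                      (source n a (subst (a ℕ.≤_) i+a≡n (ℕ.m≤n+m a i))) ⟩
        A * r ↑ n * ((1ℚ - ε) * v (suc i)) + c * r ↑ n
          ≤⟨ +-monoʳ-≤ (A * r ↑ n * ((1ℚ - ε) * v (suc i))) (by (0≤* (0≤* 0≤c (0≤↑ 0≤r n)) (gap (1≤v (suc i))))
               (ring 3 (λ c r v → c :* r :* v := c :* r :+ c :* r :* (v :- con 1ℚ)) c (r ↑ n) (v (suc i)))) ⟩
        A * r ↑ n * ((1ℚ - ε) * v (suc i)) + c * r ↑ n * v (suc i)
          ≡⟨ cong (λ z → A * r ↑ n * ((1ℚ - ε) * v (suc i)) + z * r ↑ n * v (suc i)) (sym (/-cancel c (gap< 1-ε<r))) ⟩
        A * r ↑ n * ((1ℚ - ε) * v (suc i)) + (r - (1ℚ - ε)) * A * r ↑ n * v (suc i)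
          ≡⟨ ring 5 (λ A x e v r → A :* x :* (e :* v) :+ (r :- e) :* A :* x :* v := A :* (r :* x) :* v) A (r ↑ n) (1ℚ - ε) (v (suc i)) r ⟩
        A * r ↑ suc n * v (suc i) ∎
        where
        open ≤-Reasoning
        η = ∣ y (suc n) - conv (suc n) (λ s t → π s t * y t) ∣
        split : y (suc n) - y a ≡ (y (suc n) - conv (suc n) (λ s t → π s t * y t)) + (conv (suc n) (λ s t → π s t * (y t - y a)) - (1ℚ - conv (suc n) π) * y a)
        split = sym (trans
          (cong (λ z → (y (suc n) - conv (suc n) (λ s t → π s t * y t)) + (z - (1ℚ - conv (suc n) π) * y a))
            (trans (conv-cong (suc n) (λ s t _ → ring 3 (λ p y a → p :* (y :- a) := p :* y :- p :* a) (π s t) (y t) (y a)))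
              (trans (conv-- (suc n) (λ s t → π s t * y t) (λ s t → π s t * y a))
                (cong (λ z → conv (suc n) (λ s t → π s t * y t) - z) (conv-*ʳ (suc n) (y a) π)))))
          (ring 4 (λ Y C P a → (Y :- C) :+ ((C :- P :* a) :- (con 1ℚ :- P) :* a) := Y :- a) (y (suc n)) _ (conv (suc n) π) (y a)))

      step : Bounded (suc n)
      step zero    a e refl a≤e e≤n = subst (λ z → ∣ y z - y a ∣ ≤ A * r ↑ suc n * v 0) (ℕ.≤-antisym a≤e e≤n)
        (≤-trans (∣refl∣ (y a)) (0≤bound (suc n) 0))
      step (suc j) a e j+a≡ a≤e e≤n = [ (λ e<n → old j a e (ℕ.suc-injective j+a≡) a≤e (ℕ.s≤s⁻¹ e<n))
        , (λ e≡ → subst (λ z → ∣ y z - y a ∣ ≤ A * r ↑ suc n * v (suc j)) (sym e≡) (new j a (ℕ.suc-injective j+a≡))) ]′ (ℕ.m≤n⇒m<n∨m≡n e≤n)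

    bounded : ∀ n → Bounded n
    bounded zero    j zero zero _ _ _ = ≤-trans (∣refl∣ (y 0)) (0≤bound 0 j)
    bounded (suc n) = Step.step n (bounded n)

    oscillation : ∀ s t → ∣ y (s ℕ.+ t) - y t ∣ ≤ A * (L + 1ℚ) * r ↑ (s ℕ.+ t) * l ↑ s
    oscillation s t = ≤-trans (bounded (s ℕ.+ t) s t (s ℕ.+ t) refl (ℕ.m≤n+m t s) ℕ.≤-refl)
      (≤-trans (*-monoˡ (0≤* 0≤A (0≤↑ 0≤r (s ℕ.+ t))) (v≤ s))
        (≤-reflexive (ring 4 (λ A r L l → A :* r :* (L :* l) := A :* L :* r :* l) A (r ↑ (s ℕ.+ t)) (L + 1ℚ) (l ↑ s))))

-- Renewal sequences

-- Blocks of length 1 alone would only make `M` nondecreasing; the positive weight at a second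
-- length `suc (suc L′)` makes it grow exponentially.
record Renewal : Set where
  field
    b e M   : ℕ → ℚ
    0≤b     : ∀ s → 0ℚ ≤ b s
    b0      : b 0 ≡ 0ℚ
    b1      : b 1 ≡ 1ℚ
    B       : ℚ
    b≤B     : ∀ s → b s ≤ B
    0≤e     : ∀ n → 0ℚ ≤ e n
    e≤B     : ∀ n → e n ≤ B
    e0      : e 0 ≡ 1ℚ
    M-rec   : ∀ n → M n ≡ conv n (λ s t → b s * M t) + e n
    L′      : ℕ
    β       : ℚ
    0<β     : 0ℚ < β
    β≤1     : β ≤ 1ℚ
    β≤b     : β ≤ b (suc (suc L′))

-- By convexity: on [0 , 1] the power lies below the chord through its values at 0 and 1.
↑-upper : ∀ {t} → 0ℚ ≤ t → t ≤ 1ℚ → ∀ k → (1ℚ + t) ↑ k ≤ 1ℚ + (ι 2 ↑ k - 1ℚ) * t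
↑-upper {t} 0≤t t≤1 zero    = ≤-reflexive (ring 1 (λ t → con 1ℚ := con 1ℚ :+ (con 1ℚ :- con 1ℚ) :* t) t)
↑-upper {t} 0≤t t≤1 (suc k) = ≤-trans (*-monoˡ (0≤-+ 0≤1 0≤t) (↑-upper 0≤t t≤1 k))
  (by (0≤* (0≤* (gap (1≤↑ {ι 2} 1≤2 k)) 0≤t) (gap t≤1))
    (trans (cong (λ z → 1ℚ + (z * ι 2 ↑ k - 1ℚ) * t) (ι-suc 1))
      (ring 2 (λ t x → con 1ℚ :+ ((con 1ℚ :+ con 1ℚ) :* x :- con 1ℚ) :* t := (con 1ℚ :+ t) :* (con 1ℚ :+ (x :- con 1ℚ) :* t) :+ (x :- con 1ℚ) :* t :* (con 1ℚ :- t)) t (ι 2 ↑ k))))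
  where
  1≤2 : 1ℚ ≤ ι 2
  1≤2 = ι-mono {1} {2} (ℕ.s≤s ℕ.z≤n)

module Mixing (ℛ : Renewal) where
  open Renewal ℛ public

  L : ℕ
  L = suc (suc L′)

  0≤B : 0ℚ ≤ B
  0≤B = ≤-trans (0≤b 0) (b≤B 0)

  M-nonneg : ∀ n m → m ℕ.≤ n → 0ℚ ≤ M m
  M-rec₁ : ∀ n → M (suc n) ≡ conv n (λ s t → b (suc s) * M t) + e (suc n)
  M-rec₁ n = trans (M-rec (suc n)) (cong (_+ e (suc n))
    (trans (cong (_+ conv n (λ s t → b (suc s) * M t)) (trans (cong (_* M (suc n)) b0) (*-zeroˡ (M (suc n)))))
      (+-identityˡ (conv n (λ s t → b (suc s) * M t)))))

  M-nonneg n zero m≤n = subst (0ℚ ≤_) (sym (trans (M-rec 0) (trans (cong (λ z → z * M 0 + e 0) b0) (trans (cong (_+ e 0) (*-zeroˡ (M 0))) (+-identityˡ (e 0)))))) (0≤e 0)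
  M-nonneg (suc n) (suc m) m≤n = subst (0ℚ ≤_) (sym (M-rec₁ m)) (0≤-+
    (0≤conv m λ s t s+t≡m → 0≤* (0≤b (suc s)) (M-nonneg n t (ℕ.≤-trans (subst (t ℕ.≤_) s+t≡m (ℕ.m≤n+m t s)) (ℕ.s≤s⁻¹ m≤n))))
    (0≤e (suc m)))

  0≤M : ∀ n → 0ℚ ≤ M n
  0≤M n = M-nonneg n n ℕ.≤-refl

  M0 : M 0 ≡ 1ℚ
  M0 = trans (M-rec 0) (trans (cong₂ _+_ (trans (cong (_* M 0) b0) (*-zeroˡ (M 0))) e0) (+-identityˡ 1ℚ))

  M-suc : ∀ n → M n ≤ M (suc n)
  M-suc n = begin
    M n                                                ≡⟨ sym (trans (cong (_* M n) b1) (*-identityˡ (M n))) ⟩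
    b 1 * M n                                          ≤⟨ conv-term n {λ s t → b (suc s) * M t} (λ s t _ → 0≤* (0≤b (suc s)) (0≤M t)) 0 n refl ⟩
    conv n (λ s t → b (suc s) * M t)                   ≤⟨ p≤p+q (0≤e (suc n)) ⟩
    conv n (λ s t → b (suc s) * M t) + e (suc n)       ≡⟨ sym (M-rec₁ n) ⟩
    M (suc n)                                          ∎
    where open ≤-Reasoning

  M-mono : ∀ s t → M t ≤ M (s ℕ.+ t)
  M-mono zero    t = ≤-refl
  M-mono (suc s) t = ≤-trans (M-mono s t) (M-suc (s ℕ.+ t))

  1≤M : ∀ n → 1ℚ ≤ M n
  1≤M n = subst₂ _≤_ M0 (cong M (ℕ.+-identityʳ n)) (M-mono n 0)

  0<M : ∀ n → 0ℚ < M n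
  0<M n = <-≤-trans 0<1 (1≤M n)

  -- `M` does not decrease, because of the blocks of length 1 and weight 1; a first block of length
  -- `L` contributes another `β * M n`.
  M-growth : ∀ n → (1ℚ + β) * M n ≤ M (L ℕ.+ n)
  M-growth n = begin
    (1ℚ + β) * M n
      ≡⟨ ring 2 (λ b m → (con 1ℚ :+ b) :* m := m :+ b :* m) β (M n) ⟩
    M n + β * M n
      ≤⟨ +-mono-≤ (≤-trans (M-mono (suc L′) n) (≤-reflexive (sym (trans (cong (_* M (suc L′ ℕ.+ n)) b1) (*-identityˡ (M (suc L′ ℕ.+ n)))))))
                  (≤-trans (*-monoʳ (0≤M n) β≤b)
                    (conv-term (L′ ℕ.+ n) {λ s t → b (suc (suc s)) * M t} (λ s t _ → 0≤* (0≤b (suc (suc s))) (0≤M t)) L′ n refl)) ⟩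
    b 1 * M (suc L′ ℕ.+ n) + conv (L′ ℕ.+ n) (λ s t → b (suc (suc s)) * M t)
      ≤⟨ p≤p+q (0≤e (L ℕ.+ n)) ⟩
    conv (suc L′ ℕ.+ n) (λ s t → b (suc s) * M t) + e (L ℕ.+ n)
      ≡⟨ sym (M-rec₁ (suc L′ ℕ.+ n)) ⟩
    M (L ℕ.+ n) ∎
    where open ≤-Reasoning

  k₀ : ℕ
  k₀ = L ℕ.* 8

  -- Chosen such that l ↑ 8L ≤ 1 + β; the eighth power leaves room for moments.
  t₀ l γ : ℚ
  t₀ = β * ½ ↑ k₀
  l  = 1ℚ + t₀
  γ  = l ↑ 8

  0<t₀ : 0ℚ < t₀
  0<t₀ = 0<* 0<β (0<↑ (positive⁻¹ ½) k₀)

  t₀≤1 : t₀ ≤ 1ℚ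
  t₀≤1 = ≤-trans (*-mono-≤ (0≤↑ (<⇒≤ (positive⁻¹ ½)) k₀) 0≤1 β≤1 (↑≤1 (<⇒≤ (positive⁻¹ ½)) ½≤1 k₀)) (≤-reflexive (*-identityˡ 1ℚ))
    where
    ½≤1 : ½ ≤ 1ℚ
    ½≤1 = p≤p+q {½} {½} (<⇒≤ (positive⁻¹ ½))

  1<l : 1ℚ < l
  1<l = by< 0<t₀ refl

  1≤l : 1ℚ ≤ l
  1≤l = <⇒≤ 1<l

  0<l : 0ℚ < l
  0<l = <-≤-trans 0<1 1≤l

  0≤l : 0ℚ ≤ l
  0≤l = <⇒≤ 0<l

  0<γ : 0ℚ < γ
  0<γ = 0<↑ 0<l 8

  1≤γ : 1ℚ ≤ γ
  1≤γ = 1≤↑ 1≤l 8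

  γ↑L≤ : γ ↑ L ≤ 1ℚ + β
  γ↑L≤ = begin
    γ ↑ L                                ≡⟨ sym (↑-* l L 8) ⟩
    l ↑ k₀                               ≤⟨ ↑-upper (<⇒≤ 0<t₀) t₀≤1 k₀ ⟩
    1ℚ + (ι 2 ↑ k₀ - 1ℚ) * t₀            ≤⟨ by (<⇒≤ 0<t₀) (ring 2 (λ x t → con 1ℚ :+ x :* t := con 1ℚ :+ (x :- con 1ℚ) :* t :+ t) (ι 2 ↑ k₀) t₀) ⟩
    1ℚ + ι 2 ↑ k₀ * t₀                   ≡⟨ cong (1ℚ +_) (ring 3 (λ x b h → x :* (b :* h) := b :* (x :* h)) (ι 2 ↑ k₀) β (½ ↑ k₀)) ⟩
    1ℚ + β * (ι 2 ↑ k₀ * ½ ↑ k₀)         ≡⟨ cong (λ z → 1ℚ + β * z) (trans (sym (↑-distrib (ι 2) ½ k₀)) (1↑ k₀)) ⟩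
    1ℚ + β * 1ℚ                          ≡⟨ cong (1ℚ +_) (*-identityʳ β) ⟩
    1ℚ + β                               ∎
    where open ≤-Reasoning

  -- Lengths `L` are stripped off while `s` is at least `L`: each costs `γ ↑ L ≤ 1ℚ + β`, which
  -- `M-growth` pays. What is left of `s` costs at most the constant `γ ↑ L`. The fuel `f` bounds
  -- `s`.
  γ-growth : ∀ f s t → s ℕ.≤ f → γ ↑ s * M t ≤ γ ↑ L * M (s ℕ.+ t)
  γ-growth f s t s≤f = [ large f s≤f , small ]′ (ℕ.≤-total L s)
    where
    open ≤-Reasoning
    small : s ℕ.≤ L → γ ↑ s * M t ≤ γ ↑ L * M (s ℕ.+ t)
    small s≤L = *-mono-≤ (0≤M t) (0≤↑ (<⇒≤ 0<γ) L) (↑-mono-exp 1≤γ s≤L) (M-mono s t)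
    large : ∀ f → s ℕ.≤ f → L ℕ.≤ s → γ ↑ s * M t ≤ γ ↑ L * M (s ℕ.+ t)
    large zero    s≤0 L≤s = contradiction (ℕ.≤-trans L≤s s≤0) λ ()
    large (suc f) s≤f L≤s = begin
      γ ↑ s * M t                          ≡⟨ cong (λ z → γ ↑ z * M t) (sym (ℕ.m+[n∸m]≡n L≤s)) ⟩
      γ ↑ (L ℕ.+ s′) * M t                 ≡⟨ trans (cong (_* M t) (↑-+ γ L s′)) (*-assoc (γ ↑ L) (γ ↑ s′) (M t)) ⟩
      γ ↑ L * (γ ↑ s′ * M t)               ≤⟨ *-monoˡ (0≤↑ (<⇒≤ 0<γ) L) (γ-growth f s′ t s′≤f) ⟩
      γ ↑ L * (γ ↑ L * M (s′ ℕ.+ t))       ≤⟨ *-monoˡ (0≤↑ (<⇒≤ 0<γ) L) (≤-trans (*-monoʳ (0≤M (s′ ℕ.+ t)) γ↑L≤) (M-growth (s′ ℕ.+ t))) ⟩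
      γ ↑ L * M (L ℕ.+ (s′ ℕ.+ t))         ≡⟨ cong (λ z → γ ↑ L * M z) (trans (sym (ℕ.+-assoc L s′ t)) (cong (ℕ._+ t) (ℕ.m+[n∸m]≡n L≤s))) ⟩
      γ ↑ L * M (s ℕ.+ t)                  ∎
      where
      s′ = s ℕ.∸ L
      s′≤f : s′ ℕ.≤ f
      s′≤f = ℕ.s≤s⁻¹ (ℕ.<-≤-trans (ℕ.∸-monoʳ-< (ℕ.s≤s ℕ.z≤n) L≤s) s≤f)

  Γ : ℚ
  Γ = γ ↑ L

  0≤Γ : 0ℚ ≤ Γ
  0≤Γ = 0≤↑ (<⇒≤ 0<γ) L

  growth : ∀ s t → γ ↑ s * M t ≤ Γ * M (s ℕ.+ t)
  growth s t = γ-growth s s t ℕ.≤-refl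

  γ↑≤M : ∀ n → γ ↑ n ≤ Γ * M n
  γ↑≤M n = subst₂ _≤_ (trans (cong (γ ↑ n *_) M0) (*-identityʳ (γ ↑ n))) (cong (λ z → Γ * M z) (ℕ.+-identityʳ n)) (growth n 0)

  W : ℕ → ℚ
  W n = M n ⁻¹

  0≤W : ∀ n → 0ℚ ≤ W n
  0≤W n = 0≤⁻¹ (0<M n)

  γ⁻ : ℚ
  γ⁻ = γ ⁻¹

  0≤γ⁻ : 0ℚ ≤ γ⁻
  0≤γ⁻ = 0≤⁻¹ 0<γ

  1<γ : 1ℚ < γ
  1<γ = <-≤-trans 1<l (≤-trans (≤-reflexive (sym (*-identityʳ l))) (*-monoˡ 0≤l (1≤↑ 1≤l 7)))

  inverse<1 : ∀ {x} → 1ℚ < x → x ⁻¹ < 1ℚ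
  inverse<1 {x} 1<x = subst₂ _<_ (*-identityʳ (x ⁻¹)) (trans (*-comm (x ⁻¹) x) (*-⁻¹ 0<x)) (*-monoʳ-<-pos (x ⁻¹) {{positive (⁻¹-pos 0<x)}} 1<x)
    where 0<x = <-trans 0<1 1<x

  ⁻¹↑*↑ : ∀ {x} → 0ℚ < x → ∀ n → x ⁻¹ ↑ n * x ↑ n ≡ 1ℚ
  ⁻¹↑*↑ {x} 0<x n = trans (sym (↑-distrib (x ⁻¹) x n)) (trans (cong (_↑ n) (trans (*-comm (x ⁻¹) x) (*-⁻¹ 0<x))) (1↑ n))

  W-decay : ∀ n → W n ≤ Γ * γ⁻ ↑ n
  W-decay n = subst (_≤ Γ * γ⁻ ↑ n) (*-identityˡ (W n)) (/≤ {Γ * γ⁻ ↑ n} {1ℚ} (0<M n)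
    (subst₂ _≤_ (⁻¹↑*↑ 0<γ n) (ring 3 (λ i g m → i :* (g :* m) := g :* i :* m) (γ⁻ ↑ n) Γ (M n)) (*-monoˡ (0≤↑ 0≤γ⁻ n) (γ↑≤M n))))

  -- Given the total length s + t, the probability that the first block has length `s`. The missing
  -- mass is that of a last block, see `killed`.
  π : ℕ → ℕ → ℚ
  π s t = b s * M t * W (s ℕ.+ t)

  0≤π : ∀ s t → 0ℚ ≤ π s t
  0≤π s t = 0≤* (0≤* (0≤b s) (0≤M t)) (0≤W (s ℕ.+ t))

  π-sum : ∀ n (f : ℕ → ℚ) → conv n (λ s t → π s t * f t) ≡ W n * conv n (λ s t → b s * (M t * f t))
  π-sum n f = trans (conv-cong n λ s t s+t≡n → trans (cong (λ z → b s * M t * W z * f t) s+t≡n)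
    (ring 4 (λ b M W f → b :* M :* W :* f := W :* (b :* (M :* f))) (b s) (M t) (W n) (f t)))
    (conv-* n (W n) (λ s t → b s * (M t * f t)))

  killed : ∀ n → 1ℚ - conv n π ≡ e n * W n
  killed n = begin
    1ℚ - conv n π
      ≡⟨ cong (λ z → 1ℚ - z) (trans (conv-cong n λ s t s+t≡n → trans (cong (λ z → b s * M t * W z) s+t≡n) (*-comm (b s * M t) (W n))) (conv-* n (W n) (λ s t → b s * M t))) ⟩
    1ℚ - W n * conv n (λ s t → b s * M t)
      ≡⟨ cong (_- W n * conv n (λ s t → b s * M t)) (sym (*-⁻¹ (0<M n))) ⟩
    M n * W n - W n * conv n (λ s t → b s * M t)
      ≡⟨ cong (λ z → z * W n - W n * conv n (λ s t → b s * M t)) (M-rec n) ⟩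
    (conv n (λ s t → b s * M t) + e n) * W n - W n * conv n (λ s t → b s * M t)
      ≡⟨ ring 3 (λ c e w → (c :+ e) :* w :- w :* c := e :* w) (conv n (λ s t → b s * M t)) (e n) (W n) ⟩
    e n * W n ∎
    where open ≡-Reasoning

  0≤killed : ∀ n → 0ℚ ≤ e n * W n
  0≤killed n = 0≤* (0≤e n) (0≤W n)

  π-total : ∀ n → conv n π ≤ 1ℚ
  π-total n = by (0≤killed n) (trans (ring 1 (λ c → con 1ℚ := c :+ (con 1ℚ :- c)) (conv n π)) (cong (conv n π +_) (killed n)))

  ratio : ∀ s t → γ ↑ s * (M t * W (s ℕ.+ t)) ≤ Γ
  ratio s t = subst (_≤ Γ) (*-assoc (γ ↑ s) (M t) (W (s ℕ.+ t))) (/≤ (0<M (s ℕ.+ t)) (growth s t))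

  π-tail : ∀ s t → π s t * γ ↑ s ≤ B * Γ
  π-tail s t = ≤-trans (≤-reflexive (ring 4 (λ b M W g → b :* M :* W :* g := b :* (g :* (M :* W))) (b s) (M t) (W (s ℕ.+ t)) (γ ↑ s)))
    (*-mono-≤ (0≤* (0≤↑ (<⇒≤ 0<γ) s) (0≤* (0≤M t) (0≤W (s ℕ.+ t)))) 0≤B (b≤B s) (ratio s t))

  w : ℕ → ℚ
  w s = l ↑ s

  0≤w : ∀ s → 0ℚ ≤ w s
  0≤w s = 0≤↑ 0≤l s

  1≤w : ∀ s → 1ℚ ≤ w s
  1≤w s = 1≤↑ 1≤l s

  κ⁻ : ℚ
  κ⁻ = (l ↑ 4) ⁻¹

  0<l⁴ : 0ℚ < l ↑ 4
  0<l⁴ = 0<↑ 0<l 4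

  1<l⁴ : 1ℚ < l ↑ 4
  1<l⁴ = <-≤-trans 1<l (≤-trans (≤-reflexive (sym (*-identityʳ l))) (*-monoˡ 0≤l (1≤↑ 1≤l 3)))

  D : ℚ
  D = B * Γ * (1ℚ - κ⁻) ⁻¹

  w⁴ : ℕ → ℚ
  w⁴ s = w s * w s * (w s * w s)

  l⁴↑ : ∀ s → (l ↑ 4) ↑ s ≡ w⁴ s
  l⁴↑ s = trans (sym (↑-* l s 4)) (trans (cong (l ↑_) (ℕ.*-comm s 4)) (trans (↑-* l 4 s)
    (ring 1 (λ x → x :* (x :* (x :* (x :* con 1ℚ))) := x :* x :* (x :* x)) (w s))))

  -- By `π-tail` the product of `π s t` and `γ ↑ s`, the power 8s of `l`, is bounded. The weight
  -- `w⁴ s` uses up half of this exponent and leaves the geometric factor `κ⁻ ↑ s`.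
  moment : ∀ n → conv n (λ s t → π s t * w⁴ s) ≤ D
  moment n = ≤-trans (conv-mono n λ s t _ → bound s t)
    (≤-trans (≤-reflexive (conv-* n (B * Γ) (λ s _ → κ⁻ ↑ s)))
      (*-monoˡ (0≤* 0≤B 0≤Γ) (conv-geometric-≤ (0≤⁻¹ 0<l⁴) (inverse<1 1<l⁴) n)))
    where
    open ≤-Reasoning
    γ-split : ∀ s → γ ↑ s ≡ (l ↑ 4) ↑ s * (l ↑ 4) ↑ s
    γ-split s = trans (cong (_↑ s) (↑-+ l 4 4)) (↑-distrib (l ↑ 4) (l ↑ 4) s)
    bound : ∀ s t → π s t * w⁴ s ≤ B * Γ * κ⁻ ↑ s
    bound s t = begin
      π s t * w⁴ s                                         ≡⟨ cong (π s t *_) (sym (l⁴↑ s)) ⟩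
      π s t * (l ↑ 4) ↑ s                                  ≡⟨ sym (*-identityʳ _) ⟩
      π s t * (l ↑ 4) ↑ s * 1ℚ                             ≡⟨ cong (π s t * (l ↑ 4) ↑ s *_) (sym (⁻¹↑*↑ 0<l⁴ s)) ⟩
      π s t * (l ↑ 4) ↑ s * (κ⁻ ↑ s * (l ↑ 4) ↑ s)         ≡⟨ ring 3 (λ p x k → p :* x :* (k :* x) := p :* (x :* x) :* k) (π s t) ((l ↑ 4) ↑ s) (κ⁻ ↑ s) ⟩
      π s t * ((l ↑ 4) ↑ s * (l ↑ 4) ↑ s) * κ⁻ ↑ s         ≡⟨ cong (λ z → π s t * z * κ⁻ ↑ s) (sym (γ-split s)) ⟩
      π s t * γ ↑ s * κ⁻ ↑ s                               ≤⟨ *-monoʳ (0≤↑ (0≤⁻¹ 0<l⁴) s) (π-tail s t) ⟩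
      B * Γ * κ⁻ ↑ s                                       ∎

  0≤D : 0ℚ ≤ D
  0≤D = 0≤* (0≤* 0≤B 0≤Γ) (0≤⁻¹ (gap< (inverse<1 1<l⁴)))

  R₀ : ℚ
  R₀ = B * Γ * (1ℚ - γ⁻) ⁻¹ + (1ℚ + B)

  0<R₀ : 0ℚ < R₀
  0<R₀ = <-≤-trans (0<-+ 0<1 0≤B) (p≤q+p (0≤* (0≤* 0≤B 0≤Γ) (0≤⁻¹ (gap< (inverse<1 1<γ)))))

  -- In the renewal equation `growth` bounds `M t` by `Γ * M n * γ⁻ ↑ s`, a geometric series. The
  -- result bounds the probability of a block of length 1 from below.
  M-ratio : ∀ t → M (suc t) ≤ R₀ * M t
  M-ratio n = begin
    M (suc n)
      ≡⟨ M-rec₁ n ⟩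
    conv n (λ s t → b (suc s) * M t) + e (suc n)
      ≤⟨ +-mono-≤ (conv-mono n step) (e≤B (suc n)) ⟩
    conv n (λ s t → B * Γ * M n * γ⁻ ↑ s) + B
      ≤⟨ +-mono-≤ (≤-trans (≤-reflexive (conv-* n (B * Γ * M n) (λ s _ → γ⁻ ↑ s)))
                           (*-monoˡ (0≤* (0≤* 0≤B 0≤Γ) (0≤M n)) (conv-geometric-≤ 0≤γ⁻ (inverse<1 1<γ) n)))
                  (p≤q+p 0≤1) ⟩
    B * Γ * M n * (1ℚ - γ⁻) ⁻¹ + (1ℚ + B)
      ≤⟨ by (0≤* (0≤-+ 0≤1 0≤B) (gap (1≤M n)))
           (ring 4 (λ G i B m → (G :* i :+ (con 1ℚ :+ B)) :* m := G :* m :* i :+ (con 1ℚ :+ B) :+ (con 1ℚ :+ B) :* (m :- con 1ℚ)) (B * Γ) ((1ℚ - γ⁻) ⁻¹) B (M n)) ⟩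
    R₀ * M n ∎
    where
    open ≤-Reasoning
    step : ∀ s t → s ℕ.+ t ≡ n → b (suc s) * M t ≤ B * Γ * M n * γ⁻ ↑ s
    step s t s+t≡n = begin
      b (suc s) * M t                              ≤⟨ *-monoʳ (0≤M t) (b≤B (suc s)) ⟩
      B * M t                                      ≡⟨ sym (*-identityʳ (B * M t)) ⟩
      B * M t * 1ℚ                                 ≡⟨ cong (B * M t *_) (sym (⁻¹↑*↑ 0<γ s)) ⟩
      B * M t * (γ⁻ ↑ s * γ ↑ s)                   ≡⟨ ring 4 (λ B m i g → B :* m :* (i :* g) := B :* i :* (g :* m)) B (M t) (γ⁻ ↑ s) (γ ↑ s) ⟩
      B * γ⁻ ↑ s * (γ ↑ s * M t)                   ≤⟨ *-monoˡ (0≤* 0≤B (0≤↑ 0≤γ⁻ s)) (growth s t) ⟩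
      B * γ⁻ ↑ s * (Γ * M (s ℕ.+ t))               ≡⟨ cong (λ z → B * γ⁻ ↑ s * (Γ * M z)) s+t≡n ⟩
      B * γ⁻ ↑ s * (Γ * M n)                       ≡⟨ ring 4 (λ B i G m → B :* i :* (G :* m) := B :* G :* m :* i) B (γ⁻ ↑ s) Γ (M n) ⟩
      B * Γ * M n * γ⁻ ↑ s                         ∎

  δ : ℚ
  δ = R₀ ⁻¹

  0<δ : 0ℚ < δ
  0<δ = ⁻¹-pos 0<R₀

  δ≤ratio : ∀ t → δ ≤ M t * W (suc t)
  δ≤ratio t = ≤/ (0<M (suc t)) (≤-trans (*-monoˡ (<⇒≤ 0<δ) (M-ratio t))
    (≤-reflexive (trans (ring 3 (λ d r m → d :* (r :* m) := r :* d :* m) δ R₀ (M t)) (trans (cong (_* M t) (*-⁻¹ 0<R₀)) (*-identityˡ (M t))))))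

  δ≤π : ∀ t → δ ≤ π 1 t
  δ≤π t = ≤-trans (δ≤ratio t) (≤-reflexive (cong (_* W (suc t)) (sym (trans (cong (_* M t) b1) (*-identityˡ (M t))))))

  1≤w² : ∀ s → 1ℚ ≤ w s * w s
  1≤w² s = ≤-trans (≤-reflexive (sym (*-identityˡ 1ℚ))) (*-mono-≤ 0≤1 (0≤w s) (1≤w s) (1≤w s))

  moment₂ : ∀ n → conv n (λ s t → π s t * (w s * w s)) ≤ D
  moment₂ n = ≤-trans (conv-mono n λ s t _ → *-monoˡ (0≤π s t)
    (subst (_≤ w⁴ s) (*-identityʳ (w s * w s)) (*-monoˡ (0≤sq (w s)) (1≤w² s)))) (moment n)

  chain : Chain
  chain = record
    { π = π ; 0≤π = 0≤π ; π-moves = λ t → trans (cong (λ z → z * M t * W t) b0) (ring 2 (λ m w → con 0ℚ :* m :* w := con 0ℚ) (M t) (W t))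
    ; π-total = π-total ; δ = δ ; 0<δ = 0<δ ; δ≤π = δ≤π ; l = l ; 1<l = 1<l ; D = D ; π-moment = moment₂ }

  private
    module Q = Coupling chain

  -- Geometrically small oscillation, up to the factor w s = l ↑ s.
  Settles : (ℕ → ℚ) → Set
  Settles y = ∃[ A ] ∃[ r ] 0ℚ ≤ A × 0ℚ ≤ r × r < 1ℚ × (∀ s t → ∣ y (s ℕ.+ t) - y t ∣ ≤ A * r ↑ (s ℕ.+ t) * w s)

  Source : (ℕ → ℚ) → (ℕ → ℚ) → Set
  Source y bound = ∀ n k → k ℕ.≤ n →
    ∣ y (suc n) - conv (suc n) (λ s t → π s t * y t) ∣ + (1ℚ - conv (suc n) π) * ∣ y k ∣ ≤ bound n

  settles : ∀ y c r₁ → 0ℚ ≤ c → 0ℚ ≤ r₁ → r₁ < 1ℚ → Source y (λ n → c * r₁ ↑ n) → Settles y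
  settles y c r₁ 0≤c 0≤r₁ r₁<1 source =
    let r , r₁≤r , 1-ε<r , 0≤r , r<1 = Q.rate r₁ 0≤r₁ r₁<1
        source′ : Source y (λ n → c * r ↑ n)
        source′ n k k≤n = ≤-trans (source n k k≤n) (*-monoˡ 0≤c (↑-mono 0≤r₁ r₁≤r n))
    in Q.Contraction.A r 1-ε<r (<⇒≤ r<1) 0≤r y c 0≤c source′ * (Q.L + 1ℚ) , r
       , 0≤* (Q.Contraction.0≤A r 1-ε<r (<⇒≤ r<1) 0≤r y c 0≤c source′) (<⇒≤ Q.0<L+1) , 0≤r , r<1
       , Q.Contraction.oscillation r 1-ε<r (<⇒≤ r<1) 0≤r y c 0≤c source′

  -- The ratio of consecutive masses, with M (-1) read as 0. Its limit is the inverse of the growth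
  -- rate of `M`.
  R : ℕ → ℚ
  R zero    = 0ℚ
  R (suc n) = M n * W (suc n)

  0≤R : ∀ n → 0ℚ ≤ R n
  0≤R zero    = ≤-refl
  0≤R (suc n) = 0≤* (0≤M n) (0≤W (suc n))

  R≤1 : ∀ n → R n ≤ 1ℚ
  R≤1 zero    = 0≤1
  R≤1 (suc n) = /≤ {1ℚ} {M n} (0<M (suc n)) (subst (M n ≤_) (sym (*-identityˡ (M (suc n)))) (M-suc n))

  -- As `M t * R t` is M (t - 1), the sum over the blocks is the renewal equation at `n`, from which
  -- only the last blocks `e n` are missing.
  R-harmonic : ∀ n → R (suc n) - conv (suc n) (λ s t → π s t * R t) ≡ e n * W (suc n)
  R-harmonic n = begin
    M n * W (suc n) - conv (suc n) (λ s t → π s t * R t)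
      ≡⟨ cong (λ z → M n * W (suc n) - z) (trans (π-sum (suc n) R) (cong (W (suc n) *_) inner)) ⟩
    M n * W (suc n) - W (suc n) * (M n - e n)
      ≡⟨ ring 3 (λ m w e → m :* w :- w :* (m :- e) := e :* w) (M n) (W (suc n)) (e n) ⟩
    e n * W (suc n) ∎
    where
    open ≡-Reasoning
    cancel : ∀ t → M (suc t) * R (suc t) ≡ M t
    cancel t = trans (ring 3 (λ m m′ w → m′ :* (m :* w) := m′ :* w :* m) (M t) (M (suc t)) (W (suc t)))
      (trans (cong (_* M t) (*-⁻¹ (0<M (suc t)))) (*-identityˡ (M t)))
    inner : conv (suc n) (λ s t → b s * (M t * R t)) ≡ M n - e n
    inner = begin
      conv (suc n) (λ s t → b s * (M t * R t))
        ≡⟨ conv-snoc n (λ s t → b s * (M t * R t)) ⟩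
      conv n (λ s t → b s * (M (suc t) * R (suc t))) + b (suc n) * (M 0 * 0ℚ)
        ≡⟨ cong₂ _+_ (conv-cong n λ s t _ → cong (b s *_) (cancel t)) (ring 2 (λ b m → b :* (m :* con 0ℚ) := con 0ℚ) (b (suc n)) (M 0)) ⟩
      conv n (λ s t → b s * M t) + 0ℚ
        ≡⟨ ring 2 (λ c e → c :+ con 0ℚ := c :+ e :- e) (conv n (λ s t → b s * M t)) (e n) ⟩
      conv n (λ s t → b s * M t) + e n - e n
        ≡⟨ cong (_- e n) (sym (M-rec n)) ⟩
      M n - e n ∎

  γ⁻<1 : γ⁻ < 1ℚ
  γ⁻<1 = inverse<1 1<γ

  0≤BΓ : 0ℚ ≤ B * Γ
  0≤BΓ = 0≤* 0≤B 0≤Γ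

  W-decay′ : ∀ n {x} → 0ℚ ≤ x → x ≤ B → x * W (suc n) ≤ B * Γ * γ⁻ ↑ n
  W-decay′ n 0≤x x≤B = ≤-trans (*-mono-≤ (0≤W (suc n)) 0≤B x≤B (W-decay (suc n)))
    (≤-trans (≤-reflexive (sym (*-assoc B Γ (γ⁻ ↑ suc n)))) (*-monoˡ 0≤BΓ (↑-anti-exp 0≤γ⁻ (<⇒≤ γ⁻<1) (ℕ.n≤1+n n))))

  killed≤ : ∀ n → 1ℚ - conv (suc n) π ≤ B * Γ * γ⁻ ↑ n
  killed≤ n = ≤-trans (≤-reflexive (killed (suc n))) (W-decay′ n (0≤e (suc n)) (e≤B (suc n)))

  abstract
    R-settles : Settles R
    R-settles = settles R (B * Γ + B * Γ) γ⁻ (0≤-+ 0≤BΓ 0≤BΓ) 0≤γ⁻ γ⁻<1 λ n k _ →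
      ≤-trans (+-mono-≤
        (≤-trans (≤-reflexive (trans (cong ∣_∣ (R-harmonic n)) (0≤p⇒∣p∣≡p (0≤* (0≤e n) (0≤W (suc n)))))) (W-decay′ n (0≤e n) (e≤B n)))
        (≤-trans (*-mono-≤ (0≤∣p∣ (R k)) (0≤* 0≤BΓ (0≤↑ 0≤γ⁻ n)) (killed≤ n) (∣≥0∣ (0≤R k) (R≤1 k))) (≤-reflexive (*-identityʳ (B * Γ * γ⁻ ↑ n)))))
        (≤-reflexive (sym (*-distribʳ-+ (γ⁻ ↑ n) (B * Γ) (B * Γ))))

  ρ : ℕ → ℕ → ℚ
  ρ s t = M t * W (s ℕ.+ t)

  0≤ρ : ∀ s t → 0ℚ ≤ ρ s t
  0≤ρ s t = 0≤* (0≤M t) (0≤W (s ℕ.+ t))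

  -- The quotient of `ρ s t` by `ρ s (suc t)` is that of `R (suc t)` by `R (s ℕ.+ suc t)`, so this
  -- is the relative change of `ρ`; the second factor is the inverse of `R (s ℕ.+ suc t)`.
  ξ : ℕ → ℕ → ℚ
  ξ s t = (R (s ℕ.+ suc t) - R (suc t)) * (M (suc (s ℕ.+ t)) * W (s ℕ.+ t))

  ρ-diff : ∀ s t → ρ s (suc t) - ρ s t ≡ ρ s (suc t) * ξ s t
  ρ-diff s t = sym (begin
    M (suc t) * W (s ℕ.+ suc t) * ((R (s ℕ.+ suc t) - M t * W (suc t)) * (M′ * W (s ℕ.+ t)))
      ≡⟨ cong (λ z → M (suc t) * W z * ((R z - M t * W (suc t)) * (M′ * W (s ℕ.+ t)))) (ℕ.+-suc s t) ⟩
    M (suc t) * W (suc (s ℕ.+ t)) * ((M (s ℕ.+ t) * W (suc (s ℕ.+ t)) - M t * W (suc t)) * (M′ * W (s ℕ.+ t)))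
      ≡⟨ ring 7 (λ m₁ w₃ m₂ m w₁ m₃ w₂ → m₁ :* w₃ :* ((m₂ :* w₃ :- m :* w₁) :* (m₃ :* w₂)) := m₁ :* w₃ :* (m₂ :* w₂) :* (m₃ :* w₃) :- (m₁ :* w₁) :* (m₃ :* w₃) :* (m :* w₂))
           (M (suc t)) (W (suc (s ℕ.+ t))) (M (s ℕ.+ t)) (M t) (W (suc t)) M′ (W (s ℕ.+ t)) ⟩
    M (suc t) * W (suc (s ℕ.+ t)) * (M (s ℕ.+ t) * W (s ℕ.+ t)) * (M′ * W (suc (s ℕ.+ t))) - (M (suc t) * W (suc t)) * (M′ * W (suc (s ℕ.+ t))) * (M t * W (s ℕ.+ t))
      ≡⟨ cong₂ _-_
           (cong₂ (λ x y → M (suc t) * W (suc (s ℕ.+ t)) * x * y) (*-⁻¹ (0<M (s ℕ.+ t))) (*-⁻¹ (0<M (suc (s ℕ.+ t)))))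
           (cong₂ (λ x y → x * y * (M t * W (s ℕ.+ t))) (*-⁻¹ (0<M (suc t))) (*-⁻¹ (0<M (suc (s ℕ.+ t))))) ⟩
    M (suc t) * W (suc (s ℕ.+ t)) * 1ℚ * 1ℚ - 1ℚ * 1ℚ * (M t * W (s ℕ.+ t))
      ≡⟨ ring 2 (λ a b → a :* con 1ℚ :* con 1ℚ :- con 1ℚ :* con 1ℚ :* b := a :- b) (M (suc t) * W (suc (s ℕ.+ t))) (M t * W (s ℕ.+ t)) ⟩
    M (suc t) * W (suc (s ℕ.+ t)) - M t * W (s ℕ.+ t)
      ≡⟨ cong (λ z → M (suc t) * W z - M t * W (s ℕ.+ t)) (sym (ℕ.+-suc s t)) ⟩
    ρ s (suc t) - ρ s t ∎)
    where
    open ≡-Reasoning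
    M′ = M (suc (s ℕ.+ t))

  Aᴿ rᴿ κ : ℚ
  Aᴿ = proj₁ R-settles
  rᴿ = proj₁ (proj₂ R-settles)
  κ  = Aᴿ * R₀

  0≤Aᴿ : 0ℚ ≤ Aᴿ
  0≤Aᴿ = proj₁ (proj₂ (proj₂ R-settles))
  0≤rᴿ : 0ℚ ≤ rᴿ
  0≤rᴿ = proj₁ (proj₂ (proj₂ (proj₂ R-settles)))
  rᴿ<1 : rᴿ < 1ℚ
  rᴿ<1 = proj₁ (proj₂ (proj₂ (proj₂ (proj₂ R-settles))))
  0≤κ : 0ℚ ≤ κ
  0≤κ = 0≤* 0≤Aᴿ (<⇒≤ 0<R₀)

  ξ-bound : ∀ s t → ∣ ξ s t ∣ ≤ κ * rᴿ ↑ (s ℕ.+ t) * w s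
  ξ-bound s t = begin
    ∣ ξ s t ∣
      ≤⟨ ∣*∣ {R (s ℕ.+ suc t) - R (suc t)} {M (suc (s ℕ.+ t)) * W (s ℕ.+ t)}
           (proj₂ (proj₂ (proj₂ (proj₂ (proj₂ R-settles)))) s (suc t))
           (∣≥0∣ (0≤* (0≤M (suc (s ℕ.+ t))) (0≤W (s ℕ.+ t))) (/≤ (0<M (s ℕ.+ t)) (M-ratio (s ℕ.+ t)))) ⟩
    Aᴿ * rᴿ ↑ (s ℕ.+ suc t) * w s * R₀
      ≤⟨ *-monoʳ (<⇒≤ 0<R₀) (*-monoʳ (0≤w s) (*-monoˡ 0≤Aᴿ (↑-anti-exp 0≤rᴿ (<⇒≤ rᴿ<1) (ℕ.+-monoʳ-≤ s (ℕ.n≤1+n t))))) ⟩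
    Aᴿ * rᴿ ↑ (s ℕ.+ t) * w s * R₀
      ≡⟨ ring 4 (λ a r w d → a :* r :* w :* d := a :* d :* r :* w) Aᴿ (rᴿ ↑ (s ℕ.+ t)) (w s) R₀ ⟩
    κ * rᴿ ↑ (s ℕ.+ t) * w s ∎
    where open ≤-Reasoning

  π-diff : ∀ s t → ∣ π s (suc t) - π s t ∣ ≤ κ * rᴿ ↑ (s ℕ.+ t) * (π s (suc t) * w s)
  π-diff s t = begin
    ∣ π s (suc t) - π s t ∣
      ≡⟨ cong ∣_∣ (trans (ring 5 (λ b m w m′ w′ → b :* m :* w :- b :* m′ :* w′ := b :* (m :* w :- m′ :* w′)) (b s) (M (suc t)) (W (s ℕ.+ suc t)) (M t) (W (s ℕ.+ t)))
           (trans (cong (b s *_) (ρ-diff s t)) (ring 4 (λ b m w x → b :* (m :* w :* x) := b :* m :* w :* x) (b s) (M (suc t)) (W (s ℕ.+ suc t)) (ξ s t)))) ⟩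
    ∣ π s (suc t) * ξ s t ∣
      ≤⟨ ∣*∣ {π s (suc t)} {ξ s t} (∣∣-self (0≤π s (suc t))) (ξ-bound s t) ⟩
    π s (suc t) * (κ * rᴿ ↑ (s ℕ.+ t) * w s)
      ≡⟨ ring 3 (λ p k w → p :* (k :* w) := k :* (p :* w)) (π s (suc t)) (κ * rᴿ ↑ (s ℕ.+ t)) (w s) ⟩
    κ * rᴿ ↑ (s ℕ.+ t) * (π s (suc t) * w s) ∎
    where open ≤-Reasoning

  p : ℕ → ℚ
  p n = ι (suc n)

  0≤p : ∀ n → 0ℚ ≤ p n
  0≤p n = 0≤ι (suc n)

  1≤p : ∀ n → 1ℚ ≤ p n
  1≤p n = ι-mono {1} {suc n} (ℕ.s≤s ℕ.z≤n)

  p-mono : ∀ {m n} → m ℕ.≤ n → p m ≤ p n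
  p-mono m≤n = ι-mono (ℕ.s≤s m≤n)

  π-w≤D : ∀ n → conv n (λ s t → π s t * w s) ≤ D
  π-w≤D n = ≤-trans (conv-mono n λ s t _ → *-monoˡ (0≤π s t) (subst (_≤ w s * w s) (*-identityʳ (w s)) (*-monoˡ (0≤w s) (1≤w s)))) (moment₂ n)

  ⊔<1 : ∀ {x y} → x < 1ℚ → y < 1ℚ → x ⊔ y < 1ℚ
  ⊔<1 {x} {y} x<1 y<1 = [ (λ e → subst (_< 1ℚ) (sym e) x<1) , (λ e → subst (_< 1ℚ) (sym e) y<1) ]′ (⊔-sel x y)

  absorb² : ∀ r → 0ℚ ≤ r → r < 1ℚ → ∃[ C ] ∃[ r′ ] 0ℚ ≤ C × 0ℚ ≤ r′ × r′ < 1ℚ × r ≤ r′ × (∀ n → p n * p n * r ↑ n ≤ C * r′ ↑ n)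
  absorb² r 0≤r r<1 = C₁ * C₂ , r₂ , 0≤* (<⇒≤ 0<C₁) (<⇒≤ 0<C₂) , 0≤slower 0≤r₁ r₁<1 , slower<1 0≤r₁ r₁<1
    , ≤-trans (r≤slower 0≤r r<1) (r≤slower 0≤r₁ r₁<1) , λ n → begin
      p n * p n * r ↑ n            ≡⟨ *-assoc (p n) (p n) (r ↑ n) ⟩
      p n * (p n * r ↑ n)          ≤⟨ *-monoˡ (0≤p n) (absorb 0≤r r<1 n) ⟩
      p n * (C₁ * r₁ ↑ n)          ≡⟨ ring 3 (λ p c r → p :* (c :* r) := c :* (p :* r)) (p n) C₁ (r₁ ↑ n) ⟩
      C₁ * (p n * r₁ ↑ n)          ≤⟨ *-monoˡ (<⇒≤ 0<C₁) (absorb 0≤r₁ r₁<1 n) ⟩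
      C₁ * (C₂ * r₂ ↑ n)           ≡⟨ sym (*-assoc C₁ C₂ (r₂ ↑ n)) ⟩
      C₁ * C₂ * r₂ ↑ n             ∎
    where
    open ≤-Reasoning
    r₁ = slower 0≤r r<1
    0≤r₁ = 0≤slower 0≤r r<1
    r₁<1 = slower<1 0≤r r<1
    r₂ = slower 0≤r₁ r₁<1
    C₁ = (1ℚ - r₁) ⁻¹
    C₂ = (1ℚ - r₂) ⁻¹
    0<C₁ = ⁻¹-pos (gap< r₁<1)
    0<C₂ = ⁻¹-pos (gap< (slower<1 0≤r₁ r₁<1))

  -- The value 0 at 0 removes the term with `t = 0` from the recursion for the increments.
  Δ : (ℕ → ℚ) → ℕ → ℚ
  Δ y zero    = 0ℚ
  Δ y (suc n) = y (suc n) - y n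

  -- Subtracting the recursions for `y n` and `y (suc n)` term by term leaves a recursion for `Δ y`
  -- with the same `π`. The errors are differences of `π`, `τ` and `f` and the boundary terms at
  -- `t = 0`; all are exponentially small, also when multiplied by the quadratic a priori bound on
  -- `y`.
  module Increments (y : ℕ → ℚ) (τ : ℕ → ℕ → ℚ) (f : ℕ → ℚ)
    (y-rec : ∀ n → y n ≡ conv n (λ s t → π s t * y t + τ s t) + f n)
    (c₁ r₁ Y : ℚ) (0≤c₁ : 0ℚ ≤ c₁) (0≤r₁ : 0ℚ ≤ r₁) (r₁<1 : r₁ < 1ℚ) (0≤Y : 0ℚ ≤ Y)
    (τ-diff : ∀ n → ∣ conv n (λ s t → τ s (suc t) - τ s t) ∣ ≤ c₁ * r₁ ↑ n)
    (τ-last : ∀ n → ∣ τ (suc n) 0 ∣ ≤ c₁ * r₁ ↑ n)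
    (f-small : ∀ n → ∣ f n ∣ ≤ c₁ * r₁ ↑ n)
    (y≤ : ∀ n → ∣ y n ∣ ≤ Y * (p n * p n))
    where

    error : ∀ n → Δ y (suc n) - conv (suc n) (λ s t → π s t * Δ y t) ≡
      (f (suc n) - f n) + conv n (λ s t → τ s (suc t) - τ s t) + (τ (suc n) 0 + (conv n (λ s t → (π s (suc t) - π s t) * y t) + π (suc n) 0 * y 0))
    error n = begin
      y (suc n) - y n - conv (suc n) (λ s t → π s t * Δ y t)
        ≡⟨ cong₂ (λ u v → u - v - conv (suc n) (λ s t → π s t * Δ y t))
             (trans (y-rec (suc n)) (cong (_+ f (suc n)) (conv-snoc n (λ s t → π s t * y t + τ s t)))) (y-rec n) ⟩
      conv n (λ s t → π s (suc t) * y (suc t) + τ s (suc t)) + (π (suc n) 0 * y 0 + τ (suc n) 0) + f (suc n) - (conv n (λ s t → π s t * y t + τ s t) + f n) - conv (suc n) (λ s t → π s t * Δ y t)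
        ≡⟨ cong₂ (λ u v → u + (π (suc n) 0 * y 0 + τ (suc n) 0) + f (suc n) - (conv n (λ s t → π s t * y t + τ s t) + f n) - v)
             expand (trans (conv-snoc n (λ s t → π s t * Δ y t)) (cong (E +_) (*-zeroʳ (π (suc n) 0)))) ⟩
      A + Bᵉ + (E + Cᵉ) + (π (suc n) 0 * y 0 + τ (suc n) 0) + f (suc n) - (A + f n) - (E + 0ℚ)
        ≡⟨ ring 8 (λ A B E C x t f f′ → A :+ B :+ (E :+ C) :+ (x :+ t) :+ f′ :- (A :+ f) :- (E :+ con 0ℚ) := (f′ :- f) :+ B :+ (t :+ (C :+ x)))
             A Bᵉ E Cᵉ (π (suc n) 0 * y 0) (τ (suc n) 0) (f n) (f (suc n)) ⟩
      (f (suc n) - f n) + Bᵉ + (τ (suc n) 0 + (Cᵉ + π (suc n) 0 * y 0)) ∎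
      where
      open ≡-Reasoning
      A  = conv n (λ s t → π s t * y t + τ s t)
      Bᵉ = conv n (λ s t → τ s (suc t) - τ s t)
      Cᵉ = conv n (λ s t → (π s (suc t) - π s t) * y t)
      E  = conv n (λ s t → π s (suc t) * (y (suc t) - y t))
      expand : conv n (λ s t → π s (suc t) * y (suc t) + τ s (suc t)) ≡ A + Bᵉ + (E + Cᵉ)
      expand = trans (conv-cong n λ s t _ → ring 6 (λ p y t p′ y′ t′ → p′ :* y′ :+ t′ := (p :* y :+ t) :+ (t′ :- t) :+ (p′ :* (y′ :- y) :+ (p′ :- p) :* y))
          (π s t) (y t) (τ s t) (π s (suc t)) (y (suc t)) (τ s (suc t)))
        (trans (conv-+ n (λ s t → (π s t * y t + τ s t) + (τ s (suc t) - τ s t)) (λ s t → π s (suc t) * (y (suc t) - y t) + (π s (suc t) - π s t) * y t))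
          (cong₂ _+_ (conv-+ n (λ s t → π s t * y t + τ s t) (λ s t → τ s (suc t) - τ s t))
                     (conv-+ n (λ s t → π s (suc t) * (y (suc t) - y t)) (λ s t → (π s (suc t) - π s t) * y t))))

    r₂ : ℚ
    r₂ = r₁ ⊔ (rᴿ ⊔ γ⁻)

    r₁≤r₂ : r₁ ≤ r₂
    r₁≤r₂ = p≤p⊔q r₁ (rᴿ ⊔ γ⁻)

    rᴿ≤r₂ : rᴿ ≤ r₂
    rᴿ≤r₂ = ≤-trans (p≤p⊔q rᴿ γ⁻) (p≤q⊔p r₁ (rᴿ ⊔ γ⁻))

    γ⁻≤r₂ : γ⁻ ≤ r₂
    γ⁻≤r₂ = ≤-trans (p≤q⊔p rᴿ γ⁻) (p≤q⊔p r₁ (rᴿ ⊔ γ⁻))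

    r₂<1 : r₂ < 1ℚ
    r₂<1 = ⊔<1 r₁<1 (⊔<1 rᴿ<1 γ⁻<1)

    0≤r₂ : 0ℚ ≤ r₂
    0≤r₂ = ≤-trans 0≤r₁ r₁≤r₂

    Z : ℚ
    Z = c₁ + c₁ + c₁ + (c₁ + (κ * D * Y + B * Γ * Y)) + B * Γ * (Y + Y)

    0≤Z : 0ℚ ≤ Z
    0≤Z = 0≤-+ (0≤-+ (0≤-+ (0≤-+ 0≤c₁ 0≤c₁) 0≤c₁) (0≤-+ 0≤c₁ (0≤-+ (0≤* (0≤* 0≤κ 0≤D) 0≤Y) (0≤* 0≤BΓ 0≤Y)))) (0≤* 0≤BΓ (0≤-+ 0≤Y 0≤Y))

    P : ℕ → ℚ
    P n = p n * p n * r₂ ↑ n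

    1≤p² : ∀ n → 1ℚ ≤ p n * p n
    1≤p² n = ≤-trans (≤-reflexive (sym (*-identityˡ 1ℚ))) (*-mono-≤ 0≤1 (0≤p n) (1≤p n) (1≤p n))

    p²-mono : ∀ {m n} → m ℕ.≤ n → p m * p m ≤ p n * p n
    p²-mono {m} {n} m≤n = *-mono-≤ (0≤p m) (0≤p n) (p-mono m≤n) (p-mono m≤n)

    0≤r₂↑ : ∀ n → 0ℚ ≤ r₂ ↑ n
    0≤r₂↑ = 0≤↑ 0≤r₂

    r₂≤P : ∀ n → r₂ ↑ n ≤ P n
    r₂≤P n = subst (_≤ P n) (*-identityˡ (r₂ ↑ n)) (*-monoʳ (0≤r₂↑ n) (1≤p² n))

    upgrade : ∀ {c r} n → 0ℚ ≤ c → 0ℚ ≤ r → r ≤ r₂ → c * r ↑ n ≤ c * P n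
    upgrade n 0≤c 0≤r r≤ = *-monoˡ 0≤c (≤-trans (↑-mono 0≤r r≤ n) (r₂≤P n))

    π-shift : ∀ n → ∣ conv n (λ s t → (π s (suc t) - π s t) * y t) ∣ ≤ κ * D * Y * P n
    π-shift n = begin
      ∣ conv n (λ s t → (π s (suc t) - π s t) * y t) ∣
        ≤⟨ conv-abs n (λ s t s+t≡n → ≤-trans (∣*∣ {π s (suc t) - π s t} {y t} (π-diff s t) (≤-trans (y≤ t) (*-monoˡ 0≤Y (p²-mono (subst (t ℕ.≤_) s+t≡n (ℕ.m≤n+m t s))))))
             (≤-reflexive (trans (cong (λ z → κ * rᴿ ↑ z * (π s (suc t) * w s) * (Y * (p n * p n))) s+t≡n)
               (ring 4 (λ k r x Y → k :* r :* x :* Y := k :* r :* Y :* x) κ (rᴿ ↑ n) (π s (suc t) * w s) (Y * (p n * p n)))))) ⟩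
      conv n (λ s t → κ * rᴿ ↑ n * (Y * (p n * p n)) * (π s (suc t) * w s))
        ≡⟨ conv-* n (κ * rᴿ ↑ n * (Y * (p n * p n))) (λ s t → π s (suc t) * w s) ⟩
      κ * rᴿ ↑ n * (Y * (p n * p n)) * conv n (λ s t → π s (suc t) * w s)
        ≤⟨ *-mono-≤ (0≤conv n λ s t _ → 0≤* (0≤π s (suc t)) (0≤w s)) (0≤* (0≤* 0≤κ (0≤r₂↑ n)) (0≤* 0≤Y (0≤sq (p n))))
             (*-monoʳ (0≤* 0≤Y (0≤sq (p n))) (*-monoˡ 0≤κ (↑-mono 0≤rᴿ rᴿ≤r₂ n)))
             (≤-trans (≤-trans (p≤p+q (0≤* (0≤π (suc n) 0) (0≤w (suc n)))) (≤-reflexive (sym (conv-snoc n (λ s t → π s t * w s))))) (π-w≤D (suc n))) ⟩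
      κ * r₂ ↑ n * (Y * (p n * p n)) * D
        ≡⟨ ring 5 (λ k r Y q D → k :* r :* (Y :* q) :* D := k :* D :* Y :* (q :* r)) κ (r₂ ↑ n) Y (p n * p n) D ⟩
      κ * D * Y * P n ∎
      where open ≤-Reasoning

    π-last : ∀ n → ∣ π (suc n) 0 * y 0 ∣ ≤ B * Γ * Y * P n
    π-last n = ≤-trans (∣*∣ {π (suc n) 0} {y 0} (∣∣-self (0≤π (suc n) 0)) (y≤ 0)) (begin
      π (suc n) 0 * (Y * (p 0 * p 0))
        ≤⟨ *-mono-≤ (0≤* 0≤Y (0≤sq (p 0))) (0≤* 0≤BΓ (0≤↑ 0≤γ⁻ n))
             (≤-trans (≤-reflexive (trans (cong (λ z → b (suc n) * z * W (suc n ℕ.+ 0)) M0) (cong₂ _*_ (*-identityʳ (b (suc n))) (cong W (ℕ.+-identityʳ (suc n))))))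
               (W-decay′ n (0≤b (suc n)) (b≤B (suc n)))) (*-monoˡ 0≤Y (p²-mono {0} {n} ℕ.z≤n)) ⟩
      B * Γ * γ⁻ ↑ n * (Y * (p n * p n))
        ≤⟨ *-monoʳ (0≤* 0≤Y (0≤sq (p n))) (*-monoˡ 0≤BΓ (↑-mono 0≤γ⁻ γ⁻≤r₂ n)) ⟩
      B * Γ * r₂ ↑ n * (Y * (p n * p n))
        ≡⟨ ring 4 (λ b r Y q → b :* r :* (Y :* q) := b :* Y :* (q :* r)) (B * Γ) (r₂ ↑ n) Y (p n * p n) ⟩
      B * Γ * Y * P n ∎)
      where open ≤-Reasoning

    Δ≤ : ∀ n k → k ℕ.≤ n → ∣ Δ y k ∣ ≤ (Y + Y) * (p n * p n)
    Δ≤ n zero    _   = 0≤* (0≤-+ 0≤Y 0≤Y) (0≤sq (p n))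
    Δ≤ n (suc k) k<n = ≤-trans (∣-∣ {y (suc k)} {y k} (≤-trans (y≤ (suc k)) (*-monoˡ 0≤Y (p²-mono k<n)))
                                     (≤-trans (y≤ k) (*-monoˡ 0≤Y (p²-mono (ℕ.≤-trans (ℕ.n≤1+n k) k<n)))))
      (≤-reflexive (sym (*-distribʳ-+ (p n * p n) Y Y)))

    source : Source (Δ y) (λ n → Z * P n)
    source n k k≤n = begin
      ∣ Δ y (suc n) - conv (suc n) (λ s t → π s t * Δ y t) ∣ + (1ℚ - conv (suc n) π) * ∣ Δ y k ∣
        ≤⟨ +-mono-≤
             (≤-trans (≤-reflexive (cong ∣_∣ (error n)))
               (∣+∣ {f (suc n) - f n + conv n (λ s t → τ s (suc t) - τ s t)}
                 (∣+∣ {f (suc n) - f n}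
                   (∣-∣ {f (suc n)} {f n} (≤-trans (f-small (suc n)) (*-monoˡ 0≤c₁ (↑-anti-exp 0≤r₁ (<⇒≤ r₁<1) (ℕ.n≤1+n n)))) (f-small n))
                   (τ-diff n))
                 (∣+∣ {τ (suc n) 0} (τ-last n)
                   (∣+∣ {conv n (λ s t → (π s (suc t) - π s t) * y t)} (π-shift n) (π-last n)))))
             (*-mono-≤ (0≤∣p∣ (Δ y k)) (0≤* 0≤BΓ (0≤↑ 0≤γ⁻ n)) (killed≤ n) (Δ≤ n k k≤n)) ⟩
      c₁ * r₁ ↑ n + c₁ * r₁ ↑ n + c₁ * r₁ ↑ n + (c₁ * r₁ ↑ n + (κ * D * Y * P n + B * Γ * Y * P n)) + B * Γ * γ⁻ ↑ n * ((Y + Y) * (p n * p n))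
        ≤⟨ +-mono-≤ (+-mono-≤ (+-mono-≤ (+-mono-≤ u u) u) (+-monoˡ-≤ (κ * D * Y * P n + B * Γ * Y * P n) u))
             (*-monoʳ (0≤* (0≤-+ 0≤Y 0≤Y) (0≤sq (p n))) (*-monoˡ 0≤BΓ (↑-mono 0≤γ⁻ γ⁻≤r₂ n))) ⟩
      c₁ * P n + c₁ * P n + c₁ * P n + (c₁ * P n + (κ * D * Y * P n + B * Γ * Y * P n)) + B * Γ * r₂ ↑ n * ((Y + Y) * (p n * p n))
        ≡⟨ ring 6 (λ c k g Y q r → c :* (q :* r) :+ c :* (q :* r) :+ c :* (q :* r) :+ (c :* (q :* r) :+ (k :* Y :* (q :* r) :+ g :* Y :* (q :* r))) :+ g :* r :* ((Y :+ Y) :* q) := (c :+ c :+ c :+ (c :+ (k :* Y :+ g :* Y)) :+ g :* (Y :+ Y)) :* (q :* r)) c₁ (κ * D) (B * Γ) Y (p n * p n) (r₂ ↑ n) ⟩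
      Z * P n ∎
      where
      open ≤-Reasoning
      u : c₁ * r₁ ↑ n ≤ c₁ * P n
      u = upgrade n 0≤c₁ 0≤r₁ r₁≤r₂

    Δ-settles : Settles (Δ y)
    Δ-settles =
      let C , r , 0≤C , 0≤r , r<1 , _ , h = absorb² r₂ 0≤r₂ r₂<1
      in settles (Δ y) (Z * C) r (0≤* 0≤Z 0≤C) 0≤r r<1 λ n k k≤n → ≤-trans (source n k k≤n)
           (≤-trans (*-monoˡ 0≤Z (h n)) (≤-reflexive (sym (*-assoc Z C (r ↑ n)))))

  module Settled (y : ℕ → ℚ) (st : Settles (Δ y)) where

    A r : ℚ
    A = proj₁ st
    r = proj₁ (proj₂ st)

    0≤A : 0ℚ ≤ A
    0≤A = proj₁ (proj₂ (proj₂ st))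
    0≤r : 0ℚ ≤ r
    0≤r = proj₁ (proj₂ (proj₂ (proj₂ st)))
    r<1 : r < 1ℚ
    r<1 = proj₁ (proj₂ (proj₂ (proj₂ (proj₂ st))))

    Δ-osc : ∀ s t → ∣ Δ y (s ℕ.+ t) - Δ y t ∣ ≤ A * r ↑ (s ℕ.+ t) * w s
    Δ-osc = proj₂ (proj₂ (proj₂ (proj₂ (proj₂ st))))

    -- `A * l * r ↑ t` equals `A′ * (r ↑ t - r ↑ suc t)`, so the bounds for single steps of `Δ y`
    -- telescope. Another factor `i` sums the resulting deviations of `y` from a line.
    i A′ : ℚ
    i  = (1ℚ - r) ⁻¹
    A′ = A * l * i

    0≤i : 0ℚ ≤ i
    0≤i = 0≤⁻¹ (gap< r<1)

    0≤A′ : 0ℚ ≤ A′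
    0≤A′ = 0≤* (0≤* 0≤A 0≤l) 0≤i

    telescope : ∀ c n → c * r ↑ n ≡ c * i * (r ↑ n - r ↑ suc n)
    telescope c n = sym (trans (ring 4 (λ c i x r → c :* i :* (x :- r :* x) := c :* x :* ((con 1ℚ :- r) :* i)) c i (r ↑ n) r)
      (trans (cong (c * r ↑ n *_) (*-⁻¹ (gap< r<1))) (*-identityʳ (c * r ↑ n))))

    Δ-step : ∀ t → ∣ Δ y (suc t) - Δ y t ∣ ≤ A′ * (r ↑ t - r ↑ suc t)
    Δ-step t = begin
      ∣ Δ y (suc t) - Δ y t ∣          ≤⟨ Δ-osc 1 t ⟩
      A * r ↑ suc t * (l * 1ℚ)         ≡⟨ ring 3 (λ a r l → a :* r :* (l :* con 1ℚ) := a :* l :* r) A (r ↑ suc t) l ⟩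
      A * l * r ↑ suc t                ≤⟨ *-monoˡ (0≤* 0≤A 0≤l) (↑-anti-exp 0≤r (<⇒≤ r<1) (ℕ.n≤1+n t)) ⟩
      A * l * r ↑ t                    ≡⟨ telescope (A * l) t ⟩
      A′ * (r ↑ t - r ↑ suc t)         ∎
      where open ≤-Reasoning

    Δ-close : ∀ s t → ∣ Δ y (s ℕ.+ t) - Δ y t ∣ ≤ A′ * (r ↑ t - r ↑ (s ℕ.+ t))
    Δ-close zero    t = ≤-trans (∣refl∣ (Δ y t)) (≤-reflexive (ring 2 (λ a r → con 0ℚ := a :* (r :- r)) A′ (r ↑ t)))
    Δ-close (suc s) t = ≤-trans (∣sum∣ {Δ y (suc s ℕ.+ t)} {Δ y (s ℕ.+ t)} (Δ-step (s ℕ.+ t)) (Δ-close s t))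
      (≤-reflexive (ring 4 (λ a x y z → a :* (x :- y) :+ a :* (z :- x) := a :* (z :- y)) A′ (r ↑ (s ℕ.+ t)) (r ↑ suc (s ℕ.+ t)) (r ↑ t)))

    Δ-cauchy : ∀ {t k} → t ℕ.≤ k → ∣ Δ y k - Δ y t ∣ ≤ A′ * r ↑ t
    Δ-cauchy {t} {k} t≤k = subst (λ z → ∣ Δ y z - Δ y t ∣ ≤ A′ * r ↑ t) (ℕ.m∸n+n≡m t≤k)
      (≤-trans (Δ-close (k ℕ.∸ t) t) (by (0≤* 0≤A′ (0≤↑ 0≤r (k ℕ.∸ t ℕ.+ t)))
        (ring 3 (λ a x z → a :* x := a :* (x :- z) :+ a :* z) A′ (r ↑ t) (r ↑ (k ℕ.∸ t ℕ.+ t)))))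

    Δ-bounded : ∀ k → ∣ Δ y k ∣ ≤ A′
    Δ-bounded k = ≤-trans (≤-reflexive (cong ∣_∣ (ring 1 (λ x → x := x :- con 0ℚ) (Δ y k))))
      (≤-trans (Δ-cauchy {0} {k} ℕ.z≤n) (≤-reflexive (*-identityʳ A′)))

    lipschitz : ∀ s t → ∣ y (s ℕ.+ t) - y t ∣ ≤ A′ * ι s
    lipschitz zero    t = ≤-trans (∣refl∣ (y t)) (≤-reflexive (sym (*-zeroʳ A′)))
    lipschitz (suc s) t = ≤-trans (∣sum∣ {y (suc s ℕ.+ t)} {y (s ℕ.+ t)} (Δ-bounded (suc s ℕ.+ t)) (lipschitz s t))
      (≤-reflexive (trans (ring 2 (λ a s → a :+ a :* s := a :* (con 1ℚ :+ s)) A′ (ι s)) (cong (A′ *_) (sym (ι-suc s)))))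

    slope-error : ∀ n k → n ℕ.≤ k → ∣ y n - y 0 - ι n * Δ y k ∣ ≤ A′ * i * (1ℚ - r ↑ n)
    slope-error zero    k _   = ≤-trans (≤-reflexive (cong ∣_∣ (ring 2 (λ y d → y :- y :- con 0ℚ :* d := con 0ℚ) (y 0) (Δ y k))))
      (≤-reflexive (ring 1 (λ a → con 0ℚ := a :* (con 1ℚ :- con 1ℚ)) (A′ * i)))
    slope-error (suc n) k n<k = begin
      ∣ y (suc n) - y 0 - ι (suc n) * Δ y k ∣
        ≡⟨ cong ∣_∣ (trans (cong (λ z → y (suc n) - y 0 - z * Δ y k) (ι-suc n))
             (ring 5 (λ a b c n d → a :- b :- (con 1ℚ :+ n) :* d := (c :- b :- n :* d) :+ (a :- c :- d)) (y (suc n)) (y 0) (y n) (ι n) (Δ y k))) ⟩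
      ∣ (y n - y 0 - ι n * Δ y k) + (Δ y (suc n) - Δ y k) ∣
        ≤⟨ ∣+∣ {y n - y 0 - ι n * Δ y k} (slope-error n k (ℕ.≤-trans (ℕ.n≤1+n n) n<k)) (∣flip∣ {Δ y k} {Δ y (suc n)} (Δ-cauchy n<k)) ⟩
      A′ * i * (1ℚ - r ↑ n) + A′ * r ↑ suc n
        ≤⟨ +-monoʳ-≤ (A′ * i * (1ℚ - r ↑ n)) (≤-trans (*-monoˡ 0≤A′ (↑-anti-exp 0≤r (<⇒≤ r<1) (ℕ.n≤1+n n))) (≤-reflexive (telescope A′ n))) ⟩
      A′ * i * (1ℚ - r ↑ n) + A′ * i * (r ↑ n - r ↑ suc n)
        ≡⟨ ring 3 (λ a x z → a :* (con 1ℚ :- x) :+ a :* (x :- z) := a :* (con 1ℚ :- z)) (A′ * i) (r ↑ n) (r ↑ suc n) ⟩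
      A′ * i * (1ℚ - r ↑ suc n) ∎
      where open ≤-Reasoning

    slope : ℝ
    approx slope = Δ y
    cauchy slope ε 0<ε =
      let N , h = ↑-eventually-≤ 0≤r r<1 0≤A′ (½ * ε) (halve 0<ε)
      in N , λ j k N≤j N≤k → ≤-trans (∣sum∣ {Δ y j} {Δ y N} (≤-trans (Δ-cauchy N≤j) (h N ℕ.≤-refl))
           (∣flip∣ {Δ y k} {Δ y N} (≤-trans (Δ-cauchy N≤k) (h N ℕ.≤-refl)))) (≤-reflexive (½+½ ε))

    slope-O[1] : ∀ n k → n ℕ.≤ k → ∣ y n - Δ y k * ι n ∣ ≤ ∣ y 0 ∣ + A′ * i
    slope-O[1] n k n≤k = begin
      ∣ y n - Δ y k * ι n ∣                       ≡⟨ cong ∣_∣ (ring 4 (λ y y₀ d n → y :- d :* n := y₀ :+ (y :- y₀ :- n :* d)) (y n) (y 0) (Δ y k) (ι n)) ⟩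
      ∣ y 0 + (y n - y 0 - ι n * Δ y k) ∣         ≤⟨ ∣+∣ {y 0} ≤-refl (slope-error n k n≤k) ⟩
      ∣ y 0 ∣ + A′ * i * (1ℚ - r ↑ n)             ≤⟨ +-monoʳ-≤ ∣ y 0 ∣ (by (0≤* (0≤* 0≤A′ 0≤i) (0≤↑ 0≤r n)) (ring 2 (λ a x → a := a :* (con 1ℚ :- x) :+ a :* x) (A′ * i) (r ↑ n))) ⟩
      ∣ y 0 ∣ + A′ * i                            ∎
      where open ≤-Reasoning

    slope-IsO[1] : ∀ (a : ℕ → ℚ) → (∀ n → a (suc n) ≡ y n) → IsO[1] (λ n → fromℚ (a n) -ᴿ slope *ᴿ fromℚ (ι n))
    slope-IsO[1] a a≡ = C , 1 , λ { (suc n) _ ε 0<ε → n , λ k n≤k → ≤-trans (bound n k n≤k) (p≤p+q {C} {ε} (<⇒≤ 0<ε)) }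
      where
      C : ℚ
      -- The last `A′` pays for the index shift: `a (suc n)` is compared with `suc n` times the
      -- slope, `y n` with `n` times the slope.
      C = ∣ y 0 ∣ + A′ * i + A′
      bound : ∀ n k → n ℕ.≤ k → ∣ a (suc n) + - (Δ y k * ι (suc n)) ∣ ≤ C
      bound n k n≤k = ≤-trans (≤-reflexive (cong ∣_∣ (trans (cong₂ (λ z s → z + - (Δ y k * s)) (a≡ n) (ι-suc n))
          (ring 3 (λ y d n → y :+ :- (d :* (con 1ℚ :+ n)) := y :- d :* n :+ :- d) (y n) (Δ y k) (ι n)))))
        (∣+∣ {y n - Δ y k * ι n} { - Δ y k} (slope-O[1] n k n≤k) (∣neg∣ {Δ y k} (Δ-bounded k)))

-- Approximate solutions of φ′ y = - y φ y

cube : ℚ → ℚ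
cube x = x * x * x

cube-mono : ∀ {x y} → 0ℚ ≤ x → x ≤ y → cube x ≤ cube y
cube-mono 0≤x x≤y = *-mono-≤ 0≤x (0≤* 0≤y 0≤y) (*-mono-≤ 0≤x 0≤y x≤y x≤y) x≤y
  where 0≤y = ≤-trans 0≤x x≤y

0≤cube : ∀ {x} → 0ℚ ≤ x → 0ℚ ≤ cube x
0≤cube {x} 0≤x = 0≤* (0≤sq x) 0≤x

-- Ψ behaves on [-Y , Y], up to an additive error τ, like the integral of a function φ satisfying φ′ y = - y φ y.
record Smooth (Ψ φ : ℚ → ℚ) (C τ Y : ℚ) : Set where
  field
    taylor  : ∀ y h → ∣ y ∣ ≤ Y → ∣ y + h ∣ ≤ Y → ∣ Ψ (y + h) - Ψ y - (h * φ y - ½ * (h * h) * (y * φ y)) ∣ ≤ C * cube ∣ h ∣ + τ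
    φ-decay : ∀ y → ∣ y ∣ ≤ Y → cube (1ℚ + ∣ y ∣) * ∣ φ y ∣ ≤ C
    0≤C     : 0ℚ ≤ C

-- `y` and `y′` are the standardised distances from the threshold before and after a block is split
-- off, `ω` and `ω′` the standard deviations, `a` and `a′` their inverses, `δ` the centred reward.
-- `Q` bounds what the block changes and `u` the inverse deviations; every error apart from `τ` has
-- to be of order u³.
module Local {Ψ φ C τ Y} (smooth : Smooth Ψ φ C τ Y)
  (y y′ ω ω′ a a′ δ Q u Cʸ : ℚ)
  (0<ω : 0ℚ < ω) (0<ω′ : 0ℚ < ω′) (aω : a * ω ≡ 1ℚ) (a′ω′ : a′ * ω′ ≡ 1ℚ) (0≤a : 0ℚ ≤ a) (0≤a′ : 0ℚ ≤ a′)
  (a≤u : a ≤ u) (a′≤u : a′ ≤ u) (u≤1 : u ≤ 1ℚ) (1≤Q : 1ℚ ≤ Q)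
  (κ≤ : ∣ ω * ω - ω′ * ω′ ∣ ≤ Q) (δ≤ : ∣ δ ∣ ≤ Q) (move : y′ * ω′ ≡ y * ω - δ)
  (yu≤ : ∣ y ∣ * u ≤ Cʸ) (y≤ : ∣ y ∣ ≤ Y) (y′≤ : ∣ y′ ∣ ≤ Y)
  where
  open Smooth smooth

  h D g s : ℚ
  h = y′ - y
  D = ω - ω′
  g = (ω + ω′) ⁻¹
  s = 1ℚ + ∣ y ∣

  0≤u : 0ℚ ≤ u
  0≤u = ≤-trans 0≤a a≤u
  0≤Q : 0ℚ ≤ Q
  0≤Q = ≤-trans 0≤1 1≤Q
  1≤s : 1ℚ ≤ s
  1≤s = p≤p+q (0≤∣p∣ y)
  0≤s : 0ℚ ≤ s
  0≤s = ≤-trans 0≤1 1≤s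
  y≤s : ∣ y ∣ ≤ s
  y≤s = p≤q+p 0≤1

  0<ω+ω′ : 0ℚ < ω + ω′
  0<ω+ω′ = 0<-+ 0<ω (<⇒≤ 0<ω′)

  g≤u : g ≤ u
  g≤u = ≤-trans (⁻¹-anti 0<ω (p≤p+q (<⇒≤ 0<ω′))) (≤-trans (≤-reflexive (sym (⁻¹-unique 0<ω (trans (*-comm ω a) aω)))) a≤u)

  -- Only the squares of the deviations are known to be close; dividing by their sum gains a factor
  -- `u`.
  D≤ : ∣ D ∣ ≤ Q * u
  D≤ = subst (λ z → ∣ z ∣ ≤ Q * u)
    (trans (ring 3 (λ w w′ g → (w :* w :- w′ :* w′) :* g := (w :- w′) :* ((w :+ w′) :* g)) ω ω′ g) (trans (cong (D *_) (*-⁻¹ 0<ω+ω′)) (*-identityʳ D)))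
    (∣*∣ {ω * ω - ω′ * ω′} {g} κ≤ (∣≥0∣ (0≤⁻¹ 0<ω+ω′) g≤u))

  a≤ : ∣ a ∣ ≤ u
  a≤ = ∣≥0∣ 0≤a a≤u
  a′≤ : ∣ a′ ∣ ≤ u
  a′≤ = ∣≥0∣ 0≤a′ a′≤u

  h≡ : h ≡ a′ * (y * D - δ)
  h≡ = begin
    y′ - y                             ≡⟨ cong (_- y) (sym (trans (cong (y′ *_) (trans (*-comm ω′ a′) a′ω′)) (*-identityʳ y′))) ⟩
    y′ * (ω′ * a′) - y                 ≡⟨ cong (_- y) (trans (sym (*-assoc y′ ω′ a′)) (cong (_* a′) move)) ⟩
    (y * ω - δ) * a′ - y               ≡⟨ cong (λ z → (y * ω - δ) * a′ - z) (sym (trans (cong (y *_) a′ω′) (*-identityʳ y))) ⟩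
    (y * ω - δ) * a′ - y * (a′ * ω′)   ≡⟨ ring 5 (λ y w d a w′ → (y :* w :- d) :* a :- y :* (a :* w′) := a :* (y :* (w :- w′) :- d)) y ω δ a′ ω′ ⟩
    a′ * (y * D - δ)                   ∎
    where open ≡-Reasoning

  a′-a : a′ - a ≡ a * a′ * D
  a′-a = begin
    a′ - a                             ≡⟨ cong₂ _-_ (sym (trans (cong (a′ *_) aω) (*-identityʳ a′))) (sym (trans (cong (a *_) a′ω′) (*-identityʳ a))) ⟩
    a′ * (a * ω) - a * (a′ * ω′)       ≡⟨ ring 4 (λ a a′ w w′ → a′ :* (a :* w) :- a :* (a′ :* w′) := a :* a′ :* (w :- w′)) a a′ ω ω′ ⟩
    a * a′ * D                         ∎
    where open ≡-Reasoning

  -- The expansion of `h` up to terms of order u³: `D` is replaced by ½ a (ω² - ω′²), which differs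
  -- from it by ½ a D².
  h₀ : ℚ
  h₀ = ½ * y * (a * a) * (ω * ω - ω′ * ω′) - a * δ

  h-h₀ : h - h₀ ≡ y * (D * D) * (a * (a′ + ½ * a)) - δ * (a * a′ * D)
  h-h₀ = begin
    h - h₀
      ≡⟨ cong₂ _-_ h≡ (trans (ring 5 (λ y a w w′ d → con ½ :* y :* (a :* a) :* (w :* w :- w′ :* w′) :- a :* d := y :* a :* (w :- w′) :* (a :* w) :- con ½ :* y :* (a :* a) :* ((w :- w′) :* (w :- w′)) :- a :* d) y a ω ω′ δ)
           (cong (λ z → y * a * D * z - ½ * y * (a * a) * (D * D) - a * δ) aω)) ⟩
    a′ * (y * D - δ) - (y * a * D * 1ℚ - ½ * y * (a * a) * (D * D) - a * δ)
      ≡⟨ ring 5 (λ y a a′ D d → a′ :* (y :* D :- d) :- (y :* a :* D :* con 1ℚ :- con ½ :* y :* (a :* a) :* (D :* D) :- a :* d) := (y :* D :- d) :* (a′ :- a) :+ con ½ :* y :* (a :* a) :* (D :* D)) y a a′ D δ ⟩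
    (y * D - δ) * (a′ - a) + ½ * y * (a * a) * (D * D)
      ≡⟨ cong (λ z → (y * D - δ) * z + ½ * y * (a * a) * (D * D)) a′-a ⟩
    (y * D - δ) * (a * a′ * D) + ½ * y * (a * a) * (D * D)
      ≡⟨ ring 5 (λ y a a′ D d → (y :* D :- d) :* (a :* a′ :* D) :+ con ½ :* y :* (a :* a) :* (D :* D) := y :* (D :* D) :* (a :* (a′ :+ con ½ :* a)) :- d :* (a :* a′ :* D)) y a a′ D δ ⟩
    y * (D * D) * (a * (a′ + ½ * a)) - δ * (a * a′ * D) ∎
    where open ≡-Reasoning

  Q²u³ : ℚ
  Q²u³ = Q * Q * (u * u * u)

  0≤Q²u³ : 0ℚ ≤ Q²u³
  0≤Q²u³ = 0≤* (0≤sq Q) (0≤cube 0≤u)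

  ∣h-h₀∣≤ : ∣ h - h₀ ∣ ≤ (s + s) * Q²u³
  ∣h-h₀∣≤ = ≤-trans (≤-reflexive (cong ∣_∣ h-h₀)) (≤-trans
    (∣-∣ {y * (D * D) * (a * (a′ + ½ * a))} {δ * (a * a′ * D)}
      (∣*∣ {y * (D * D)} {a * (a′ + ½ * a)} (∣*∣ {y} {D * D} ≤-refl (∣*∣ {D} {D} D≤ D≤))
        (∣*∣ {a} {a′ + ½ * a} a≤ (∣+∣ {a′} {½ * a} a′≤ (∣*∣ {½} {a} {½} ≤-refl a≤))))
      (∣*∣ {δ} {a * a′ * D} δ≤ (∣*∣ {a * a′} {D} (∣*∣ {a} {a′} a≤ a′≤) D≤)))
    (by (0≤-+ (0≤* 0≤Q²u³ (0≤-+ (0≤* (0≤-+ (0≤∣p∣ y) (0≤* (0≤∣p∣ y) (<⇒≤ (positive⁻¹ ½)))) (gap u≤1)) (0≤* (0≤∣p∣ y) (<⇒≤ (positive⁻¹ ½))))) 0≤Q²u³)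
      (ring 3 (λ Y Q u → ((con 1ℚ :+ Y) :+ (con 1ℚ :+ Y)) :* (Q :* Q :* (u :* u :* u)) := Y :* (Q :* u :* (Q :* u)) :* (u :* (u :+ con ½ :* u)) :+ Q :* (u :* u :* (Q :* u)) :+ (Q :* Q :* (u :* u :* u) :* ((Y :+ Y :* con ½) :* (con 1ℚ :- u) :+ Y :* con ½) :+ Q :* Q :* (u :* u :* u))) ∣ y ∣ Q u)))

  -- The leading term of `h` is `- (δ * a)`. What remains is of order u², so that `h * h` may be
  -- replaced by `δ * δ * (a * a)`.
  e₁ : ℚ
  e₁ = h + δ * a

  e₁≡ : e₁ ≡ y * D * a′ - δ * (a * a′ * D)
  e₁≡ = trans (cong (_+ δ * a) h≡) (trans (ring 5 (λ y D d a a′ → a′ :* (y :* D :- d) :+ d :* a := y :* D :* a′ :- d :* (a′ :- a)) y D δ a a′)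
    (cong (λ z → y * D * a′ - δ * z) a′-a))

  Qu≤Q²u : Q * Q * (u * u * u) ≤ Q * Q * (u * u)
  Qu≤Q²u = *-monoˡ (0≤sq Q) (subst (u * u * u ≤_) (*-identityʳ (u * u)) (*-monoˡ (0≤sq u) u≤1))

  ∣e₁∣≤ : ∣ e₁ ∣ ≤ s * (Q * Q * (u * u))
  ∣e₁∣≤ = ≤-trans (≤-reflexive (cong ∣_∣ e₁≡)) (≤-trans
    (∣-∣ {y * D * a′} {δ * (a * a′ * D)} (∣*∣ {y * D} {a′} (∣*∣ {y} {D} ≤-refl D≤) a′≤)
      (∣*∣ {δ} {a * a′ * D} δ≤ (∣*∣ {a * a′} {D} (∣*∣ {a} {a′} a≤ a′≤) D≤)))
    (by (0≤-+ (0≤* (0≤* (0≤* (0≤∣p∣ y) 0≤Q) (0≤sq u)) (gap 1≤Q)) (gap Qu≤Q²u))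
      (ring 3 (λ Y Q u → (con 1ℚ :+ Y) :* (Q :* Q :* (u :* u)) := Y :* (Q :* u) :* u :+ Q :* (u :* u :* (Q :* u)) :+ (Y :* Q :* (u :* u) :* (Q :- con 1ℚ) :+ (Q :* Q :* (u :* u) :- Q :* Q :* (u :* u :* u)))) ∣ y ∣ Q u)))

  Q⁴u³ : ℚ
  Q⁴u³ = Q * Q * (Q * Q) * (u * u * u)

  0≤Q⁴u³ : 0ℚ ≤ Q⁴u³
  0≤Q⁴u³ = 0≤* (0≤sq (Q * Q)) (0≤cube 0≤u)

  1≤Q² : 1ℚ ≤ Q * Q
  1≤Q² = ≤-trans (≤-reflexive (sym (*-identityˡ 1ℚ))) (*-mono-≤ 0≤1 0≤Q 1≤Q 1≤Q)

  Q²u³≤ : Q²u³ ≤ Q⁴u³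
  Q²u³≤ = *-monoʳ (0≤cube 0≤u) (subst (_≤ Q * Q * (Q * Q)) (*-identityʳ (Q * Q)) (*-monoˡ (0≤sq Q) 1≤Q²))

  quadratic : ∣ h * h - δ * δ * (a * a) ∣ ≤ s * s * (Q⁴u³ + Q⁴u³ + Q⁴u³)
  quadratic = ≤-trans (≤-reflexive (cong ∣_∣ (ring 3 (λ h d a → h :* h :- d :* d :* (a :* a) := (h :+ d :* a) :* ((h :+ d :* a) :- (d :* a :+ d :* a))) h δ a)))
    (≤-trans (∣*∣ {e₁} {e₁ - (δ * a + δ * a)} ∣e₁∣≤ (∣-∣ {e₁} {δ * a + δ * a} ∣e₁∣≤ (∣+∣ {δ * a} {δ * a} (∣*∣ {δ} {a} δ≤ a≤) (∣*∣ {δ} {a} δ≤ a≤))))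
    (by (0≤-+ (0≤* (0≤* 0≤s 0≤s) (0≤* 0≤Q⁴u³ (gap u≤1)))
          (0≤-+ (0≤* (0≤* 0≤s 0≤s) (0≤* (0≤* (0≤-+ 0≤Q 0≤Q) (0≤sq Q)) (0≤* (0≤cube 0≤u) (gap 1≤Q))))
                (0≤* (0≤* 0≤s (gap 1≤s)) (0≤* (0≤-+ 0≤Q 0≤Q) (0≤* (0≤sq Q) (0≤cube 0≤u))))))
      (ring 3 (λ s Q u → s :* s :* (Q :* Q :* (Q :* Q) :* (u :* u :* u) :+ Q :* Q :* (Q :* Q) :* (u :* u :* u) :+ Q :* Q :* (Q :* Q) :* (u :* u :* u)) := s :* (Q :* Q :* (u :* u)) :* (s :* (Q :* Q :* (u :* u)) :+ (Q :* u :+ Q :* u)) :+ (s :* s :* (Q :* Q :* (Q :* Q) :* (u :* u :* u) :* (con 1ℚ :- u)) :+ (s :* s :* ((Q :+ Q) :* (Q :* Q) :* (u :* u :* u :* (Q :- con 1ℚ))) :+ s :* (s :- con 1ℚ) :* ((Q :+ Q) :* (Q :* Q :* (u :* u :* u)))))) s Q u)))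

  -- The cubic Taylor error has no decay in `y`. So the factor `∣ y ∣` that comes with `D` is traded
  -- for the constant `Cʸ`, at the price of one `u`.
  ∣h∣≤ : ∣ h ∣ ≤ Q * u * (1ℚ + Cʸ)
  ∣h∣≤ = ≤-trans (≤-reflexive (cong ∣_∣ h≡)) (≤-trans
    (∣*∣ {a′} {y * D - δ} a′≤ (∣-∣ {y * D} {δ} (∣*∣ {y} {D} ≤-refl D≤) δ≤))
    (≤-trans (≤-reflexive (ring 3 (λ u Y Q → u :* (Y :* (Q :* u) :+ Q) := Q :* u :* (con 1ℚ :+ Y :* u)) u ∣ y ∣ Q))
      (*-monoˡ (0≤* 0≤Q 0≤u) (+-monoʳ-≤ 1ℚ yu≤))))

  -- Averaged over the blocks both parts cancel: `δ` has mean 0, and by the law of total variance so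
  -- has ω² - ω′² - δ², up to the error in the deviations.
  main : ℚ
  main = ½ * (y * φ y) * (a * a) * (ω * ω - ω′ * ω′ - δ * δ) - φ y * a * δ

  E : ℚ
  E = 1ℚ + 1ℚ + 1ℚ + 1ℚ + cube (1ℚ + Cʸ)

  0≤Cʸ : 0ℚ ≤ Cʸ
  0≤Cʸ = ≤-trans (0≤* (0≤∣p∣ y) 0≤u) yu≤

  -- The error of `h` grows like `s` and that of `h * h`, with its factor `y`, like `cube s`;
  -- `φ-decay` absorbs both.
  estimate : ∣ Ψ y′ - Ψ y - main ∣ ≤ C * E * Q⁴u³ + τ
  estimate = begin
    ∣ Ψ y′ - Ψ y - main ∣
      ≡⟨ cong ∣_∣ (trans (ring 4 (λ A B M T → A :- B :- M := (A :- B :- T) :+ (T :- M)) (Ψ y′) (Ψ y) main (h * φ y - ½ * (h * h) * (y * φ y)))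
           (cong (Ψ y′ - Ψ y - (h * φ y - ½ * (h * h) * (y * φ y)) +_)
             (ring 6 (λ h f y a k d → h :* f :- con ½ :* (h :* h) :* (y :* f) :- (con ½ :* (y :* f) :* (a :* a) :* (k :- d :* d) :- f :* a :* d) := f :* (h :- (con ½ :* y :* (a :* a) :* k :- a :* d)) :- con ½ :* (y :* f) :* (h :* h :- d :* d :* (a :* a))) h (φ y) y a (ω * ω - ω′ * ω′) δ))) ⟩
    ∣ (Ψ y′ - Ψ y - (h * φ y - ½ * (h * h) * (y * φ y))) + (φ y * (h - h₀) - ½ * (y * φ y) * (h * h - δ * δ * (a * a))) ∣
      ≤⟨ ∣+∣ {Ψ y′ - Ψ y - (h * φ y - ½ * (h * h) * (y * φ y))}
           (subst (λ z → ∣ Ψ z - Ψ y - (h * φ y - ½ * (h * h) * (y * φ y)) ∣ ≤ C * cube ∣ h ∣ + τ) y+h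
             (taylor y h y≤ (subst (λ z → ∣ z ∣ ≤ Y) (sym y+h) y′≤)))
           (∣-∣ {φ y * (h - h₀)} {½ * (y * φ y) * (h * h - δ * δ * (a * a))}
             (∣*∣ {φ y} {h - h₀} ≤-refl ∣h-h₀∣≤)
             (∣*∣ {½ * (y * φ y)} {h * h - δ * δ * (a * a)} (∣*∣ {½} {y * φ y} {½} ≤-refl (∣*∣ {y} {φ y} ≤-refl ≤-refl)) quadratic)) ⟩
    C * cube ∣ h ∣ + τ + (F * ((s + s) * Q²u³) + ½ * (∣ y ∣ * F) * (s * s * (Q⁴u³ + Q⁴u³ + Q⁴u³)))
      ≤⟨ +-mono-≤ (+-monoˡ-≤ τ (*-monoˡ 0≤C (≤-trans (cube-mono (0≤∣p∣ h) ∣h∣≤) cube-Q))) (+-mono-≤ linear-term quadratic-term) ⟩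
    C * (cube (1ℚ + Cʸ) * Q⁴u³) + τ + ((C + C) * Q⁴u³ + (C + C) * Q⁴u³)
      ≡⟨ ring 4 (λ C k x t → C :* (k :* x) :+ t :+ ((C :+ C) :* x :+ (C :+ C) :* x) := C :* (con 1ℚ :+ con 1ℚ :+ con 1ℚ :+ con 1ℚ :+ k) :* x :+ t) C (cube (1ℚ + Cʸ)) Q⁴u³ τ ⟩
    C * E * Q⁴u³ + τ ∎
    where
    open ≤-Reasoning
    F = ∣ φ y ∣
    0≤F = 0≤∣p∣ (φ y)
    y+h : y + h ≡ y′
    y+h = ring 2 (λ y z → y :+ (z :- y) := z) y y′
    s³F≤C : cube s * F ≤ C
    s³F≤C = φ-decay y y≤
    s≤s³ : s ≤ cube s
    s≤s³ = by (0≤* (0≤* 0≤s (0≤-+ 0≤s 0≤1)) (gap 1≤s)) (ring 1 (λ s → s :* s :* s := s :+ s :* (s :+ con 1ℚ) :* (s :- con 1ℚ)) s)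
    linear-term : F * ((s + s) * Q²u³) ≤ (C + C) * Q⁴u³
    linear-term = ≤-trans (≤-reflexive (ring 3 (λ f s q → f :* ((s :+ s) :* q) := (s :* f :+ s :* f) :* q) F s Q²u³))
      (*-mono-≤ 0≤Q²u³ (0≤-+ 0≤C 0≤C) (+-mono-≤ sF≤C sF≤C) Q²u³≤)
      where
      sF≤C : s * F ≤ C
      sF≤C = ≤-trans (*-monoʳ 0≤F s≤s³) s³F≤C
    quadratic-term : ½ * (∣ y ∣ * F) * (s * s * (Q⁴u³ + Q⁴u³ + Q⁴u³)) ≤ (C + C) * Q⁴u³
    quadratic-term = begin
      ½ * (∣ y ∣ * F) * (s * s * (Q⁴u³ + Q⁴u³ + Q⁴u³))
        ≤⟨ *-monoʳ (0≤* (0≤sq s) (0≤-+ (0≤-+ 0≤Q⁴u³ 0≤Q⁴u³) 0≤Q⁴u³)) (*-monoˡ (<⇒≤ (positive⁻¹ ½)) (*-monoʳ 0≤F y≤s)) ⟩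
      ½ * (s * F) * (s * s * (Q⁴u³ + Q⁴u³ + Q⁴u³))
        ≡⟨ ring 3 (λ s f q → con ½ :* (s :* f) :* (s :* s :* (q :+ q :+ q)) := s :* s :* s :* f :* (con ½ :* (q :+ q :+ q))) s F Q⁴u³ ⟩
      cube s * F * (½ * (Q⁴u³ + Q⁴u³ + Q⁴u³))
        ≤⟨ *-monoʳ (0≤* (<⇒≤ (positive⁻¹ ½)) (0≤-+ (0≤-+ 0≤Q⁴u³ 0≤Q⁴u³) 0≤Q⁴u³)) s³F≤C ⟩
      C * (½ * (Q⁴u³ + Q⁴u³ + Q⁴u³))
        ≤⟨ by (0≤* (0≤* (<⇒≤ (positive⁻¹ ½)) 0≤C) 0≤Q⁴u³) (ring 2 (λ C q → (C :+ C) :* q := C :* (con ½ :* (q :+ q :+ q)) :+ con ½ :* C :* q) C Q⁴u³) ⟩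
      (C + C) * Q⁴u³ ∎
    cube-Q : cube (Q * u * (1ℚ + Cʸ)) ≤ cube (1ℚ + Cʸ) * Q⁴u³
    cube-Q = by (0≤* (0≤* (0≤cube (0≤-+ 0≤1 0≤Cʸ)) (0≤* (0≤cube 0≤Q) (0≤cube 0≤u))) (gap 1≤Q))
      (ring 3 (λ c Q u → c :* c :* c :* (Q :* Q :* (Q :* Q) :* (u :* u :* u)) := Q :* u :* c :* (Q :* u :* c) :* (Q :* u :* c) :+ c :* c :* c :* (Q :* Q :* Q :* (u :* u :* u)) :* (Q :- con 1ℚ)) (1ℚ + Cʸ) Q u)

-- The exponential polynomials expSum

expTerm-suc : ∀ q k → ι (suc k) * expTerm q (suc k) ≡ q * expTerm q k
expTerm-suc q k = trans (ring 4 (λ n t q i → n :* (t :* q :* i) := q :* t :* (i :* n)) (ι (suc k)) (expTerm q k) q (inv k))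
  (trans (cong (q * expTerm q k *_) (inv*ι k)) (*-identityʳ (q * expTerm q k)))

ι-inv : ∀ k x → ι (suc k) * (inv k * x) ≡ x
ι-inv k x = trans (ring 3 (λ n i x → n :* (i :* x) := i :* n :* x) (ι (suc k)) (inv k) x) (trans (cong (_* x) (inv*ι k)) (*-identityˡ x))

module ExpTaylor {B p q : ℚ} (p≤B : ∣ p ∣ ≤ B) (q≤B : ∣ q ∣ ≤ B) where

  d : ℚ
  d = p - q

  0≤B : 0ℚ ≤ B
  0≤B = ≤∣∣ {p} p≤B

  remainder : ℕ → ℚ
  remainder k = expTerm p (suc (suc k)) - expTerm q (suc (suc k)) - d * expTerm q (suc k)

  remainder-suc : ∀ k → remainder (suc k) ≡ inv (suc (suc k)) * (p * remainder k + d * d * expTerm q (suc k))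
  remainder-suc k = begin
    P * p * i - Q * q * i - d * Q
      ≡⟨ cong (λ z → P * p * i - Q * q * i - z) (sym (ι-inv (suc (suc k)) (d * Q))) ⟩
    P * p * i - Q * q * i - ι (suc (suc (suc k))) * (i * (d * Q))
      ≡⟨ cong (λ z → P * p * i - Q * q * i - z * (i * (d * Q))) (ι-suc (suc (suc k))) ⟩
    P * p * i - Q * q * i - (1ℚ + n) * (i * (d * Q))
      ≡⟨ ring 6 (λ P Q p q i n → P :* p :* i :- Q :* q :* i :- (con 1ℚ :+ n) :* (i :* ((p :- q) :* Q)) := i :* (p :* (P :- Q) :- (p :- q) :* (n :* Q))) P Q p q i n ⟩
    i * (p * (P - Q) - (p - q) * (n * Q))
      ≡⟨ cong (λ z → i * (p * (P - Q) - (p - q) * z)) (expTerm-suc q (suc k)) ⟩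
    i * (p * (P - Q) - (p - q) * (q * T))
      ≡⟨ ring 6 (λ i p q P Q T → i :* (p :* (P :- Q) :- (p :- q) :* (q :* T)) := i :* (p :* (P :- Q :- (p :- q) :* T) :+ (p :- q) :* (p :- q) :* T)) i p q P Q T ⟩
    i * (p * remainder k + d * d * T) ∎
    where
    open ≡-Reasoning
    P Q T i n : ℚ
    P = expTerm p (suc (suc k))
    Q = expTerm q (suc (suc k))
    T = expTerm q (suc k)
    i = inv (suc (suc k))
    n = ι (suc (suc k))

  -- Taylor's bound with a factor 2 to spare: the second derivative of the term of index k + 2 is
  -- the term of index k. The recursion `remainder-suc` replaces derivatives.
  remainder-bound : ∀ k → ∣ remainder k ∣ ≤ d * d * expTerm B k
  remainder-bound zero = ≤-trans (≤-reflexive (trans (cong ∣_∣ eq) (0≤p⇒∣p∣≡p (0≤* (<⇒≤ (positive⁻¹ ½)) (0≤sq d)))))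
    (by (0≤* (<⇒≤ (positive⁻¹ ½)) (0≤sq d)) (ring 1 (λ d → d :* d :* con 1ℚ := con ½ :* (d :* d) :+ con ½ :* (d :* d)) d))
    where
    eq : remainder 0 ≡ ½ * (d * d)
    eq = ring 2 (λ p q → con 1ℚ :* p :* con 1ℚ :* p :* con ½ :- con 1ℚ :* q :* con 1ℚ :* q :* con ½ :- (p :- q) :* (con 1ℚ :* q :* con 1ℚ) := con ½ :* ((p :- q) :* (p :- q))) p q
  remainder-bound (suc k) = begin
    ∣ remainder (suc k) ∣
      ≡⟨ cong ∣_∣ (remainder-suc k) ⟩
    ∣ i * (p * remainder k + d * d * expTerm q (suc k)) ∣
      ≤⟨ ∣*∣ {i} {p * remainder k + d * d * expTerm q (suc k)} (∣∣-self (0≤inv (suc (suc k))))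
           (∣+∣ {p * remainder k} {d * d * expTerm q (suc k)} (∣*∣ {p} {remainder k} p≤B (remainder-bound k))
             (∣*∣ {d * d} {expTerm q (suc k)} (∣∣-self (0≤sq d)) (expTerm-bound q≤B (suc k)))) ⟩
    i * (B * (d * d * expTerm B k) + d * d * expTerm B (suc k))
      ≡⟨ cong (i *_) (trans (ring 4 (λ B d t u → B :* (d :* t) :+ d :* u := d :* (B :* t :+ u)) B (d * d) (expTerm B k) (expTerm B (suc k)))
           (cong (λ z → d * d * (z + expTerm B (suc k))) (sym (expTerm-suc B k)))) ⟩
    i * (d * d * (ι (suc k) * expTerm B (suc k) + expTerm B (suc k)))
      ≤⟨ *-monoˡ (0≤inv (suc (suc k))) (by (0≤* (0≤sq d) (expTerm-nonNeg 0≤B (suc k)))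
           (trans (cong (_* (d * d * expTerm B (suc k))) (trans (ι-suc (suc (suc k))) (cong (1ℚ +_) (ι-suc (suc k)))))
             (ring 3 (λ n d t → (con 1ℚ :+ (con 1ℚ :+ n)) :* (d :* t) := d :* (n :* t :+ t) :+ d :* t) (ι (suc k)) (d * d) (expTerm B (suc k))))) ⟩
    i * (ι (suc (suc (suc k))) * (d * d * expTerm B (suc k)))
      ≡⟨ trans (ring 3 (λ i n x → i :* (n :* x) := n :* (i :* x)) i (ι (suc (suc (suc k)))) (d * d * expTerm B (suc k))) (ι-inv (suc (suc k)) (d * d * expTerm B (suc k))) ⟩
    d * d * expTerm B (suc k) ∎
    where
    open ≤-Reasoning
    i : ℚ
    i = inv (suc (suc k))

  exp-taylor : ∀ k → ∣ expSum p (suc (suc k)) - expSum q (suc (suc k)) - d * expSum q (suc k) ∣ ≤ d * d * expSum B k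
  exp-taylor zero = ≤-reflexive (trans (cong ∣_∣ (ring 2 (λ p q → con 0ℚ :+ con 1ℚ :+ con 1ℚ :* p :* con 1ℚ :- (con 0ℚ :+ con 1ℚ :+ con 1ℚ :* q :* con 1ℚ) :- (p :- q) :* (con 0ℚ :+ con 1ℚ) := con 0ℚ) p q)) (sym (*-zeroʳ (d * d))))
  exp-taylor (suc k) = ≤-trans (≤-reflexive (cong ∣_∣
      (ring 7 (λ A a B b d C c → A :+ a :- (B :+ b) :- d :* (C :+ c) := (A :- B :- d :* C) :+ (a :- b :- d :* c))
        (expSum p (suc (suc k))) (expTerm p (suc (suc k))) (expSum q (suc (suc k))) (expTerm q (suc (suc k))) d (expSum q (suc k)) (expTerm q (suc k)))))
    (≤-trans (∣+∣ {expSum p (suc (suc k)) - expSum q (suc (suc k)) - d * expSum q (suc k)} (exp-taylor k) (remainder-bound k))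
      (≤-reflexive (sym (*-distribˡ-+ (d * d) (expSum B k) (expTerm B k)))))

-- (1 - z / (K + 1)) ^ (K + 1)
Pw : ℕ → ℚ → ℚ
Pw K z = (1ℚ - z * inv K) ↑ suc K

module ExpPower {B : ℚ} (0≤B : 0ℚ ≤ B) where
  open ExpTail 0≤B using (cap; N; 0≤capN; term≤capN; sum≤capN)

  c Cᵉ : ℚ
  c  = cap N
  Cᵉ = (1ℚ + 1ℚ) * (B * B * c)

  0≤Cᵉ : 0ℚ ≤ Cᵉ
  0≤Cᵉ = 0≤* (0≤-+ 0≤1 0≤1) (0≤* (0≤* 0≤B 0≤B) 0≤capN)

  module _ (K : ℕ) (z : ℚ) (0≤z : 0ℚ ≤ z) (z≤B : z ≤ B) (B≤K : B ≤ ι (suc K)) where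

    ζ step : ℚ
    ζ    = z * inv K
    step = ζ * ζ * c + ζ * (c * B * inv K)

    0≤ζ : 0ℚ ≤ ζ
    0≤ζ = 0≤* 0≤z (0≤inv K)

    ζ≤1 : ζ ≤ 1ℚ
    ζ≤1 = ≤-trans (*-monoʳ (0≤inv K) (≤-trans z≤B B≤K)) (≤-reflexive (trans (*-comm (ι (suc K)) (inv K)) (inv*ι K)))

    Mζ : ι (suc K) * ζ ≡ z
    Mζ = trans (cong (ι (suc K) *_) (*-comm z (inv K))) (ι-inv K z)

    F : ℕ → ℚ
    F j = expSum (- (ι j * ζ)) (suc (suc K))

    arg≤B : ∀ j → j ℕ.≤ suc K → ∣ - (ι j * ζ) ∣ ≤ B
    arg≤B j j≤ = ∣neg∣ {ι j * ζ} (∣≥0∣ (0≤* (0≤ι j) 0≤ζ) (≤-trans (*-monoʳ 0≤ζ (ι-mono j≤)) (≤-trans (≤-reflexive Mζ) z≤B)))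

    euler-step : ∀ j → suc j ℕ.≤ suc K → ∣ F (suc j) - (1ℚ - ζ) * F j ∣ ≤ step
    euler-step j j<M = begin
      ∣ F (suc j) - (1ℚ - ζ) * F j ∣
        ≡⟨ cong ∣_∣ (trans (ring 4 (λ a s t z → a :- (con 1ℚ :- z) :* (s :+ t) := a :- (s :+ t) :- (:- z) :* s :+ z :* t) (F (suc j)) (expSum q (suc K)) (expTerm q (suc K)) ζ)
             (cong (λ x → F (suc j) - F j - x * expSum q (suc K) + ζ * expTerm q (suc K)) (sym d≡))) ⟩
      ∣ (F (suc j) - F j - (p - q) * expSum q (suc K)) + ζ * expTerm q (suc K) ∣
        ≤⟨ ∣+∣ {F (suc j) - F j - (p - q) * expSum q (suc K)}
             (≤-trans (ExpTaylor.exp-taylor {B} {p} {q} (arg≤B (suc j) j<M) (arg≤B j (ℕ.≤-trans (ℕ.n≤1+n j) j<M)) K)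
               (≤-trans (≤-reflexive (cong (_* expSum B K) (trans (cong₂ _*_ d≡ d≡) (ring 1 (λ z → (:- z) :* (:- z) := z :* z) ζ)))) (*-monoˡ (0≤sq ζ) (sum≤capN K))))
             (∣*∣ {ζ} {expTerm q (suc K)} (∣∣-self 0≤ζ) (≤-trans (expTerm-bound (arg≤B j (ℕ.≤-trans (ℕ.n≤1+n j) j<M)) (suc K))
               (*-monoʳ (0≤inv K) (*-monoʳ 0≤B (term≤capN K))))) ⟩
      step ∎
      where
      open ≤-Reasoning
      p q : ℚ
      p = - (ι (suc j) * ζ)
      q = - (ι j * ζ)
      d≡ : p - q ≡ - ζ
      d≡ = trans (cong (λ x → - (x * ζ) - q) (ι-suc j)) (ring 2 (λ n z → :- ((con 1ℚ :+ n) :* z) :- :- (n :* z) := :- z) (ι j) ζ)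

    expSum-0 : ∀ k → expSum 0ℚ (suc k) ≡ 1ℚ
    expSum-0 zero    = refl
    expSum-0 (suc k) = trans (cong₂ _+_ (expSum-0 k) (trans (cong (_* inv k) (*-zeroʳ (expTerm 0ℚ k))) (*-zeroˡ (inv k)))) (+-identityʳ 1ℚ)

    -- Euler's method with `suc K` steps of length `ζ`. Multiplication by `1ℚ - ζ` makes an error of
    -- order 1 / K² in each step, from Taylor's formula and from the top term by which a truncated
    -- sum differs from its derivative; the total is of order 1 / K.
    euler : ∀ j → j ℕ.≤ suc K → ∣ F j - (1ℚ - ζ) ↑ j ∣ ≤ ι j * step
    euler zero    _ = ≤-reflexive (trans (cong ∣_∣ (trans (cong (_- 1ℚ) (trans (cong (λ x → expSum x (suc (suc K))) (ring 1 (λ z → :- (con 0ℚ :* z) := con 0ℚ) ζ)) (expSum-0 (suc K)))) (+-inverseʳ 1ℚ))) (sym (*-zeroˡ step)))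
    euler (suc j) h = begin
      ∣ F (suc j) - (1ℚ - ζ) * (1ℚ - ζ) ↑ j ∣
        ≡⟨ cong ∣_∣ (ring 4 (λ a b z x → a :- z :* x := (a :- z :* b) :+ z :* (b :- x)) (F (suc j)) (F j) (1ℚ - ζ) ((1ℚ - ζ) ↑ j)) ⟩
      ∣ (F (suc j) - (1ℚ - ζ) * F j) + (1ℚ - ζ) * (F j - (1ℚ - ζ) ↑ j) ∣
        ≤⟨ ∣+∣ {F (suc j) - (1ℚ - ζ) * F j} (euler-step j h)
             (∣*∣ {1ℚ - ζ} {F j - (1ℚ - ζ) ↑ j} (∣≥0∣ (gap ζ≤1) (by 0≤ζ (ring 1 (λ z → con 1ℚ := con 1ℚ :- z :+ z) ζ))) (euler j (ℕ.≤-trans (ℕ.n≤1+n j) h))) ⟩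
      step + 1ℚ * (ι j * step)
        ≡⟨ trans (ring 2 (λ s n → s :+ con 1ℚ :* (n :* s) := (con 1ℚ :+ n) :* s) step (ι j)) (cong (_* step) (sym (ι-suc j))) ⟩
      ι (suc j) * step ∎
      where open ≤-Reasoning

    expSum-Pw : ∣ expSum (- z) (suc (suc K)) - Pw K z ∣ ≤ Cᵉ * inv K
    expSum-Pw = begin
      ∣ expSum (- z) (suc (suc K)) - Pw K z ∣
        ≡⟨ cong (λ x → ∣ expSum (- x) (suc (suc K)) - Pw K z ∣) (sym Mζ) ⟩
      ∣ F (suc K) - (1ℚ - ζ) ↑ suc K ∣
        ≤⟨ euler (suc K) ℕ.≤-refl ⟩
      ι (suc K) * step
        ≡⟨ trans (ring 5 (λ n z i c B → n :* (z :* i :* (z :* i) :* c :+ z :* i :* (c :* B :* i)) := n :* (i :* (z :* (z :* i :* c) :+ z :* (c :* B :* i)))) (ι (suc K)) z (inv K) c B)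
             (ι-inv K (z * (z * inv K * c) + z * (c * B * inv K))) ⟩
      z * (z * inv K * c) + z * (c * B * inv K)
        ≡⟨ ring 4 (λ z i c B → z :* (z :* i :* c) :+ z :* (c :* B :* i) := (z :* z :+ z :* B) :* (c :* i)) z (inv K) c B ⟩
      (z * z + z * B) * (c * inv K)
        ≤⟨ *-monoʳ (0≤* 0≤capN (0≤inv K)) (+-mono-≤ (*-mono-≤ 0≤z 0≤B z≤B z≤B) (*-monoʳ 0≤B z≤B)) ⟩
      (B * B + B * B) * (c * inv K)
        ≡⟨ ring 3 (λ B c i → (B :* B :+ B :* B) :* (c :* i) := (con 1ℚ :+ con 1ℚ) :* (B :* B :* c) :* i) B c (inv K) ⟩
      Cᵉ * inv K ∎
      where open ≤-Reasoning

-- Uniform estimates for the powers Pw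

-- Taylor's formula with the second derivative bounded by its value at `c`, by induction on the
-- exponent.
power-taylor : ∀ {a b c} → ∣ a ∣ ≤ c → ∣ b ∣ ≤ c → ∀ k →
  ∣ a ↑ suc (suc k) - b ↑ suc (suc k) - ι (suc (suc k)) * b ↑ suc k * (a - b) ∣ ≤ ½ * (ι (suc (suc k)) * ι (suc k)) * ((a - b) * (a - b) * c ↑ k)
power-taylor {a} {b} {c} a≤c b≤c zero = ≤-reflexive (trans (cong ∣_∣ eq) (trans (0≤p⇒∣p∣≡p (0≤sq (a - b))) eq′))
  where
  eq : a ↑ 2 - b ↑ 2 - ι 2 * b ↑ 1 * (a - b) ≡ (a - b) * (a - b)
  eq = trans (cong (λ z → a ↑ 2 - b ↑ 2 - z * b ↑ 1 * (a - b)) (ι-suc 1))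
    (ring 2 (λ a b → a :* (a :* con 1ℚ) :- b :* (b :* con 1ℚ) :- (con 1ℚ :+ con 1ℚ) :* (b :* con 1ℚ) :* (a :- b) := (a :- b) :* (a :- b)) a b)
  eq′ : (a - b) * (a - b) ≡ ½ * (ι 2 * ι 1) * ((a - b) * (a - b) * 1ℚ)
  eq′ = ring 1 (λ x → x := con 1ℚ :* (x :* con 1ℚ)) ((a - b) * (a - b))
power-taylor {a} {b} {c} a≤c b≤c (suc k) = begin
  ∣ a * A - b * Bᵏ - ι (3 ℕ.+ k) * Bᵏ * (a - b) ∣
    ≡⟨ cong ∣_∣ (trans (cong (λ z → a * A - b * Bᵏ - z * Bᵏ * (a - b)) (ι-suc (suc (suc k))))
         (ring 5 (λ a A b x n → a :* A :- b :* (b :* x) :- (con 1ℚ :+ n) :* (b :* x) :* (a :- b) := a :* (A :- b :* x :- n :* x :* (a :- b)) :+ n :* x :* ((a :- b) :* (a :- b))) a A b (b ↑ suc k) n)) ⟩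
  ∣ a * (A - Bᵏ - n * b ↑ suc k * (a - b)) + n * b ↑ suc k * ((a - b) * (a - b)) ∣
    ≤⟨ ∣+∣ {a * (A - Bᵏ - n * b ↑ suc k * (a - b))} (∣*∣ {a} {A - Bᵏ - n * b ↑ suc k * (a - b)} a≤c (power-taylor a≤c b≤c k))
         (∣*∣ {n * b ↑ suc k} {(a - b) * (a - b)} (∣*∣ {n} {b ↑ suc k} (∣∣-self (0≤ι (suc (suc k)))) (≤-trans (≤-reflexive (∣↑∣ b (suc k))) (↑-mono (0≤∣p∣ b) b≤c (suc k)))) (∣∣-self (0≤sq (a - b)))) ⟩
  c * (½ * (n * ι (suc k)) * ((a - b) * (a - b) * c ↑ k)) + n * (c * c ↑ k) * ((a - b) * (a - b))
    ≡⟨ cong (λ z → c * (½ * (z * ι (suc k)) * ((a - b) * (a - b) * c ↑ k)) + z * (c * c ↑ k) * ((a - b) * (a - b))) (ι-suc (suc k)) ⟩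
  c * (½ * ((1ℚ + m) * m) * ((a - b) * (a - b) * c ↑ k)) + (1ℚ + m) * (c * c ↑ k) * ((a - b) * (a - b))
    ≡⟨ ring 4 (λ c m d x → c :* (con ½ :* ((con 1ℚ :+ m) :* m) :* (d :* x)) :+ (con 1ℚ :+ m) :* (c :* x) :* d := con ½ :* ((con 1ℚ :+ (con 1ℚ :+ m)) :* (con 1ℚ :+ m)) :* (d :* (c :* x))) c m ((a - b) * (a - b)) (c ↑ k) ⟩
  ½ * ((1ℚ + (1ℚ + m)) * (1ℚ + m)) * ((a - b) * (a - b) * c ↑ suc k)
    ≡⟨ cong (λ z → ½ * z * ((a - b) * (a - b) * c ↑ suc k)) (sym (cong₂ _*_ (trans (ι-suc (suc (suc k))) (cong (1ℚ +_) (ι-suc (suc k)))) (ι-suc (suc k)))) ⟩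
  ½ * (ι (3 ℕ.+ k) * ι (2 ℕ.+ k)) * ((a - b) * (a - b) * c ↑ suc k) ∎
  where
  open ≤-Reasoning
  A Bᵏ n m : ℚ
  A  = a ↑ suc (suc k)
  Bᵏ = b ↑ suc (suc k)
  n  = ι (suc (suc k))
  m  = ι (suc k)

bernoulli₂ : ∀ {t} → 0ℚ ≤ t → ∀ n → 1ℚ + ι n * t + ½ * (ι n * ι n - ι n) * (t * t) ≤ (1ℚ + t) ↑ n
bernoulli₂ {t} 0≤t zero    = ≤-reflexive (ring 1 (λ t → con 1ℚ :+ con 0ℚ :* t :+ con ½ :* (con 0ℚ :* con 0ℚ :- con 0ℚ) :* (t :* t) := con 1ℚ) t)
bernoulli₂ {t} 0≤t (suc n) = ≤-trans
  (by (0≤* (0≤* (<⇒≤ (positive⁻¹ ½)) 0≤n²-n) (0≤* (0≤sq t) 0≤t))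
    (trans (ring 2 (λ t n → (con 1ℚ :+ t) :* (con 1ℚ :+ n :* t :+ con ½ :* (n :* n :- n) :* (t :* t)) := con 1ℚ :+ (con 1ℚ :+ n) :* t :+ con ½ :* ((con 1ℚ :+ n) :* (con 1ℚ :+ n) :- (con 1ℚ :+ n)) :* (t :* t) :+ con ½ :* (n :* n :- n) :* (t :* t :* t)) t (ι n))
           (cong (λ z → 1ℚ + z * t + ½ * (z * z - z) * (t * t) + ½ * (ι n * ι n - ι n) * (t * t * t)) (sym (ι-suc n)))))
  (*-monoˡ (0≤-+ 0≤1 0≤t) (bernoulli₂ 0≤t n))
  where
  0≤n²-n : 0ℚ ≤ ι n * ι n - ι n
  0≤n²-n = gap (subst (ι n ≤_) (ι-homo-* n n) (ι-mono (n≤n*n n)))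
    where
    n≤n*n : ∀ n → n ℕ.≤ n ℕ.* n
    n≤n*n zero    = ℕ.z≤n
    n≤n*n (suc n) = ℕ.m≤m*n (suc n) (suc n)

sqh : ℚ → ℚ
sqh y = ½ * (y * y)

0≤sqh : ∀ y → 0ℚ ≤ sqh y
0≤sqh y = 0≤* (<⇒≤ (positive⁻¹ ½)) (0≤sq y)

-- The truncated exponential sum may be negative for large arguments, and its bounds depend on their
-- range. The power `G y` is close to it, lies between 0 and 1 where `sqh y ≤ ι M`, and has decay
-- and Taylor bounds that, up to a `slack` of order 1 / M, depend neither on `M` nor on the range.
-- The offset in `M = 4 + j` makes `k = M - 2` at least half of `M`.
module PowEstimates (j : ℕ) where

  k K₁ M : ℕ
  k = 2 ℕ.+ j
  K₁ = suc k
  M = suc K₁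

  i : ℚ
  i = inv K₁

  0≤i : 0ℚ ≤ i
  0≤i = 0≤inv K₁

  iM : i * ι M ≡ 1ℚ
  iM = inv*ι K₁

  i≤½ : i ≤ ½
  i≤½ = *-cancelˡ {i} {½} {ι M} (0<ι K₁) (≤-trans (≤-reflexive (trans (*-comm (ι M) i) iM))
    (subst (_≤ ι M * ½) (*-identityˡ 1ℚ) (≤-trans (≤-reflexive (trans (*-identityˡ 1ℚ) 2*½)) (*-monoʳ (<⇒≤ (positive⁻¹ ½)) (ι-mono {2} {M} (ℕ.s≤s (ℕ.s≤s ℕ.z≤n)))))))
    where
    2*½ : 1ℚ ≡ ι 2 * ½
    2*½ = refl

  ½≤ki : ½ ≤ ι k * i
  ½≤ki = *-cancelˡ {½} {ι k * i} {ι M} (0<ι K₁) (≤-trans (*-monoʳ (<⇒≤ (positive⁻¹ ½)) (ι-mono {M} {k ℕ.+ k} M≤2k))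
    (≤-reflexive (trans (trans (cong (_* ½) (ι-homo-+ k k)) (ring 1 (λ k → (k :+ k) :* con ½ := k) (ι k)))
      (sym (trans (ring 3 (λ m k i → m :* (k :* i) := i :* m :* k) (ι M) (ι k) i) (trans (cong (_* ι k) iM) (*-identityˡ (ι k))))))))
    where
    M≤2k : M ℕ.≤ k ℕ.+ k
    M≤2k = ℕ.≤-trans (ℕ.≤-reflexive (ℕ.+-comm 2 k)) (ℕ.+-monoʳ-≤ k (ℕ.m≤m+n 2 j))

  b : ℚ → ℚ
  b z = 1ℚ - z * i

  module _ {z} (0≤z : 0ℚ ≤ z) (z≤M : z ≤ ι M) where

    0≤b : 0ℚ ≤ b z
    0≤b = gap (≤-trans (*-monoʳ 0≤i z≤M) (≤-reflexive (trans (*-comm (ι M) i) iM)))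

    b≤1 : b z ≤ 1ℚ
    b≤1 = by (0≤* 0≤z 0≤i) (ring 1 (λ x → con 1ℚ := con 1ℚ :- x :+ x) (z * i))

    shrink : ∀ n → b z ↑ n * (1ℚ + z * i) ↑ n ≤ 1ℚ
    shrink n = ≤-trans (≤-reflexive (sym (↑-distrib (b z) (1ℚ + z * i) n)))
      (↑≤1 (0≤* 0≤b (0≤-+ 0≤1 (0≤* 0≤z 0≤i))) (by (0≤sq (z * i)) (ring 1 (λ x → con 1ℚ := (con 1ℚ :- x) :* (con 1ℚ :+ x) :+ x :* x) (z * i))) n)

    b^k-decay : b z ↑ k * (1ℚ + ½ * z) ≤ 1ℚ
    b^k-decay = ≤-trans (*-monoˡ (0≤↑ 0≤b k) (≤-trans (+-monoʳ-≤ 1ℚ (≤-trans (*-monoʳ 0≤z ½≤ki) (≤-reflexive (ring 3 (λ k i z → k :* i :* z := k :* (z :* i)) (ι k) i z))))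
      (bernoulli (0≤* 0≤z 0≤i) k))) (shrink k)

    -- As (1 - x)(1 + x) ≤ 1, a lower bound for (1 + z / M)^M is an upper bound for the power. The
    -- square requires Bernoulli's inequality to second order.
    Pw-decay : Pw K₁ z * ((1ℚ + ½ * z) * (1ℚ + ½ * z)) ≤ 1ℚ
    Pw-decay = ≤-trans (*-monoˡ (0≤↑ 0≤b M) (≤-trans square (bernoulli₂ (0≤* 0≤z 0≤i) M))) (shrink M)
      where
      n : ℚ
      n = ι M
      square : (1ℚ + ½ * z) * (1ℚ + ½ * z) ≤ 1ℚ + n * (z * i) + ½ * (n * n - n) * (z * i * (z * i))
      square = by (0≤* (0≤* (<⇒≤ (positive⁻¹ ½)) (0≤sq z)) (gap i≤½)) (trans
        (ring 3 (λ n z i → con 1ℚ :+ n :* (z :* i) :+ con ½ :* (n :* n :- n) :* (z :* i :* (z :* i)) := con 1ℚ :+ i :* n :* z :+ con ½ :* (i :* n :* (i :* n) :- i :* n :* i) :* (z :* z)) n z i)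
        (trans (cong (λ x → 1ℚ + x * z + ½ * (x * x - x * i) * (z * z)) iM)
          (ring 2 (λ z i → con 1ℚ :+ con 1ℚ :* z :+ con ½ :* (con 1ℚ :* con 1ℚ :- con 1ℚ :* i) :* (z :* z) := (con 1ℚ :+ con ½ :* z) :* (con 1ℚ :+ con ½ :* z) :+ con ½ :* (z :* z) :* (con ½ :- i)) z i)))

    0≤Pw : 0ℚ ≤ Pw K₁ z
    0≤Pw = 0≤↑ 0≤b M

    Pw≤1 : Pw K₁ z ≤ 1ℚ
    Pw≤1 = ↑≤1 0≤b b≤1 M

  module _ {z z′ c} (0≤z : 0ℚ ≤ z) (z≤M : z ≤ ι M) (0≤z′ : 0ℚ ≤ z′) (z′≤M : z′ ≤ ι M) (b≤c : b z ≤ c) (b′≤c : b z′ ≤ c) where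

    -- The derivative of the power is minus `b z ↑ K₁` and not minus `Pw K₁ z`; the two differ by
    -- the factor `1ℚ - z * i`, whence the last term.
    Pw-taylor : ∣ Pw K₁ z′ - Pw K₁ z * (1ℚ - (z′ - z)) ∣ ≤ (z′ - z) * (z′ - z) * c ↑ k + ∣ z′ - z ∣ * (z * i)
    Pw-taylor = begin
      ∣ Pw K₁ z′ - Pw K₁ z * (1ℚ - ζ) ∣
        ≡⟨ cong ∣_∣ (trans (ring 5 (λ P z i x ζ → P :- (con 1ℚ :- z :* i) :* x :* (con 1ℚ :- ζ) := (P :- (con 1ℚ :- z :* i) :* x :+ x :* ζ :* con 1ℚ) :- ζ :* x :* (z :* i)) (Pw K₁ z′) z i x ζ)
             (cong (λ y → (Pw K₁ z′ - Pw K₁ z + x * ζ * y) - ζ * x * (z * i)) (sym iM))) ⟩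
      ∣ (Pw K₁ z′ - Pw K₁ z + x * ζ * (i * ι M)) - ζ * x * (z * i) ∣
        ≤⟨ ∣-∣ {Pw K₁ z′ - Pw K₁ z + x * ζ * (i * ι M)} {ζ * x * (z * i)}
             (≤-trans (≤-reflexive (cong ∣_∣ (ring 7 (λ P Q x z z′ i n → P :- Q :+ x :* (z′ :- z) :* (i :* n) := P :- Q :- n :* x :* (con 1ℚ :- z′ :* i :- (con 1ℚ :- z :* i))) (Pw K₁ z′) (Pw K₁ z) x z z′ i (ι M))))
               (≤-trans (power-taylor {b z′} {b z} {c} (∣≥0∣ (0≤b 0≤z′ z′≤M) b′≤c) (∣≥0∣ (0≤b 0≤z z≤M) b≤c) k) main))
             (∣*∣ {ζ * x} {z * i} (≤-trans (∣*∣ {ζ} {x} ≤-refl (∣≥0∣ (0≤↑ (0≤b 0≤z z≤M) K₁) (↑≤1 (0≤b 0≤z z≤M) (b≤1 0≤z z≤M) K₁))) (≤-reflexive (*-identityʳ ∣ ζ ∣))) (∣∣-self (0≤* 0≤z 0≤i))) ⟩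
      ζ * ζ * c ↑ k + ∣ ζ ∣ * (z * i) ∎
      where
      open ≤-Reasoning
      ζ x : ℚ
      ζ = z′ - z
      x = b z ↑ K₁
      0≤c : 0ℚ ≤ c
      0≤c = ≤-trans (0≤b 0≤z z≤M) b≤c
      main : ½ * (ι M * ι K₁) * ((b z′ - b z) * (b z′ - b z) * c ↑ k) ≤ ζ * ζ * c ↑ k
      main = begin
        ½ * (ι M * ι K₁) * ((b z′ - b z) * (b z′ - b z) * c ↑ k)
          ≤⟨ *-monoʳ (0≤* (0≤sq (b z′ - b z)) (0≤↑ 0≤c k)) (≤-trans (*-monoˡ (<⇒≤ (positive⁻¹ ½)) (*-monoˡ (0≤ι M) (ι-mono (ℕ.n≤1+n K₁))))
               (by (0≤* (<⇒≤ (positive⁻¹ ½)) (0≤sq (ι M))) (ring 1 (λ n → n :* n := con ½ :* (n :* n) :+ con ½ :* (n :* n)) (ι M)))) ⟩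
        ι M * ι M * ((b z′ - b z) * (b z′ - b z) * c ↑ k)
          ≡⟨ ring 5 (λ n z z′ i x → n :* n :* ((con 1ℚ :- z′ :* i :- (con 1ℚ :- z :* i)) :* (con 1ℚ :- z′ :* i :- (con 1ℚ :- z :* i)) :* x) := i :* n :* (i :* n) :* ((z′ :- z) :* (z′ :- z) :* x)) (ι M) z z′ i (c ↑ k) ⟩
        i * ι M * (i * ι M) * (ζ * ζ * c ↑ k)
          ≡⟨ trans (cong (λ y → y * y * (ζ * ζ * c ↑ k)) iM) (trans (cong (_* (ζ * ζ * c ↑ k)) (*-identityˡ 1ℚ)) (*-identityˡ (ζ * ζ * c ↑ k))) ⟩
        ζ * ζ * c ↑ k ∎

  G : ℚ → ℚ
  G y = Pw K₁ (sqh y)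

  module _ {y} (y≤M : sqh y ≤ ι M) where

    0≤G : 0ℚ ≤ G y
    0≤G = 0≤Pw (0≤sqh y) y≤M

    G≤1 : G y ≤ 1ℚ
    G≤1 = Pw≤1 (0≤sqh y) y≤M

    -- By `Pw-decay`, `G y` times the square of 1 + y² / 4 is at most 1, and this square has degree
    -- 4 > 3. The factor 32 makes the difference of the two polynomials a visible sum of squares.
    G-decay : cube (1ℚ + ∣ y ∣) * G y ≤ ι 32
    G-decay = ≤-trans (*-monoʳ 0≤G bound) (≤-trans (≤-reflexive (ring 3 (λ a q g → a :* q :* g := a :* (g :* q)) (ι 32) (q * q) (G y)))
      (≤-trans (*-monoˡ (0≤ι 32) (Pw-decay (0≤sqh y) y≤M)) (≤-reflexive (*-identityʳ (ι 32)))))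
      where
      t q : ℚ
      t = ∣ y ∣
      q = 1ℚ + ½ * sqh y
      bound : cube (1ℚ + t) ≤ ι 32 * (q * q)
      bound = by (0≤-+ (0≤-+ (0≤* (0≤sq t) (0≤-+ (0≤-+ (0≤sq (t - ½)) (0≤sq t)) (positive⇒nonNeg′ (ι 11 + ¾) ))) (0≤sq (t - 1ℚ - ½))) (positive⇒nonNeg′ (ι 28 + ¾)))
        (trans (cong (λ x → ι 32 * ((1ℚ + ½ * (½ * x)) * (1ℚ + ½ * (½ * x)))) (trans (sym (0≤p⇒∣p∣≡p (0≤sq y))) (∣p*q∣≡∣p∣*∣q∣ y y)))
          (ring 1 (λ t → con (ι 32) :* ((con 1ℚ :+ con ½ :* (con ½ :* (t :* t))) :* (con 1ℚ :+ con ½ :* (con ½ :* (t :* t)))) := (con 1ℚ :+ t) :* (con 1ℚ :+ t) :* (con 1ℚ :+ t) :+ (t :* t :* ((t :- con ½) :* (t :- con ½) :+ t :* t :+ (con (ι 11) :+ (con ½ :+ con ½ :* con ½))) :+ (t :- con 1ℚ :- con ½) :* (t :- con 1ℚ :- con ½) :+ (con (ι 28) :+ (con ½ :+ con ½ :* con ½)))) t))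
        where
        ¾ : ℚ
        ¾ = ½ + ½ * ½
        positive⇒nonNeg′ : ∀ q {{_ : NonNegative q}} → 0ℚ ≤ q
        positive⇒nonNeg′ q = nonNegative⁻¹ q

  module _ {y t} (y≤M : sqh y ≤ ι M) (y′≤M : sqh (y + t) ≤ ι M) where

    yG≤32 : ∣ y ∣ * G y ≤ ι 32
    yG≤32 = ≤-trans (*-monoʳ (0≤G {y} y≤M) (by {∣ y ∣} {cube (1ℚ + ∣ y ∣)}
        (0≤-+ (0≤sq (∣ y ∣ - 1ℚ)) (0≤* (0≤∣p∣ y) (0≤-+ (0≤sq ∣ y ∣) (0≤-+ (0≤* (0≤ι 2) (0≤∣p∣ y)) (0≤ι 4)))))
        (ring 1 (λ t → (con 1ℚ :+ t) :* (con 1ℚ :+ t) :* (con 1ℚ :+ t) := t :+ ((t :- con 1ℚ) :* (t :- con 1ℚ) :+ t :* (t :* t :+ (con (ι 2) :* t :+ con (ι 4))))) ∣ y ∣)))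
      (G-decay {y} y≤M)

    slack : ℚ
    slack = ∣ sqh (y + t) - sqh y ∣ * (sqh y * i)

    ζ : ℚ
    ζ = sqh (y + t) - sqh y

    ζ≡ : ζ ≡ t * (y + ½ * t)
    ζ≡ = ring 2 (λ y t → con ½ :* ((y :+ t) :* (y :+ t)) :- con ½ :* (y :* y) := t :* (y :+ con ½ :* t)) y t

    -- For `x` the end point with the larger base `b (sqh x)`. `ζ` is `t` times the midpoint of `y`
    -- and `y + t`, whose square is at most a multiple of `1ℚ + ½ * sqh x`, and this is the factor
    -- that `b^k-decay` absorbs.
    near-min : ∣ t ∣ ≤ 1ℚ → ∀ x → sqh x ≤ ι M → ∣ y + ½ * t ∣ ≤ ∣ x ∣ + ½ * ∣ t ∣ → ζ * ζ * b (sqh x) ↑ k ≤ ι 8 * (t * t)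
    near-min t≤1 x x≤M h = begin
      ζ * ζ * B
        ≡⟨ cong (λ z → z * z * B) ζ≡ ⟩
      t * (y + ½ * t) * (t * (y + ½ * t)) * B
        ≡⟨ ring 3 (λ t x B → t :* x :* (t :* x) :* B := t :* t :* (x :* x :* B)) t (y + ½ * t) B ⟩
      t * t * ((y + ½ * t) * (y + ½ * t) * B)
        ≤⟨ *-monoˡ (0≤sq t) (*-monoʳ 0≤B (≤-trans (∣∣*∣∣ {y + ½ * t} {∣ x ∣ + ½} (≤-trans h (+-monoʳ-≤ ∣ x ∣ (≤-trans (*-monoˡ (<⇒≤ (positive⁻¹ ½)) t≤1) (≤-reflexive (*-identityʳ ½)))))) square)) ⟩
      t * t * (ι 8 * (1ℚ + ½ * sqh x) * B)
        ≡⟨ ring 4 (λ t e q B → t :* (e :* q :* B) := e :* t :* (B :* q)) (t * t) (ι 8) (1ℚ + ½ * sqh x) B ⟩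
      ι 8 * (t * t) * (B * (1ℚ + ½ * sqh x))
        ≤⟨ *-monoˡ (0≤* (0≤ι 8) (0≤sq t)) (b^k-decay (0≤sqh x) x≤M) ⟩
      ι 8 * (t * t) * 1ℚ
        ≡⟨ *-identityʳ (ι 8 * (t * t)) ⟩
      ι 8 * (t * t) ∎
      where
      open ≤-Reasoning
      B : ℚ
      B = b (sqh x) ↑ k
      0≤B : 0ℚ ≤ B
      0≤B = 0≤↑ (0≤b (0≤sqh x) x≤M) k
      square : (∣ x ∣ + ½) * (∣ x ∣ + ½) ≤ ι 8 * (1ℚ + ½ * sqh x)
      square = by (0≤-+ (0≤sq (∣ x ∣ - ½)) (nonNegative⁻¹ (ι 7 + ½)))
        (trans (cong (λ z → ι 8 * (1ℚ + ½ * (½ * z))) (trans (sym (0≤p⇒∣p∣≡p (0≤sq x))) (∣p*q∣≡∣p∣*∣q∣ x x)))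
          (ring 1 (λ x → con (ι 8) :* (con 1ℚ :+ con ½ :* (con ½ :* (x :* x))) := (x :+ con ½) :* (x :+ con ½) :+ ((x :- con ½) :* (x :- con ½) :+ (con (ι 7) :+ con ½))) ∣ x ∣))

    0≤slack : 0ℚ ≤ slack
    0≤slack = 0≤* (0≤∣p∣ ζ) (0≤* (0≤sqh y) 0≤i)

    -- For `∣ t ∣ ≥ 1` no expansion is made: `G` and `y * G y` are bounded, and 2 + 32 |t| is at
    -- most 34 t².
    G-taylor : ∣ G (y + t) - G y * (1ℚ - y * t) ∣ ≤ ι 40 * (t * t) + slack
    G-taylor = [ small , large ]′ (≤-total ∣ t ∣ 1ℚ)
      where
      open ≤-Reasoning
      small : ∣ t ∣ ≤ 1ℚ → ∣ G (y + t) - G y * (1ℚ - y * t) ∣ ≤ ι 40 * (t * t) + slack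
      small t≤1 = begin
        ∣ G (y + t) - G y * (1ℚ - y * t) ∣
          ≡⟨ cong ∣_∣ (ring 4 (λ P Q y t → P :- Q :* (con 1ℚ :- y :* t) := (P :- Q :* (con 1ℚ :- (con ½ :* ((y :+ t) :* (y :+ t)) :- con ½ :* (y :* y)))) :- Q :* (con ½ :* (t :* t))) (G (y + t)) (G y) y t) ⟩
        ∣ (G (y + t) - G y * (1ℚ - ζ)) - G y * (½ * (t * t)) ∣
          ≤⟨ ∣-∣ {G (y + t) - G y * (1ℚ - ζ)} {G y * (½ * (t * t))}
               (≤-trans (Pw-taylor {sqh y} {sqh (y + t)} {c} (0≤sqh y) y≤M (0≤sqh (y + t)) y′≤M (p≤p⊔q (b (sqh y)) (b (sqh (y + t)))) (p≤q⊔p (b (sqh y)) (b (sqh (y + t))))) (+-monoˡ-≤ slack ζ²c≤))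
               (∣*∣ {G y} {½ * (t * t)} (∣≥0∣ (0≤G {y} y≤M) (G≤1 {y} y≤M)) (∣∣-self (0≤* (<⇒≤ (positive⁻¹ ½)) (0≤sq t)))) ⟩
        ι 8 * (t * t) + slack + 1ℚ * (½ * (t * t))
          ≤⟨ by (0≤* (nonNegative⁻¹ (ι 31 + ½)) (0≤sq t)) (ring 2 (λ T s → con (ι 40) :* T :+ s := con (ι 8) :* T :+ s :+ con 1ℚ :* (con ½ :* T) :+ (con (ι 31) :+ con ½) :* T) (t * t) slack) ⟩
        ι 40 * (t * t) + slack ∎
        where
        c : ℚ
        c = b (sqh y) ⊔ b (sqh (y + t))
        ζ²c≤ : ζ * ζ * c ↑ k ≤ ι 8 * (t * t)
        ζ²c≤ = [ (λ e → subst (λ z → ζ * ζ * z ↑ k ≤ ι 8 * (t * t)) (sym e) (near-min t≤1 y y≤M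
                   (∣+∣ {y} {½ * t} ≤-refl (∣*∣ {½} {t} {½} ≤-refl ≤-refl))))
               , (λ e → subst (λ z → ζ * ζ * z ↑ k ≤ ι 8 * (t * t)) (sym e) (near-min t≤1 (y + t) y′≤M
                   (≤-trans (≤-reflexive (cong ∣_∣ (ring 2 (λ y t → y :+ con ½ :* t := y :+ t :- con ½ :* t) y t))) (∣-∣ {y + t} {½ * t} ≤-refl (∣*∣ {½} {t} {½} ≤-refl ≤-refl))))) ]′
               (⊔-sel (b (sqh y)) (b (sqh (y + t))))
      large : 1ℚ ≤ ∣ t ∣ → ∣ G (y + t) - G y * (1ℚ - y * t) ∣ ≤ ι 40 * (t * t) + slack
      large 1≤t = begin
        ∣ G (y + t) - G y * (1ℚ - y * t) ∣
          ≡⟨ cong ∣_∣ (ring 4 (λ P Q y t → P :- Q :* (con 1ℚ :- y :* t) := (P :- Q) :+ y :* Q :* t) (G (y + t)) (G y) y t) ⟩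
        ∣ (G (y + t) - G y) + y * G y * t ∣
          ≤⟨ ∣+∣ {G (y + t) - G y} {y * G y * t} (∣-∣ {G (y + t)} {G y} (∣≥0∣ (0≤G {y + t} y′≤M) (G≤1 {y + t} y′≤M)) (∣≥0∣ (0≤G {y} y≤M) (G≤1 {y} y≤M)))
               (∣*∣ {y * G y} {t} (≤-trans (∣*∣ {y} {G y} ≤-refl (∣∣-self (0≤G {y} y≤M))) yG≤32) ≤-refl) ⟩
        1ℚ + 1ℚ + ι 32 * ∣ t ∣
          ≤⟨ +-mono-≤ (+-mono-≤ 1≤t² 1≤t²) (*-monoˡ (0≤ι 32) t≤t²) ⟩
        T + T + ι 32 * T
          ≤⟨ by (0≤-+ (0≤* (0≤ι 6) 0≤T) 0≤slack) (ring 2 (λ T s → con (ι 40) :* T :+ s := T :+ T :+ con (ι 32) :* T :+ (con (ι 6) :* T :+ s)) T slack) ⟩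
        ι 40 * T + slack
          ≡⟨ cong (λ z → ι 40 * z + slack) (sym tt) ⟩
        ι 40 * (t * t) + slack ∎
        where
        T : ℚ
        T = ∣ t ∣ * ∣ t ∣
        tt : t * t ≡ T
        tt = trans (sym (0≤p⇒∣p∣≡p (0≤sq t))) (∣p*q∣≡∣p∣*∣q∣ t t)
        0≤T : 0ℚ ≤ T
        0≤T = 0≤sq ∣ t ∣
        t≤t² : ∣ t ∣ ≤ T
        t≤t² = subst (_≤ T) (*-identityʳ ∣ t ∣) (*-monoˡ (0≤∣p∣ t) 1≤t)
        1≤t² : 1ℚ ≤ T
        1≤t² = ≤-trans 1≤t t≤t²

-- The Gaussian integral as a power series

gaussTerm : ℚ → ℕ → ℚ
gaussTerm q j = q * expTerm (- sqh q) j * inv (j ℕ.+ j)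

gaussSum : ℚ → ℕ → ℚ
gaussSum q zero    = 0ℚ
gaussSum q (suc k) = gaussSum q k + gaussTerm q k

expTerm-* : ∀ x y j → expTerm (x * y) j ≡ expTerm x j * y ↑ j
expTerm-* x y zero    = refl
expTerm-* x y (suc j) = trans (cong (λ z → z * (x * y) * inv j) (expTerm-* x y j))
  (ring 5 (λ t p x y i → t :* p :* (x :* y) :* i := t :* x :* i :* (y :* p)) (expTerm x j) (y ↑ j) x y (inv j))

↑-square : ∀ q j → (q * q) ↑ j ≡ q ↑ (j ℕ.+ j)
↑-square q j = trans (↑-distrib q q j) (sym (↑-+ q j j))

coeff : ℕ → ℚ
coeff j = expTerm (- ½) j

expTerm-sqh : ∀ q j → expTerm (- sqh q) j ≡ coeff j * q ↑ (j ℕ.+ j)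
expTerm-sqh q j = trans (cong (λ z → expTerm z j) (ring 1 (λ q → :- (con ½ :* (q :* q)) := (:- con ½) :* (q :* q)) q))
  (trans (expTerm-* (- ½) (q * q) j) (cong (coeff j *_) (↑-square q j)))

gaussTerm-monomial : ∀ q j → gaussTerm q j ≡ coeff j * inv (j ℕ.+ j) * q ↑ suc (j ℕ.+ j)
gaussTerm-monomial q j = trans (cong (λ z → q * z * inv (j ℕ.+ j)) (expTerm-sqh q j))
  (ring 4 (λ q c p i → q :* (c :* p) :* i := c :* i :* (q :* p)) q (coeff j) (q ↑ (j ℕ.+ j)) (inv (j ℕ.+ j)))

sqh-mono : ∀ {q B} → ∣ q ∣ ≤ B → sqh q ≤ sqh B
sqh-mono {q} h = *-monoˡ (<⇒≤ (positive⁻¹ ½)) (∣∣*∣∣ {q} h)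

coeff-bound : ∀ j → ∣ coeff j ∣ ≤ expTerm ½ j
coeff-bound = expTerm-bound {½} { - ½} ≤-refl

module GaussTaylor {B x y : ℚ} (x≤B : ∣ x ∣ ≤ B) (y≤B : ∣ y ∣ ≤ B) where

  d : ℚ
  d = x - y

  0≤B : 0ℚ ≤ B
  0≤B = ≤∣∣ {x} x≤B

  -- Of the two factors in the second derivative of x^(2j + 3), one cancels against the denominator
  -- of the series and the other against the factorial; a term of the exponential series of `sqh B`
  -- remains.
  term-taylor : ∀ j → ∣ gaussTerm x (suc j) - gaussTerm y (suc j) - d * expTerm (- sqh y) (suc j) ∣ ≤ ½ * B * (d * d) * expTerm (sqh B) j
  term-taylor j = begin
    ∣ gaussTerm x j′ - gaussTerm y j′ - d * expTerm (- sqh y) j′ ∣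
      ≡⟨ cong ∣_∣ (trans (cong₂ (λ u v → u - v - d * expTerm (- sqh y) j′) (gaussTerm-monomial x j′) (gaussTerm-monomial y j′))
           (trans (cong (λ z → c * i * X - c * i * Y - d * z) (trans (expTerm-sqh y j′) (cong (c *_) (sym (ι-inv (j′ ℕ.+ j′) P)))))
             (ring 7 (λ c i X Y d n P → c :* i :* X :- c :* i :* Y :- d :* (c :* (n :* (i :* P))) := c :* i :* (X :- Y :- n :* P :* d)) c i X Y d n P))) ⟩
    ∣ c * i * (X - Y - n * P * d) ∣
      ≤⟨ ∣*∣ {c * i} {X - Y - n * P * d} (∣*∣ {c} {i} (coeff-bound j′) (∣∣-self (0≤inv (j′ ℕ.+ j′)))) (power-taylor {x} {y} {B} x≤B y≤B (j ℕ.+ j′)) ⟩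
    expTerm ½ j′ * i * (½ * (n * ι (j′ ℕ.+ j′)) * (d * d * B ↑ (j ℕ.+ j′)))
      ≡⟨ ring 6 (λ t i n m d b → t :* i :* (con ½ :* (n :* m) :* (d :* b)) := n :* (i :* (con ½ :* (t :* m) :* (d :* b)))) (expTerm ½ j′) i n (ι (j′ ℕ.+ j′)) (d * d) (B ↑ (j ℕ.+ j′)) ⟩
    n * (i * (½ * (expTerm ½ j′ * ι (j′ ℕ.+ j′)) * (d * d * B ↑ (j ℕ.+ j′))))
      ≡⟨ ι-inv (j′ ℕ.+ j′) (½ * (expTerm ½ j′ * ι (j′ ℕ.+ j′)) * (d * d * B ↑ (j ℕ.+ j′))) ⟩
    ½ * (expTerm ½ j′ * ι (j′ ℕ.+ j′)) * (d * d * B ↑ (j ℕ.+ j′))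
      ≡⟨ cong₂ (λ u v → ½ * (expTerm ½ j′ * u) * (d * d * v)) (ι-homo-+ j′ j′) (trans (cong (B ↑_) (ℕ.+-suc j j)) (cong (B *_) (sym (↑-square B j)))) ⟩
    ½ * (expTerm ½ j′ * (ι j′ + ι j′)) * (d * d * (B * (B * B) ↑ j))
      ≡⟨ ring 4 (λ t n d b → con ½ :* (t :* (n :+ n)) :* (d :* b) := n :* t :* (d :* b)) (expTerm ½ j′) (ι j′) (d * d) (B * (B * B) ↑ j) ⟩
    ι j′ * expTerm ½ j′ * (d * d * (B * (B * B) ↑ j))
      ≡⟨ cong (_* (d * d * (B * (B * B) ↑ j))) (expTerm-suc ½ j) ⟩
    ½ * expTerm ½ j * (d * d * (B * (B * B) ↑ j))
      ≡⟨ ring 4 (λ t d B p → con ½ :* t :* (d :* (B :* p)) := con ½ :* B :* d :* (t :* p)) (expTerm ½ j) (d * d) B ((B * B) ↑ j) ⟩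
    ½ * B * (d * d) * (expTerm ½ j * (B * B) ↑ j)
      ≡⟨ cong (½ * B * (d * d) *_) (sym (expTerm-* ½ (B * B) j)) ⟩
    ½ * B * (d * d) * expTerm (sqh B) j ∎
    where
    open ≤-Reasoning
    j′ = suc j
    c i n X Y P : ℚ
    c = coeff j′
    i = inv (j′ ℕ.+ j′)
    n = ι (suc (j′ ℕ.+ j′))
    X = x ↑ suc (j′ ℕ.+ j′)
    Y = y ↑ suc (j′ ℕ.+ j′)
    P = y ↑ (j′ ℕ.+ j′)

  sum-taylor : ∀ k → ∣ gaussSum x (suc k) - gaussSum y (suc k) - d * expSum (- sqh y) (suc k) ∣ ≤ ½ * B * (d * d) * expSum (sqh B) k
  sum-taylor zero    = ≤-reflexive (trans (cong ∣_∣ (ring 2 (λ x y → con 0ℚ :+ x :* con 1ℚ :* con 1ℚ :- (con 0ℚ :+ y :* con 1ℚ :* con 1ℚ) :- (x :- y) :* (con 0ℚ :+ con 1ℚ) := con 0ℚ) x y)) (sym (*-zeroʳ (½ * B * (d * d)))))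
  sum-taylor (suc k) = ≤-trans (≤-reflexive (cong ∣_∣
      (ring 7 (λ A a B b d C c → A :+ a :- (B :+ b) :- d :* (C :+ c) := (A :- B :- d :* C) :+ (a :- b :- d :* c))
        (gaussSum x (suc k)) (gaussTerm x (suc k)) (gaussSum y (suc k)) (gaussTerm y (suc k)) d (expSum (- sqh y) (suc k)) (expTerm (- sqh y) (suc k)))))
    (≤-trans (∣+∣ {gaussSum x (suc k) - gaussSum y (suc k) - d * expSum (- sqh y) (suc k)} (sum-taylor k) (term-taylor k))
      (≤-reflexive (sym (*-distribˡ-+ (½ * B * (d * d)) (expSum (sqh B) k) (expTerm (sqh B) k)))))

-- Truncations of ∫₀ʸ exp (- t² / 2) dt and of its integrand
Ψ φ : ℕ → ℚ → ℚ
Ψ k y = gaussSum y (suc (suc k))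
φ k y = expSum (- sqh y) (suc (suc k))

module GaussSmooth {B : ℚ} (0≤B : 0ℚ ≤ B) where
  open ExpTail (0≤sqh B) using (cap; N; 0≤capN; sum≤capN)
  open ExpPower (0≤sqh B) using (Cᵉ; 0≤Cᵉ; expSum-Pw)

  C₁ : ℚ
  C₁ = ½ * B * cap N

  0≤C₁ : 0ℚ ≤ C₁
  0≤C₁ = 0≤* (0≤* (<⇒≤ (positive⁻¹ ½)) 0≤B) 0≤capN

  Ψ-taylor : ∀ k {x y} → ∣ x ∣ ≤ B → ∣ y ∣ ≤ B → ∣ Ψ k x - Ψ k y - (x - y) * φ k y ∣ ≤ C₁ * ((x - y) * (x - y))
  Ψ-taylor k {x} {y} x≤B y≤B = ≤-trans (GaussTaylor.sum-taylor {B} {x} {y} x≤B y≤B (suc k))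
    (≤-trans (*-monoˡ (0≤* (0≤* (<⇒≤ (positive⁻¹ ½)) 0≤B) (0≤sq (x - y))) (sum≤capN (suc k)))
      (≤-reflexive (ring 3 (λ B d c → con ½ :* B :* d :* c := con ½ :* B :* c :* d) B ((x - y) * (x - y)) (cap N))))

  C₂ Cᵗ : ℚ
  C₂ = sqh B * sqh B + Cᵉ
  Cᵗ = (B + B) * C₂ + (C₁ + ι 16) * ((B + B) * (B + B))

  0≤C₂ : 0ℚ ≤ C₂
  0≤C₂ = 0≤-+ (0≤sq (sqh B)) 0≤Cᵉ

  module At (j : ℕ) (B≤ : sqh B ≤ ι (4 ℕ.+ j)) where
    open PowEstimates j

    φ-G : ∀ {y} → ∣ y ∣ ≤ B → ∣ φ K₁ y - G y ∣ ≤ Cᵉ * i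
    φ-G {y} y≤B = expSum-Pw K₁ (sqh y) (0≤sqh y) (sqh-mono {y} y≤B) B≤

    sqh≤M : ∀ {y} → ∣ y ∣ ≤ B → sqh y ≤ ι M
    sqh≤M {y} y≤B = ≤-trans (sqh-mono {y} y≤B) B≤

    -- A direct Taylor estimate would have a constant depending on `B`. Instead `h` is covered in
    -- `M` steps `θ`: in each of them `Ψ K₁` moves by about `θ * φ K₁`, `φ K₁` is close to `G`, and
    -- `G` follows its expansion at `y` with the constant 40. Every error that depends on `B`
    -- carries a factor `i` in the end.
    module Path (y h : ℚ) (y≤B : ∣ y ∣ ≤ B) (y+h≤B : ∣ y + h ∣ ≤ B) where

      θ H e : ℚ
      θ = h * i
      H = ∣ h ∣
      e = ∣ θ ∣ * (ι 40 * (H * H) + C₂ * i) + C₁ * (θ * θ)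

      Mθ : ι M * θ ≡ h
      Mθ = trans (cong (ι M *_) (*-comm h i)) (ι-inv K₁ h)

      -- The points y + n θ are convex combinations of y and y + h.
      point≤B : ∀ n → n ℕ.≤ M → ∣ y + ι n * θ ∣ ≤ B
      point≤B n n≤M = begin
        ∣ y + ι n * θ ∣
          ≡⟨ cong ∣_∣ (ring 4 (λ y n h i → y :+ n :* (h :* i) := (con 1ℚ :- n :* i) :* y :+ n :* i :* (y :+ h)) y (ι n) h i) ⟩
        ∣ (1ℚ - ι n * i) * y + ι n * i * (y + h) ∣
          ≤⟨ ∣+∣ {(1ℚ - ι n * i) * y} (∣*∣ {1ℚ - ι n * i} {y} (∣∣-self (gap ni≤1)) y≤B) (∣*∣ {ι n * i} {y + h} (∣∣-self (0≤* (0≤ι n) 0≤i)) y+h≤B) ⟩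
        (1ℚ - ι n * i) * B + ι n * i * B
          ≡⟨ ring 2 (λ x B → (con 1ℚ :- x) :* B :+ x :* B := B) (ι n * i) B ⟩
        B ∎
        where
        open ≤-Reasoning
        ni≤1 : ι n * i ≤ 1ℚ
        ni≤1 = ≤-trans (*-monoʳ 0≤i (ι-mono n≤M)) (≤-reflexive (trans (*-comm (ι M) i) iM))

      travelled : ∀ n → n ℕ.≤ M → ∣ ι n * θ ∣ ≤ H
      travelled n n≤M = ≤-trans (∣*∣ {ι n} {θ} (∣∣-self (0≤ι n)) ≤-refl)
        (≤-trans (*-monoʳ (0≤∣p∣ θ) (ι-mono n≤M)) (≤-reflexive (trans (cong (_* ∣ θ ∣) (sym (0≤p⇒∣p∣≡p (0≤ι M)))) (trans (sym (∣p*q∣≡∣p∣*∣q∣ (ι M) θ)) (cong ∣_∣ Mθ)))))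

      slack≤ : ∀ n (n≤M : n ℕ.≤ M) → slack {y} {ι n * θ} (sqh≤M {y} y≤B) (sqh≤M {y + ι n * θ} (point≤B n n≤M)) ≤ sqh B * sqh B * i
      slack≤ n n≤M = ≤-trans (*-mono-≤ (0≤* (0≤sqh y) 0≤i) (0≤sqh B)
          (∣p∣≤q {sqh (y + ι n * θ) - sqh y} (≤-trans (by (0≤sqh y) (ring 2 (λ a b → a := a :- b :+ b) (sqh (y + ι n * θ)) (sqh y))) (sqh-mono {y + ι n * θ} (point≤B n n≤M)))
                 (≤-trans (by (0≤sqh (y + ι n * θ)) (ring 2 (λ a b → b := :- (a :- b) :+ a) (sqh (y + ι n * θ)) (sqh y))) (sqh-mono {y} y≤B)))
          (*-monoʳ 0≤i (sqh-mono {y} y≤B)))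
        (≤-reflexive (sym (*-assoc (sqh B) (sqh B) i)))

      -- The sum of `G y * (1ℚ - y * (ι m * θ)) * θ` over m < n.
      target : ℕ → ℚ
      target n = G y * (ι n * θ - y * (θ * θ) * (½ * (ι n * ι n - ι n)))

      advance : ∀ n → suc n ℕ.≤ M → ∣ Ψ K₁ (y + ι (suc n) * θ) - Ψ K₁ (y + ι n * θ) - (target (suc n) - target n) ∣ ≤ e
      advance n n<M = begin
        ∣ Ψ K₁ z′ - Ψ K₁ z - (target (suc n) - target n) ∣
          ≡⟨ cong (λ x → ∣ Ψ K₁ z′ - Ψ K₁ z - (G y * (x * θ - y * (θ * θ) * (½ * (x * x - x))) - target n) ∣) (ι-suc n) ⟩
        ∣ Ψ K₁ z′ - Ψ K₁ z - (G y * ((1ℚ + ι n) * θ - y * (θ * θ) * (½ * ((1ℚ + ι n) * (1ℚ + ι n) - (1ℚ + ι n)))) - target n) ∣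
          ≡⟨ cong ∣_∣ (ring 8 (λ P Q f g G y t n → P :- Q :- (G :* ((con 1ℚ :+ n) :* t :- y :* (t :* t) :* (con ½ :* ((con 1ℚ :+ n) :* (con 1ℚ :+ n) :- (con 1ℚ :+ n)))) :- G :* (n :* t :- y :* (t :* t) :* (con ½ :* (n :* n :- n)))) := t :* ((f :- g) :+ (g :- G :* (con 1ℚ :- y :* (n :* t)))) :+ (P :- Q :- t :* f)) (Ψ K₁ z′) (Ψ K₁ z) (φ K₁ z) (G z) (G y) y θ (ι n)) ⟩
        ∣ θ * ((φ K₁ z - G z) + (G z - G y * (1ℚ - y * (ι n * θ)))) + (Ψ K₁ z′ - Ψ K₁ z - θ * φ K₁ z) ∣
          ≤⟨ ∣+∣ {θ * ((φ K₁ z - G z) + (G z - G y * (1ℚ - y * (ι n * θ))))}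
               (∣*∣ {θ} {(φ K₁ z - G z) + (G z - G y * (1ℚ - y * (ι n * θ)))} ≤-refl
                 (∣+∣ {φ K₁ z - G z} (φ-G {z} z≤B)
                   (≤-trans (G-taylor {y} {ι n * θ} (sqh≤M {y} y≤B) (sqh≤M {z} z≤B)) (+-mono-≤ (*-monoˡ (0≤ι 40) (∣∣*∣∣ {ι n * θ} (travelled n n≤M))) (slack≤ n n≤M)))))
               (subst (λ x → ∣ Ψ K₁ z′ - Ψ K₁ z - x * φ K₁ z ∣ ≤ C₁ * (x * x)) z′-z (Ψ-taylor K₁ {z′} {z} (point≤B (suc n) n<M) z≤B)) ⟩
        ∣ θ ∣ * (Cᵉ * i + (ι 40 * (H * H) + sqh B * sqh B * i)) + C₁ * (θ * θ)
          ≡⟨ cong (λ x → ∣ θ ∣ * x + C₁ * (θ * θ)) (ring 4 (λ c i h s → c :* i :+ (h :+ s :* i) := h :+ (s :+ c) :* i) Cᵉ i (ι 40 * (H * H)) (sqh B * sqh B)) ⟩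
        e ∎
        where
        open ≤-Reasoning
        n≤M = ℕ.≤-trans (ℕ.n≤1+n n) n<M
        z z′ : ℚ
        z  = y + ι n * θ
        z′ = y + ι (suc n) * θ
        z≤B = point≤B n n≤M
        z′-z : z′ - z ≡ θ
        z′-z = trans (cong (λ x → y + x * θ - z) (ι-suc n)) (ring 3 (λ y n t → y :+ (con 1ℚ :+ n) :* t :- (y :+ n :* t) := t) y (ι n) θ)

      follow : ∀ n → n ℕ.≤ M → ∣ Ψ K₁ (y + ι n * θ) - Ψ K₁ y - target n ∣ ≤ ι n * e
      follow zero    _ = ≤-reflexive (trans (cong ∣_∣ (trans (cong (λ x → Ψ K₁ x - Ψ K₁ y - target 0) (ring 2 (λ y t → y :+ con 0ℚ :* t := y) y θ))
        (ring 4 (λ P G y t → P :- P :- G :* (con 0ℚ :* t :- y :* (t :* t) :* (con ½ :* (con 0ℚ :* con 0ℚ :- con 0ℚ))) := con 0ℚ) (Ψ K₁ y) (G y) y θ))) (sym (*-zeroˡ e)))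
      follow (suc n) h = ≤-trans (≤-reflexive (cong ∣_∣ (ring 5 (λ P Q R t t′ → P :- R :- t′ := (P :- Q :- (t′ :- t)) :+ (Q :- R :- t)) (Ψ K₁ (y + ι (suc n) * θ)) (Ψ K₁ (y + ι n * θ)) (Ψ K₁ y) (target n) (target (suc n)))))
        (≤-trans (∣+∣ {Ψ K₁ (y + ι (suc n) * θ) - Ψ K₁ (y + ι n * θ) - (target (suc n) - target n)} (advance n h) (follow n (ℕ.≤-trans (ℕ.n≤1+n n) h)))
          (≤-reflexive (trans (ring 2 (λ e n → e :+ n :* e := (con 1ℚ :+ n) :* e) e (ι n)) (cong (_* e) (sym (ι-suc n))))))

      H≤2B : H ≤ B + B
      H≤2B = subst (λ x → ∣ x ∣ ≤ B + B) (ring 2 (λ y h → y :+ h :- y := h) y h) (∣-∣ {y + h} {y} y+h≤B y≤B)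

      HH : h * h ≡ H * H
      HH = trans (sym (0≤p⇒∣p∣≡p (0≤sq h))) (∣p*q∣≡∣p∣*∣q∣ h h)

      Me : ι M * e ≡ ι 40 * cube H + (H * C₂ + C₁ * (h * h)) * i
      Me = trans (cong (λ x → ι M * (x * (ι 40 * (H * H) + C₂ * i) + C₁ * (θ * θ))) (trans (∣p*q∣≡∣p∣*∣q∣ h i) (cong (H *_) (0≤p⇒∣p∣≡p 0≤i))))
        (trans (ring 7 (λ n H i a C c h → n :* (H :* i :* (a :* (H :* H) :+ C :* i) :+ c :* (h :* i :* (h :* i))) := i :* n :* (a :* (H :* H :* H) :+ (H :* C :+ c :* (h :* h)) :* i)) (ι M) H i (ι 40) C₂ C₁ h)
          (trans (cong (_* (ι 40 * cube H + (H * C₂ + C₁ * (h * h)) * i)) iM) (*-identityˡ (ι 40 * cube H + (H * C₂ + C₁ * (h * h)) * i))))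

      target-M : target M ≡ h * G y - ½ * (h * h) * (y * G y) + ½ * (h * h) * i * (y * G y)
      target-M = trans (ring 5 (λ G n y h i → G :* (n :* (h :* i) :- y :* (h :* i :* (h :* i)) :* (con ½ :* (n :* n :- n))) := i :* n :* (h :* G) :- i :* n :* (i :* n) :* (con ½ :* (h :* h) :* (y :* G)) :+ i :* n :* (con ½ :* (h :* h) :* i :* (y :* G))) (G y) (ι M) y h i)
        (trans (cong (λ x → x * (h * G y) - x * x * (½ * (h * h) * (y * G y)) + x * (½ * (h * h) * i * (y * G y))) iM)
          (ring 3 (λ a b c → con 1ℚ :* a :- con 1ℚ :* con 1ℚ :* b :+ con 1ℚ :* c := a :- b :+ c) (h * G y) (½ * (h * h) * (y * G y)) (½ * (h * h) * i * (y * G y))))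

      taylor′ : ∣ Ψ K₁ (y + h) - Ψ K₁ y - (h * G y - ½ * (h * h) * (y * G y)) ∣ ≤ ι 40 * cube H + Cᵗ * i
      taylor′ = begin
        ∣ Ψ K₁ (y + h) - Ψ K₁ y - (h * G y - ½ * (h * h) * (y * G y)) ∣
          ≡⟨ cong ∣_∣ (trans (ring 4 (λ P Q t x → P :- Q :- t := (P :- Q :- (t :+ x)) :+ x) (Ψ K₁ (y + h)) (Ψ K₁ y) (h * G y - ½ * (h * h) * (y * G y)) E)
               (cong₂ (λ u w → (Ψ K₁ (y + u) - Ψ K₁ y - w) + E) (sym Mθ) (sym target-M))) ⟩
        ∣ (Ψ K₁ (y + ι M * θ) - Ψ K₁ y - target M) + E ∣
          ≤⟨ ∣+∣ {Ψ K₁ (y + ι M * θ) - Ψ K₁ y - target M} (follow M ℕ.≤-refl)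
               (∣*∣ {½ * (h * h) * i} {y * G y} (∣∣-self (0≤* (0≤* (<⇒≤ (positive⁻¹ ½)) (0≤sq h)) 0≤i)) (≤-trans (∣*∣ {y} {G y} ≤-refl (∣∣-self (0≤G {y} (sqh≤M {y} y≤B)))) (yG≤32 {y} {0ℚ} (sqh≤M {y} y≤B) (subst (λ x → sqh x ≤ ι M) (sym (+-identityʳ y)) (sqh≤M {y} y≤B))))) ⟩
        ι M * e + ½ * (h * h) * i * ι 32
          ≡⟨ cong₂ (λ u x → u + ½ * x * i * ι 32) (trans Me (cong (λ x → ι 40 * cube H + (H * C₂ + C₁ * x) * i) HH)) HH ⟩
        ι 40 * cube H + (H * C₂ + C₁ * (H * H)) * i + ½ * (H * H) * i * ι 32
          ≡⟨ ring 5 (λ a H C c i → a :+ (H :* C :+ c :* (H :* H)) :* i :+ con ½ :* (H :* H) :* i :* con (ι 32) := a :+ (H :* C :+ (c :+ con (ι 16)) :* (H :* H)) :* i) (ι 40 * cube H) H C₂ C₁ i ⟩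
        ι 40 * cube H + (H * C₂ + (C₁ + ι 16) * (H * H)) * i
          ≤⟨ +-monoʳ-≤ (ι 40 * cube H) (*-monoʳ 0≤i (+-mono-≤ (*-monoʳ 0≤C₂ H≤2B)
               (*-monoˡ (0≤-+ 0≤C₁ (0≤ι 16)) (*-mono-≤ (0≤∣p∣ h) (0≤-+ 0≤B 0≤B) H≤2B H≤2B)))) ⟩
        ι 40 * cube H + Cᵗ * i ∎
        where
        open ≤-Reasoning
        E : ℚ
        E = ½ * (h * h) * i * (y * G y)

    smooth : Smooth (Ψ K₁) G (ι 40) (Cᵗ * i) B
    smooth = record
      { taylor  = λ y h y≤B y+h≤B → Path.taylor′ y h y≤B y+h≤B
      ; φ-decay = λ y y≤B → ≤-trans (≤-reflexive (cong (cube (1ℚ + ∣ y ∣) *_) (0≤p⇒∣p∣≡p (0≤G {y} (sqh≤M {y} y≤B))))) (≤-trans (G-decay {y} (sqh≤M {y} y≤B)) (ι-mono {32} {40} (ℕ.m≤m+n 32 8)))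
      ; 0≤C     = 0≤ι 40 }

-- A mean value theorem without derivatives: bounds for `G` on the grid between `y` and `y + h`
-- become bounds for the increment of `Ψ K₁`, up to `Cˢ * i`.
module GaussIncrement {B : ℚ} (0≤B : 0ℚ ≤ B) (j : ℕ) (B≤ : sqh B ≤ ι (4 ℕ.+ j)) where
  open PowEstimates j
  open ExpPower (0≤sqh B) using (Cᵉ; 0≤Cᵉ)
  open GaussSmooth 0≤B
  open At j B≤

  Cˢ : ℚ
  Cˢ = (B + B) * Cᵉ + C₁ * ((B + B) * (B + B))

  module _ (y h g₁ g₂ : ℚ) (0≤h : 0ℚ ≤ h) (y≤B : ∣ y ∣ ≤ B) (y+h≤B : ∣ y + h ∣ ≤ B)
           (g₁≤G : ∀ n → n ℕ.≤ M → g₁ ≤ G (y + ι n * (h * i))) (G≤g₂ : ∀ n → n ℕ.≤ M → G (y + ι n * (h * i)) ≤ g₂) where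
    open Path y h y≤B y+h≤B

    0≤θ : 0ℚ ≤ θ
    0≤θ = 0≤* 0≤h 0≤i

    e′ : ℚ
    e′ = θ * (Cᵉ * i) + C₁ * (θ * θ)

    drift : ∀ n → n ℕ.≤ M → (ι n * (θ * g₁) ≤ Ψ K₁ (y + ι n * θ) - Ψ K₁ y + ι n * e′) × (Ψ K₁ (y + ι n * θ) - Ψ K₁ y ≤ ι n * (θ * g₂) + ι n * e′)
    drift zero    _ = ≤-reflexive (sym (trans (cong (λ z → z + 0ℚ * e′) start) (ring 2 (λ e g → con 0ℚ :+ con 0ℚ :* e := con 0ℚ :* g) e′ (θ * g₁))))
                    , ≤-reflexive (trans start (ring 2 (λ e g → con 0ℚ := con 0ℚ :* g :+ con 0ℚ :* e) e′ (θ * g₂)))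
      where
      start : Ψ K₁ (y + 0ℚ * θ) - Ψ K₁ y ≡ 0ℚ
      start = trans (cong (λ z → Ψ K₁ z - Ψ K₁ y) (ring 2 (λ y t → y :+ con 0ℚ :* t := y) y θ)) (+-inverseʳ (Ψ K₁ y))
    drift (suc n) n<M =
        by (0≤-+ (0≤-+ (gap (proj₁ IH)) (gap (proj₂ step))) (0≤* 0≤θ (gap (g₁≤G n n≤M))))
          (trans (cong (λ z → Ψ K₁ z′ - Ψ K₁ y + z * e′) (ι-suc n)) (trans
            (ring 8 (λ P Q R n t g G e → P :- R :+ (con 1ℚ :+ n) :* e := (con 1ℚ :+ n) :* (t :* g) :+ (Q :- R :+ n :* e :- n :* (t :* g) :+ (e :- :- (P :- Q :- t :* G)) :+ t :* (G :- g)))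
              (Ψ K₁ z′) (Ψ K₁ z) (Ψ K₁ y) (ι n) θ g₁ (G z) e′) (cong (λ x → x * (θ * g₁) + (Ψ K₁ z - Ψ K₁ y + ι n * e′ - ι n * (θ * g₁) + (e′ - - (Ψ K₁ z′ - Ψ K₁ z - θ * G z)) + θ * (G z - g₁))) (sym (ι-suc n)))))
      , by (0≤-+ (0≤-+ (gap (proj₂ IH)) (gap (proj₁ step))) (0≤* 0≤θ (gap (G≤g₂ n n≤M))))
          (trans (cong (λ z → z * (θ * g₂) + z * e′) (ι-suc n))
            (ring 8 (λ P Q R n t g G e → (con 1ℚ :+ n) :* (t :* g) :+ (con 1ℚ :+ n) :* e := P :- R :+ (n :* (t :* g) :+ n :* e :- (Q :- R) :+ (e :- (P :- Q :- t :* G)) :+ t :* (g :- G)))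
              (Ψ K₁ z′) (Ψ K₁ z) (Ψ K₁ y) (ι n) θ g₂ (G z) e′))
      where
      n≤M = ℕ.≤-trans (ℕ.n≤1+n n) n<M
      IH = drift n n≤M
      z z′ : ℚ
      z  = y + ι n * θ
      z′ = y + ι (suc n) * θ
      z′-z : z′ - z ≡ θ
      z′-z = trans (cong (λ x → y + x * θ - z) (ι-suc n)) (ring 3 (λ y n t → y :+ (con 1ℚ :+ n) :* t :- (y :+ n :* t) := t) y (ι n) θ)
      step′ : ∣ Ψ K₁ z′ - Ψ K₁ z - θ * G z ∣ ≤ e′
      step′ = ≤-trans (≤-reflexive (cong ∣_∣ (ring 5 (λ P Q t f G → P :- Q :- t :* G := t :* (f :- G) :+ (P :- Q :- t :* f)) (Ψ K₁ z′) (Ψ K₁ z) θ (φ K₁ z) (G z))))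
        (∣+∣ {θ * (φ K₁ z - G z)} (∣*∣ {θ} {φ K₁ z - G z} (∣∣-self 0≤θ) (φ-G {z} (point≤B n n≤M)))
          (subst (λ x → ∣ Ψ K₁ z′ - Ψ K₁ z - x * φ K₁ z ∣ ≤ C₁ * (x * x)) z′-z (Ψ-taylor K₁ {z′} {z} (point≤B (suc n) n<M) (point≤B n n≤M))))
      step = ∣∣-≤ {Ψ K₁ z′ - Ψ K₁ z - θ * G z} step′

    Me′ : ι M * e′ ≤ Cˢ * i
    Me′ = ≤-trans (≤-reflexive (trans (ring 5 (λ n h i C c → n :* (h :* i :* (C :* i) :+ c :* (h :* i :* (h :* i))) := i :* n :* ((h :* C :+ c :* (h :* h)) :* i)) (ι M) h i Cᵉ C₁)
        (trans (cong (_* ((h * Cᵉ + C₁ * (h * h)) * i)) iM) (*-identityˡ ((h * Cᵉ + C₁ * (h * h)) * i)))))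
      (*-monoʳ 0≤i (+-mono-≤ (*-monoʳ 0≤Cᵉ h≤2B) (*-monoˡ 0≤C₁ (*-mono-≤ 0≤h (0≤-+ 0≤B 0≤B) h≤2B h≤2B))))
      where
      h≤2B : h ≤ B + B
      h≤2B = ≤-trans (p≤∣p∣ h) H≤2B

    increment : (h * g₁ ≤ Ψ K₁ (y + h) - Ψ K₁ y + Cˢ * i) × (Ψ K₁ (y + h) - Ψ K₁ y ≤ h * g₂ + Cˢ * i)
    increment = ≤-trans (≤-reflexive (sym (scale g₁))) (≤-trans (proj₁ (drift M ℕ.≤-refl)) (subst (λ x → Ψ K₁ (y + x) - Ψ K₁ y + ι M * e′ ≤ Ψ K₁ (y + h) - Ψ K₁ y + Cˢ * i) (sym Mθ) (+-monoʳ-≤ (Ψ K₁ (y + h) - Ψ K₁ y) Me′)))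
              , ≤-trans (≤-reflexive (cong (λ x → Ψ K₁ (y + x) - Ψ K₁ y) (sym Mθ))) (≤-trans (proj₂ (drift M ℕ.≤-refl)) (+-mono-≤ (≤-reflexive (scale g₂)) Me′))
      where
      scale : ∀ g → ι M * (θ * g) ≡ h * g
      scale g = trans (sym (*-assoc (ι M) θ g)) (cong (_* g) Mθ)

    point : ∀ n → n ℕ.≤ M → (y ≤ y + ι n * (h * i)) × (sqh (y + ι n * (h * i)) ≤ ι M)
    point n n≤M = p≤p+q (0≤* (0≤ι n) 0≤θ) , sqh≤M {y + ι n * θ} (point≤B n n≤M)

-- Eventually in k, uniformly on bounded sets
Gs : ℕ → ℚ → ℚ
Gs k y = gaussSum y (suc k)

Eventually : (ℕ → Set) → Set
Eventually P = ∃[ N ] ∀ k → N ℕ.≤ k → P k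

both-eventually : ∀ {P Q : ℕ → Set} → Eventually P → Eventually Q → Eventually (λ k → P k × Q k)
both-eventually (M , p) (N , q) = M ℕ.⊔ N , λ k h → p k (ℕ.≤-trans (ℕ.m≤m⊔n M N) h) , q k (ℕ.≤-trans (ℕ.m≤n⊔m M N) h)

map-eventually : ∀ {P Q : ℕ → Set} → Eventually P → (∀ k → P k → Q k) → Eventually Q
map-eventually (N , p) f = N , λ k h → f k (p k h)

-- The estimates for `j` concern `Ψ K₁`, which is `Gs (4 ℕ.+ j)`, and have errors that are multiples
-- of `i = inv (3 ℕ.+ j)`.
shifted : ∀ {P : ℕ → Set} B {C ε} → 0ℚ ≤ C → 0ℚ < ε → (∀ j → sqh B ≤ ι (4 ℕ.+ j) → C * inv (3 ℕ.+ j) ≤ ε → P (4 ℕ.+ j)) → Eventually P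
shifted {P} B {C} {ε} 0≤C 0<ε h =
  let N₁ , h₁ = archimedean (sqh B)
      N₂ , h₂ = eventually-small C 0≤C ε 0<ε
  in 4 ℕ.+ (N₁ ℕ.+ N₂) , λ k N≤k → subst P (ℕ.m+[n∸m]≡n {4} {k} (ℕ.≤-trans (ℕ.m≤m+n 4 (N₁ ℕ.+ N₂)) N≤k))
       (let j = k ℕ.∸ 4
            N≤j : N₁ ℕ.+ N₂ ℕ.≤ j
            N≤j = ℕ.≤-trans (ℕ.≤-reflexive (sym (ℕ.m+n∸m≡n 4 (N₁ ℕ.+ N₂)))) (ℕ.∸-monoˡ-≤ 4 N≤k)
        in h j (≤-trans h₁ (ι-mono (ℕ.≤-trans (ℕ.m≤m+n N₁ N₂) (ℕ.≤-trans N≤j (ℕ.m≤n+m j 4)))))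
               (h₂ (3 ℕ.+ j) (ℕ.≤-trans (ℕ.m≤n+m N₂ N₁) (ℕ.≤-trans N≤j (ℕ.m≤n+m j 3)))))

module _ {B : ℚ} (0≤B : 0ℚ ≤ B) where

  private
    0≤Cˢ : 0ℚ ≤ (B + B) * ExpPower.Cᵉ (0≤sqh B) + GaussSmooth.C₁ 0≤B * ((B + B) * (B + B))
    0≤Cˢ = 0≤-+ (0≤* (0≤-+ 0≤B 0≤B) (ExpPower.0≤Cᵉ (0≤sqh B))) (0≤* (GaussSmooth.0≤C₁ 0≤B) (0≤sq (B + B)))

  Gs-increment : ∀ ε → 0ℚ < ε → Eventually λ k → ∀ x y → ∣ x ∣ ≤ B → ∣ y ∣ ≤ B → x ≤ y → (Gs k x ≤ Gs k y + ε) × (Gs k y ≤ Gs k x + (y - x) + ε)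
  Gs-increment ε 0<ε = shifted B 0≤Cˢ 0<ε λ j B≤ small x y x≤B y≤B x≤y →
    let open PowEstimates j
        open GaussIncrement 0≤B j B≤
        x+h : x + (y - x) ≡ y
        x+h = ring 2 (λ x y → x :+ (y :- x) := y) x y
        y≤B′ = subst (λ z → ∣ z ∣ ≤ B) (sym x+h) y≤B
        sq≤ = λ n n≤M → GaussSmooth.At.sqh≤M 0≤B j B≤ {x + ι n * ((y - x) * i)} (GaussSmooth.At.Path.point≤B 0≤B j B≤ x (y - x) x≤B y≤B′ n n≤M)
        l , r = increment x (y - x) 0ℚ 1ℚ (gap x≤y) x≤B y≤B′
                  (λ n n≤M → 0≤G {x + ι n * ((y - x) * i)} (sq≤ n n≤M)) (λ n n≤M → G≤1 {x + ι n * ((y - x) * i)} (sq≤ n n≤M))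
        l′ = subst (λ z → (y - x) * 0ℚ ≤ Ψ K₁ z - Ψ K₁ x + Cˢ * i) x+h l
        r′ = subst (λ z → Ψ K₁ z - Ψ K₁ x ≤ (y - x) * 1ℚ + Cˢ * i) x+h r
    in ≤-trans (by (gap l′) (ring 4 (λ a b d s → a :+ s := b :+ (a :- b :+ s :- d :* con 0ℚ)) (Ψ K₁ y) (Ψ K₁ x) (y - x) (Cˢ * i))) (+-monoʳ-≤ (Ψ K₁ y) small)
     , ≤-trans (by (gap r′) (ring 4 (λ a b d s → b :+ d :+ s := a :+ (d :* con 1ℚ :+ s :- (a :- b))) (Ψ K₁ y) (Ψ K₁ x) (y - x) (Cˢ * i))) (+-monoʳ-≤ (Ψ K₁ x + (y - x)) small)

  -- The constant 40 does not depend on `B`; only the index from which on the estimate holds does.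
  Gs-smooth : ∀ τ → 0ℚ < τ → Eventually λ k → ∃[ φ ] Smooth (Gs k) φ (ι 40) τ B
  Gs-smooth τ 0<τ = shifted B 0≤Cᵗ 0<τ λ j B≤ small → PowEstimates.G j , weaken (GaussSmooth.At.smooth 0≤B j B≤) small
    where
    open GaussSmooth 0≤B using (Cᵗ; C₂; 0≤C₂; 0≤C₁)
    0≤Cᵗ : 0ℚ ≤ Cᵗ
    0≤Cᵗ = 0≤-+ (0≤* (0≤-+ 0≤B 0≤B) 0≤C₂) (0≤* (0≤-+ 0≤C₁ (0≤ι 16)) (0≤sq (B + B)))
    weaken : ∀ {Ψ φ C τ τ′ Y} → Smooth Ψ φ C τ Y → τ ≤ τ′ → Smooth Ψ φ C τ′ Y
    weaken {C = C} s τ≤ = record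
      { taylor = λ y h y≤ y+h≤ → ≤-trans (Smooth.taylor s y h y≤ y+h≤) (+-monoʳ-≤ (C * cube ∣ h ∣) τ≤)
      ; φ-decay = Smooth.φ-decay s ; 0≤C = Smooth.0≤C s }

inv-cancel : ∀ n x → inv n * inv n * (ι (suc n) * ι (suc n) * x) ≡ x
inv-cancel n x = trans (ring 3 (λ i m x → i :* i :* (m :* m :* x) := i :* m :* (i :* m) :* x) (inv n) (ι (suc n)) x)
  (trans (cong (λ z → z * z * x) (inv*ι n)) (trans (cong (_* x) (*-identityˡ 1ℚ)) (*-identityˡ x)))

inv-inv : ∀ n → inv n - inv (suc n) ≡ inv n * inv (suc n)
inv-inv n = begin
  inv n - inv (suc n)
    ≡⟨ cong₂ _-_ (sym (trans (cong (inv n *_) (inv*ι (suc n))) (*-identityʳ (inv n)))) (sym (trans (cong (inv (suc n) *_) (inv*ι n)) (*-identityʳ (inv (suc n))))) ⟩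
  inv n * (inv (suc n) * ι (suc (suc n))) - inv (suc n) * (inv n * ι (suc n))
    ≡⟨ cong (λ z → inv n * (inv (suc n) * z) - inv (suc n) * (inv n * ι (suc n))) (ι-suc (suc n)) ⟩
  inv n * (inv (suc n) * (1ℚ + ι (suc n))) - inv (suc n) * (inv n * ι (suc n))
    ≡⟨ ring 3 (λ a b m → a :* (b :* (con 1ℚ :+ m)) :- b :* (a :* m) := a :* b) (inv n) (inv (suc n)) (ι (suc n)) ⟩
  inv n * inv (suc n) ∎
  where open ≡-Reasoning

inv²≤ : ∀ n → inv n * inv n ≤ ι 2 * (inv n - inv (suc n))
inv²≤ n = ≤-trans (*-monoˡ (0≤inv n) half) (≤-reflexive (trans (ring 2 (λ a b → a :* (con (ι 2) :* b) := con (ι 2) :* (a :* b)) (inv n) (inv (suc n))) (cong (ι 2 *_) (sym (inv-inv n)))))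
  where
  half : inv n ≤ ι 2 * inv (suc n)
  half = by (0≤* (0≤inv (suc n)) (gap (≤-trans (≤-trans (*-monoˡ (0≤inv n) (ι-mono {1} {suc n} (ℕ.s≤s ℕ.z≤n))) (≤-reflexive (inv*ι n))) ≤-refl)))
    (trans (ring 2 (λ a b → con (ι 2) :* b := a :- (a :- b :- b)) (inv n) (inv (suc n)))
      (trans (cong (λ z → inv n - (z - inv (suc n))) (inv-inv n)) (ring 2 (λ a b → a :- (a :* b :- b) := a :+ b :* (con 1ℚ :- a :* con 1ℚ)) (inv n) (inv (suc n)))))

-- On [n , n + 1] the function `G` is at most 32 / (n + 1)² by `G-decay`, and `inv²≤` replaces this
-- by a telescoping difference.
Gs-step : ∀ n ε → 0ℚ < ε → Eventually λ k → Gs k (ι (suc n)) ≤ Gs k (ι n) + ι 64 * (inv n - inv (suc n)) + ε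
Gs-step n ε 0<ε = shifted B 0≤Cˢ 0<ε λ j B≤ small →
  let open PowEstimates j
      open GaussIncrement 0≤B j B≤ using (increment; Cˢ; point)
      decay : ∀ z → ι n ≤ z → sqh z ≤ ι M → G z ≤ ι 32 * (inv n * inv n)
      decay z n≤z z≤M = ≤-trans (≤-reflexive (sym (inv-cancel n (G z)))) (≤-trans (*-monoˡ (0≤sq (inv n))
        (≤-trans (*-monoʳ (0≤G {z} z≤M) (cube-≥ z n≤z)) (G-decay {z} z≤M))) (≤-reflexive (*-comm (inv n * inv n) (ι 32))))
      _ , r = increment (ι n) 1ℚ 0ℚ (ι 32 * (inv n * inv n)) 0≤1 n≤B n+1≤B
        (λ m m≤M → 0≤G {ι n + ι m * (1ℚ * i)} (proj₂ (point (ι n) 1ℚ 0ℚ 1ℚ 0≤1 n≤B n+1≤B (λ m m≤M → 0≤G {ι n + ι m * (1ℚ * i)} (sq≤ j B≤ m m≤M)) (λ m m≤M → G≤1 {ι n + ι m * (1ℚ * i)} (sq≤ j B≤ m m≤M)) m m≤M)))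
        (λ m m≤M → decay (ι n + ι m * (1ℚ * i)) (p≤p+q (0≤* (0≤ι m) (0≤* 0≤1 0≤i))) (sq≤ j B≤ m m≤M))
      r′ = subst (λ z → Ψ K₁ z - Ψ K₁ (ι n) ≤ 1ℚ * (ι 32 * (inv n * inv n)) + Cˢ * i) n+1 r
  in begin
    Ψ K₁ (ι (suc n))
      ≤⟨ by (gap r′) (ring 4 (λ a b c s → b :+ c :+ s := a :+ (con 1ℚ :* c :+ s :- (a :- b))) (Ψ K₁ (ι (suc n))) (Ψ K₁ (ι n)) (ι 32 * (inv n * inv n)) (Cˢ * i)) ⟩
    Ψ K₁ (ι n) + ι 32 * (inv n * inv n) + Cˢ * i
      ≤⟨ +-mono-≤ (+-monoʳ-≤ (Ψ K₁ (ι n)) (≤-trans (*-monoˡ (0≤ι 32) (inv²≤ n)) (≤-reflexive (ring 1 (λ d → con (ι 32) :* (con (ι 2) :* d) := con (ι 64) :* d) (inv n - inv (suc n)))))) small ⟩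
    Ψ K₁ (ι n) + ι 64 * (inv n - inv (suc n)) + ε ∎
  where
  open ≤-Reasoning
  B : ℚ
  B = ι (suc n)
  0≤B : 0ℚ ≤ B
  0≤B = 0≤ι (suc n)
  0≤Cˢ : 0ℚ ≤ (B + B) * ExpPower.Cᵉ (0≤sqh B) + GaussSmooth.C₁ 0≤B * ((B + B) * (B + B))
  0≤Cˢ = 0≤-+ (0≤* (0≤-+ 0≤B 0≤B) (ExpPower.0≤Cᵉ (0≤sqh B))) (0≤* (GaussSmooth.0≤C₁ 0≤B) (0≤sq (B + B)))
  n+1 : ι n + 1ℚ ≡ ι (suc n)
  n+1 = trans (+-comm (ι n) 1ℚ) (sym (ι-suc n))
  n≤B : ∣ ι n ∣ ≤ B
  n≤B = ∣≥0∣ (0≤ι n) (ι-mono (ℕ.n≤1+n n))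
  n+1≤B : ∣ ι n + 1ℚ ∣ ≤ B
  n+1≤B = ≤-trans (≤-reflexive (cong ∣_∣ n+1)) (∣∣-self 0≤B)
  sq≤ : ∀ j (B≤ : sqh B ≤ ι (4 ℕ.+ j)) m → m ℕ.≤ PowEstimates.M j → sqh (ι n + ι m * (1ℚ * inv (PowEstimates.K₁ j))) ≤ ι (PowEstimates.M j)
  sq≤ j B≤ m m≤M = GaussSmooth.At.sqh≤M 0≤B j B≤ {ι n + ι m * (1ℚ * inv (PowEstimates.K₁ j))} (GaussSmooth.At.Path.point≤B 0≤B j B≤ (ι n) 1ℚ n≤B n+1≤B m m≤M)
  cube-≥ : ∀ z → ι n ≤ z → ι (suc n) * ι (suc n) ≤ cube (1ℚ + ∣ z ∣)
  cube-≥ z n≤z = ≤-trans (*-mono-≤ 0≤B 0≤s m≤ m≤) (subst (_≤ cube s) (*-identityʳ (s * s)) (*-monoˡ (0≤sq s) (p≤p+q (0≤∣p∣ z))))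
    where
    s : ℚ
    s = 1ℚ + ∣ z ∣
    0≤s : 0ℚ ≤ s
    0≤s = 0≤-+ 0≤1 (0≤∣p∣ z)
    m≤ : ι (suc n) ≤ s
    m≤ = ≤-trans (≤-reflexive (ι-suc n)) (+-monoʳ-≤ 1ℚ (≤-trans n≤z (p≤∣p∣ z)))

Gs-tail : ∀ n s ε → 0ℚ < ε → Eventually λ k → Gs k (ι (s ℕ.+ n)) ≤ Gs k (ι n) + ι 64 * (inv n - inv (s ℕ.+ n)) + ε
Gs-tail n zero    ε 0<ε = 0 , λ k _ → by (<⇒≤ 0<ε) (ring 3 (λ g i e → g :+ con (ι 64) :* (i :- i) :+ e := g :+ e) (Gs k (ι n)) (inv n) ε)
Gs-tail n (suc s) ε 0<ε = map-eventually (both-eventually (Gs-step (s ℕ.+ n) (½ * ε) (halve 0<ε)) (Gs-tail n s (½ * ε) (halve 0<ε)))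
  (λ k → λ { (h₁ , h₂) → ≤-trans h₁ (≤-trans (+-monoˡ-≤ (½ * ε) (+-monoˡ-≤ (ι 64 * (inv (s ℕ.+ n) - inv (suc s ℕ.+ n))) h₂))
    (≤-reflexive (ring 5 (λ g a b c e → g :+ con (ι 64) :* (a :- b) :+ con ½ :* e :+ con (ι 64) :* (b :- c) :+ con ½ :* e := g :+ con (ι 64) :* (a :- c) :+ e) (Gs k (ι n)) (inv n) (inv (s ℕ.+ n)) (inv (suc s ℕ.+ n)) ε))) })

Gs-odd : ∀ k y → Gs k (- y) ≡ - Gs k y
Gs-odd k y = go (suc k)
  where
  go : ∀ k → gaussSum (- y) k ≡ - gaussSum y k
  go zero    = refl
  go (suc k) = trans (cong₂ _+_ (go k) (trans (cong (λ z → (- y) * expTerm (- z) k * inv (k ℕ.+ k)) (ring 1 (λ y → con ½ :* ((:- y) :* (:- y)) := con ½ :* (y :* y)) y))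
      (ring 3 (λ y t i → (:- y) :* t :* i := :- (y :* t :* i)) y (expTerm (- sqh y) k) (inv (k ℕ.+ k)))))
    (sym (neg-distrib-+ (gaussSum y k) (gaussTerm y k)))

Gs-0 : ∀ k → Gs k 0ℚ ≡ 0ℚ
Gs-0 k = go (suc k)
  where
  go : ∀ k → gaussSum 0ℚ k ≡ 0ℚ
  go zero    = refl
  go (suc k) = trans (cong₂ _+_ (go k) (ring 2 (λ t i → con 0ℚ :* t :* i := con 0ℚ) (expTerm (- sqh 0ℚ) k) (inv (k ℕ.+ k)))) (+-identityʳ 0ℚ)

1-nx≤ : ∀ {x} → 0ℚ ≤ x → x ≤ 1ℚ → ∀ n → 1ℚ - ι n * x ≤ (1ℚ - x) ↑ n
1-nx≤ {x} 0≤x x≤1 zero    = ≤-reflexive (ring 1 (λ x → con 1ℚ :- con 0ℚ :* x := con 1ℚ) x)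
1-nx≤ {x} 0≤x x≤1 (suc n) = ≤-trans (by (0≤* (0≤ι n) (0≤sq x))
    (trans (ring 2 (λ x n → (con 1ℚ :- x) :* (con 1ℚ :- n :* x) := con 1ℚ :- (con 1ℚ :+ n) :* x :+ n :* (x :* x)) x (ι n)) (cong (λ z → 1ℚ - z * x + ι n * (x * x)) (sym (ι-suc n)))))
  (*-monoˡ (gap x≤1) (1-nx≤ 0≤x x≤1 n))

-- By Bernoulli's inequality `G z` is at least `1ℚ - sqh z`, hence at least ½ on [0 , 1]. This keeps
-- the total mass away from 0, so that it can be inverted.
Gs-1 : ∀ ε → 0ℚ < ε → Eventually λ k → ½ ≤ Gs k 1ℚ + ε
Gs-1 ε 0<ε = shifted 1ℚ 0≤Cˢ 0<ε λ j B≤ small →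
  let open PowEstimates j
      open GaussIncrement 0≤1 j B≤ using (increment; Cˢ)
      open GaussSmooth.At 0≤1 j B≤ using (sqh≤M)
      pt = GaussSmooth.At.Path.point≤B 0≤1 j B≤ 0ℚ 1ℚ 0≤1 ≤-refl
      lower : ∀ z → ∣ z ∣ ≤ 1ℚ → ½ ≤ G z
      lower z z≤1 = ≤-trans (by (gap (sqh-mono {z} {1ℚ} z≤1)) (trans (ring 3 (λ m z i → con 1ℚ :- m :* (z :* i) := con 1ℚ :- i :* m :* z) (ι M) (sqh z) i)
            (trans (cong (λ x → 1ℚ - x * sqh z) iM) (ring 1 (λ z → con 1ℚ :- con 1ℚ :* z := con ½ :+ (con ½ :- z)) (sqh z)))))
          (1-nx≤ (0≤* (0≤sqh z) 0≤i) (≤-trans (*-monoʳ 0≤i (sqh≤M {z} z≤1)) (≤-reflexive (trans (*-comm (ι M) i) iM))) M)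
      l , _ = increment 0ℚ 1ℚ ½ 1ℚ 0≤1 0≤1 ≤-refl (λ n n≤M → lower (0ℚ + ι n * (1ℚ * i)) (pt n n≤M))
                (λ n n≤M → G≤1 {0ℚ + ι n * (1ℚ * i)} (sqh≤M {0ℚ + ι n * (1ℚ * i)} (pt n n≤M)))
  in begin
    ½                                              ≡⟨ refl ⟩
    1ℚ * ½                                         ≤⟨ l ⟩
    Ψ K₁ (0ℚ + 1ℚ) - Ψ K₁ 0ℚ + Cˢ * i              ≡⟨ cong₂ (λ u w → Ψ K₁ u - w + Cˢ * i) (+-identityˡ 1ℚ) (Gs-0 (suc K₁)) ⟩
    Ψ K₁ 1ℚ - 0ℚ + Cˢ * i                          ≤⟨ +-mono-≤ (≤-reflexive (ring 1 (λ x → x :- con 0ℚ := x) (Ψ K₁ 1ℚ))) small ⟩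
    Ψ K₁ 1ℚ + ε                                    ∎
  where
  open ≤-Reasoning
  0≤Cˢ : 0ℚ ≤ (1ℚ + 1ℚ) * ExpPower.Cᵉ (0≤sqh 1ℚ) + GaussSmooth.C₁ 0≤1 * ((1ℚ + 1ℚ) * (1ℚ + 1ℚ))
  0≤Cˢ = 0≤-+ (0≤* (0≤-+ 0≤1 0≤1) (ExpPower.0≤Cᵉ (0≤sqh 1ℚ))) (0≤* (GaussSmooth.0≤C₁ 0≤1) (0≤sq (1ℚ + 1ℚ)))

-- The normal distribution function

gaussTerm-bound : ∀ {B q} → ∣ q ∣ ≤ B → ∀ j → ∣ gaussTerm q j ∣ ≤ B * expTerm (sqh B) j
gaussTerm-bound {B} {q} q≤B j = ≤-trans
  (∣*∣ {q * expTerm (- sqh q) j} {inv (j ℕ.+ j)}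
    (∣*∣ {q} {expTerm (- sqh q) j} q≤B (expTerm-bound (∣neg∣ {sqh q} (∣≥0∣ (0≤sqh q) (sqh-mono {q} q≤B))) j))
    (∣≥0∣ (0≤inv (j ℕ.+ j)) inv≤1))
  (≤-reflexive (*-identityʳ (B * expTerm (sqh B) j)))
  where
  inv≤1 : inv (j ℕ.+ j) ≤ 1ℚ
  inv≤1 = ≤-trans (≤-trans (≤-reflexive (sym (*-identityʳ (inv (j ℕ.+ j))))) (*-monoˡ (0≤inv (j ℕ.+ j)) (ι-mono {1} {suc (j ℕ.+ j)} (ℕ.s≤s ℕ.z≤n)))) (≤-reflexive (inv*ι (j ℕ.+ j)))

gaussSum-tail : ∀ {B q} → ∣ q ∣ ≤ B → ∀ {i j} → i ℕ.≤′ j → ∣ gaussSum q j - gaussSum q i ∣ ≤ B * (expSum (sqh B) j - expSum (sqh B) i)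
gaussSum-tail {B} {q} q≤B {i} ℕ.≤′-refl = ≤-trans (∣refl∣ (gaussSum q i)) (≤-reflexive (ring 2 (λ B e → con 0ℚ := B :* (e :- e)) B (expSum (sqh B) i)))
gaussSum-tail {B} {q} q≤B {i} (ℕ.≤′-step {n = j} i≤j) = ≤-trans
  (≤-reflexive (cong ∣_∣ (ring 3 (λ a b c → a :+ b :- c := (a :- c) :+ b) (gaussSum q j) (gaussTerm q j) (gaussSum q i))))
  (≤-trans (∣+∣ {gaussSum q j - gaussSum q i} (gaussSum-tail q≤B i≤j) (gaussTerm-bound q≤B j))
    (≤-reflexive (ring 4 (λ B e t s → B :* (e :- s) :+ B :* t := B :* (e :+ t :- s)) B (expSum (sqh B) j) (expTerm (sqh B) j) (expSum (sqh B) i))))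

Gs-lip : ∀ {B} → 0ℚ ≤ B → ∀ ε → 0ℚ < ε → Eventually λ k → ∀ x y → ∣ x ∣ ≤ B → ∣ y ∣ ≤ B → ∣ Gs k x - Gs k y ∣ ≤ ∣ x - y ∣ + ε
Gs-lip 0≤B ε 0<ε = map-eventually (Gs-increment 0≤B ε 0<ε) λ k h x y x≤B y≤B →
  [ (λ x≤y → let a , b = h x y x≤B y≤B x≤y in ordered k x y (p≤∣p∣′ x y) a b)
  , (λ y≤x → let a , b = h y x y≤B x≤B y≤x in ∣flip∣ {Gs k y} {Gs k x} (subst (λ z → ∣ Gs k y - Gs k x ∣ ≤ z + ε) (∣p-q∣≡∣q-p∣ y x) (ordered k y x (p≤∣p∣′ y x) a b))) ]′ (≤-total x y)
  where
  p≤∣p∣′ : ∀ x y → y - x ≤ ∣ x - y ∣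
  p≤∣p∣′ x y = ≤-trans (p≤∣p∣ (y - x)) (≤-reflexive (∣p-q∣≡∣q-p∣ y x))
  ordered : ∀ k x y → y - x ≤ ∣ x - y ∣ → Gs k x ≤ Gs k y + ε → Gs k y ≤ Gs k x + (y - x) + ε → ∣ Gs k x - Gs k y ∣ ≤ ∣ x - y ∣ + ε
  ordered k x y d≤ h₁ h₂ = ∣p-q∣≤r {Gs k x} {Gs k y}
    (≤-trans h₁ (+-monoʳ-≤ (Gs k y) (p≤q+p (0≤∣p∣ (x - y)))))
    (≤-trans h₂ (≤-trans (≤-reflexive (+-assoc (Gs k x) (y - x) ε)) (+-monoʳ-≤ (Gs k x) (+-monoˡ-≤ ε d≤))))

Gs-stable : ∀ {B} → 0ℚ ≤ B → ∀ ε → 0ℚ < ε → ∃[ N ] ∀ i j → N ℕ.≤ i → i ℕ.≤ j → ∀ x → ∣ x ∣ ≤ B → ∣ Gs i x - Gs j x ∣ ≤ ε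
Gs-stable {B} 0≤B ε 0<ε =
  let N₁ , h₁ = eventually-small (B * C) (0≤* 0≤B 0≤C) ε 0<ε
  in N ℕ.⊔ N₁ , λ i j N≤i i≤j x x≤B → ∣flip∣ {Gs j x} {Gs i x} (≤-trans (gaussSum-tail {B} {x} x≤B (ℕ.≤⇒≤′ (ℕ.s≤s i≤j)))
       (≤-trans (*-monoˡ 0≤B (tail (ℕ.≤-trans (ℕ.m≤m⊔n N N₁) N≤i) i≤j))
         (≤-trans (≤-reflexive (sym (*-assoc B C (inv i)))) (h₁ i (ℕ.≤-trans (ℕ.m≤n⊔m N N₁) N≤i)))))
  where open ExpTail (0≤sqh B) using (N; C; 0≤C; tail)

third : ℚ
third = inv 2

0<third : ∀ {ε} → 0ℚ < ε → 0ℚ < third * ε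
0<third = 0<* (0<inv 2)

thirds : ∀ ε → third * ε + third * ε + third * ε ≡ ε
thirds ε = trans (ring 2 (λ t e → t :* e :+ t :* e :+ t :* e := (t :+ t :+ t) :* e) third ε) (*-identityˡ ε)

Gs-cauchy : ∀ {f} → IsCauchy f → IsCauchy (λ k → Gs k (f k))
Gs-cauchy {f} cf ε 0<ε =
  let B , 0<B , f≤B = cauchy⇒bounded {f} cf
      N₁ , h₁ = Gs-lip (<⇒≤ 0<B) (third * ε) (0<third 0<ε)
      N₂ , h₂ = Gs-stable (<⇒≤ 0<B) (third * ε) (0<third 0<ε)
      N₃ , h₃ = cf (third * ε) (0<third 0<ε)
      N = N₁ ℕ.⊔ (N₂ ℕ.⊔ N₃)
      ordered : ∀ i j → N ℕ.≤ i → i ℕ.≤ j → ∣ Gs i (f i) - Gs j (f j) ∣ ≤ ε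
      ordered i j N≤i i≤j =
        let N₁≤i , r = both {N₁} N≤i
            N₂≤i , N₃≤i = both {N₂} r
        in ≤-trans (∣sum∣ {Gs i (f i)} {Gs i (f j)} {Gs j (f j)} (h₁ i N₁≤i (f i) (f j) (f≤B i) (f≤B j)) (h₂ i j N₂≤i i≤j (f j) (f≤B j)))
             (≤-trans (+-monoˡ-≤ (third * ε) (+-monoˡ-≤ (third * ε) (h₃ i j N₃≤i (ℕ.≤-trans N₃≤i i≤j)))) (≤-reflexive (thirds ε)))
  in N , λ i j N≤i N≤j → [ ordered i j N≤i , (λ j≤i → ∣flip∣ {Gs j (f j)} {Gs i (f i)} (ordered j i N≤j j≤i)) ]′ (ℕ.≤-total i j)

Ψᴿ : ℝ → ℝ
approx (Ψᴿ x) k = Gs k (approx x k)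
cauchy (Ψᴿ x)   = Gs-cauchy {approx x} (cauchy x)

inv-anti : ∀ {m n} → m ℕ.≤ n → inv n ≤ inv m
inv-anti {m} {n} m≤n = *-cancelˡ {inv n} {inv m} {ι (suc n)} (0<ι n) (≤-trans (≤-reflexive (trans (*-comm (ι (suc n)) (inv n)) (trans (inv*ι n) (sym (trans (*-comm (ι (suc m)) (inv m)) (inv*ι m))))))
  (*-monoʳ (0≤inv m) (ι-mono (ℕ.s≤s m≤n))))

-- The limit of Gs k at infinity, approximated at the points n + 16 in order to stay away from 0.
module Total where

  abstract
    index : ℕ → ℕ
    index n = proj₁ (Gs-cauchy {λ _ → ι (16 ℕ.+ n)} (cauchy (fromℚ (ι (16 ℕ.+ n)))) (inv (16 ℕ.+ n)) (0<inv (16 ℕ.+ n)))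

    I : ℕ → ℚ
    I n = Gs (index n) (ι (16 ℕ.+ n))

    I-approx : ∀ n k → index n ℕ.≤ k → ∣ Gs k (ι (16 ℕ.+ n)) - I n ∣ ≤ inv (16 ℕ.+ n)
    I-approx n k h = proj₂ (Gs-cauchy {λ _ → ι (16 ℕ.+ n)} (cauchy (fromℚ (ι (16 ℕ.+ n)))) (inv (16 ℕ.+ n)) (0<inv (16 ℕ.+ n))) k (index n) h ℕ.≤-refl

  extract : ∀ {P : ℕ → Set} {Q : Set} → Eventually P → (∀ k → P k → Q) → Q
  extract (N , p) f = f N (p N ℕ.≤-refl)

  near : ∀ n m → n ℕ.≤ m → Eventually λ k → ∣ Gs k (ι n) - Gs k (ι m) ∣ ≤ ι 65 * inv n
  near n m n≤m = map-eventually (both-eventually (Gs-increment {ι m} (0≤ι m) (inv n) (0<inv n)) (Gs-tail n (m ℕ.∸ n) (inv n) (0<inv n))) (λ k → λ { (h₁ , h₂) → ∣p-q∣≤r {Gs k (ι n)} {Gs k (ι m)}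
        (≤-trans (proj₁ (h₁ (ι n) (ι m) (∣≥0∣ (0≤ι n) (ι-mono n≤m)) (∣∣-self (0≤ι m)) (ι-mono n≤m)))
          (+-monoʳ-≤ (Gs k (ι m)) (by (0≤* (0≤ι 64) (0≤inv n)) (ring 1 (λ i → con (ι 65) :* i := i :+ con (ι 64) :* i) (inv n)))))
        (≤-trans (subst (λ z → Gs k (ι z) ≤ Gs k (ι n) + ι 64 * (inv n - inv z) + inv n) (ℕ.m∸n+n≡m n≤m) h₂)
          (by (0≤* (0≤ι 64) (0≤inv m)) (ring 3 (λ g i j → g :+ con (ι 65) :* i := g :+ con (ι 64) :* (i :- j) :+ i :+ con (ι 64) :* j) (Gs k (ι n)) (inv n) (inv m)))) })

  I-close : ∀ n m → n ℕ.≤ m → ∣ I n - I m ∣ ≤ ι 67 * inv n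
  I-close n m n≤m = extract (both-eventually (near (16 ℕ.+ n) (16 ℕ.+ m) (ℕ.+-monoʳ-≤ 16 n≤m)) (index n ℕ.⊔ index m , λ k h → h)) λ k → λ { (h , N≤k) →
    ≤-trans (∣sum∣ {I n} {Gs k (ι (16 ℕ.+ n))} {I m} (∣flip∣ {Gs k (ι (16 ℕ.+ n))} {I n} (I-approx n k (ℕ.≤-trans (ℕ.m≤m⊔n (index n) (index m)) N≤k)))
        (∣sum∣ {Gs k (ι (16 ℕ.+ n))} {Gs k (ι (16 ℕ.+ m))} {I m} h (I-approx m k (ℕ.≤-trans (ℕ.m≤n⊔m (index n) (index m)) N≤k))))
      (≤-trans (+-mono-≤ inv≤ (+-mono-≤ (*-monoˡ (0≤ι 65) inv≤) (≤-trans (inv-anti (ℕ.+-monoʳ-≤ 16 n≤m)) inv≤)))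
        (≤-reflexive (ring 1 (λ i → i :+ (con (ι 65) :* i :+ i) := con (ι 67) :* i) (inv n)))) }
    where
    inv≤ : inv (16 ℕ.+ n) ≤ inv n
    inv≤ = inv-anti (ℕ.m≤n+m n 16)

  I-cauchy : IsCauchy I
  I-cauchy ε 0<ε =
    let N , h = eventually-small (ι 67) (0≤ι 67) ε 0<ε
    in N , λ i j N≤i N≤j → [ (λ i≤j → ≤-trans (I-close i j i≤j) (h i N≤i)) , (λ j≤i → ∣flip∣ {I j} {I i} (≤-trans (I-close j i j≤i) (h j N≤j))) ]′ (ℕ.≤-total i j)

  ¼ : ℚ
  ¼ = ½ * ½

  ¼≤I : ∀ n → ¼ ≤ I n
  ¼≤I n = extract (both-eventually (Gs-1 (inv 16) (0<inv 16)) (both-eventually (Gs-increment {ι (16 ℕ.+ n)} (0≤ι (16 ℕ.+ n)) (inv 16) (0<inv 16)) (index n , λ k h → h))) λ k → λ { (h₁ , h₂ , N≤k) →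
    let 1≤ = ι-mono {1} {16 ℕ.+ n} (ℕ.s≤s ℕ.z≤n)
        a = proj₁ (h₂ 1ℚ (ι (16 ℕ.+ n)) (∣≥0∣ 0≤1 1≤) (∣∣-self (0≤ι (16 ℕ.+ n))) 1≤)
        b = proj₁ (∣∣-≤ {Gs k (ι (16 ℕ.+ n)) - I n} (≤-trans (I-approx n k N≤k) (inv-anti (ℕ.m≤m+n 16 n))))
    -- The errors in `Gs-1`, in the monotonicity and in `I` are at most 1/17 each, and ½ - 3/17
    -- exceeds ¼.
    in by (0≤-+ (0≤-+ (gap h₁) (gap a)) (0≤-+ (gap b) (nonNegative⁻¹ (½ - ¼ - inv 16 - inv 16 - inv 16))))
         (ring 3 (λ I g x → I := con ¼ :+ ((x :+ con (inv 16) :- con ½) :+ (g :+ con (inv 16) :- x) :+ (con (inv 16) :- (g :- I) :+ (con ½ :- con ¼ :- con (inv 16) :- con (inv 16) :- con (inv 16))))) (I n) (Gs k (ι (16 ℕ.+ n))) (Gs k 1ℚ)) }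

  -- By oddness the Gaussian mass of the whole line is twice the limit of `I`.
  c : ℕ → ℚ
  c n = (I n + I n) ⁻¹

  0<2I : ∀ n → 0ℚ < I n + I n
  0<2I n = <-≤-trans (positive⁻¹ ½) (+-mono-≤ (¼≤I n) (¼≤I n))

  0<c : ∀ n → 0ℚ < c n
  0<c n = ⁻¹-pos (0<2I n)

  0≤c : ∀ n → 0ℚ ≤ c n
  0≤c n = <⇒≤ (0<c n)

  c≤2 : ∀ n → c n ≤ ι 2
  c≤2 n = ≤-trans (⁻¹-anti {½} (positive⁻¹ ½) (+-mono-≤ (¼≤I n) (¼≤I n))) (≤-reflexive (sym (⁻¹-unique {½} {ι 2} (positive⁻¹ ½) refl)))

  cI : ∀ n → c n * I n ≡ ½
  cI n = trans (ring 2 (λ c i → c :* i := con ½ :* ((i :+ i) :* c)) (c n) (I n)) (trans (cong (½ *_) (*-⁻¹ (0<2I n))) (*-identityʳ ½))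

  c-cauchy : IsCauchy c
  c-cauchy ε 0<ε =
    let N , h = I-cauchy (inv 7 * ε) (0<* (0<inv 7) 0<ε)
    in N , λ i j N≤i N≤j → begin
      ∣ c i - c j ∣
        ≡⟨ cong ∣_∣ (trans (⁻¹-difference (0<2I i) (0<2I j)) (ring 4 (λ a b x y → a :* b :* (y :+ y :- (x :+ x)) := a :* b :* ((y :- x) :+ (y :- x))) (c i) (c j) (I i) (I j))) ⟩
      ∣ c i * c j * ((I j - I i) + (I j - I i)) ∣
        ≤⟨ ∣*∣ {c i * c j} {(I j - I i) + (I j - I i)} (∣*∣ {c i} {c j} (∣≥0∣ (0≤c i) (c≤2 i)) (∣≥0∣ (0≤c j) (c≤2 j))) (∣+∣ {I j - I i} {I j - I i} (h j i N≤j N≤i) (h j i N≤j N≤i)) ⟩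
      ι 2 * ι 2 * (inv 7 * ε + inv 7 * ε)
        ≡⟨ trans (ring 2 (λ t e → con (ι 2) :* con (ι 2) :* (t :* e :+ t :* e) := t :* con (ι 8) :* e) (inv 7) ε) (trans (cong (_* ε) (inv*ι 7)) (*-identityˡ ε)) ⟩
      ε ∎
    where open ≤-Reasoning

  cᴿ : ℝ
  approx cᴿ = c
  cauchy cᴿ = c-cauchy

  Φ : ℝ → ℝ
  Φ x = fromℚ ½ +ᴿ cᴿ *ᴿ Ψᴿ x

  -- 134 inv m is small; beyond M, the function Gs k is close to I k.
  saturation : ∀ ε → 0ℚ < ε → ∃[ m ] ∀ B → Eventually λ k → ∀ x → ι m ≤ x → x ≤ B → ∣ Gs k x - I k ∣ ≤ ε
  saturation ε 0<ε =
    let m , small = eventually-small (ι 134) (0≤ι 134) ε 0<ε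
        M = 16 ℕ.+ m
    in M , λ B → let b , B≤b = archimedean B
                     N = M ℕ.+ b
                     M≤N = ℕ.m≤m+n M b
                     x≤N : ∀ x → x ≤ B → x ≤ ι N
                     x≤N x x≤B = ≤-trans x≤B (≤-trans B≤b (ι-mono (ℕ.m≤n+m b M)))
       in map-eventually
          (both-eventually (Gs-increment {ι N} (0≤ι N) (inv M) (0<inv M))
            (both-eventually (near M N M≤N) (both-eventually (index m , λ k h → h) (m , λ k h → h))))
          (λ k → λ { (inc , nr , idx , m≤k) x M≤x x≤B →
            let N≥x = x≤N x x≤B
                0≤x = ≤-trans (0≤ι M) M≤x
                absx = ∣≥0∣ 0≤x N≥x
                lo = proj₁ (inc (ι M) x (∣≥0∣ (0≤ι M) (≤-trans M≤x N≥x)) absx M≤x)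
                hi = proj₁ (inc x (ι N) absx (∣∣-self (0≤ι N)) N≥x)
                nr′ = proj₂ (∣∣-≤ {Gs k (ι M) - Gs k (ι N)} nr)
                closeM : ∣ Gs k x - Gs k (ι M) ∣ ≤ ι 66 * inv M
                closeM = ∣p-q∣≤r {Gs k x} {Gs k (ι M)}
                  (by (0≤-+ (gap hi) (gap nr′)) (ring 4 (λ x g h i → g :+ con (ι 66) :* i := x :+ (h :+ i :- x :+ (con (ι 65) :* i :- :- (g :- h)))) (Gs k x) (Gs k (ι M)) (Gs k (ι N)) (inv M)))
                  (≤-trans lo (+-monoʳ-≤ (Gs k x) (by (0≤* (0≤ι 65) (0≤inv M)) (ring 1 (λ i → con (ι 66) :* i := i :+ con (ι 65) :* i) (inv M)))))
            in ≤-trans (∣sum∣ {Gs k x} {Gs k (ι M)} {I k} closeM (∣sum∣ {Gs k (ι M)} {I m} {I k} (I-approx m k idx) (I-close m k m≤k)))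
                 (≤-trans (+-mono-≤ (*-monoˡ (0≤ι 66) (inv≤ {m})) (+-monoˡ-≤ (ι 67 * inv m) (inv≤ {m})))
                   (≤-trans (≤-reflexive (ring 1 (λ i → con (ι 66) :* i :+ (i :+ con (ι 67) :* i) := con (ι 134) :* i) (inv m))) (small m ℕ.≤-refl))) })
    where
    inv≤ : ∀ {m} → inv (16 ℕ.+ m) ≤ inv m
    inv≤ {m} = inv-anti (ℕ.m≤n+m m 16)

≤ᴿ-trans : ∀ {x y z} → x ≤ᴿ y → y ≤ᴿ z → x ≤ᴿ z
≤ᴿ-trans {x} {y} {z} x≤y y≤z ε 0<ε = map-eventually (both-eventually (x≤y (½ * ε) (halve 0<ε)) (y≤z (½ * ε) (halve 0<ε)))
  λ k → λ { (h₁ , h₂) → ≤-trans h₁ (≤-trans (+-monoˡ-≤ (½ * ε) h₂) (≤-reflexive (trans (+-assoc (approx z k) (½ * ε) (½ * ε)) (cong (approx z k +_) (½+½ ε))))) }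

-- Riemann sums of the Gaussian density

density : ℝ → ℝ
density t = Total.cᴿ *ᴿ exp (-ᴿ (fromℚ ½ *ᴿ (t *ᴿ t)))

RiemannSum-≤ : ∀ {f δ a b s} → RiemannSum f δ a b s → a ≤ᴿ b
RiemannSum-≤ (end (a≤b , _))                              = a≤b
RiemannSum-≤ {a = a} {b} (cell {c = e} t a≤t t≤e _ rest) = ≤ᴿ-trans {a} {t} {b} a≤t (≤ᴿ-trans {t} {e} {b} t≤e (RiemannSum-≤ rest))

module Integral (B₀ : ℚ) (0≤B₀ : 0ℚ ≤ B₀) where
  open Total using (c; 0≤c; c≤2)

  -- The rational approximations of a real number in [- B₀ , B₀] may lie outside, but eventually by
  -- at most 1.
  B : ℚ
  B = B₀ + 1ℚ

  0≤B : 0ℚ ≤ B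
  0≤B = 0≤-+ 0≤B₀ 0≤1

  open ExpTail (0≤sqh B) using (cap; N; 0≤capN; sum≤capN)

  C₁ Lφ Kᴿ : ℚ
  C₁ = ½ * B * cap N
  Lφ = B * cap N
  Kᴿ = ι 2 * (C₁ + Lφ)

  0≤C₁ : 0ℚ ≤ C₁
  0≤C₁ = 0≤* (0≤* (<⇒≤ (positive⁻¹ ½)) 0≤B) 0≤capN
  0≤Lφ : 0ℚ ≤ Lφ
  0≤Lφ = 0≤* 0≤B 0≤capN
  0≤Kᴿ : 0ℚ ≤ Kᴿ
  0≤Kᴿ = 0≤* (0≤ι 2) (0≤-+ 0≤C₁ 0≤Lφ)

  E : ℕ → ℚ → ℚ
  E k t = expSum (- (½ * (t * t))) (suc k)

  E-lip : ∀ k {a t} → ∣ a ∣ ≤ B → ∣ t ∣ ≤ B → ∣ E k a - E k t ∣ ≤ Lφ * ∣ a - t ∣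
  E-lip k {a} {t} a≤B t≤B = begin
    ∣ E k a - E k t ∣
      ≤⟨ expSum-lipschitz {sqh B} { - sqh a} { - sqh t} (∣neg∣ {sqh a} (∣≥0∣ (0≤sqh a) (sqh-mono {a} a≤B))) (∣neg∣ {sqh t} (∣≥0∣ (0≤sqh t) (sqh-mono {t} t≤B))) k ⟩
    ∣ - sqh a - - sqh t ∣ * expSum (sqh B) k
      ≤⟨ *-mono-≤ (ExpTail.expSum-nonNeg (0≤sqh B) k) (0≤* 0≤B (0≤∣p∣ (a - t)))
           (≤-trans (≤-reflexive (cong ∣_∣ (ring 2 (λ a t → :- (con ½ :* (a :* a)) :- :- (con ½ :* (t :* t)) := :- (con ½ :* (a :+ t) :* (a :- t))) a t)))
             (∣neg∣ {½ * (a + t) * (a - t)} (∣*∣ {½ * (a + t)} {a - t} (≤-trans (∣*∣ {½} {a + t} {½} ≤-refl (∣+∣ {a} {t} a≤B t≤B)) (≤-reflexive (ring 1 (λ B → con ½ :* (B :+ B) := B) B))) ≤-refl)))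
           (sum≤capN k) ⟩
    B * ∣ a - t ∣ * cap N
      ≡⟨ ring 3 (λ B x c → B :* x :* c := B :* c :* x) B ∣ a - t ∣ (cap N) ⟩
    Lφ * ∣ a - t ∣ ∎
    where open ≤-Reasoning

  -- Inequalities between reals hold for the `k`-th approximations only up to a slack `σ`, so
  -- `e - a` may even be negative. The errors `Kᴿ * δ * d` of the cells add up to a multiple of the
  -- length of the interval; the others are made small through `σ`.
  module CellBound (k : ℕ) (a t e δ σ : ℚ) (0≤δ : 0ℚ ≤ δ) (0≤σ : 0ℚ ≤ σ) (σ≤1 : σ ≤ 1ℚ) (a≤B : ∣ a ∣ ≤ B) (t≤B : ∣ t ∣ ≤ B) (e≤B : ∣ e ∣ ≤ B)
      (a≤t : a ≤ t + σ) (t≤e : t ≤ e + σ) (e-a≤ : e - a ≤ δ + σ) where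

    d : ℚ
    d = e - a

    Q : ℚ
    Q = ι 6 * B + ι 4 * δ + ι 12

    ∣d∣≤δ : ∣ d ∣ ≤ δ + (σ + σ + σ)
    ∣d∣≤δ = ∣p∣≤q (≤-trans e-a≤ (by (0≤-+ 0≤σ 0≤σ) (ring 2 (λ d s → d :+ (s :+ s :+ s) := d :+ s :+ (s :+ s)) δ σ)))
      (by (0≤-+ (0≤-+ (gap a≤t) (gap t≤e)) (0≤-+ 0≤δ 0≤σ)) (ring 5 (λ a t e s d → d :+ (s :+ s :+ s) := :- (e :- a) :+ (t :+ s :- a :+ (e :+ s :- t) :+ (d :+ s))) a t e σ δ))

    ∣d∣≤d : ∣ d ∣ ≤ d + ι 4 * σ
    ∣d∣≤d = ∣p∣≤q (p≤p+q (0≤* (0≤ι 4) 0≤σ))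
      (by (0≤-+ (0≤-+ (gap a≤t) (gap t≤e)) (0≤-+ (gap a≤t) (gap t≤e))) (ring 4 (λ a t e s → e :- a :+ con (ι 4) :* s := :- (e :- a) :+ (t :+ s :- a :+ (e :+ s :- t) :+ (t :+ s :- a :+ (e :+ s :- t)))) a t e σ))

    ∣a-t∣≤ : ∣ a - t ∣ ≤ δ + (σ + σ + σ)
    ∣a-t∣≤ = ∣p∣≤q (by (0≤-+ (gap a≤t) (0≤-+ 0≤δ (0≤-+ 0≤σ 0≤σ))) (ring 4 (λ a t s d → d :+ (s :+ s :+ s) := a :- t :+ (t :+ s :- a :+ (d :+ (s :+ s)))) a t σ δ))
      (by (0≤-+ (gap t≤e) (0≤-+ (gap e-a≤) 0≤σ)) (ring 5 (λ a t e s d → d :+ (s :+ s :+ s) := :- (a :- t) :+ (e :+ s :- t :+ (d :+ s :- (e :- a) :+ s))) a t e σ δ))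

    d≤2B : d ≤ B + B
    d≤2B = ≤-trans (p≤∣p∣ d) (∣-∣ {e} {a} e≤B a≤B)

    cell-error : ∣ c k * (Gs k e - Gs k a - d * E k t) ∣ ≤ Kᴿ * δ * d + Kᴿ * Q * σ
    cell-error = begin
      ∣ c k * (Gs k e - Gs k a - d * E k t) ∣
        ≤⟨ ∣*∣ {c k} {Gs k e - Gs k a - d * E k t} (∣≥0∣ (0≤c k) (c≤2 k))
             (≤-trans (≤-reflexive (cong ∣_∣ (ring 5 (λ x y d f g → x :- y :- d :* g := (x :- y :- d :* f) :+ d :* (f :- g)) (Gs k e) (Gs k a) d (E k a) (E k t))))
               (∣+∣ {Gs k e - Gs k a - d * E k a} (≤-trans (GaussTaylor.sum-taylor {B} {e} {a} e≤B a≤B k) (*-monoˡ (0≤* (0≤* (<⇒≤ (positive⁻¹ ½)) 0≤B) (0≤sq d)) (sum≤capN k)))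
                 (∣*∣ {d} {E k a - E k t} ≤-refl (≤-trans (E-lip k {a} {t} a≤B t≤B) (*-monoˡ 0≤Lφ ∣a-t∣≤))))) ⟩
      ι 2 * (½ * B * (d * d) * cap N + ∣ d ∣ * (Lφ * D))
        ≡⟨ cong (λ z → ι 2 * (½ * B * z * cap N + ∣ d ∣ * (Lφ * D))) (trans (sym (0≤p⇒∣p∣≡p (0≤sq d))) (∣p*q∣≡∣p∣*∣q∣ d d)) ⟩
      ι 2 * (½ * B * (∣ d ∣ * ∣ d ∣) * cap N + ∣ d ∣ * (Lφ * D))
        ≤⟨ *-monoˡ (0≤ι 2) (+-monoˡ-≤ (∣ d ∣ * (Lφ * D)) (≤-trans (≤-reflexive (ring 3 (λ B d c → con ½ :* B :* (d :* d) :* c := d :* (con ½ :* B :* c :* d)) B ∣ d ∣ (cap N))) (*-monoˡ (0≤∣p∣ d) (*-monoˡ 0≤C₁ ∣d∣≤δ)))) ⟩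
      ι 2 * (∣ d ∣ * (C₁ * D) + ∣ d ∣ * (Lφ * D))
        ≡⟨ ring 4 (λ d C L D → con (ι 2) :* (d :* (C :* D) :+ d :* (L :* D)) := con (ι 2) :* (C :+ L) :* D :* d) ∣ d ∣ C₁ Lφ D ⟩
      Kᴿ * D * ∣ d ∣
        ≤⟨ *-monoˡ (0≤* 0≤Kᴿ (0≤-+ 0≤δ (0≤-+ (0≤-+ 0≤σ 0≤σ) 0≤σ))) ∣d∣≤d ⟩
      Kᴿ * (δ + (σ + σ + σ)) * (d + ι 4 * σ)
        ≤⟨ by (0≤* 0≤Kᴿ (0≤* 0≤σ (0≤-+ (0≤* (0≤ι 3) (gap d≤2B)) (0≤* (0≤ι 12) (gap σ≤1)))))
             (ring 5 (λ K D s d B → K :* D :* d :+ K :* (con (ι 6) :* B :+ con (ι 4) :* D :+ con (ι 12)) :* s := K :* (D :+ (s :+ s :+ s)) :* (d :+ con (ι 4) :* s) :+ K :* (s :* (con (ι 3) :* (B :+ B :- d) :+ con (ι 12) :* (con 1ℚ :- s)))) Kᴿ δ σ d B) ⟩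
      Kᴿ * δ * d + Kᴿ * Q * σ ∎
      where
      open ≤-Reasoning
      D : ℚ
      D = δ + (σ + σ + σ)

  Inside : ℝ → Set
  Inside x = fromℚ (- B₀) ≤ᴿ x × x ≤ᴿ fromℚ B₀

  inside-bound : ∀ x → Inside x → Eventually λ k → ∣ approx x k ∣ ≤ B
  inside-bound x (lo , hi) = map-eventually (both-eventually (lo 1ℚ 0<1) (hi 1ℚ 0<1)) λ k → λ { (h₁ , h₂) →
    ∣p∣≤q h₂ (by (gap h₁) (ring 2 (λ B x → B :+ con 1ℚ := :- x :+ (x :+ con 1ℚ :- :- B)) B₀ (approx x k))) }

  -- Each cell takes half of the remaining `ε` for its slack, which suffices for any number of
  -- cells. The index from which on the bound holds depends on the partition, as `_≤ᴿ_` permits.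
  riemann-error : ∀ δ → 0ℚ ≤ δ → ∀ {a b s} → RiemannSum density δ a b s → fromℚ (- B₀) ≤ᴿ a → b ≤ᴿ fromℚ B₀ →
    ∀ ε → 0ℚ < ε → Eventually λ k →
    ∣ approx s k - c k * (Gs k (approx b k) - Gs k (approx a k)) ∣ ≤ Kᴿ * δ * (approx b k - approx a k) + ε
  riemann-error δ 0≤δ {a} {b} (end (a≤b , b≤a)) lo hi ε 0<ε =
    map-eventually (both-eventually (inside-bound a (lo , ≤ᴿ-trans {a} {b} {fromℚ B₀} a≤b hi)) (both-eventually (inside-bound b (≤ᴿ-trans {fromℚ (- B₀)} {a} {b} lo a≤b , hi))
        (both-eventually (a≤b σ 0<σ) (both-eventually (b≤a σ 0<σ) (Gs-lip 0≤B σ 0<σ))))) λ k → λ { (a≤B , b≤B , h₁ , h₂ , lip) → begin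
    ∣ 0ℚ - c k * (Gs k (approx b k) - Gs k (approx a k)) ∣
      ≡⟨ trans (cong ∣_∣ (ring 1 (λ x → con 0ℚ :- x := :- x) (c k * (Gs k (approx b k) - Gs k (approx a k))))) (∣-p∣≡∣p∣ (c k * (Gs k (approx b k) - Gs k (approx a k)))) ⟩
    ∣ c k * (Gs k (approx b k) - Gs k (approx a k)) ∣
      ≤⟨ ∣*∣ {c k} {Gs k (approx b k) - Gs k (approx a k)} (∣≥0∣ (0≤c k) (c≤2 k)) (≤-trans (lip (approx b k) (approx a k) b≤B a≤B) (+-monoˡ-≤ σ (∣p-q∣≤r {approx b k} {approx a k} h₂ h₁))) ⟩
    ι 2 * (σ + σ)
      ≤⟨ by (0≤* (0≤* 0≤Kᴿ 0≤δ) (gap h₁)) (trans (cong (Kᴿ * δ * (approx b k - approx a k) +_) (sym Qσ))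
           (ring 4 (λ K b a s → K :* (b :- a) :+ (con (ι 4) :+ K) :* s := con (ι 2) :* (s :+ s) :+ K :* (b :+ s :- a)) (Kᴿ * δ) (approx b k) (approx a k) σ)) ⟩
    Kᴿ * δ * (approx b k - approx a k) + ε ∎ }
    where
    open ≤-Reasoning
    Q σ : ℚ
    Q = ι 4 + Kᴿ * δ
    σ = ε * Q ⁻¹
    0<Q : 0ℚ < Q
    0<Q = 0<-+ (0<ι 3) (0≤* 0≤Kᴿ 0≤δ)
    0<σ : 0ℚ < σ
    0<σ = 0<* 0<ε (⁻¹-pos 0<Q)
    Qσ : Q * σ ≡ ε
    Qσ = /-cancel ε 0<Q
  riemann-error δ 0≤δ {a} {b} (cell {c = e} {s = s} t a≤t t≤e e-a≤ rest) lo hi ε 0<ε =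
    map-eventually (both-eventually (riemann-error δ 0≤δ rest loe hi (½ * ε) (halve 0<ε))
        (both-eventually (inside-bound a (lo , ≤ᴿ-trans {a} {t} {fromℚ B₀} a≤t t≤B₀)) (both-eventually (inside-bound t (lot , t≤B₀)) (both-eventually (inside-bound e (loe , e≤B₀))
          (both-eventually (a≤t σ 0<σ) (both-eventually (t≤e σ 0<σ) (e-a≤ σ 0<σ))))))) λ k → λ { (IH , aB , tB , eB , h₁ , h₂ , h₃) →
      let a′ = approx a k ; b′ = approx b k ; e′ = approx e k ; t′ = approx t k
      in begin
      ∣ c k * E k t′ * (e′ - a′) + approx s k - c k * (Gs k b′ - Gs k a′) ∣
        ≡⟨ cong ∣_∣ (ring 7 (λ c f d s x y z → c :* f :* d :+ s :- c :* (x :- y) := (s :- c :* (x :- z)) :- c :* (z :- y :- d :* f)) (c k) (E k t′) (e′ - a′) (approx s k) (Gs k b′) (Gs k a′) (Gs k e′)) ⟩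
      ∣ (approx s k - c k * (Gs k b′ - Gs k e′)) - c k * (Gs k e′ - Gs k a′ - (e′ - a′) * E k t′) ∣
        ≤⟨ ∣-∣ {approx s k - c k * (Gs k b′ - Gs k e′)} {c k * (Gs k e′ - Gs k a′ - (e′ - a′) * E k t′)} IH
             (≤-trans (CellBound.cell-error k a′ t′ e′ δ σ 0≤δ (<⇒≤ 0<σ) σ≤1 aB tB eB h₁ h₂ h₃) (+-monoʳ-≤ (Kᴿ * δ * (e′ - a′)) KQσ≤)) ⟩
      Kᴿ * δ * (b′ - e′) + ½ * ε + (Kᴿ * δ * (e′ - a′) + ½ * ε)
        ≡⟨ ring 5 (λ K b e a x → K :* (b :- e) :+ con ½ :* x :+ (K :* (e :- a) :+ con ½ :* x) := K :* (b :- a) :+ x) (Kᴿ * δ) b′ e′ a′ ε ⟩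
      Kᴿ * δ * (b′ - a′) + ε ∎ }
    where
    open ≤-Reasoning
    lot = ≤ᴿ-trans {fromℚ (- B₀)} {a} {t} lo a≤t
    loe = ≤ᴿ-trans {fromℚ (- B₀)} {t} {e} lot t≤e
    e≤B₀ = ≤ᴿ-trans {e} {b} {fromℚ B₀} (RiemannSum-≤ rest) hi
    t≤B₀ = ≤ᴿ-trans {t} {e} {fromℚ B₀} t≤e e≤B₀
    P Q σ : ℚ
    P = Kᴿ * (ι 6 * B + ι 4 * δ + ι 12)
    Q = P + 1ℚ + ½ * ε
    σ = ½ * ε * Q ⁻¹
    0≤P : 0ℚ ≤ P
    0≤P = 0≤* 0≤Kᴿ (0≤-+ (0≤-+ (0≤* (0≤ι 6) 0≤B) (0≤* (0≤ι 4) 0≤δ)) (0≤ι 12))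
    0<Q : 0ℚ < Q
    0<Q = 0<-+ (<-≤-trans 0<1 (p≤q+p 0≤P)) (<⇒≤ (halve 0<ε))
    0<σ : 0ℚ < σ
    0<σ = 0<* (halve 0<ε) (⁻¹-pos 0<Q)
    σ≤1 : σ ≤ 1ℚ
    σ≤1 = /≤ {1ℚ} {½ * ε} 0<Q (≤-trans (p≤q+p (0≤-+ 0≤P 0≤1)) (≤-reflexive (sym (*-identityˡ Q))))
    KQσ≤ : P * σ ≤ ½ * ε
    KQσ≤ = ≤-trans (*-monoʳ (<⇒≤ 0<σ) (≤-trans (p≤p+q {P} 0≤1) (p≤p+q {P + 1ℚ} (<⇒≤ (halve 0<ε))))) (≤-reflexive (/-cancel (½ * ε) 0<Q))

Φ-integral : ∀ a b → a ≤ᴿ b → HasIntegral density a b (Total.Φ b -ᴿ Total.Φ a)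
Φ-integral a b a≤b ε 0<ε = δ , 0<δ , λ s rs ε′ 0<ε′ →
  map-eventually (riemann-error δ (<⇒≤ 0<δ) rs lo hi ε′ 0<ε′) λ k h → begin
    ∣ approx s k - ((½ + c k * Gs k (approx b k)) - (½ + c k * Gs k (approx a k))) ∣
      ≡⟨ cong ∣_∣ (ring 4 (λ s c x y → s :- ((con ½ :+ c :* x) :- (con ½ :+ c :* y)) := s :- c :* (x :- y)) (approx s k) (c k) (Gs k (approx b k)) (Gs k (approx a k))) ⟩
    ∣ approx s k - c k * (Gs k (approx b k) - Gs k (approx a k)) ∣
      ≤⟨ h ⟩
    Kᴿ * δ * (approx b k - approx a k) + ε′
      ≤⟨ +-monoˡ-≤ ε′ (≤-trans (*-monoˡ (0≤* 0≤Kᴿ (<⇒≤ 0<δ)) (≤-trans (p≤∣p∣ (approx b k - approx a k)) (∣-∣ {approx b k} {approx a k} (b≤ k) (a≤ k))))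
           (≤-trans (≤-reflexive (ring 3 (λ K d x → K :* d :* x := K :* x :* d) Kᴿ δ (Bᵇ + Bᵃ))) (≤-trans (*-monoʳ (<⇒≤ 0<δ) (p≤p+q {Kᴿ * (Bᵇ + Bᵃ)} 0≤1)) (≤-reflexive (/-cancel ε 0<Q))))) ⟩
    ε + ε′ ∎
  where
  open ≤-Reasoning
  open Total using (c)
  ba = cauchy⇒bounded {approx a} (cauchy a)
  bb = cauchy⇒bounded {approx b} (cauchy b)
  Bᵃ Bᵇ B₀ : ℚ
  Bᵃ = proj₁ ba
  Bᵇ = proj₁ bb
  B₀ = Bᵇ + Bᵃ
  0≤Bᵃ = <⇒≤ (proj₁ (proj₂ ba))
  0≤Bᵇ = <⇒≤ (proj₁ (proj₂ bb))
  a≤ = proj₂ (proj₂ ba)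
  b≤ = proj₂ (proj₂ bb)
  0≤B₀ : 0ℚ ≤ B₀
  0≤B₀ = 0≤-+ 0≤Bᵇ 0≤Bᵃ
  open Integral B₀ 0≤B₀
  Q δ : ℚ
  Q = Kᴿ * (Bᵇ + Bᵃ) + 1ℚ
  δ = ε * Q ⁻¹
  0<Q : 0ℚ < Q
  0<Q = <-≤-trans 0<1 (p≤q+p (0≤* 0≤Kᴿ 0≤B₀))
  0<δ : 0ℚ < δ
  0<δ = 0<* 0<ε (⁻¹-pos 0<Q)
  lo : fromℚ (- B₀) ≤ᴿ a
  lo ε 0<ε = 0 , λ k _ → by (0≤-+ (0≤-+ (gap (proj₂ (∣∣-≤ {approx a k} (a≤ k)))) 0≤Bᵇ) (<⇒≤ 0<ε)) (ring 4 (λ a b c e → a :+ e := :- (c :+ b) :+ (b :- :- a :+ c :+ e)) (approx a k) Bᵃ Bᵇ ε)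
  hi : b ≤ᴿ fromℚ B₀
  hi ε 0<ε = 0 , λ k _ → by (0≤-+ (0≤-+ (gap (proj₁ (∣∣-≤ {approx b k} (b≤ k)))) 0≤Bᵃ) (<⇒≤ 0<ε)) (ring 4 (λ b B A e → B :+ A :+ e := b :+ (B :- b :+ A :+ e)) (approx b k) Bᵇ Bᵃ ε)

module Limits (ε : ℚ) (0<ε : 0ℚ < ε) where
  open Total

  m : ℕ
  m = proj₁ (saturation (½ * ε) (halve 0<ε))

  far : ∀ B → Eventually λ k → ∀ x → ι m ≤ x → x ≤ B → ∣ c k * (Gs k x - I k) ∣ ≤ ε
  far B = map-eventually (proj₂ (saturation (½ * ε) (halve 0<ε)) B) λ k h x m≤x x≤B →
    ≤-trans (∣*∣ {c k} {Gs k x - I k} (∣≥0∣ (0≤c k) (c≤2 k)) (h x m≤x x≤B)) (≤-reflexive (ring 1 (λ e → con (ι 2) :* (con ½ :* e) := e) ε))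

  Mᴸ : ℚ
  Mᴸ = ι m + 1ℚ

  upper : ∀ x → fromℚ Mᴸ ≤ᴿ x → ∣ Φ x -ᴿ fromℚ 1ℚ ∣ᴿ ≤ᴿ fromℚ ε
  upper x M≤x ε′ 0<ε′ =
    let B , _ , x≤B = cauchy⇒bounded {approx x} (cauchy x)
    in map-eventually (both-eventually (far B) (M≤x 1ℚ 0<1)) λ k → λ { (h , g) →
      ≤-trans (≤-trans (≤-reflexive (cong ∣_∣ (trans (cong (λ z → ½ + c k * Gs k (approx x k) - (½ + z)) (sym (cI k))) (ring 3 (λ c g i → con ½ :+ c :* g :- (con ½ :+ c :* i) := c :* (g :- i)) (c k) (Gs k (approx x k)) (I k)))))
        (h (approx x k) (by (gap g) (ring 2 (λ m x → x := m :+ (x :+ con 1ℚ :- (m :+ con 1ℚ))) (ι m) (approx x k))) (≤-trans (p≤∣p∣ (approx x k)) (x≤B k)))) (p≤p+q (<⇒≤ 0<ε′)) }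

  -- As `Gs k` is odd and ½ is `c k * I k`, this is the limit at +∞ with the argument negated.
  lower′ : ∀ x → x ≤ᴿ fromℚ (- Mᴸ) → ∣ Φ x ∣ᴿ ≤ᴿ fromℚ ε
  lower′ x x≤M ε′ 0<ε′ =
    let B , _ , x≤B = cauchy⇒bounded {approx x} (cauchy x)
    in map-eventually (both-eventually (far B) (x≤M 1ℚ 0<1)) λ k → λ { (h , g) →
      ≤-trans (≤-trans (≤-reflexive (trans (cong ∣_∣ (trans (cong₂ _+_ (sym (cI k)) (cong (c k *_) (trans (ring 1 (λ g → g := :- :- g) (Gs k (approx x k))) (cong -_ (sym (Gs-odd k (approx x k)))))))
              (ring 3 (λ c g i → c :* i :+ c :* (:- g) := :- (c :* (g :- i))) (c k) (Gs k (- approx x k)) (I k)))) (∣-p∣≡∣p∣ (c k * (Gs k (- approx x k) - I k)))))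
        (h (- approx x k) (by (gap g) (ring 2 (λ m x → :- x := m :+ (:- (m :+ con 1ℚ) :+ con 1ℚ :- x)) (ι m) (approx x k))) (≤-trans (proj₂ (∣∣-≤ {approx x k} ≤-refl)) (x≤B k)))) (p≤p+q (<⇒≤ 0<ε′)) }

Φ-standard : IsStandardNormalCDF Total.Φ
Φ-standard = record
  { c       = Total.cᴿ
  ; density = Φ-integral
  ; at-−∞   = λ ε 0<ε → - Limits.Mᴸ ε 0<ε , Limits.lower′ ε 0<ε
  ; at-+∞   = λ ε 0<ε → Limits.Mᴸ ε 0<ε , Limits.upper ε 0<ε }

-- Square roots

sq-reflects-≤ : ∀ {x y} → 0ℚ ≤ y → x * x ≤ y * y → x ≤ y
sq-reflects-≤ {x} {y} 0≤y h = ≮⇒≥ λ y<x →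
  <-irrefl refl (≤-<-trans (≤-trans h (*-monoˡ 0≤y (<⇒≤ y<x))) (*-monoˡ-<-pos x {{positive (≤-<-trans 0≤y y<x)}} y<x ))

/-ι : ∀ a k → (ℤ.+ a) / suc k ≡ ι a * inv k
/-ι a k = trans (fromℚᵘ-cong {ℚᵘ.mkℚᵘ (ℤ.+ a) k} {ℚᵘ.mkℚᵘ (ℤ.+ a) 0 ℚᵘ.* ℚᵘ.mkℚᵘ (ℤ.+ 1) k} (ℚᵘ.*≡* (cong₂ ℤ._*_ (sym (ℤ.*-identityʳ (ℤ.+ a))) (cong (λ z → ℤ.+ suc z) (ℕ.+-identityʳ k)))))
  (fromℚᵘ-homo-* (ℚᵘ.mkℚᵘ (ℤ.+ a) 0) (ℚᵘ.mkℚᵘ (ℤ.+ 1) k))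

module _ (n : ℕ) where

  private
    j : ℕ → ℕ
    j k = isqrt (n ℕ.* (suc k ℕ.* suc k))

    j≤ : ∀ k → j k ℕ.≤ suc n ℕ.* suc k
    j≤ k = square-reflects-≤ (ℕ.≤-trans (isqrt-lower (n ℕ.* (suc k ℕ.* suc k)))
      (ℕ.≤-trans (ℕ.*-monoˡ-≤ (suc k ℕ.* suc k) (ℕ.≤-trans (ℕ.n≤1+n n) (ℕ.m≤m*n (suc n) (suc n))))
        (ℕ.≤-reflexive (ℕ.[m*n]*[o*p]≡[m*o]*[n*p] (suc n) (suc n) (suc k) (suc k)))))

  √ℕ-spec : ∀ k → 0ℚ ≤ approx (√ℕ n) k × ∣ approx (√ℕ n) k * approx (√ℕ n) k - ι n ∣ ≤ (ι 2 * ι (suc n) + 1ℚ) * inv k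
  √ℕ-spec k = subst (λ r → 0ℚ ≤ r × ∣ r * r - ι n ∣ ≤ (ι 2 * ι (suc n) + 1ℚ) * inv k) (sym (/-ι (j k) k))
    (0≤* (0≤ι (j k)) (0≤inv k) , ∣p-q∣≤r {J * i * (J * i)} {ι n}
      (≤-trans (≤-trans (≤-reflexive (regroup J)) (*-monoˡ (0≤sq i) lo)) (≤-trans (≤-reflexive (n≡)) (p≤p+q (0≤* 0≤c (0≤inv k)))))
      (≤-trans (≤-reflexive (sym n≡)) (≤-trans (*-monoˡ (0≤sq i) hi) (≤-trans (≤-reflexive (ring 2 (λ i j → i :* i :* ((con 1ℚ :+ j) :* (con 1ℚ :+ j)) := j :* i :* (j :* i) :+ i :* i :* (con (ι 2) :* j :+ con 1ℚ)) i J))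
        (+-monoʳ-≤ (J * i * (J * i)) slack)))))
    where
    J i κ : ℚ
    J = ι (j k)
    i = inv k
    κ = ι (suc k)
    iκ : i * κ ≡ 1ℚ
    iκ = inv*ι k
    0≤c : 0ℚ ≤ ι 2 * ι (suc n) + 1ℚ
    0≤c = 0≤-+ (0≤* (0≤ι 2) (0≤ι (suc n))) 0≤1
    regroup : ∀ J → J * i * (J * i) ≡ i * i * (J * J)
    regroup J = ring 2 (λ J i → J :* i :* (J :* i) := i :* i :* (J :* J)) J i
    n≡ : i * i * (ι n * (κ * κ)) ≡ ι n
    n≡ = trans (ring 3 (λ i κ n → i :* i :* (n :* (κ :* κ)) := i :* κ :* (i :* κ) :* n) i κ (ι n))
      (trans (cong (λ z → z * z * ι n) iκ) (trans (cong (_* ι n) (*-identityˡ 1ℚ)) (*-identityˡ (ι n))))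
    ι-nκκ : ι (n ℕ.* (suc k ℕ.* suc k)) ≡ ι n * (κ * κ)
    ι-nκκ = trans (ι-homo-* n (suc k ℕ.* suc k)) (cong (ι n *_) (ι-homo-* (suc k) (suc k)))
    lo : J * J ≤ ι n * (κ * κ)
    lo = subst₂ _≤_ (ι-homo-* (j k) (j k)) ι-nκκ (ι-mono (isqrt-lower (n ℕ.* (suc k ℕ.* suc k))))
    hi : ι n * (κ * κ) ≤ (1ℚ + J) * (1ℚ + J)
    hi = subst₂ _≤_ ι-nκκ (trans (ι-homo-* (suc (j k)) (suc (j k))) (cong₂ _*_ (ι-suc (j k)) (ι-suc (j k)))) (ι-mono (ℕ.<⇒≤ (isqrt-upper (n ℕ.* (suc k ℕ.* suc k)))))
    J≤ : J ≤ ι (suc n) * κ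
    J≤ = ≤-trans (ι-mono (j≤ k)) (≤-reflexive (ι-homo-* (suc n) (suc k)))
    1≤κ : 1ℚ ≤ κ
    1≤κ = ι-mono {1} {suc k} (ℕ.s≤s ℕ.z≤n)
    slack : i * i * (ι 2 * J + 1ℚ) ≤ (ι 2 * ι (suc n) + 1ℚ) * i
    slack = ≤-trans (*-monoˡ (0≤sq i) (+-mono-≤ (*-monoˡ (0≤ι 2) J≤) 1≤κ))
      (≤-reflexive (trans (ring 3 (λ i n κ → i :* i :* (con (ι 2) :* (n :* κ) :+ κ) := (con (ι 2) :* n :+ con 1ℚ) :* (i :* κ) :* i) i (ι (suc n)) κ)
        (cong (_* i) (trans (cong ((ι 2 * ι (suc n) + 1ℚ) *_) iκ) (*-identityʳ (ι 2 * ι (suc n) + 1ℚ))))))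

↥-nonNegative : ∀ p → NonNegative p → ℤ.NonNegative (↥ p)
↥-nonNegative (mkℚ _ _ _) h = h

numerator≡ : ∀ p → 0ℚ ≤ p → p ≡ ι ℤ.∣ ↥ p ∣ * inv (ℚ.denominator-1 p)
numerator≡ p 0≤p = trans (sym (↥p/↧p≡p p)) (trans (cong (λ z → z / ↧ₙ p) (sym (ℤ.0≤i⇒+∣i∣≡i (ℤ.nonNegative⁻¹ (↥ p) {{↥-nonNegative p (nonNegative 0≤p)}}))))
  (/-ι ℤ.∣ ↥ p ∣ (ℚ.denominator-1 p)))

scaled-square : ∀ {p r i N c} → p ≡ N * (i * i) → ∣ r * r - N ∣ ≤ c → ∣ r * i * (r * i) - p ∣ ≤ i * i * c
scaled-square {p} {r} {i} {N} p≡ h = ≤-trans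
  (≤-reflexive (cong ∣_∣ (trans (cong (λ z → r * i * (r * i) - z) p≡) (ring 3 (λ r i n → r :* i :* (r :* i) :- n :* (i :* i) := i :* i :* (r :* r :- n)) r i N))))
  (∣*∣ {i * i} {r * r - N} (∣∣-self (0≤sq i)) h)

module SquareRoot (p : ℚ) (0≤p : 0ℚ ≤ p) where

  a d n : ℕ
  a = ℤ.∣ ↥ p ∣
  d = ℚ.denominator-1 p
  n = a ℕ.* suc d

  i Q : ℚ
  i = inv d
  Q = i * i * (ι 2 * ι (suc n) + 1ℚ)

  0≤Q : 0ℚ ≤ Q
  0≤Q = 0≤* (0≤sq i) (0≤-+ (0≤* (0≤ι 2) (0≤ι (suc n))) 0≤1)

  rearrange : ∀ {a d i} → i * d ≡ 1ℚ → a * d * (i * i) ≡ a * i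
  rearrange {a} {d} {i} id = trans (ring 3 (λ a d i → a :* d :* (i :* i) := a :* i :* (i :* d)) a d i) (trans (cong (a * i *_) id) (*-identityʳ (a * i)))

  p≡ : p ≡ ι n * (i * i)
  p≡ = trans (numerator≡ p 0≤p) (sym (trans (cong (_* (i * i)) (ι-homo-* a (suc d))) (rearrange {ι a} {ι (suc d)} {i} (inv*ι d))))

  bound : ∀ k → 0ℚ ≤ approx (√ℕ n) k * i × ∣ approx (√ℕ n) k * i * (approx (√ℕ n) k * i) - p ∣ ≤ Q * inv k
  bound k = 0≤* (proj₁ (√ℕ-spec n k)) (0≤inv d) ,
    ≤-trans (scaled-square {p} {approx (√ℕ n) k} {i} {ι n} p≡ (proj₂ (√ℕ-spec n k))) (≤-reflexive (sym (*-assoc (i * i) (ι 2 * ι (suc n) + 1ℚ) (inv k))))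

√-approx : ∀ p k → approx (√ p) k ≡ approx (√ℕ (ℤ.∣ ↥ p ∣ ℕ.* suc (ℚ.denominator-1 p))) k * inv (ℚ.denominator-1 p)
√-approx p k = refl

√-spec : ∀ p → 0ℚ ≤ p → ∀ ε → 0ℚ < ε → Eventually λ k → 0ℚ ≤ approx (√ p) k × ∣ approx (√ p) k * approx (√ p) k - p ∣ ≤ ε
√-spec p 0≤p ε 0<ε = map-eventually (eventually-small (SquareRoot.Q p 0≤p) (SquareRoot.0≤Q p 0≤p) ε 0<ε) step
  where
  step : ∀ k → SquareRoot.Q p 0≤p * inv k ≤ ε → 0ℚ ≤ approx (√ p) k × ∣ approx (√ p) k * approx (√ p) k - p ∣ ≤ ε
  step k small = subst (λ r → 0ℚ ≤ r × ∣ r * r - p ∣ ≤ ε) (sym (√-approx p k))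
    (proj₁ (SquareRoot.bound p 0≤p k) , ≤-trans (proj₂ (SquareRoot.bound p 0≤p k)) small)

-- Sums over lists of vectors

∑ : {A : Set} → List A → (A → ℚ) → ℚ
∑ xs f = sumℚ (map f xs)

module _ {A : Set} where

  ∑-ext : ∀ (xs : List A) {f g} → (∀ x → f x ≡ g x) → ∑ xs f ≡ ∑ xs g
  ∑-ext []       h = refl
  ∑-ext (x ∷ xs) h = cong₂ _+_ (h x) (∑-ext xs h)

  ∑-+ : ∀ (xs : List A) f g → ∑ xs (λ x → f x + g x) ≡ ∑ xs f + ∑ xs g
  ∑-+ []       f g = refl
  ∑-+ (x ∷ xs) f g = trans (cong (f x + g x +_) (∑-+ xs f g))
    (ring 4 (λ a b c d → a :+ b :+ (c :+ d) := a :+ c :+ (b :+ d)) (f x) (g x) (∑ xs f) (∑ xs g))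

  ∑-* : ∀ (xs : List A) c f → ∑ xs (λ x → c * f x) ≡ c * ∑ xs f
  ∑-* []       c f = sym (*-zeroʳ c)
  ∑-* (x ∷ xs) c f = trans (cong (c * f x +_) (∑-* xs c f)) (sym (*-distribˡ-+ c (f x) (∑ xs f)))

  ∑-++ : ∀ (xs ys : List A) f → ∑ (xs ++ ys) f ≡ ∑ xs f + ∑ ys f
  ∑-++ []       ys f = sym (+-identityˡ (∑ ys f))
  ∑-++ (x ∷ xs) ys f = trans (cong (f x +_) (∑-++ xs ys f)) (sym (+-assoc (f x) (∑ xs f) (∑ ys f)))

  ∑-map : ∀ {B : Set} (g : B → A) xs f → ∑ (map g xs) f ≡ ∑ xs (f ∘ g)
  ∑-map g []       f = refl
  ∑-map g (x ∷ xs) f = cong (f (g x) +_) (∑-map g xs f)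

  ∑-zero : ∀ (xs : List A) {f} → (∀ x → f x ≡ 0ℚ) → ∑ xs f ≡ 0ℚ
  ∑-zero []       h = refl
  ∑-zero (x ∷ xs) h = trans (cong₂ _+_ (h x) (∑-zero xs h)) (+-identityˡ 0ℚ)

  ∑-mono : ∀ (xs : List A) {f g} → (∀ x → f x ≤ g x) → ∑ xs f ≤ ∑ xs g
  ∑-mono []       h = ≤-refl
  ∑-mono (x ∷ xs) h = +-mono-≤ (h x) (∑-mono xs h)

  ∑-filter : ∀ {P : A → Set} (P? : Decidable P) xs f → ∑ (filter P? xs) f ≡ ∑ xs (λ x → if does (P? x) then f x else 0ℚ)
  ∑-filter P? []       f = refl
  ∑-filter P? (x ∷ xs) f with does (P? x)
  ... | true  = cong (f x +_) (∑-filter P? xs f)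
  ... | false = trans (∑-filter P? xs f) (sym (+-identityˡ _))

∑-product : ∀ {A B C : Set} (h : A → B → C) xs ys f → ∑ (cartesianProductWith h xs ys) f ≡ ∑ xs (λ x → ∑ ys (λ y → f (h x y)))
∑-product h []       ys f = refl
∑-product h (x ∷ xs) ys f = trans (∑-++ (map (h x) ys) (cartesianProductWith h xs ys) f) (cong₂ _+_ (∑-map (h x) ys f) (∑-product h xs ys f))

conv-∑ : ∀ {A : Set} n (xs : List A) (F : A → ℕ → ℕ → ℚ) → conv n (λ a c → ∑ xs (λ x → F x a c)) ≡ ∑ xs (λ x → conv n (F x))
conv-∑ n []       F = conv-0 n
conv-∑ n (x ∷ xs) F = trans (conv-+ n (F x) (λ a c → ∑ xs (λ x → F x a c))) (cong (conv n (F x) +_) (conv-∑ n xs F))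

fac⁻¹ : ℕ → ℚ
fac⁻¹ zero    = 1ℚ
fac⁻¹ (suc n) = fac⁻¹ n * inv n

fac⁻¹-suc : ∀ n → ι (suc n) * fac⁻¹ (suc n) ≡ fac⁻¹ n
fac⁻¹-suc n = trans (ring 3 (λ m f i → m :* (f :* i) := f :* (i :* m)) (ι (suc n)) (fac⁻¹ n) (inv n)) (trans (cong (fac⁻¹ n *_) (inv*ι n)) (*-identityʳ (fac⁻¹ n)))

0<fac⁻¹ : ∀ n → 0ℚ < fac⁻¹ n
0<fac⁻¹ zero    = 0<1
0<fac⁻¹ (suc n) = 0<* (0<fac⁻¹ n) (0<inv n)

0≤fac⁻¹ : ∀ n → 0ℚ ≤ fac⁻¹ n
0≤fac⁻¹ n = <⇒≤ (0<fac⁻¹ n)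

vectorSum : ℕ → ℕ → (List ℕ → ℚ) → ℚ
vectorSum h m G = ∑ (vectors (upTo h) m) (λ v → G (toList v))

-- The exponential generating weight 1 / m! turns the choice of the positions of the zeros into a convolution.
weighted : ℕ → ℕ → (List ℕ → ℚ) → ℚ
weighted h m G = fac⁻¹ m * vectorSum h m G

vectorSum-ext : ∀ h m {F G} → (∀ l → F l ≡ G l) → vectorSum h m F ≡ vectorSum h m G
vectorSum-ext h m e = ∑-ext (vectors (upTo h) m) (λ v → e (toList v))

weighted-ext : ∀ h m {F G} → (∀ l → F l ≡ G l) → weighted h m F ≡ weighted h m G
weighted-ext h m e = cong (fac⁻¹ m *_) (vectorSum-ext h m e)

vectorSum-suc : ∀ h m G → vectorSum h (suc m) G ≡ ∑ (upTo h) (λ x → vectorSum h m (λ l → G (x ∷ l)))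
vectorSum-suc h m G = ∑-product _∷_ (upTo h) (vectors (upTo h) m) (λ v → G (toList v))

upTo-suc : ∀ h → upTo (suc h) ≡ 0 ∷ map suc (upTo h)
upTo-suc h = cong (0 ∷_) (sym (map-upTo suc h))

module Split (b : ℕ) .{{_ : NonTrivial b}} where

  split : ℕ → ℕ → (ℕ → List ℕ → ℚ) → ℚ
  split h m K = weighted (suc h) m (λ l → K (zeros b l) (lower b l))

  -- The first entry is zero or positive. The factor `ι (suc m)` is differentiation of the
  -- exponential generating function with the coefficients `split h m K`.
  split-suc : ∀ h m K → ι (suc m) * split h (suc m) K ≡ split h m (λ a → K (suc a)) + ∑ (upTo h) (λ x → split h m (λ a l → K a (x ∷ l)))
  split-suc h m K = begin
    ι (suc m) * (fac⁻¹ (suc m) * V)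
      ≡⟨ trans (sym (*-assoc (ι (suc m)) (fac⁻¹ (suc m)) V)) (cong (_* V) (fac⁻¹-suc m)) ⟩
    fac⁻¹ m * V
      ≡⟨ cong (fac⁻¹ m *_) (trans (vectorSum-suc (suc h) m (λ l → K (zeros b l) (lower b l)))
           (trans (cong (λ xs → ∑ xs (λ x → vectorSum (suc h) m (λ l → K (zeros b (x ∷ l)) (lower b (x ∷ l))))) (upTo-suc h))
             (cong (vectorSum (suc h) m (λ l → K (suc (zeros b l)) (lower b l)) +_) (∑-map suc (upTo h) (λ x → vectorSum (suc h) m (λ l → K (zeros b (x ∷ l)) (lower b (x ∷ l)))))))) ⟩
    fac⁻¹ m * (V₀ + ∑ (upTo h) V₁)
      ≡⟨ trans (*-distribˡ-+ (fac⁻¹ m) V₀ (∑ (upTo h) V₁)) (cong (fac⁻¹ m * V₀ +_) (sym (∑-* (upTo h) (fac⁻¹ m) V₁))) ⟩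
    split h m (λ a → K (suc a)) + ∑ (upTo h) (λ x → split h m (λ a l → K a (x ∷ l))) ∎
    where
    open ≡-Reasoning
    V V₀ : ℚ
    V  = vectorSum (suc h) (suc m) (λ l → K (zeros b l) (lower b l))
    V₀ = vectorSum (suc h) m (λ l → K (suc (zeros b l)) (lower b l))
    V₁ : ℕ → ℚ
    V₁ x = vectorSum (suc h) m (λ l → K (zeros b l) (x ∷ lower b l))

  convolved : ℕ → ℕ → (ℕ → List ℕ → ℚ) → ℚ
  convolved h m K = conv m (λ a c → fac⁻¹ a * weighted h c (K a))

  -- The product rule for exponential generating functions: `ι (suc m)` is `ι a + ι c`, and each
  -- summand lowers one of the two factorials.
  convolved-suc : ∀ h m K → ι (suc m) * convolved h (suc m) K ≡ convolved h m (λ a → K (suc a)) + ∑ (upTo h) (λ x → convolved h m (λ a l → K a (x ∷ l)))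
  convolved-suc h m K = begin
    ι (suc m) * conv (suc m) F
      ≡⟨ trans (sym (conv-* (suc m) (ι (suc m)) F)) (conv-cong (suc m) λ a c e → trans (cong (λ z → ι z * F a c) (sym e))
           (trans (cong (_* F a c) (ι-homo-+ a c)) (*-distribʳ-+ (F a c) (ι a) (ι c)))) ⟩
    conv (suc m) (λ a c → ι a * F a c + ι c * F a c)
      ≡⟨ conv-+ (suc m) (λ a c → ι a * F a c) (λ a c → ι c * F a c) ⟩
    0ℚ * F 0 (suc m) + conv m (λ a c → ι (suc a) * F (suc a) c) + conv (suc m) (λ a c → ι c * F a c)
      ≡⟨ cong₂ _+_ (trans (cong (_+ conv m (λ a c → ι (suc a) * F (suc a) c)) (*-zeroˡ (F 0 (suc m)))) (trans (+-identityˡ (conv m (λ a c → ι (suc a) * F (suc a) c)))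
             (conv-cong m λ a c _ → trans (sym (*-assoc (ι (suc a)) (fac⁻¹ (suc a)) (weighted h c (K (suc a))))) (cong (_* weighted h c (K (suc a))) (fac⁻¹-suc a)))))
           (trans (conv-snoc m (λ a c → ι c * F a c)) (trans (cong (conv m (λ a c → ι (suc c) * F a (suc c)) +_) (*-zeroˡ (F (suc m) 0)))
             (trans (+-identityʳ (conv m (λ a c → ι (suc c) * F a (suc c)))) (conv-cong m λ a c _ → inner a c)))) ⟩
    convolved h m (λ a → K (suc a)) + conv m (λ a c → ∑ (upTo h) (λ x → fac⁻¹ a * weighted h c (λ l → K a (x ∷ l))))
      ≡⟨ cong (convolved h m (λ a → K (suc a)) +_) (conv-∑ m (upTo h) (λ x a c → fac⁻¹ a * weighted h c (λ l → K a (x ∷ l)))) ⟩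
    convolved h m (λ a → K (suc a)) + ∑ (upTo h) (λ x → convolved h m (λ a l → K a (x ∷ l))) ∎
    where
    open ≡-Reasoning
    F : ℕ → ℕ → ℚ
    F a c = fac⁻¹ a * weighted h c (K a)
    inner : ∀ a c → ι (suc c) * F a (suc c) ≡ ∑ (upTo h) (λ x → fac⁻¹ a * weighted h c (λ l → K a (x ∷ l)))
    inner a c = trans (ring 4 (λ n f g v → n :* (f :* (g :* v)) := f :* (n :* g :* v)) (ι (suc c)) (fac⁻¹ a) (fac⁻¹ (suc c)) (vectorSum h (suc c) (K a)))
      (trans (cong₂ (λ g v → fac⁻¹ a * (g * v)) (fac⁻¹-suc c) (vectorSum-suc h c (K a)))
        (trans (cong (fac⁻¹ a *_) (sym (∑-* (upTo h) (fac⁻¹ c) (λ x → vectorSum h c (λ l → K a (x ∷ l)))))) (sym (∑-* (upTo h) (fac⁻¹ a) (λ x → weighted h c (λ l → K a (x ∷ l)))))))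

  *-cancelˡ-≡ : ∀ n {x y} → ι (suc n) * x ≡ ι (suc n) * y → x ≡ y
  *-cancelˡ-≡ n {x} {y} e = ≤-antisym (*-cancelˡ (0<ι n) (≤-reflexive e)) (*-cancelˡ (0<ι n) (≤-reflexive (sym e)))

  -- Both sides satisfy the same recursion in `m`, which involves all `K` at once.
  split-convolution : ∀ h m K → split h m K ≡ convolved h m K
  split-convolution h zero    K = sym (*-identityˡ (weighted h 0 (K 0)))
  split-convolution h (suc m) K = *-cancelˡ-≡ m (trans (split-suc h m K)
    (trans (cong₂ _+_ (split-convolution h m (λ a → K (suc a))) (∑-ext (upTo h) λ x → split-convolution h m (λ a l → K a (x ∷ l)))) (sym (convolved-suc h m K))))

-- From distribution functions to real thresholds

indicator : ∀ {P : Set} → Dec P → ℚ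
indicator P? = if does P? then 1ℚ else 0ℚ


-- The standardising factor is a real number, so the limit law is stated for every rational `ŵ` near
-- it. The closeness `η₀` is fixed before `n`.
record LimitBound (E : ℕ → (ℕ → ℚ) → ℚ) (m v : ℕ → ℚ) (z ε : ℚ) : Set where
  field
    η₀   : ℚ
    N    : ℕ
    0<η₀ : 0ℚ < η₀
    η₀≤½ : η₀ ≤ ½
    core : ∀ n → N ℕ.≤ n → ∀ ŵ → 0ℚ < ŵ → ∣ ŵ * ŵ * v n - 1ℚ ∣ ≤ η₀ * η₀ →
           Eventually λ k → ∣ E n (λ x → indicator ((ι x - m n) * ŵ ≤? z)) - (½ + Total.c k * Gs k z) ∣ ≤ ε

CentralLimit : (ℕ → (ℕ → ℚ) → ℚ) → (ℕ → ℚ) → (ℕ → ℚ) → Set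
CentralLimit E m v = ∀ z ε → 0ℚ < ε → LimitBound E m v z ε

indicator-mono : ∀ {P Q : Set} (P? : Dec P) (Q? : Dec Q) → (P → Q) → indicator P? ≤ indicator Q?
indicator-mono (yes p) (yes _) f = ≤-refl
indicator-mono (yes p) (no ¬q) f = contradiction (f p) ¬q
indicator-mono (no _)  (yes _) f = 0≤1
indicator-mono (no _)  (no _)  f = ≤-refl


-- A threshold on d W for a real number W is compared with a threshold on d ŵ for a rational ŵ near W.
module Threshold (x W : ℝ) (x̂ ŵ ε d : ℚ) (0<ε : 0ℚ < ε) (K : ℕ)
  (x≈ : ∀ k → K ℕ.≤ k → ∣ approx x k - x̂ ∣ ≤ ε) (W≈ : ∀ k → K ℕ.≤ k → ∣ d * (approx W k - ŵ) ∣ ≤ ε) where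

  threshold⁺ : fromℚ d *ᴿ W ≤ᴿ x → d * ŵ ≤ x̂ + ι 3 * ε
  threshold⁺ h =
    let N , hk = h ε 0<ε
        k = N ℕ.⊔ K
        K≤k = ℕ.m≤n⊔m N K
    in by {d * ŵ} {x̂ + ι 3 * ε} (0≤-+ (0≤-+ (gap (hk k (ℕ.m≤m⊔n N K))) (gap (proj₁ (∣∣-≤ {approx x k - x̂} (x≈ k K≤k))))) (gap (proj₂ (∣∣-≤ {d * (approx W k - ŵ)} (W≈ k K≤k)))))
         (ring 6 (λ d w u x y e → x :+ con (ι 3) :* e := d :* w :+ (y :+ e :- d :* u :+ (e :- (y :- x)) :+ (e :- :- (d :* (u :- w))))) d ŵ (approx W k) x̂ (approx x k) ε)

  threshold⁻ : d * ŵ ≤ x̂ - ι 2 * ε → fromℚ d *ᴿ W ≤ᴿ x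
  threshold⁻ h ε′ 0<ε′ = K , λ k K≤k → by {d * approx W k} {approx x k + ε′}
    (0≤-+ (0≤-+ (gap h) (gap (proj₁ (∣∣-≤ {d * (approx W k - ŵ)} (W≈ k K≤k))))) (0≤-+ (gap (proj₂ (∣∣-≤ {approx x k - x̂} (x≈ k K≤k)))) (<⇒≤ 0<ε′)))
    (ring 7 (λ d w u x y e f → y :+ f := d :* u :+ (x :- con (ι 2) :* e :- d :* w :+ (e :- d :* (u :- w)) :+ (e :- :- (y :- x) :+ f))) d ŵ (approx W k) x̂ (approx x k) ε ε′)

-- Averages over finite lists

rate : {A : Set} → List A → ℚ
rate []       = 0ℚ
rate (_ ∷ xs) = inv (length xs)

0≤rate : ∀ {A : Set} (xs : List A) → 0ℚ ≤ rate xs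
0≤rate []       = ≤-refl
0≤rate (_ ∷ xs) = 0≤inv (length xs)

𝔼-∑ : ∀ {A : Set} (xs : List A) X → 𝔼 xs X ≡ rate xs * ∑ xs X
𝔼-∑ []       X = sym (*-zeroˡ 0ℚ)
𝔼-∑ (x ∷ xs) X = trans (cong (λ k → ∑ (x ∷ xs) X * inv k) (length-map X xs)) (*-comm (∑ (x ∷ xs) X) (inv (length xs)))

∑-1 : ∀ {A : Set} (xs : List A) → ∑ xs (λ _ → 1ℚ) ≡ ι (length xs)
∑-1 []       = refl
∑-1 (x ∷ xs) = trans (cong (1ℚ +_) (∑-1 xs)) (sym (ι-suc (length xs)))

module _ {A : Set} (xs : List A) where

  𝔼-ext : ∀ {X Y} → (∀ x → X x ≡ Y x) → 𝔼 xs X ≡ 𝔼 xs Y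
  𝔼-ext {X} {Y} h = trans (𝔼-∑ xs X) (trans (cong (rate xs *_) (∑-ext xs h)) (sym (𝔼-∑ xs Y)))

  𝔼-+ : ∀ X Y → 𝔼 xs (λ x → X x + Y x) ≡ 𝔼 xs X + 𝔼 xs Y
  𝔼-+ X Y = trans (𝔼-∑ xs (λ x → X x + Y x)) (trans (cong (rate xs *_) (∑-+ xs X Y))
    (trans (*-distribˡ-+ (rate xs) (∑ xs X) (∑ xs Y)) (sym (cong₂ _+_ (𝔼-∑ xs X) (𝔼-∑ xs Y)))))

  𝔼-* : ∀ c X → 𝔼 xs (λ x → c * X x) ≡ c * 𝔼 xs X
  𝔼-* c X = trans (𝔼-∑ xs (λ x → c * X x)) (trans (cong (rate xs *_) (∑-* xs c X))
    (trans (ring 3 (λ r c s → r :* (c :* s) := c :* (r :* s)) (rate xs) c (∑ xs X)) (cong (c *_) (sym (𝔼-∑ xs X)))))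

  𝔼-mono : ∀ {X Y} → (∀ x → X x ≤ Y x) → 𝔼 xs X ≤ 𝔼 xs Y
  𝔼-mono {X} {Y} h = ≤-trans (≤-reflexive (𝔼-∑ xs X)) (≤-trans (*-monoˡ (0≤rate xs) (∑-mono xs h)) (≤-reflexive (sym (𝔼-∑ xs Y))))

rate*length : ∀ {A : Set} {x : A} {xs} → x ∈ xs → rate xs * ι (length xs) ≡ 1ℚ
rate*length {xs = _ ∷ xs} _ = inv*ι (length xs)

sqrt : ∀ q → 0ℚ ≤ q → ∀ ε → 0ℚ < ε → ∃[ ω ] 0ℚ ≤ ω × ∣ ω * ω - q ∣ ≤ ε
sqrt q 0≤q ε 0<ε = let N , h = √-spec q 0≤q ε 0<ε in approx (√ q) N , h N ℕ.≤-refl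


-- Finite measures and renewal processes with rewards

Meas : Set → Set
Meas A = List (ℚ × A)

∫ : {A : Set} → Meas A → (A → ℚ) → ℚ
∫ []            f = 0ℚ
∫ ((p , a) ∷ μ) f = p * f a + ∫ μ f

Positive-on : {A : Set} → (A → Set) → Meas A → Set
Positive-on P = All λ x → 0ℚ ≤ proj₁ x × P (proj₂ x)

module _ {A : Set} where

  ∫-ext : ∀ (μ : Meas A) {f g} → (∀ a → f a ≡ g a) → ∫ μ f ≡ ∫ μ g
  ∫-ext []            h = refl
  ∫-ext ((p , a) ∷ μ) h = cong₂ _+_ (cong (p *_) (h a)) (∫-ext μ h)

  ∫-+ : ∀ (μ : Meas A) f g → ∫ μ (λ a → f a + g a) ≡ ∫ μ f + ∫ μ g
  ∫-+ []            f g = refl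
  ∫-+ ((p , a) ∷ μ) f g = trans (cong (p * (f a + g a) +_) (∫-+ μ f g))
    (ring 5 (λ p x y u v → p :* (x :+ y) :+ (u :+ v) := p :* x :+ u :+ (p :* y :+ v)) p (f a) (g a) (∫ μ f) (∫ μ g))

  ∫-* : ∀ (μ : Meas A) c f → ∫ μ (λ a → c * f a) ≡ c * ∫ μ f
  ∫-* []            c f = sym (*-zeroʳ c)
  ∫-* ((p , a) ∷ μ) c f = trans (cong (p * (c * f a) +_) (∫-* μ c f))
    (ring 4 (λ p c x u → p :* (c :* x) :+ c :* u := c :* (p :* x :+ u)) p c (f a) (∫ μ f))

  ∫-mono : ∀ {P : A → Set} {μ f g} → Positive-on P μ → (∀ a → P a → f a ≤ g a) → ∫ μ f ≤ ∫ μ g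
  ∫-mono []                h = ≤-refl
  ∫-mono {μ = (p , a) ∷ _} ((0≤p , Pa) ∷ ps) h = +-mono-≤ (*-monoˡ 0≤p (h a Pa)) (∫-mono ps h)

  0≤∫ : ∀ {P : A → Set} {μ f} → Positive-on P μ → (∀ a → P a → 0ℚ ≤ f a) → 0ℚ ≤ ∫ μ f
  0≤∫ []                h = ≤-refl
  0≤∫ {μ = (p , a) ∷ _} ((0≤p , Pa) ∷ ps) h = 0≤-+ (0≤* 0≤p (h a Pa)) (0≤∫ ps h)

  ∫-abs : ∀ {P : A → Set} {μ f g} → Positive-on P μ → (∀ a → P a → ∣ f a ∣ ≤ g a) → ∣ ∫ μ f ∣ ≤ ∫ μ g
  ∫-abs []                h = ≤-refl
  ∫-abs {μ = (p , a) ∷ _} {f} ((0≤p , Pa) ∷ ps) h = ∣+∣ {p * f a} (∣*∣ {p} {f a} (∣∣-self 0≤p) (h a Pa)) (∫-abs ps h)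

mass : {A : Set} → Meas A → ℚ
mass μ = ∫ μ λ _ → 1ℚ

∫-const : ∀ {A : Set} (μ : Meas A) c → ∫ μ (λ _ → c) ≡ mass μ * c
∫-const μ c = trans (∫-ext μ λ _ → sym (*-identityʳ c)) (trans (∫-* μ c (λ _ → 1ℚ)) (*-comm c (mass μ)))

-- X n is distributed as d + X t, where a block of length s = n - t and reward d is chosen with weight β s (d) M t,
-- or a last block of length n and reward d with weight e n (d); X 0 = 1.
record Process : Set where
  field
    β e    : ℕ → Meas ℕ
    M      : ℕ → ℚ
    E      : ℕ → (ℕ → ℚ) → ℚ
    E-ext  : ∀ n {f g} → (∀ x → f x ≡ g x) → E n f ≡ E n g
    E-+    : ∀ n f g → E n (λ x → f x + g x) ≡ E n f + E n g
    E-*    : ∀ n c f → E n (λ x → c * f x) ≡ c * E n f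
    S      : ℕ → ℕ
    E-mono : ∀ n {f g} → (∀ x → x ℕ.≤ S n → f x ≤ g x) → E n f ≤ E n g
    E-1    : ∀ n → E n (λ _ → 1ℚ) ≡ 1ℚ
    E-0    : ∀ f → E 0 f ≡ f 1
    E-rec  : ∀ n f → M n * E n f ≡ conv n (λ s t → M t * ∫ (β s) (λ d → E t (λ x → f (d ℕ.+ x)))) + ∫ (e n) (λ d → E 0 (λ x → f (d ℕ.+ x)))
    β-on   : ∀ s → Positive-on (ℕ._≤ s) (β s)
    e-on   : ∀ n → Positive-on (ℕ._≤ n) (e n)
    β0     : β 0 ≡ []
    β1     : ∀ f → ∫ (β 1) f ≡ f 1
    e0     : ∀ f → ∫ (e 0) f ≡ f 0
    B      : ℚ
    β≤B    : ∀ s → mass (β s) ≤ B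
    e≤B    : ∀ n → mass (e n) ≤ B
    L′     : ℕ
    η      : ℚ
    0<η    : 0ℚ < η
    η≤1    : η ≤ 1ℚ
    η≤β    : ∀ f → (∀ d → 0ℚ ≤ f d) → η * f 1 ≤ ∫ (β (suc (suc L′))) f

  renewal : Renewal
  renewal = record
    { b = λ s → mass (β s) ; e = λ n → mass (e n) ; M = M
    ; 0≤b = λ s → 0≤∫ (β-on s) (λ _ _ → 0≤1) ; b0 = cong mass β0 ; b1 = β1 (λ _ → 1ℚ)
    ; B = B ; b≤B = β≤B ; 0≤e = λ n → 0≤∫ (e-on n) (λ _ _ → 0≤1) ; e≤B = e≤B ; e0 = e0 (λ _ → 1ℚ)
    ; M-rec = λ n → trans (trans (sym (*-identityʳ (M n))) (cong (M n *_) (sym (E-1 n)))) (trans (E-rec n (λ _ → 1ℚ))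
        (cong₂ _+_ (conv-cong n λ s t _ → trans (cong (M t *_) (∫-ext (β s) λ _ → E-1 t)) (*-comm (M t) (mass (β s))))
                   (∫-ext (e n) λ _ → E-1 0)))
    ; L′ = L′ ; β = η ; 0<β = 0<η ; β≤1 = η≤1
    ; β≤b = subst (_≤ mass (β (suc (suc L′)))) (*-identityʳ η) (η≤β (λ _ → 1ℚ) (λ _ → 0≤1)) }

-- Mean and variance of a renewal process with rewards

module Steps (𝒫 : Process) where
  open Process 𝒫 public
  open Mixing renewal public
    using (W; 0≤W; 0<M; 0≤M; M0; M-rec; π; 0≤π; ρ; 0≤ρ; w; 0≤w; 1≤w; l; t₀; 0<t₀; t₀≤1; 1<l; Γ; 0≤Γ; 0≤B; 0≤BΓ; γ⁻; 0≤γ⁻; γ⁻<1; γ; 0<γ; D; 0≤D; w⁴; moment; moment₂; ξ; ξ-bound; ρ-diff; κ; 0≤κ; rᴿ; 0≤rᴿ; rᴿ<1; W-decay; p; 0≤p; 1≤p; p-mono; absorb²; ⊔<1; Δ; Settles; L; ⁻¹↑*↑; δ≤ratio)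
    renaming (δ to δ₀; 0<δ to 0<δ₀)

  -- The expectation over the first block, of length `s` and reward `d`, with the length `t`
  -- remaining. A last block of length `n` is treated as one that leads to `t = 0`.
  𝔖 : ℕ → (ℕ → ℕ → ℕ → ℚ) → ℚ
  𝔖 n F = W n * (conv n (λ s t → M t * ∫ (β s) (F s t)) + ∫ (e n) (F n 0))

  E-step : ∀ n f → E n f ≡ 𝔖 n (λ s t d → E t (λ x → f (d ℕ.+ x)))
  E-step n f = trans (sym (trans (ring 3 (λ w m e → w :* (m :* e) := m :* w :* e) (W n) (M n) (E n f))
    (trans (cong (_* E n f) (*-⁻¹ (0<M n))) (*-identityˡ (E n f))))) (cong (W n *_) (E-rec n f))

  𝔖-cong : ∀ n {F G} → (∀ s t d → s ℕ.+ t ≡ n → F s t d ≡ G s t d) → 𝔖 n F ≡ 𝔖 n G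
  𝔖-cong n h = cong (W n *_) (cong₂ _+_ (conv-cong n λ s t s+t≡n → cong (M t *_) (∫-ext (β s) λ d → h s t d s+t≡n))
    (∫-ext (e n) λ d → h n 0 d (ℕ.+-identityʳ n)))

  𝔖-+ : ∀ n F G → 𝔖 n (λ s t d → F s t d + G s t d) ≡ 𝔖 n F + 𝔖 n G
  𝔖-+ n F G = trans (cong (W n *_) (cong₂ _+_
      (trans (conv-cong n λ s t _ → trans (cong (M t *_) (∫-+ (β s) (F s t) (G s t))) (*-distribˡ-+ (M t) (∫ (β s) (F s t)) (∫ (β s) (G s t))))
        (conv-+ n (λ s t → M t * ∫ (β s) (F s t)) (λ s t → M t * ∫ (β s) (G s t))))
      (∫-+ (e n) (F n 0) (G n 0))))
    (ring 5 (λ w a b c d → w :* (a :+ b :+ (c :+ d)) := w :* (a :+ c) :+ w :* (b :+ d)) (W n) (conv n (λ s t → M t * ∫ (β s) (F s t))) (conv n (λ s t → M t * ∫ (β s) (G s t))) (∫ (e n) (F n 0)) (∫ (e n) (G n 0)))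

  𝔖-* : ∀ n c F → 𝔖 n (λ s t d → c * F s t d) ≡ c * 𝔖 n F
  𝔖-* n c F = trans (cong (W n *_) (cong₂ _+_
      (trans (conv-cong n λ s t _ → trans (cong (M t *_) (∫-* (β s) c (F s t))) (ring 3 (λ m c i → m :* (c :* i) := c :* (m :* i)) (M t) c (∫ (β s) (F s t))))
        (conv-* n c (λ s t → M t * ∫ (β s) (F s t))))
      (∫-* (e n) c (F n 0))))
    (ring 4 (λ w c a b → w :* (c :* a :+ c :* b) := c :* (w :* (a :+ b))) (W n) c (conv n (λ s t → M t * ∫ (β s) (F s t))) (∫ (e n) (F n 0)))

  𝔖-1 : ∀ n → 𝔖 n (λ _ _ _ → 1ℚ) ≡ 1ℚ
  𝔖-1 n = trans (sym (trans (E-step n (λ _ → 1ℚ)) (𝔖-cong n λ _ t _ _ → E-1 t))) (E-1 n)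

  𝔖-const : ∀ n c → 𝔖 n (λ _ _ _ → c) ≡ c
  𝔖-const n c = trans (𝔖-cong n λ _ _ _ _ → sym (*-identityʳ c)) (trans (𝔖-* n c (λ _ _ _ → 1ℚ)) (trans (cong (c *_) (𝔖-1 n)) (*-identityʳ c)))

  𝔖-- : ∀ n F G → 𝔖 n (λ s t d → F s t d - G s t d) ≡ 𝔖 n F - 𝔖 n G
  𝔖-- n F G = trans (𝔖-cong n λ s t d _ → ring 2 (λ x y → x :- y := x :+ (:- con 1ℚ) :* y) (F s t d) (G s t d))
    (trans (𝔖-+ n F (λ s t d → (- 1ℚ) * G s t d)) (trans (cong (𝔖 n F +_) (𝔖-* n (- 1ℚ) G))
      (ring 2 (λ x y → x :+ (:- con 1ℚ) :* y := x :- y) (𝔖 n F) (𝔖 n G))))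

  𝔖-mono : ∀ n {F G} → (∀ s t d → suc s ℕ.+ t ≡ suc n → d ℕ.≤ suc s → F (suc s) t d ≤ G (suc s) t d) → 𝔖 (suc n) F ≤ 𝔖 (suc n) G
  𝔖-mono n {F} {G} h = *-monoˡ (0≤W (suc n)) (+-mono-≤
    (+-mono-≤ (≤-reflexive (cong (M (suc n) *_) (trans (cong (λ μ → ∫ μ (F 0 (suc n))) β0) (cong (λ μ → ∫ μ (G 0 (suc n))) (sym β0)))))
      (conv-mono n λ s t e → *-monoˡ (0≤M t) (∫-mono (β-on (suc s)) λ d d≤ → h s t d (cong suc e) d≤)))
    (∫-mono (e-on (suc n)) λ d d≤ → h n 0 d (ℕ.+-identityʳ (suc n)) d≤))

  𝔖-abs : ∀ n {F G} → (∀ s t d → suc s ℕ.+ t ≡ suc n → d ℕ.≤ suc s → ∣ F (suc s) t d ∣ ≤ G (suc s) t d) → ∣ 𝔖 (suc n) F ∣ ≤ 𝔖 (suc n) G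
  𝔖-abs n {F} {G} h = ∣p∣≤q (𝔖-mono n {F} {G} λ s t d e d≤ → proj₁ (∣∣-≤ {F (suc s) t d} (h s t d e d≤)))
    (subst (_≤ 𝔖 (suc n) G) (trans (𝔖-* (suc n) (- 1ℚ) F) (ring 1 (λ x → (:- con 1ℚ) :* x := :- x) (𝔖 (suc n) F)))
      (𝔖-mono n {λ s t d → (- 1ℚ) * F s t d} {G} λ s t d e d≤ → subst (_≤ G (suc s) t d) (ring 1 (λ x → :- x := (:- con 1ℚ) :* x) (F (suc s) t d)) (proj₂ (∣∣-≤ {F (suc s) t d} (h s t d e d≤)))))

  E-const : ∀ n c → E n (λ _ → c) ≡ c
  E-const n c = trans (E-ext n λ _ → sym (*-identityʳ c)) (trans (E-* n c (λ _ → 1ℚ)) (trans (cong (c *_) (E-1 n)) (*-identityʳ c)))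

  m : ℕ → ℚ
  m n = E n ι

  v : ℕ → ℚ
  v n = E n λ x → (ι x - m n) * (ι x - m n)

  -- By how much knowledge of the first block changes the mean.
  δ : ℕ → ℕ → ℕ → ℚ
  δ s t d = ι d + m t - m (s ℕ.+ t)

  E-shift : ∀ t d → E t (λ x → ι (d ℕ.+ x)) ≡ ι d + m t
  E-shift t d = trans (E-ext t λ x → ι-homo-+ d x) (trans (E-+ t (λ _ → ι d) ι) (cong (_+ m t) (E-const t (ι d))))

  m-step : ∀ n → m n ≡ 𝔖 n (λ s t d → ι d + m t)
  m-step n = trans (E-step n ι) (𝔖-cong n λ s t d _ → E-shift t d)

  δ-mean : ∀ n → 𝔖 n δ ≡ 0ℚ
  δ-mean n = trans (𝔖-cong n λ s t d s+t≡n → cong (λ z → ι d + m t - m z) s+t≡n)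
    (trans (𝔖-- n (λ s t d → ι d + m t) (λ _ _ _ → m n)) (trans (cong₂ _-_ (sym (m-step n)) (𝔖-const n (m n))) (+-inverseʳ (m n))))

  δ² : ℕ → ℕ → ℕ → ℚ
  δ² s t d = δ s t d * δ s t d

  -- The law of total variance: given the first block, the cross term has the factor `E t ι - m t`,
  -- which vanishes.
  v-step : ∀ n → v n ≡ 𝔖 n (λ s t d → v t + δ² s t d)
  v-step n = trans (E-step n λ x → (ι x - m n) * (ι x - m n)) (𝔖-cong n λ s t d s+t≡n → begin
    E t (λ x → (ι (d ℕ.+ x) - m n) * (ι (d ℕ.+ x) - m n))
      ≡⟨ E-ext t (λ x → trans (cong₂ (λ y z → (y - m z) * (y - m z)) (ι-homo-+ d x) (sym s+t≡n))
           (ring 4 (λ d x m m′ → (d :+ x :- m′) :* (d :+ x :- m′) := (x :- m) :* (x :- m) :+ ((d :+ m :- m′) :+ (d :+ m :- m′)) :* (x :+ (:- m)) :+ (d :+ m :- m′) :* (d :+ m :- m′))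
             (ι d) (ι x) (m t) (m (s ℕ.+ t)))) ⟩
    E t (λ x → (ι x - m t) * (ι x - m t) + (δ s t d + δ s t d) * (ι x + (- m t)) + δ s t d * δ s t d)
      ≡⟨ trans (E-+ t (λ x → (ι x - m t) * (ι x - m t) + (δ s t d + δ s t d) * (ι x + (- m t))) (λ _ → δ s t d * δ s t d))
           (cong₂ _+_ (trans (E-+ t (λ x → (ι x - m t) * (ι x - m t)) (λ x → (δ s t d + δ s t d) * (ι x + (- m t))))
             (cong (v t +_) (trans (E-* t (δ s t d + δ s t d) (λ x → ι x + (- m t)))
               (cong ((δ s t d + δ s t d) *_) (trans (E-+ t ι (λ _ → - m t)) (trans (cong (m t +_) (E-const t (- m t))) (+-inverseʳ (m t))))))))
             (E-const t (δ s t d * δ s t d))) ⟩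
    v t + (δ s t d + δ s t d) * 0ℚ + δ s t d * δ s t d
      ≡⟨ ring 3 (λ v e d → v :+ e :* con 0ℚ :+ d := v :+ d) (v t) (δ s t d + δ s t d) (δ s t d * δ s t d) ⟩
    v t + δ s t d * δ s t d ∎)
    where open ≡-Reasoning

  0≤v : ∀ n → 0ℚ ≤ v n
  0≤v n = subst (_≤ v n) (E-const n 0ℚ) (E-mono n λ x _ → 0≤sq (ι x - m n))

  m0 : m 0 ≡ 1ℚ
  m0 = E-0 ι

  v0 : v 0 ≡ 0ℚ
  v0 = trans (E-0 λ x → (ι x - m 0) * (ι x - m 0)) (trans (cong (λ z → (1ℚ - z) * (1ℚ - z)) m0) refl)

  cw : ℚ
  cw = t₀ ⁻¹

  0≤cw : 0ℚ ≤ cw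
  0≤cw = 0≤⁻¹ 0<t₀

  p≤w : ∀ s → p s ≤ cw * w s
  p≤w s = subst (p s ≤_) (*-comm (w s) cw) (≤/ 0<t₀ (begin
    p s * t₀                   ≡⟨ trans (cong (_* t₀) (ι-suc s)) (ring 2 (λ s t → (con 1ℚ :+ s) :* t := t :+ s :* t) (ι s) t₀) ⟩
    t₀ + ι s * t₀              ≤⟨ +-monoˡ-≤ (ι s * t₀) t₀≤1 ⟩
    1ℚ + ι s * t₀              ≤⟨ bernoulli (<⇒≤ 0<t₀) s ⟩
    w s                        ∎))
    where open ≤-Reasoning

  ι≤p : ∀ s → ι s ≤ p s
  ι≤p s = ι-mono (ℕ.n≤1+n s)

  ι≤w : ∀ s → ι s ≤ cw * w s
  ι≤w s = ≤-trans (ι≤p s) (p≤w s)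

  1≤w² : ∀ s → 1ℚ ≤ w s * w s
  1≤w² s = ≤-trans (≤-reflexive (sym (*-identityˡ 1ℚ))) (*-mono-≤ 0≤1 (0≤w s) (1≤w s) (1≤w s))

  ιι≤w : ∀ s → w s * (ι s * ι s) ≤ cw * cw * w⁴ s
  ιι≤w s = begin
    w s * (ι s * ι s)                    ≤⟨ *-monoˡ (0≤w s) (*-mono-≤ (0≤ι s) (0≤* 0≤cw (0≤w s)) (ι≤w s) (ι≤w s)) ⟩
    w s * (cw * w s * (cw * w s))        ≡⟨ ring 2 (λ c w → w :* (c :* w :* (c :* w)) := c :* c :* (w :* w :* w) :* con 1ℚ) cw (w s) ⟩
    cw * cw * (w s * w s * w s) * 1ℚ     ≤⟨ *-monoˡ (0≤* (0≤* 0≤cw 0≤cw) (0≤* (0≤sq (w s)) (0≤w s))) (1≤w s) ⟩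
    cw * cw * (w s * w s * w s) * w s    ≡⟨ ring 2 (λ c w → c :* c :* (w :* w :* w) :* w := c :* c :* (w :* w :* (w :* w))) cw (w s) ⟩
    cw * cw * w⁴ s                       ∎
    where open ≤-Reasoning

  wι≤w : ∀ s → w s * ι s ≤ cw * w⁴ s
  wι≤w s = begin
    w s * ι s                      ≤⟨ *-monoˡ (0≤w s) (ι≤w s) ⟩
    w s * (cw * w s)               ≡⟨ ring 2 (λ c w → w :* (c :* w) := c :* (w :* w :* con 1ℚ)) cw (w s) ⟩
    cw * (w s * w s * 1ℚ)          ≤⟨ *-monoˡ 0≤cw (*-monoˡ (0≤sq (w s)) (1≤w² s)) ⟩
    cw * w⁴ s                      ∎
    where open ≤-Reasoning

  -- Reduces a recursion with the reward `X` to `Increments`. Polynomial factors in the block length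
  -- are turned into `w⁴`, whose mean is bounded by `moment`. It is applied to the mean with the
  -- reward `d` and to the variance with the reward `δ²`.
  module Reward (y : ℕ → ℚ) (X : ℕ → ℕ → ℕ → ℚ) (H A₁ r₁ Y : ℚ)
    (0≤H : 0ℚ ≤ H) (0≤A₁ : 0ℚ ≤ A₁) (0≤r₁ : 0ℚ ≤ r₁) (r₁<1 : r₁ < 1ℚ) (0≤Y : 0ℚ ≤ Y)
    (y-step : ∀ n → y n ≡ 𝔖 n (λ s t d → y t + X s t d))
    (X≤ : ∀ s t d → d ℕ.≤ s → ∣ X s t d ∣ ≤ H * (ι s * ι s))
    (X-diff : ∀ s t d → d ℕ.≤ s → ∣ X s (suc t) d - X s t d ∣ ≤ A₁ * r₁ ↑ (s ℕ.+ t) * (w s * ι s))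
    (y≤ : ∀ n → ∣ y n ∣ ≤ Y * (p n * p n))
    where

    τ : ℕ → ℕ → ℚ
    τ s t = ρ s t * ∫ (β s) (X s t)

    f : ℕ → ℚ
    f n = W n * ∫ (e n) (λ d → y 0 + X n 0 d)

    y-rec : ∀ n → y n ≡ conv n (λ s t → π s t * y t + τ s t) + f n
    y-rec n = trans (y-step n) (trans (*-distribˡ-+ (W n) (conv n (λ s t → M t * ∫ (β s) (λ d → y t + X s t d))) (∫ (e n) (λ d → y 0 + X n 0 d)))
      (cong (_+ f n) (trans (sym (conv-* n (W n) (λ s t → M t * ∫ (β s) (λ d → y t + X s t d)))) (conv-cong n λ s t s+t≡n → begin
        W n * (M t * ∫ (β s) (λ d → y t + X s t d))
          ≡⟨ cong₂ (λ z u → W z * (M t * u)) (sym s+t≡n) (trans (∫-+ (β s) (λ _ → y t) (X s t)) (cong (_+ ∫ (β s) (X s t)) (∫-const (β s) (y t)))) ⟩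
        W (s ℕ.+ t) * (M t * (mass (β s) * y t + ∫ (β s) (X s t)))
          ≡⟨ ring 5 (λ w m b y x → w :* (m :* (b :* y :+ x)) := b :* m :* w :* y :+ m :* w :* x) (W (s ℕ.+ t)) (M t) (mass (β s)) (y t) (∫ (β s) (X s t)) ⟩
        π s t * y t + τ s t ∎))))
      where open ≡-Reasoning

    private
      ab = absorb² γ⁻ 0≤γ⁻ γ⁻<1

    Cᵃ rᵃ r₂ c₁ : ℚ
    Cᵃ = proj₁ ab
    rᵃ = proj₁ (proj₂ ab)
    r₂ = rᵃ ⊔ (rᴿ ⊔ r₁)
    c₁ = (Y + H) * (B * Γ) * Cᵃ + (κ * H * (cw * cw) * D + A₁ * cw * D)

    0≤Cᵃ : 0ℚ ≤ Cᵃ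
    0≤Cᵃ = proj₁ (proj₂ (proj₂ ab))
    0≤rᵃ : 0ℚ ≤ rᵃ
    0≤rᵃ = proj₁ (proj₂ (proj₂ (proj₂ ab)))

    rᵃ≤r₂ : rᵃ ≤ r₂
    rᵃ≤r₂ = p≤p⊔q rᵃ (rᴿ ⊔ r₁)
    rᴿ≤r₂ : rᴿ ≤ r₂
    rᴿ≤r₂ = ≤-trans (p≤p⊔q rᴿ r₁) (p≤q⊔p rᵃ (rᴿ ⊔ r₁))
    r₁≤r₂ : r₁ ≤ r₂
    r₁≤r₂ = ≤-trans (p≤q⊔p rᴿ r₁) (p≤q⊔p rᵃ (rᴿ ⊔ r₁))

    0≤r₂ : 0ℚ ≤ r₂
    0≤r₂ = ≤-trans 0≤rᵃ rᵃ≤r₂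

    0≤tail : 0ℚ ≤ κ * H * (cw * cw) * D + A₁ * cw * D
    0≤tail = 0≤-+ (0≤* (0≤* (0≤* 0≤κ 0≤H) (0≤* 0≤cw 0≤cw)) 0≤D) (0≤* (0≤* 0≤A₁ 0≤cw) 0≤D)

    0≤head : 0ℚ ≤ (Y + H) * (B * Γ) * Cᵃ
    0≤head = 0≤* (0≤* (0≤-+ 0≤Y 0≤H) 0≤BΓ) 0≤Cᵃ

    p²-decay : ∀ n → (Y + H) * (p n * p n) * (B * (Γ * γ⁻ ↑ n)) ≤ c₁ * r₂ ↑ n
    p²-decay n = begin
      (Y + H) * (p n * p n) * (B * (Γ * γ⁻ ↑ n))     ≡⟨ ring 5 (λ h p B G g → h :* p :* (B :* (G :* g)) := h :* (B :* G) :* (p :* g)) (Y + H) (p n * p n) B Γ (γ⁻ ↑ n) ⟩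
      (Y + H) * (B * Γ) * (p n * p n * γ⁻ ↑ n)       ≤⟨ *-monoˡ (0≤* (0≤-+ 0≤Y 0≤H) 0≤BΓ) (≤-trans (proj₂ (proj₂ (proj₂ (proj₂ (proj₂ (proj₂ ab))))) n) (*-monoˡ 0≤Cᵃ (↑-mono 0≤rᵃ rᵃ≤r₂ n))) ⟩
      (Y + H) * (B * Γ) * (Cᵃ * r₂ ↑ n)              ≡⟨ sym (*-assoc ((Y + H) * (B * Γ)) Cᵃ (r₂ ↑ n)) ⟩
      (Y + H) * (B * Γ) * Cᵃ * r₂ ↑ n                ≤⟨ *-monoʳ (0≤↑ 0≤r₂ n) (p≤p+q {(Y + H) * (B * Γ) * Cᵃ} 0≤tail) ⟩
      c₁ * r₂ ↑ n                                    ∎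
      where open ≤-Reasoning

    f-small : ∀ n → ∣ f n ∣ ≤ c₁ * r₂ ↑ n
    f-small n = ≤-trans (∣*∣ {W n} {∫ (e n) (λ d → y 0 + X n 0 d)} (∣≥0∣ (0≤W n) (W-decay n))
      (∫-abs (e-on n) λ d d≤n → ∣+∣ {y 0} {X n 0 d} (≤-trans (y≤ 0) (*-monoˡ 0≤Y (p²-mono′ n))) (≤-trans (X≤ n 0 d d≤n) (*-monoˡ 0≤H (*-mono-≤ (0≤ι n) (0≤p n) (ι≤p n) (ι≤p n))))))
      (begin
        Γ * γ⁻ ↑ n * ∫ (e n) (λ _ → Y * (p n * p n) + H * (p n * p n))
          ≡⟨ cong (Γ * γ⁻ ↑ n *_) (trans (∫-const (e n) (Y * (p n * p n) + H * (p n * p n))) (cong (mass (e n) *_) (sym (*-distribʳ-+ (p n * p n) Y H)))) ⟩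
        Γ * γ⁻ ↑ n * (mass (e n) * ((Y + H) * (p n * p n)))
          ≤⟨ *-monoˡ (0≤* 0≤Γ (0≤↑ 0≤γ⁻ n)) (*-monoʳ (0≤* (0≤-+ 0≤Y 0≤H) (0≤sq (p n))) (e≤B n)) ⟩
        Γ * γ⁻ ↑ n * (B * ((Y + H) * (p n * p n)))
          ≡⟨ ring 3 (λ g b q → g :* (b :* q) := q :* (b :* g)) (Γ * γ⁻ ↑ n) B ((Y + H) * (p n * p n)) ⟩
        (Y + H) * (p n * p n) * (B * (Γ * γ⁻ ↑ n))
          ≤⟨ p²-decay n ⟩
        c₁ * r₂ ↑ n ∎)
      where
      open ≤-Reasoning
      p²-mono′ : ∀ n → p 0 * p 0 ≤ p n * p n
      p²-mono′ n = *-mono-≤ (0≤p 0) (0≤p n) (1≤p n) (1≤p n)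

    ∫X≤ : ∀ s t → ∣ ∫ (β s) (X s t) ∣ ≤ mass (β s) * (H * (ι s * ι s))
    ∫X≤ s t = ≤-trans (∫-abs (β-on s) λ d d≤s → X≤ s t d d≤s) (≤-reflexive (∫-const (β s) (H * (ι s * ι s))))

    τ-last : ∀ n → ∣ τ (suc n) 0 ∣ ≤ c₁ * r₂ ↑ n
    τ-last n = ≤-trans (∣*∣ {ρ (suc n) 0} {∫ (β (suc n)) (X (suc n) 0)} (∣≥0∣ (0≤ρ (suc n) 0) ρ≤) (∫X≤ (suc n) 0))
      (≤-trans (*-monoˡ (0≤* 0≤Γ (0≤↑ 0≤γ⁻ n)) (≤-trans (*-monoʳ (0≤* 0≤H (0≤sq (p n))) (β≤B (suc n))) (*-monoˡ 0≤B (*-monoʳ (0≤sq (p n)) (p≤q+p 0≤Y)))))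
        (≤-trans (≤-reflexive (ring 3 (λ g b q → g :* (b :* q) := q :* (b :* g)) (Γ * γ⁻ ↑ n) B ((Y + H) * (p n * p n)))) (p²-decay n)))
      where
      ρ≤ : ρ (suc n) 0 ≤ Γ * γ⁻ ↑ n
      ρ≤ = ≤-trans (≤-reflexive (trans (cong₂ _*_ M0 (cong W (ℕ.+-identityʳ (suc n)))) (*-identityˡ (W (suc n)))))
        (≤-trans (W-decay (suc n)) (*-monoˡ 0≤Γ (↑-anti-exp 0≤γ⁻ (<⇒≤ γ⁻<1) (ℕ.n≤1+n n))))

    -- The product rule for differences, with the change of `ρ` expressed through `ξ`: both parts
    -- then carry the factor `ρ s (suc t)` and an exponentially small one.
    τ-diff : ∀ n → ∣ conv n (λ s t → τ s (suc t) - τ s t) ∣ ≤ c₁ * r₂ ↑ n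
    τ-diff n = begin
      ∣ conv n (λ s t → τ s (suc t) - τ s t) ∣
        ≤⟨ conv-abs n pointwise ⟩
      conv n (λ s t → C₂ * r₂ ↑ n * (π s (suc t) * w⁴ s))
        ≡⟨ conv-* n (C₂ * r₂ ↑ n) (λ s t → π s (suc t) * w⁴ s) ⟩
      C₂ * r₂ ↑ n * conv n (λ s t → π s (suc t) * w⁴ s)
        ≤⟨ *-monoˡ (0≤* 0≤C₂ (0≤↑ 0≤r₂ n)) (≤-trans (≤-trans (p≤p+q (0≤* (0≤π (suc n) 0) (0≤sq (w (suc n) * w (suc n)))))
             (≤-reflexive (sym (conv-snoc n (λ s t → π s t * w⁴ s))))) (moment (suc n))) ⟩
      C₂ * r₂ ↑ n * D
        ≡⟨ ring 6 (λ k h c a r D → (k :* h :* (c :* c) :+ a :* c) :* r :* D := (k :* h :* (c :* c) :* D :+ a :* c :* D) :* r) κ H cw A₁ (r₂ ↑ n) D ⟩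
      (κ * H * (cw * cw) * D + A₁ * cw * D) * r₂ ↑ n
        ≤⟨ *-monoʳ (0≤↑ 0≤r₂ n) (p≤q+p {κ * H * (cw * cw) * D + A₁ * cw * D} {(Y + H) * (B * Γ) * Cᵃ} 0≤head) ⟩
      c₁ * r₂ ↑ n ∎
      where
      open ≤-Reasoning
      C₂ = κ * H * (cw * cw) + A₁ * cw
      0≤C₂ = 0≤-+ (0≤* (0≤* 0≤κ 0≤H) (0≤* 0≤cw 0≤cw)) (0≤* 0≤A₁ 0≤cw)
      pointwise : ∀ s t → s ℕ.+ t ≡ n → ∣ τ s (suc t) - τ s t ∣ ≤ C₂ * r₂ ↑ n * (π s (suc t) * w⁴ s)
      pointwise s t s+t≡n = begin
        ∣ ρ s (suc t) * I′ - ρ s t * I ∣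
          ≡⟨ cong ∣_∣ (trans (ring 4 (λ a b x y → a :* y :- b :* x := a :* (y :- x) :+ (a :- b) :* x) (ρ s (suc t)) (ρ s t) I I′)
               (trans (cong (λ z → ρ s (suc t) * (I′ - I) + z * I) (ρ-diff s t))
                 (ring 4 (λ a i j x → a :* i :+ a :* x :* j := a :* (i :+ x :* j)) (ρ s (suc t)) (I′ - I) I (ξ s t)))) ⟩
        ∣ ρ s (suc t) * (I′ - I + ξ s t * I) ∣
          ≤⟨ ∣*∣ {ρ s (suc t)} {I′ - I + ξ s t * I} (∣∣-self (0≤ρ s (suc t)))
               (∣+∣ {I′ - I} {ξ s t * I} ∫-diff (∣*∣ {ξ s t} {I} (ξ-bound s t) (∫X≤ s t))) ⟩
        ρ s (suc t) * (bs * (A₁ * r₁ ↑ (s ℕ.+ t) * (w s * ι s)) + κ * rᴿ ↑ (s ℕ.+ t) * w s * (bs * (H * (ι s * ι s))))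
          ≡⟨ cong (λ z → ρ s (suc t) * (bs * (A₁ * r₁ ↑ z * (w s * ι s)) + κ * rᴿ ↑ z * w s * (bs * (H * (ι s * ι s))))) s+t≡n ⟩
        ρ s (suc t) * (bs * (A₁ * r₁ ↑ n * (w s * ι s)) + κ * rᴿ ↑ n * w s * (bs * (H * (ι s * ι s))))
          ≤⟨ *-monoˡ (0≤ρ s (suc t)) (+-mono-≤
               (*-monoˡ 0≤bs (*-mono-≤ (0≤* (0≤w s) (0≤ι s)) (0≤* 0≤A₁ (0≤↑ 0≤r₂ n)) (*-monoˡ 0≤A₁ (↑-mono 0≤r₁ r₁≤r₂ n)) (wι≤w s)))
               (≤-trans (≤-reflexive (ring 6 (λ k r w b h i → k :* r :* w :* (b :* (h :* i)) := k :* r :* (b :* h) :* (w :* i)) κ (rᴿ ↑ n) (w s) bs H (ι s * ι s)))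
                 (*-mono-≤ (0≤* (0≤w s) (0≤sq (ι s))) (0≤* (0≤* 0≤κ (0≤↑ 0≤r₂ n)) (0≤* 0≤bs 0≤H))
                   (*-monoʳ (0≤* 0≤bs 0≤H) (*-monoˡ 0≤κ (↑-mono 0≤rᴿ rᴿ≤r₂ n))) (ιι≤w s)))) ⟩
        ρ s (suc t) * (bs * (A₁ * r₂ ↑ n * (cw * w⁴ s)) + κ * r₂ ↑ n * (bs * H) * (cw * cw * w⁴ s))
          ≡⟨ ring 9 (λ m W b a r c w k h → m :* W :* (b :* (a :* r :* (c :* w)) :+ k :* r :* (b :* h) :* (c :* c :* w)) := (k :* h :* (c :* c) :+ a :* c) :* r :* (b :* m :* W :* w))
               (M (suc t)) (W (s ℕ.+ suc t)) bs A₁ (r₂ ↑ n) cw (w⁴ s) κ H ⟩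
        C₂ * r₂ ↑ n * (π s (suc t) * w⁴ s) ∎
        where
        I I′ bs : ℚ
        I  = ∫ (β s) (X s t)
        I′ = ∫ (β s) (X s (suc t))
        bs = mass (β s)
        0≤bs : 0ℚ ≤ bs
        0≤bs = 0≤∫ (β-on s) (λ _ _ → 0≤1)
        ∫-diff : ∣ I′ - I ∣ ≤ bs * (A₁ * r₁ ↑ (s ℕ.+ t) * (w s * ι s))
        ∫-diff = ≤-trans (≤-reflexive (cong ∣_∣ (trans (ring 2 (λ x y → y :- x := y :+ (:- con 1ℚ) :* x) I I′)
            (sym (trans (∫-ext (β s) λ d → ring 2 (λ x y → y :- x := y :+ (:- con 1ℚ) :* x) (X s t d) (X s (suc t) d))
              (trans (∫-+ (β s) (X s (suc t)) (λ d → (- 1ℚ) * X s t d)) (cong (I′ +_) (∫-* (β s) (- 1ℚ) (X s t)))))))))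
          (≤-trans (∫-abs (β-on s) λ d d≤s → X-diff s t d d≤s) (≤-reflexive (∫-const (β s) (A₁ * r₁ ↑ (s ℕ.+ t) * (w s * ι s)))))

    Δ-settles : Settles (Δ y)
    Δ-settles = Mixing.Increments.Δ-settles renewal y τ f y-rec c₁ r₂ Y (0≤-+ 0≤head 0≤tail) 0≤r₂
      (⊔<1 (proj₁ (proj₂ (proj₂ (proj₂ (proj₂ ab))))) (⊔<1 rᴿ<1 r₁<1)) 0≤Y τ-diff τ-last f-small y≤

  m≤p : ∀ f n → n ℕ.≤ f → m n ≤ p n
  m≤p f       zero    _   = ≤-reflexive m0
  m≤p (suc f) (suc n) n≤f = ≤-trans (≤-reflexive (m-step (suc n))) (≤-trans
    (𝔖-mono n {λ s t d → ι d + m t} {λ _ _ _ → p (suc n)} λ s t d s+t≡ d≤s →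
      ≤-trans (+-mono-≤ (ι-mono d≤s) (m≤p f t (ℕ.≤-trans (subst (t ℕ.≤_) (ℕ.suc-injective s+t≡) (ℕ.m≤n+m t s)) (ℕ.s≤s⁻¹ n≤f))))
        (≤-reflexive (trans (sym (ι-homo-+ (suc s) (suc t))) (cong ι (trans (ℕ.+-suc (suc s) t) (cong suc s+t≡))))))
    (≤-reflexive (𝔖-const (suc n) (p (suc n)))))

  0≤m : ∀ n → 0ℚ ≤ m n
  0≤m n = subst (_≤ m n) (E-const n 0ℚ) (E-mono n λ x _ → 0≤ι x)

  p≤p² : ∀ n → p n ≤ 1ℚ * (p n * p n)
  p≤p² n = ≤-trans (subst (_≤ p n * p n) (*-identityʳ (p n)) (*-monoˡ (0≤p n) (1≤p n))) (≤-reflexive (sym (*-identityˡ (p n * p n))))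

  ι≤ι² : ∀ s → ι s ≤ 1ℚ * (ι s * ι s)
  ι≤ι² zero    = ≤-refl
  ι≤ι² (suc s) = p≤p² s

  abstract
    m-settles : Settles (Δ m)
    m-settles = Reward.Δ-settles m (λ s t d → ι d) 1ℚ 0ℚ 0ℚ 1ℚ 0≤1 ≤-refl ≤-refl 0<1 0≤1
      (λ n → trans (m-step n) (𝔖-cong n λ s t d _ → +-comm (ι d) (m t)))
      (λ s t d d≤s → ∣≥0∣ (0≤ι d) (≤-trans (ι-mono d≤s) (ι≤ι² s)))
      (λ s t d d≤s → ≤-trans (∣refl∣ (ι d)) (≤-reflexive (ring 2 (λ x y → con 0ℚ := con 0ℚ :* x :* y) (0ℚ ↑ (s ℕ.+ t)) (w s * ι s))))
      (λ n → ∣≥0∣ (0≤m n) (≤-trans (m≤p n n ℕ.≤-refl) (p≤p² n)))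

  module Mean = Mixing.Settled renewal m m-settles

  κᵈ : ℚ
  κᵈ = 1ℚ + Mean.A′

  0≤κᵈ : 0ℚ ≤ κᵈ
  0≤κᵈ = 0≤-+ 0≤1 Mean.0≤A′

  δ≤ : ∀ s t d → d ℕ.≤ s → ∣ δ s t d ∣ ≤ κᵈ * ι s
  δ≤ s t d d≤s = ≤-trans (≤-reflexive (cong ∣_∣ (ring 3 (λ d x y → d :+ x :- y := d :+ (x :- y)) (ι d) (m t) (m (s ℕ.+ t)))))
    (≤-trans (∣+∣ {ι d} {m t - m (s ℕ.+ t)} (∣≥0∣ (0≤ι d) (ι-mono d≤s)) (∣flip∣ {m (s ℕ.+ t)} {m t} (Mean.lipschitz s t)))
      (≤-reflexive (ring 2 (λ s a → s :+ a :* s := (con 1ℚ :+ a) :* s) (ι s) Mean.A′)))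

  δ²≤ : ∀ s t d → d ℕ.≤ s → ∣ δ² s t d ∣ ≤ κᵈ * κᵈ * (ι s * ι s)
  δ²≤ s t d d≤s = ≤-trans (∣*∣ {δ s t d} {δ s t d} (δ≤ s t d d≤s) (δ≤ s t d d≤s))
    (≤-reflexive (ring 2 (λ k s → k :* s :* (k :* s) := k :* k :* (s :* s)) κᵈ (ι s)))

  δ-diff : ∀ s t d → ∣ δ s (suc t) d - δ s t d ∣ ≤ Mean.A * Mean.r ↑ (s ℕ.+ t) * w s
  δ-diff s t d = begin
    ∣ ι d + m (suc t) - m (s ℕ.+ suc t) - (ι d + m t - m (s ℕ.+ t)) ∣
      ≡⟨ cong ∣_∣ (trans (cong (λ z → ι d + m (suc t) - m z - (ι d + m t - m (s ℕ.+ t))) (ℕ.+-suc s t))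
           (ring 5 (λ d a b c e → d :+ a :- b :- (d :+ c :- e) := (a :- c) :- (b :- e)) (ι d) (m (suc t)) (m (suc (s ℕ.+ t))) (m t) (m (s ℕ.+ t)))) ⟩
    ∣ Δ m (suc t) - Δ m (suc (s ℕ.+ t)) ∣
      ≡⟨ cong (λ z → ∣ Δ m (suc t) - Δ m z ∣) (sym (ℕ.+-suc s t)) ⟩
    ∣ Δ m (suc t) - Δ m (s ℕ.+ suc t) ∣
      ≤⟨ ∣flip∣ {Δ m (s ℕ.+ suc t)} {Δ m (suc t)} (Mean.Δ-osc s (suc t)) ⟩
    Mean.A * Mean.r ↑ (s ℕ.+ suc t) * w s
      ≤⟨ *-monoʳ (0≤w s) (*-monoˡ Mean.0≤A (↑-anti-exp Mean.0≤r (<⇒≤ Mean.r<1) (ℕ.+-monoʳ-≤ s (ℕ.n≤1+n t)))) ⟩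
    Mean.A * Mean.r ↑ (s ℕ.+ t) * w s ∎
    where open ≤-Reasoning

  -- Only an a priori bound for `Reward`. Squares are superadditive, so a quadratic bound survives
  -- the recursion; `f` is fuel.
  v≤ : ∀ f n → n ℕ.≤ f → v n ≤ κᵈ * κᵈ * (ι n * ι n)
  v≤ f       zero    _   = ≤-trans (≤-reflexive v0) (0≤* (0≤sq κᵈ) (0≤sq (ι 0)))
  v≤ (suc f) (suc n) n≤f = ≤-trans (≤-reflexive (v-step (suc n))) (≤-trans
    (𝔖-mono n {λ s t d → v t + δ² s t d} {λ _ _ _ → κᵈ * κᵈ * (ι (suc n) * ι (suc n))} λ s t d s+t≡ d≤s → begin
      v t + δ² (suc s) t d
        ≤⟨ +-mono-≤ (v≤ f t (ℕ.≤-trans (subst (t ℕ.≤_) (ℕ.suc-injective s+t≡) (ℕ.m≤n+m t s)) (ℕ.s≤s⁻¹ n≤f)))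
                    (≤-trans (p≤∣p∣ (δ² (suc s) t d)) (δ²≤ (suc s) t d d≤s)) ⟩
      κᵈ * κᵈ * (ι t * ι t) + κᵈ * κᵈ * (ι (suc s) * ι (suc s))
        ≤⟨ by (0≤* (0≤sq κᵈ) (0≤* (0≤-+ (0≤ι (suc s)) (0≤ι (suc s))) (0≤ι t)))
             (ring 3 (λ k s t → k :* ((s :+ t) :* (s :+ t)) := k :* (t :* t) :+ k :* (s :* s) :+ k :* ((s :+ s) :* t)) (κᵈ * κᵈ) (ι (suc s)) (ι t)) ⟩
      κᵈ * κᵈ * ((ι (suc s) + ι t) * (ι (suc s) + ι t))
        ≡⟨ cong (λ z → κᵈ * κᵈ * (z * z)) (trans (sym (ι-homo-+ (suc s) t)) (cong ι s+t≡)) ⟩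
      κᵈ * κᵈ * (ι (suc n) * ι (suc n)) ∎)
    (≤-reflexive (𝔖-const (suc n) (κᵈ * κᵈ * (ι (suc n) * ι (suc n))))))
    where open ≤-Reasoning

  δ²-diff : ∀ s t d → d ℕ.≤ s → ∣ δ² s (suc t) d - δ² s t d ∣ ≤ Mean.A * (κᵈ + κᵈ) * Mean.r ↑ (s ℕ.+ t) * (w s * ι s)
  δ²-diff s t d d≤s = subst₂ _≤_
    (cong ∣_∣ (ring 2 (λ x y → (x :- y) :* (x :+ y) := x :* x :- y :* y) (δ s (suc t) d) (δ s t d)))
    (ring 5 (λ a r w k s → a :* r :* w :* (k :* s :+ k :* s) := a :* (k :+ k) :* r :* (w :* s)) Mean.A (Mean.r ↑ (s ℕ.+ t)) (w s) κᵈ (ι s))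
    (∣*∣ {δ s (suc t) d - δ s t d} {δ s (suc t) d + δ s t d} (δ-diff s t d) (∣+∣ {δ s (suc t) d} {δ s t d} (δ≤ s (suc t) d d≤s) (δ≤ s t d d≤s)))

  v≤p² : ∀ n → ∣ v n ∣ ≤ κᵈ * κᵈ * (p n * p n)
  v≤p² n = ∣≥0∣ (0≤v n) (≤-trans (v≤ n n ℕ.≤-refl) (*-monoˡ (0≤sq κᵈ) (*-mono-≤ (0≤ι n) (0≤p n) (ι≤p n) (ι≤p n))))

  module VarianceReward = Reward v δ² (κᵈ * κᵈ) (Mean.A * (κᵈ + κᵈ)) Mean.r (κᵈ * κᵈ) (0≤sq κᵈ)
    (0≤* Mean.0≤A (0≤-+ 0≤κᵈ 0≤κᵈ)) Mean.0≤r Mean.r<1 (0≤sq κᵈ) v-step δ²≤ δ²-diff v≤p²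

  abstract
    v-settles : Settles (Δ v)
    v-settles = VarianceReward.Δ-settles

  module Variance = Mixing.Settled renewal v v-settles


  -- Moments of the block length and growth of the variance

  p⁴ : ℕ → ℚ
  p⁴ s = p s * p s * (p s * p s)

  0≤p⁴ : ∀ s → 0ℚ ≤ p⁴ s
  0≤p⁴ s = 0≤sq (p s * p s)

  cw⁴ D₄ : ℚ
  cw⁴ = cw * cw * (cw * cw)
  D₄  = cw⁴ * (D + Γ * B)

  0≤cw⁴ : 0ℚ ≤ cw⁴
  0≤cw⁴ = 0≤sq (cw * cw)

  0≤D₄ : 0ℚ ≤ D₄
  0≤D₄ = 0≤* 0≤cw⁴ (0≤-+ 0≤D (0≤* 0≤Γ 0≤B))

  p⁴≤w : ∀ s → p⁴ s ≤ cw⁴ * w⁴ s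
  p⁴≤w s = ≤-trans (*-mono-≤ (0≤sq (p s)) (0≤sq (cw * w s)) p²≤ p²≤)
    (≤-reflexive (ring 2 (λ c w → c :* w :* (c :* w) :* (c :* w :* (c :* w)) := c :* c :* (c :* c) :* (w :* w :* (w :* w))) cw (w s)))
    where
    p²≤ : p s * p s ≤ cw * w s * (cw * w s)
    p²≤ = *-mono-≤ (0≤p s) (0≤* 0≤cw (0≤w s)) (p≤w s) (p≤w s)

  𝔖-by-length : ∀ n (f : ℕ → ℚ) → 𝔖 n (λ s _ _ → f s) ≡ conv n (λ s t → π s t * f s) + W n * mass (e n) * f n
  𝔖-by-length n f = trans (*-distribˡ-+ (W n) (conv n (λ s t → M t * ∫ (β s) (λ _ → f s))) (∫ (e n) (λ _ → f n)))
    (cong₂ _+_ (trans (sym (conv-* n (W n) (λ s t → M t * ∫ (β s) (λ _ → f s)))) (conv-cong n λ s t s+t≡n →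
        trans (cong₂ (λ z x → W z * (M t * x)) (sym s+t≡n) (∫-const (β s) (f s)))
          (ring 4 (λ w m b f → w :* (m :* (b :* f)) := b :* m :* w :* f) (W (s ℕ.+ t)) (M t) (mass (β s)) (f s))))
      (trans (cong (W n *_) (∫-const (e n) (f n))) (sym (*-assoc (W n) (mass (e n)) (f n)))))

  γ⁻w⁴≤1 : ∀ n → γ⁻ ↑ n * w⁴ n ≤ 1ℚ
  γ⁻w⁴≤1 n = ≤-trans (*-monoˡ (0≤↑ 0≤γ⁻ n) (≤-trans (≤-reflexive (sym (Mixing.l⁴↑ renewal n)))
    (↑-mono (<⇒≤ (Mixing.0<l⁴ renewal)) (↑-mono-exp (Mixing.1≤l renewal) {4} {8} (ℕ.m≤m+n 4 4)) n))) (≤-reflexive (⁻¹↑*↑ 0<γ n))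

  -- The last block is covered as well: its length is `n`, but the decay `γ⁻ ↑ n` of `W n` outweighs
  -- `w⁴ n`.
  fourth-moment : ∀ n → 𝔖 n (λ s _ _ → p⁴ s) ≤ D₄
  fourth-moment n = begin
    𝔖 n (λ s _ _ → p⁴ s)
      ≡⟨ 𝔖-by-length n p⁴ ⟩
    conv n (λ s t → π s t * p⁴ s) + W n * mass (e n) * p⁴ n
      ≤⟨ +-mono-≤ (conv-mono n λ s t _ → ≤-trans (*-monoˡ (0≤π s t) (p⁴≤w s)) (≤-reflexive (ring 3 (λ p c w → p :* (c :* w) := c :* (p :* w)) (π s t) (cw⁴) (w⁴ s))))
           (*-mono-≤ (0≤p⁴ n) (0≤* (0≤* 0≤Γ (0≤↑ 0≤γ⁻ n)) 0≤B) (*-mono-≤ (0≤∫ (e-on n) λ _ _ → 0≤1) (0≤* 0≤Γ (0≤↑ 0≤γ⁻ n)) (W-decay n) (e≤B n)) (p⁴≤w n)) ⟩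
    conv n (λ s t → cw⁴ * (π s t * w⁴ s)) + Γ * γ⁻ ↑ n * B * (cw⁴ * w⁴ n)
      ≡⟨ cong₂ _+_ (conv-* n (cw⁴) (λ s t → π s t * w⁴ s))
           (ring 5 (λ G g B c w → G :* g :* B :* (c :* w) := c :* (G :* B) :* (g :* w)) Γ (γ⁻ ↑ n) B (cw⁴) (w⁴ n)) ⟩
    cw⁴ * conv n (λ s t → π s t * w⁴ s) + cw⁴ * (Γ * B) * (γ⁻ ↑ n * w⁴ n)
      ≤⟨ +-mono-≤ (*-monoˡ 0≤cw⁴ (moment n)) (*-monoˡ (0≤* 0≤cw⁴ (0≤* 0≤Γ 0≤B)) (γ⁻w⁴≤1 n)) ⟩
    cw⁴ * D + cw⁴ * (Γ * B) * 1ℚ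
      ≡⟨ ring 3 (λ c D g → c :* D :+ c :* g :* con 1ℚ := c :* (D :+ g)) (cw⁴) D (Γ * B) ⟩
    D₄ ∎
    where open ≤-Reasoning

  1≤p² : ∀ s → 1ℚ ≤ p s * p s
  1≤p² s = ≤-trans (≤-reflexive (sym (*-identityˡ 1ℚ))) (*-mono-≤ 0≤1 (0≤p s) (1≤p s) (1≤p s))

  p²≤p⁴ : ∀ s → p s * p s ≤ p⁴ s
  p²≤p⁴ s = subst (_≤ p⁴ s) (*-identityʳ (p s * p s)) (*-monoˡ (0≤sq (p s)) (1≤p² s))

  ι≤p⁴ : ∀ s → ι s ≤ p⁴ s
  ι≤p⁴ s = ≤-trans (ι≤p s) (≤-trans (≤-trans (p≤p² s) (≤-reflexive (*-identityˡ (p s * p s)))) (p²≤p⁴ s))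

  mean-length : ∀ n → 𝔖 (suc n) (λ s _ _ → ι s) ≤ D₄
  mean-length n = ≤-trans (𝔖-mono n {λ s _ _ → ι s} {λ s _ _ → p⁴ s} λ s _ _ _ _ → ι≤p⁴ (suc s)) (fourth-moment (suc n))

  local-slope : ∀ s t k → s ℕ.+ t ℕ.≤ k → ∣ m (s ℕ.+ t) - m t - ι s * Δ m k ∣ ≤ ι s * (Mean.A′ * Mean.r ↑ t)
  local-slope zero    t k _ = ≤-reflexive (trans (cong ∣_∣ (ring 2 (λ y d → y :- y :- con 0ℚ :* d := con 0ℚ) (m t) (Δ m k))) (sym (*-zeroˡ (Mean.A′ * Mean.r ↑ t))))
  local-slope (suc s) t k h = begin
    ∣ m (suc s ℕ.+ t) - m t - ι (suc s) * Δ m k ∣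
      ≡⟨ cong ∣_∣ (trans (cong (λ z → m (suc s ℕ.+ t) - m t - z * Δ m k) (ι-suc s))
           (ring 5 (λ a b c n d → a :- b :- (con 1ℚ :+ n) :* d := (a :- c :- d) :+ (c :- b :- n :* d)) (m (suc s ℕ.+ t)) (m t) (m (s ℕ.+ t)) (ι s) (Δ m k))) ⟩
    ∣ (Δ m (suc s ℕ.+ t) - Δ m k) + (m (s ℕ.+ t) - m t - ι s * Δ m k) ∣
      ≤⟨ ∣+∣ {Δ m (suc s ℕ.+ t) - Δ m k} (∣flip∣ {Δ m k} {Δ m (suc s ℕ.+ t)} (Mean.Δ-cauchy h)) (local-slope s t k (ℕ.≤-trans (ℕ.n≤1+n (s ℕ.+ t)) h)) ⟩
    Mean.A′ * Mean.r ↑ (suc s ℕ.+ t) + ι s * (Mean.A′ * Mean.r ↑ t)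
      ≤⟨ +-monoˡ-≤ (ι s * (Mean.A′ * Mean.r ↑ t)) (*-monoˡ Mean.0≤A′ (↑-anti-exp Mean.0≤r (<⇒≤ Mean.r<1) (ℕ.m≤n+m t (suc s)))) ⟩
    Mean.A′ * Mean.r ↑ t + ι s * (Mean.A′ * Mean.r ↑ t)
      ≡⟨ trans (ring 2 (λ x s → x :+ s :* x := (con 1ℚ :+ s) :* x) (Mean.A′ * Mean.r ↑ t) (ι s)) (cong (_* (Mean.A′ * Mean.r ↑ t)) (sym (ι-suc s))) ⟩
    ι (suc s) * (Mean.A′ * Mean.r ↑ t) ∎
    where open ≤-Reasoning

  private
    T-spec = ↑-eventually-≤ Mean.0≤r Mean.r<1 {ι L * Mean.A′} (0≤* (0≤ι L) Mean.0≤A′) ½ (positive⁻¹ ½)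

  T : ℕ
  T = proj₁ T-spec

  -- `c₂` bounds from below the probabilities of a first block of length 1 and of one of length `L`
  -- with reward 1. The other factor of `τ₀` is the minimum of x² + y² subject to Λ x - y = ½.
  Λ c₂ τ₀ : ℚ
  Λ  = ι L
  c₂ = δ₀ ↑ L * η
  τ₀ = c₂ * (½ * ½ * (Λ * Λ + 1ℚ) ⁻¹)

  0<Λ²+1 : 0ℚ < Λ * Λ + 1ℚ
  0<Λ²+1 = subst (0ℚ <_) (+-comm 1ℚ (Λ * Λ)) (0<-+ 0<1 (0≤sq Λ))

  0<c₂ : 0ℚ < c₂
  0<c₂ = 0<* (0<↑ 0<δ₀ L) 0<η

  0<τ₀ : 0ℚ < τ₀
  0<τ₀ = 0<* 0<c₂ (0<* (positive⁻¹ (½ * ½)) (⁻¹-pos 0<Λ²+1))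

  δ₀≤1 : δ₀ ≤ 1ℚ
  δ₀≤1 = ≤-trans (δ≤ratio 0) (/≤ (0<M 1) (subst (M 0 ≤_) (sym (*-identityˡ (M 1))) (Mixing.M-suc renewal 0)))

  δ₀↑≤ratio : ∀ s t → δ₀ ↑ s ≤ M t * W (s ℕ.+ t)
  δ₀↑≤ratio zero    t = ≤-reflexive (sym (*-⁻¹ (0<M t)))
  δ₀↑≤ratio (suc s) t = ≤-trans (*-mono-≤ (0≤↑ (<⇒≤ 0<δ₀) s) (0≤* (0≤M (s ℕ.+ t)) (0≤W (suc s ℕ.+ t))) (δ≤ratio (s ℕ.+ t)) (δ₀↑≤ratio s t))
    (≤-reflexive (trans (ring 4 (λ m w m′ w′ → m :* w :* (m′ :* w′) := m :* w′ :* (m′ :* w)) (M (s ℕ.+ t)) (W (suc s ℕ.+ t)) (M t) (W (s ℕ.+ t)))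
      (trans (cong (_* (M t * W (suc s ℕ.+ t))) (*-⁻¹ (0<M (s ℕ.+ t)))) (*-identityˡ (M t * W (suc s ℕ.+ t))))))

  -- Blocks of lengths 1 and L with reward 1 cannot both have increments near 0, as L (1 - μ) ≠ 1 - L μ.
  two-blocks : ∀ t → T ℕ.≤ t → ½ * ½ * (Λ * Λ + 1ℚ) ⁻¹ ≤ δ² 1 (suc L′ ℕ.+ t) 1 + δ² L t 1
  two-blocks t T≤t = /≤ 0<Λ²+1 (begin
    ½ * ½
      ≤⟨ *-mono-≤ (<⇒≤ (positive⁻¹ ½)) (≤-trans (<⇒≤ (positive⁻¹ ½)) ½≤) ½≤ ½≤ ⟩
    (Λ * x - y) * (Λ * x - y)
      ≤⟨ by (0≤sq (x + Λ * y)) (ring 3 (λ l x y → (x :* x :+ y :* y) :* (l :* l :+ con 1ℚ) := (l :* x :- y) :* (l :* x :- y) :+ (x :+ l :* y) :* (x :+ l :* y)) Λ x y) ⟩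
    (x * x + y * y) * (Λ * Λ + 1ℚ) ∎)
    where
    open ≤-Reasoning
    x y μ : ℚ
    x = δ 1 (suc L′ ℕ.+ t) 1
    y = δ L t 1
    μ = Δ m (L ℕ.+ t)
    near : ∣ m (L ℕ.+ t) - m t - Λ * μ ∣ ≤ ½
    near = ≤-trans (local-slope L t (L ℕ.+ t) ℕ.≤-refl) (≤-trans (≤-reflexive (sym (*-assoc Λ Mean.A′ (Mean.r ↑ t)))) (proj₂ T-spec t T≤t))
    1≤Λ-1 : 1ℚ ≤ Λ - 1ℚ
    1≤Λ-1 = subst (1ℚ ≤_) (trans (ring 1 (λ x → x := con 1ℚ :+ x :- con 1ℚ) (ι (suc L′))) (cong (_- 1ℚ) (sym (ι-suc (suc L′))))) (ι-mono {1} {suc L′} (ℕ.s≤s ℕ.z≤n))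
    ½≤ : ½ ≤ Λ * x - y
    ½≤ = by (0≤-+ (gap 1≤Λ-1) (gap (proj₂ (∣∣-≤ {m (L ℕ.+ t) - m t - Λ * μ} near))))
      (ring 4 (λ l a b c → l :* (con 1ℚ :+ a :- b) :- (con 1ℚ :+ c :- b) := con ½ :+ (l :- con 1ℚ :- con 1ℚ :+ (con ½ :- :- (b :- c :- l :* (b :- a))))) Λ (m (suc L′ ℕ.+ t)) (m (L ℕ.+ t)) (m t))

  0≤∫δ² : ∀ s t → 0ℚ ≤ ∫ (β s) (δ² s t)
  0≤∫δ² s t = 0≤∫ (β-on s) λ d _ → 0≤sq (δ s t d)

  τ₀≤ : ∀ t → T ℕ.≤ t → τ₀ ≤ 𝔖 (L ℕ.+ t) δ²
  τ₀≤ t T≤t = begin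
    c₂ * (½ * ½ * (Λ * Λ + 1ℚ) ⁻¹)
      ≤⟨ *-monoˡ (<⇒≤ 0<c₂) (two-blocks t T≤t) ⟩
    c₂ * (x + y)
      ≡⟨ *-distribˡ-+ c₂ x y ⟩
    c₂ * x + c₂ * y
      ≤⟨ +-mono-≤ (*-monoʳ (0≤sq (δ 1 (suc L′ ℕ.+ t) 1)) c₂≤) (≤-trans (≤-reflexive (*-assoc (δ₀ ↑ L) η y)) (*-mono-≤ (0≤* (<⇒≤ 0<η) (0≤sq (δ L t 1))) (0≤* (0≤M t) (0≤W n)) (δ₀↑≤ratio L t) (η≤β (δ² L t) λ d → 0≤sq (δ L t d)))) ⟩
    M (suc L′ ℕ.+ t) * W n * x + M t * W n * ∫ (β L) (δ² L t)
      ≡⟨ cong (λ z → M (suc L′ ℕ.+ t) * W n * z + M t * W n * ∫ (β L) (δ² L t)) (sym (β1 (δ² 1 (suc L′ ℕ.+ t)))) ⟩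
    M (suc L′ ℕ.+ t) * W n * ∫ (β 1) (δ² 1 (suc L′ ℕ.+ t)) + M t * W n * ∫ (β L) (δ² L t)
      ≡⟨ ring 5 (λ m w a m′ b → m :* w :* a :+ m′ :* w :* b := w :* (m :* a :+ m′ :* b)) (M (suc L′ ℕ.+ t)) (W n) (∫ (β 1) (δ² 1 (suc L′ ℕ.+ t))) (M t) (∫ (β L) (δ² L t)) ⟩
    W n * (M (suc L′ ℕ.+ t) * ∫ (β 1) (δ² 1 (suc L′ ℕ.+ t)) + M t * ∫ (β L) (δ² L t))
      ≤⟨ *-monoˡ (0≤W n) (≤-trans (≤-trans (+-monoʳ-≤ (M (suc L′ ℕ.+ t) * ∫ (β 1) (δ² 1 (suc L′ ℕ.+ t)))
             (conv-term (L′ ℕ.+ t) {λ s t → M t * ∫ (β (suc (suc s))) (δ² (suc (suc s)) t)} (λ s t _ → 0≤* (0≤M t) (0≤∫δ² (suc (suc s)) t)) L′ t refl))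
           (p≤q+p (0≤* (0≤M n) (0≤∫δ² 0 n)))) (p≤p+q (0≤∫ (e-on n) λ d _ → 0≤sq (δ n 0 d)))) ⟩
    𝔖 n δ² ∎
    where
    open ≤-Reasoning
    n = L ℕ.+ t
    x y : ℚ
    x = δ² 1 (suc L′ ℕ.+ t) 1
    y = δ² L t 1
    c₂≤ : c₂ ≤ M (suc L′ ℕ.+ t) * W n
    c₂≤ = begin
      δ₀ ↑ L * η       ≤⟨ *-monoˡ (0≤↑ (<⇒≤ 0<δ₀) L) η≤1 ⟩
      δ₀ ↑ L * 1ℚ      ≡⟨ *-identityʳ (δ₀ ↑ L) ⟩
      δ₀ ↑ L           ≤⟨ ↑-anti-exp (<⇒≤ 0<δ₀) δ₀≤1 {1} {L} (ℕ.s≤s ℕ.z≤n) ⟩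
      δ₀ ↑ 1           ≡⟨ *-identityʳ δ₀ ⟩
      δ₀               ≤⟨ δ≤ratio (suc L′ ℕ.+ t) ⟩
      M (suc L′ ℕ.+ t) * W n ∎

  n₀ : ℕ
  n₀ = L ℕ.+ T

  c₃ : ℚ
  c₃ = τ₀ * (1ℚ + D₄) ⁻¹

  0<1+D₄ : 0ℚ < 1ℚ + D₄
  0<1+D₄ = 0<-+ 0<1 0≤D₄

  0<c₃ : 0ℚ < c₃
  0<c₃ = 0<* 0<τ₀ (⁻¹-pos 0<1+D₄)

  c₃D₄≤τ₀ : c₃ * D₄ ≤ τ₀
  c₃D₄≤τ₀ = ≤-trans (*-monoˡ (<⇒≤ 0<c₃) (p≤q+p 0≤1)) (≤-reflexive (trans (*-comm c₃ (1ℚ + D₄)) (/-cancel τ₀ 0<1+D₄)))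

  -- By `v-step` and `τ₀≤`, `v n` exceeds the mean of `v t` by at least `τ₀` for `n ≥ n₀`, while the
  -- lower bound drops by `c₃` times the mean block length, which is at most `D₄`. So `c₃ * D₄ ≤ τ₀`
  -- closes the induction; `f` is fuel.
  variance-growth : ∀ f n → n ℕ.≤ f → c₃ * (ι n - ι n₀) ≤ v n
  variance-growth f n n≤f = [ late f n n≤f , early ]′ (ℕ.≤-total n₀ n)
    where
    early : n ℕ.≤ n₀ → c₃ * (ι n - ι n₀) ≤ v n
    early n≤n₀ = ≤-trans (≤-trans (*-monoˡ (<⇒≤ 0<c₃) (≤-trans (+-monoˡ-≤ (- ι n₀) (ι-mono n≤n₀)) (≤-reflexive (+-inverseʳ (ι n₀))))) (≤-reflexive (*-zeroʳ c₃))) (0≤v n)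
    late : ∀ f n → n ℕ.≤ f → n₀ ℕ.≤ n → c₃ * (ι n - ι n₀) ≤ v n
    late zero    n       n≤0 n₀≤n = contradiction (ℕ.≤-trans n₀≤n n≤0) λ ()
    late (suc f) zero    _   ()
    late (suc f) (suc n) n≤f n₀≤n = begin
      c₃ * (ι (suc n) - ι n₀)
        ≤⟨ by (gap (≤-trans (*-monoˡ (<⇒≤ 0<c₃) (mean-length n)) c₃D₄≤τ₀)) (ring 3 (λ x y τ → x :+ :- y :+ τ := x :+ (τ :- y)) (c₃ * (ι (suc n) - ι n₀)) (c₃ * 𝔖 (suc n) (λ s _ _ → ι s)) τ₀) ⟩
      c₃ * (ι (suc n) - ι n₀) + - (c₃ * 𝔖 (suc n) (λ s _ _ → ι s)) + τ₀
        ≤⟨ +-monoʳ-≤ (c₃ * (ι (suc n) - ι n₀) + - (c₃ * 𝔖 (suc n) (λ s _ _ → ι s))) τ₀≤𝔖 ⟩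
      c₃ * (ι (suc n) - ι n₀) + - (c₃ * 𝔖 (suc n) (λ s _ _ → ι s)) + 𝔖 (suc n) δ²
        ≡⟨ cong (_+ 𝔖 (suc n) δ²) (sym (trans (𝔖-cong (suc n) λ s t d s+t≡ → trans (cong (λ z → c₃ * (z - ι n₀)) (trans (ring 2 (λ s t → t := s :+ t :- s) (ι s) (ι t)) (cong (_- ι s) (trans (sym (ι-homo-+ s t)) (cong ι s+t≡)))))
               (ring 4 (λ c a b s → c :* (a :- s :- b) := c :* (a :- b) :- c :* s) c₃ (ι (suc n)) (ι n₀) (ι s)))
             (trans (𝔖-- (suc n) (λ _ _ _ → c₃ * (ι (suc n) - ι n₀)) (λ s _ _ → c₃ * ι s))
               (cong₂ _-_ (𝔖-const (suc n) (c₃ * (ι (suc n) - ι n₀))) (𝔖-* (suc n) c₃ (λ s _ _ → ι s)))))) ⟩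
      𝔖 (suc n) (λ s t d → c₃ * (ι t - ι n₀)) + 𝔖 (suc n) δ²
        ≤⟨ +-monoˡ-≤ (𝔖 (suc n) δ²) (𝔖-mono n {λ s t d → c₃ * (ι t - ι n₀)} {λ s t d → v t} λ s t d s+t≡ _ →
             variance-growth f t (ℕ.≤-trans (subst (t ℕ.≤_) (ℕ.suc-injective s+t≡) (ℕ.m≤n+m t s)) (ℕ.s≤s⁻¹ n≤f))) ⟩
      𝔖 (suc n) (λ s t d → v t) + 𝔖 (suc n) δ²
        ≡⟨ sym (𝔖-+ (suc n) (λ s t d → v t) δ²) ⟩
      𝔖 (suc n) (λ s t d → v t + δ² s t d)
        ≡⟨ sym (v-step (suc n)) ⟩
      v (suc n) ∎
      where
      open ≤-Reasoning
      n₁ = suc n ℕ.∸ L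
      L+n₁ : L ℕ.+ n₁ ≡ suc n
      L+n₁ = ℕ.m+[n∸m]≡n (ℕ.≤-trans (ℕ.m≤m+n L T) n₀≤n)
      τ₀≤𝔖 : τ₀ ≤ 𝔖 (suc n) δ²
      τ₀≤𝔖 = subst (λ z → τ₀ ≤ 𝔖 z δ²) L+n₁ (τ₀≤ n₁ (ℕ.+-cancelˡ-≤ L T n₁ (ℕ.≤-trans n₀≤n (ℕ.≤-reflexive (sym L+n₁)))))

  -- Lindeberg's argument

  Kᵛ : ℚ
  Kᵛ = κᵈ + Variance.A′ + (1ℚ + 1ℚ)

  0≤Kᵛ : 0ℚ ≤ Kᵛ
  0≤Kᵛ = 0≤-+ (0≤-+ 0≤κᵈ Variance.0≤A′) (0≤-+ 0≤1 0≤1)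

  Kᵛ⁴ : ℚ
  Kᵛ⁴ = Kᵛ * Kᵛ * (Kᵛ * Kᵛ)

  -- `ω n` approximates the square root of `v n + V`. The added variance `V` keeps it away from 0
  -- for small `n` too, so that one bound `u` can serve for all inverses.
  module Comparison {Ψ φ C τ Y} (smooth : Smooth Ψ φ C τ Y) (ω : ℕ → ℚ) (V u ε₁ Z Cʸ : ℚ)
    (0<ω : ∀ n → 0ℚ < ω n) (ω⁻≤u : ∀ n → ω n ⁻¹ ≤ u) (u≤1 : u ≤ 1ℚ)
    (ω-var : ∀ n → ∣ ω n * ω n - (v n + V) ∣ ≤ ε₁) (ε₁≤1 : ε₁ ≤ 1ℚ)
    (0≤Z : 0ℚ ≤ Z) (0≤τ : 0ℚ ≤ τ) (Zu≤Y : (Z + 1ℚ) * u ≤ Y) (Zu²≤ : (Z + 1ℚ) * u * u ≤ Cʸ)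
    where
    open Smooth smooth

    a : ℕ → ℚ
    a n = ω n ⁻¹

    0≤a : ∀ n → 0ℚ ≤ a n
    0≤a n = 0≤⁻¹ (0<ω n)

    0≤u : 0ℚ ≤ u
    0≤u = ≤-trans (0≤a 0) (ω⁻≤u 0)

    -- Up to normalisation `Ψ (z * a 0)` is the distribution function of a normal variable with
    -- variance about `V`, as `v 0` vanishes. So `U n z` is what `A n z` would approximately be if
    -- the reward were normal with mean `m n` and variance `v n`.
    A U : ℕ → ℚ → ℚ
    A n z = E n (λ x → Ψ ((z - ι x) * a 0))
    U n z = Ψ ((z - m n) * a n)

    E₁ err : ℚ
    E₁  = 1ℚ + 1ℚ + 1ℚ + 1ℚ + cube (1ℚ + Cʸ)
    err = C * E₁ * (Kᵛ⁴ * cube u) * D₄ + τ + C * (u * u) * ε₁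

    -- z is far enough from the boundary of the region where Ψ is known to be smooth.
    Good : ℕ → ℚ → Set
    Good n z = ∣ z ∣ + ι n ≤ Z

    Good-step : ∀ s t d z → d ℕ.≤ s → Good (s ℕ.+ t) z → Good t (z - ι d)
    Good-step s t d z d≤s good = ≤-trans (+-monoˡ-≤ (ι t) (∣-∣ {z} {ι d} ≤-refl (∣≥0∣ (0≤ι d) (ι-mono d≤s))))
      (≤-trans (≤-reflexive (trans (+-assoc ∣ z ∣ (ι s) (ι t)) (cong (∣ z ∣ +_) (sym (ι-homo-+ s t))))) good)

    z-m≤ : ∀ n z → Good n z → ∣ z - m n ∣ ≤ Z + 1ℚ
    z-m≤ n z good = ≤-trans (∣-∣ {z} {m n} ≤-refl (∣≥0∣ (0≤m n) (m≤p n n ℕ.≤-refl)))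
      (≤-trans (≤-reflexive (trans (cong (∣ z ∣ +_) (ι-suc n)) (ring 2 (λ z n → z :+ (con 1ℚ :+ n) := z :+ n :+ con 1ℚ) ∣ z ∣ (ι n)))) (+-monoˡ-≤ 1ℚ good))

    arg≤ : ∀ n z → Good n z → ∣ (z - m n) * a n ∣ ≤ (Z + 1ℚ) * u
    arg≤ n z good = ∣*∣ {z - m n} {a n} (z-m≤ n z good) (∣≥0∣ (0≤a n) (ω⁻≤u n))

    aω : ∀ n → a n * ω n ≡ 1ℚ
    aω n = trans (*-comm (a n) (ω n)) (*-⁻¹ (0<ω n))

    p-bound : ∀ s x → ∣ x ∣ ≤ κᵈ * ι s → ∣ x ∣ ≤ Kᵛ * p s
    p-bound s x h = ≤-trans h (*-mono-≤ (0≤ι s) 0≤Kᵛ (≤-trans (p≤p+q {κᵈ} Variance.0≤A′) (p≤p+q {κᵈ + Variance.A′} (0≤-+ 0≤1 0≤1))) (ι≤p s))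

    κ-bound : ∀ s t → ∣ ω (s ℕ.+ t) * ω (s ℕ.+ t) - ω t * ω t ∣ ≤ Kᵛ * p s
    κ-bound s t = begin
      ∣ ω n * ω n - ω t * ω t ∣
        ≡⟨ cong ∣_∣ (ring 5 (λ x y a b V → x :- y := (x :- (a :+ V)) :- (y :- (b :+ V)) :+ (a :- b)) (ω n * ω n) (ω t * ω t) (v n) (v t) V) ⟩
      ∣ (ω n * ω n - (v n + V)) - (ω t * ω t - (v t + V)) + (v n - v t) ∣
        ≤⟨ ∣+∣ {(ω n * ω n - (v n + V)) - (ω t * ω t - (v t + V))}
             (∣-∣ {ω n * ω n - (v n + V)} (≤-trans (ω-var n) ε₁≤1) (≤-trans (ω-var t) ε₁≤1)) (Variance.lipschitz s t) ⟩
      1ℚ + 1ℚ + Variance.A′ * ι s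
        ≤⟨ +-mono-≤ (subst (_≤ (1ℚ + 1ℚ) * p s) (*-identityʳ (1ℚ + 1ℚ)) (*-monoˡ (0≤-+ 0≤1 0≤1) (1≤p s))) (*-monoˡ Variance.0≤A′ (ι≤p s)) ⟩
      (1ℚ + 1ℚ) * p s + Variance.A′ * p s
        ≤⟨ by (0≤* 0≤κᵈ (0≤p s)) (ring 3 (λ k V p → (k :+ V :+ (con 1ℚ :+ con 1ℚ)) :* p := (con 1ℚ :+ con 1ℚ) :* p :+ V :* p :+ k :* p) κᵈ Variance.A′ (p s)) ⟩
      Kᵛ * p s ∎
      where
      open ≤-Reasoning
      n = s ℕ.+ t

    1≤Kp : ∀ s → 1ℚ ≤ Kᵛ * p s
    1≤Kp s = ≤-trans (≤-reflexive (sym (*-identityˡ 1ℚ))) (*-mono-≤ 0≤1 0≤Kᵛ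
      (≤-trans (p≤p+q {1ℚ} 0≤1) (p≤q+p {1ℚ + 1ℚ} {κᵈ + Variance.A′} (0≤-+ 0≤κᵈ Variance.0≤A′))) (1≤p s))

    main : ℕ → ℚ → ℕ → ℕ → ℕ → ℚ
    main n z s t d = ½ * (y * φ y) * (a n * a n) * (ω n * ω n - ω t * ω t - δ² s t d) - φ y * a n * δ s t d
      where y = (z - m n) * a n

    local-error : ∀ n z → Good n z → ∀ s t d → s ℕ.+ t ≡ n → d ℕ.≤ s →
      ∣ U t (z - ι d) - U n z - main n z s t d ∣ ≤ C * E₁ * (Kᵛ⁴ * cube u) * p⁴ s + τ
    local-error _ z good s t d refl d≤s = ≤-trans
      (Local.estimate smooth y y′ (ω n) (ω t) (a n) (a t) (δ s t d) (Kᵛ * p s) u Cʸ (0<ω n) (0<ω t) (aω n) (aω t) (0≤a n) (0≤a t)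
        (ω⁻≤u n) (ω⁻≤u t) u≤1 (1≤Kp s) (κ-bound s t) (p-bound s (δ s t d) (δ≤ s t d d≤s)) move
        (≤-trans (*-monoʳ 0≤u (arg≤ n z good)) Zu²≤) (≤-trans (arg≤ n z good) Zu≤Y) (≤-trans (arg≤ t (z - ι d) (Good-step s t d z d≤s good)) Zu≤Y))
      (≤-reflexive (cong (_+ τ) (ring 4 (λ C K p u → C :* (K :* p :* (K :* p) :* (K :* p :* (K :* p)) :* u) := C :* (K :* K :* (K :* K) :* u) :* (p :* p :* (p :* p))) (C * E₁) Kᵛ (p s) (cube u))))
      where
      n = s ℕ.+ t
      y y′ : ℚ
      y  = (z - m n) * a n
      y′ = (z - ι d - m t) * a t
      cancel : ∀ k x → x * a k * ω k ≡ x
      cancel k x = trans (*-assoc x (a k) (ω k)) (trans (cong (x *_) (aω k)) (*-identityʳ x))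
      move : y′ * ω t ≡ y * ω n - δ s t d
      move = trans (cancel t (z - ι d - m t)) (trans (ring 4 (λ z d t n → z :- d :- t := z :- n :- (d :+ t :- n)) z (ι d) (m t) (m n))
        (cong (_- δ s t d) (sym (cancel n (z - m n)))))

    variance-mismatch : ∀ n → ∣ 𝔖 (suc n) (λ s t d → ω (suc n) * ω (suc n) - ω t * ω t - δ² s t d) ∣ ≤ ε₁ + ε₁
    variance-mismatch n = begin
      ∣ 𝔖 N (λ s t d → ω N * ω N - ω t * ω t - δ² s t d) ∣
        ≡⟨ cong ∣_∣ (trans (𝔖-cong N λ s t d _ → ring 6 (λ x y q a b V → x :- y :- q := (x :- (a :+ V)) :- (y :- (b :+ V)) :+ (a :- (b :+ q))) (ω N * ω N) (ω t * ω t) (δ² s t d) (v N) (v t) V)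
             (trans (𝔖-+ N G (λ s t d → v N - (v t + δ² s t d)))
               (trans (cong (𝔖 N G +_) (trans (𝔖-- N (λ _ _ _ → v N) (λ s t d → v t + δ² s t d)) (trans (cong₂ _-_ (𝔖-const N (v N)) (sym (v-step N))) (+-inverseʳ (v N)))))
                 (+-identityʳ (𝔖 N G))))) ⟩
      ∣ 𝔖 N G ∣
        ≤⟨ 𝔖-abs n {G} {λ _ _ _ → ε₁ + ε₁} (λ s t d _ _ → ∣-∣ {ω N * ω N - (v N + V)} (ω-var N) (ω-var t)) ⟩
      𝔖 N (λ _ _ _ → ε₁ + ε₁)
        ≡⟨ 𝔖-const N (ε₁ + ε₁) ⟩
      ε₁ + ε₁ ∎
      where
      open ≤-Reasoning
      N = suc n
      G : ℕ → ℕ → ℕ → ℚ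
      G s t d = (ω N * ω N - (v N + V)) - (ω t * ω t - (v t + V))

    -- The linear term vanishes exactly by `δ-mean`, the quadratic one up to the errors of the
    -- rational square roots.
    main-small : ∀ n z → Good (suc n) z → ∣ 𝔖 (suc n) (main (suc n) z) ∣ ≤ C * (u * u) * ε₁
    main-small n z good = begin
      ∣ 𝔖 N (main N z) ∣
        ≡⟨ cong ∣_∣ (trans (𝔖-- N (λ s t d → coef * (ω N * ω N - ω t * ω t - δ² s t d)) (λ s t d → φ y * a N * δ s t d))
             (trans (cong₂ _-_ (𝔖-* N coef (λ s t d → ω N * ω N - ω t * ω t - δ² s t d)) (trans (𝔖-* N (φ y * a N) δ) (trans (cong (φ y * a N *_) (δ-mean N)) (*-zeroʳ (φ y * a N)))))
               (ring 1 (λ x → x :- con 0ℚ := x) (coef * 𝔖 N (λ s t d → ω N * ω N - ω t * ω t - δ² s t d))))) ⟩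
      ∣ coef * 𝔖 N (λ s t d → ω N * ω N - ω t * ω t - δ² s t d) ∣
        ≤⟨ ∣*∣ {coef} (∣*∣ {½ * (y * φ y)} {a N * a N} (∣*∣ {½} {y * φ y} {½} ≤-refl yφ≤C) (∣*∣ {a N} {a N} a≤u a≤u)) (variance-mismatch n) ⟩
      ½ * C * (u * u) * (ε₁ + ε₁)
        ≡⟨ ring 3 (λ C u e → con ½ :* C :* u :* (e :+ e) := C :* u :* e) C (u * u) ε₁ ⟩
      C * (u * u) * ε₁ ∎
      where
      open ≤-Reasoning
      N = suc n
      y coef : ℚ
      y = (z - m N) * a N
      coef = ½ * (y * φ y) * (a N * a N)
      a≤u : ∣ a N ∣ ≤ u
      a≤u = ∣≥0∣ (0≤a N) (ω⁻≤u N)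
      yφ≤C : ∣ y * φ y ∣ ≤ C
      yφ≤C = ≤-trans (≤-reflexive (∣p*q∣≡∣p∣*∣q∣ y (φ y))) (≤-trans (*-monoʳ (0≤∣p∣ (φ y)) y≤s³) (φ-decay y (≤-trans (arg≤ N z good) Zu≤Y)))
        where
        y≤s³ : ∣ y ∣ ≤ cube (1ℚ + ∣ y ∣)
        y≤s³ = by (0≤-+ 0≤1 (0≤* (0≤∣p∣ y) (0≤-+ (0≤-+ 0≤1 0≤1) (0≤-+ (0≤* (0≤∣p∣ y) (0≤-+ (0≤-+ 0≤1 0≤1) 0≤1)) (0≤sq ∣ y ∣)))))
          (ring 1 (λ x → (con 1ℚ :+ x) :* (con 1ℚ :+ x) :* (con 1ℚ :+ x) := x :+ (con 1ℚ :+ x :* (con 1ℚ :+ con 1ℚ :+ (x :* (con 1ℚ :+ con 1ℚ :+ con 1ℚ) :+ x :* x)))) ∣ y ∣)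

    0≤Q : 0ℚ ≤ C * E₁ * (Kᵛ⁴ * cube u)
    0≤Q = 0≤* (0≤* 0≤C (0≤-+ (0≤-+ (0≤-+ (0≤-+ 0≤1 0≤1) 0≤1) 0≤1) (0≤cube (0≤-+ 0≤1 (≤-trans 0≤Zu² Zu²≤))))) (0≤* (0≤sq (Kᵛ * Kᵛ)) (0≤cube 0≤u))
      where
      0≤Zu² : 0ℚ ≤ (Z + 1ℚ) * u * u
      0≤Zu² = 0≤* (0≤* (0≤-+ 0≤Z 0≤1) 0≤u) 0≤u

    0≤ε₁ : 0ℚ ≤ ε₁
    0≤ε₁ = ≤∣∣ {ω 0 * ω 0 - (v 0 + V)} (ω-var 0)

    0≤err : 0ℚ ≤ err
    0≤err = 0≤-+ (0≤-+ (0≤* 0≤Q 0≤D₄) 0≤τ) (0≤* (0≤* 0≤C (0≤sq u)) 0≤ε₁)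

    -- At 0 both sides agree, as the reward is the constant `m 0`. Otherwise the rest after the
    -- first block is compared by induction, and the block itself costs one `err`; `f` is fuel.
    comparison : ∀ f n z → n ℕ.≤ f → Good n z → ∣ A n z - U n z ∣ ≤ ι n * err
    comparison f zero z _ _ = ≤-reflexive (trans (cong ∣_∣ (trans (cong (_- U 0 z) (trans (E-0 λ x → Ψ ((z - ι x) * a 0)) (cong (λ y → Ψ ((z - y) * a 0)) (sym m0)))) (+-inverseʳ (U 0 z)))) (sym (*-zeroˡ err)))
    comparison (suc f) (suc n) z n≤f good = begin
      ∣ A N z - U N z ∣
        ≡⟨ cong ∣_∣ (trans (cong₂ _-_ (trans (E-step N λ x → Ψ ((z - ι x) * a 0)) (𝔖-cong N λ s t d _ → E-ext t λ x → cong (λ y → Ψ (y * a 0))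
               (trans (cong (λ y → z - y) (ι-homo-+ d x)) (ring 3 (λ z d x → z :- (d :+ x) := z :- d :- x) z (ι d) (ι x)))))
               (sym (𝔖-const N (U N z))))
             (trans (sym (𝔖-- N (λ s t d → A t (z - ι d)) (λ _ _ _ → U N z)))
               (trans (𝔖-cong N λ s t d _ → ring 4 (λ A u U M → A :- U := (A :- u) :+ (u :- U :- M) :+ M) (A t (z - ι d)) (U t (z - ι d)) (U N z) (main N z s t d))
                 (trans (𝔖-+ N (λ s t d → F₁ s t d + F₂ s t d) (main N z)) (cong (_+ 𝔖 N (main N z)) (𝔖-+ N F₁ F₂)))))) ⟩
      ∣ 𝔖 N F₁ + 𝔖 N F₂ + 𝔖 N (main N z) ∣
        ≤⟨ ∣+∣ {𝔖 N F₁ + 𝔖 N F₂} (∣+∣ {𝔖 N F₁} first second) (main-small n z good) ⟩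
      ι n * err + (C * E₁ * (Kᵛ⁴ * cube u) * D₄ + τ) + C * (u * u) * ε₁
        ≡⟨ trans (ring 4 (λ n e a b → n :* e :+ a :+ b := n :* e :+ (a :+ b)) (ι n) err (C * E₁ * (Kᵛ⁴ * cube u) * D₄ + τ) (C * (u * u) * ε₁))
             (trans (ring 2 (λ n e → n :* e :+ e := (con 1ℚ :+ n) :* e) (ι n) err) (cong (_* err) (sym (ι-suc n)))) ⟩
      ι N * err ∎
      where
      open ≤-Reasoning
      N = suc n
      F₁ F₂ : ℕ → ℕ → ℕ → ℚ
      F₁ s t d = A t (z - ι d) - U t (z - ι d)
      F₂ s t d = U t (z - ι d) - U N z - main N z s t d
      first : ∣ 𝔖 N F₁ ∣ ≤ ι n * err
      first = ≤-trans (𝔖-abs n {F₁} {λ _ _ _ → ι n * err} λ s t d s+t≡ d≤s →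
          let t≤n = subst (t ℕ.≤_) (ℕ.suc-injective s+t≡) (ℕ.m≤n+m t s)
          in ≤-trans (comparison f t (z - ι d) (ℕ.≤-trans t≤n (ℕ.s≤s⁻¹ n≤f)) (Good-step (suc s) t d z d≤s (subst (λ k → Good k z) (sym s+t≡) good)))
               (*-monoʳ 0≤err (ι-mono t≤n)))
        (≤-reflexive (𝔖-const N (ι n * err)))
      second : ∣ 𝔖 N F₂ ∣ ≤ C * E₁ * (Kᵛ⁴ * cube u) * D₄ + τ
      second = ≤-trans (𝔖-abs n {F₂} {λ s _ _ → C * E₁ * (Kᵛ⁴ * cube u) * p⁴ s + τ} λ s t d s+t≡ d≤s → local-error N z good (suc s) t d s+t≡ d≤s)
        (≤-trans (≤-reflexive (trans (𝔖-+ N (λ s _ _ → C * E₁ * (Kᵛ⁴ * cube u) * p⁴ s) (λ _ _ _ → τ)) (cong₂ _+_ (𝔖-* N (C * E₁ * (Kᵛ⁴ * cube u)) (λ s _ _ → p⁴ s)) (𝔖-const N τ))))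
          (+-monoˡ-≤ τ (*-monoˡ 0≤Q (fourth-moment N))))

  module Shifted (z t η₀ ε₁ : ℚ) (0<η₀ : 0ℚ < η₀) (η₀≤½ : η₀ ≤ ½) (0<ε₁ : 0ℚ < ε₁) where

    -- `c₄` bounds ŵ² n and `c₅` bounds u² n, so the cubic errors of the `n` steps are of order n u³
    -- ≤ c₅ u. `u₀` and `εω` are chosen such that the sums of the cubic errors and of the errors of
    -- the square roots are at most `ε₁` each.
    q c₄ c₅ A₀ Cʸ E₁ P₁ u₀ εω : ℚ
    q  = η₀ ⁻¹
    c₄ = ι 4 * c₃ ⁻¹
    c₅ = ι 4 * c₄ * (q * q)
    A₀ = ∣ z ∣ + ∣ t ∣
    Cʸ = ι 4 * c₅ + ι 2 * A₀ * q
    E₁ = 1ℚ + 1ℚ + 1ℚ + 1ℚ + cube (1ℚ + Cʸ)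
    P₁ = ι 40 * E₁ * Kᵛ⁴ * D₄ * c₅
    u₀ = ε₁ * (P₁ + ε₁) ⁻¹
    εω = ε₁ * (ι 40 * c₅ + ε₁) ⁻¹

    0≤η₀ : 0ℚ ≤ η₀
    0≤η₀ = <⇒≤ 0<η₀
    0≤q : 0ℚ ≤ q
    0≤q = 0≤⁻¹ 0<η₀
    0≤c₄ : 0ℚ ≤ c₄
    0≤c₄ = 0≤* (0≤ι 4) (0≤⁻¹ 0<c₃)
    0≤c₅ : 0ℚ ≤ c₅
    0≤c₅ = 0≤* (0≤* (0≤ι 4) 0≤c₄) (0≤sq q)
    0≤A₀ : 0ℚ ≤ A₀
    0≤A₀ = 0≤-+ (0≤∣p∣ z) (0≤∣p∣ t)
    0≤Cʸ : 0ℚ ≤ Cʸ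
    0≤Cʸ = 0≤-+ (0≤* (0≤ι 4) 0≤c₅) (0≤* (0≤* (0≤ι 2) 0≤A₀) 0≤q)
    0≤P₁ : 0ℚ ≤ P₁
    0≤P₁ = 0≤* (0≤* (0≤* (0≤* (0≤ι 40) (0≤-+ (0≤-+ (0≤-+ (0≤-+ 0≤1 0≤1) 0≤1) 0≤1) (0≤cube (0≤-+ 0≤1 0≤Cʸ)))) (0≤sq (Kᵛ * Kᵛ))) 0≤D₄) 0≤c₅

    fraction : ∀ {P} → 0ℚ ≤ P → let x = ε₁ * (P + ε₁) ⁻¹ in 0ℚ < x × x ≤ 1ℚ × P * x ≤ ε₁
    fraction {P} 0≤P = 0<x , /≤ {1ℚ} {ε₁} 0<Q (≤-trans (p≤q+p 0≤P) (≤-reflexive (sym (*-identityˡ (P + ε₁)))))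
      , ≤-trans (*-monoʳ (<⇒≤ 0<x) (p≤p+q {P} (<⇒≤ 0<ε₁))) (≤-reflexive (/-cancel ε₁ 0<Q))
      where
      0<Q : 0ℚ < P + ε₁
      0<Q = <-≤-trans 0<ε₁ (p≤q+p 0≤P)
      0<x : 0ℚ < ε₁ * (P + ε₁) ⁻¹
      0<x = 0<* 0<ε₁ (⁻¹-pos 0<Q)

    0<u₀ : 0ℚ < u₀
    0<u₀ = proj₁ (fraction 0≤P₁)
    u₀≤1 : u₀ ≤ 1ℚ
    u₀≤1 = proj₁ (proj₂ (fraction 0≤P₁))
    P₁u₀≤ε₁ : P₁ * u₀ ≤ ε₁
    P₁u₀≤ε₁ = proj₂ (proj₂ (fraction 0≤P₁))
    0≤40c₅ : 0ℚ ≤ ι 40 * c₅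
    0≤40c₅ = 0≤* (0≤ι 40) 0≤c₅
    0<εω : 0ℚ < εω
    0<εω = proj₁ (fraction 0≤40c₅)
    εω≤1 : εω ≤ 1ℚ
    εω≤1 = proj₁ (proj₂ (fraction 0≤40c₅))
    40c₅εω≤ε₁ : ι 40 * c₅ * εω ≤ ε₁
    40c₅εω≤ε₁ = proj₂ (proj₂ (fraction 0≤40c₅))

    0<u₀² : 0ℚ < u₀ * u₀
    0<u₀² = 0<* 0<u₀ 0<u₀

    -- Beyond twice `n₀` the bound in `variance-growth` is at least `c₃ * (½ * ι n)`; the
    -- archimedean part forces `u ≤ u₀`.
    N : ℕ
    N = suc (n₀ ℕ.+ n₀) ℕ.+ proj₁ (archimedean (c₅ * (u₀ * u₀) ⁻¹))

    module For (n : ℕ) (N≤n : N ℕ.≤ n) (ŵ : ℚ) (0<ŵ : 0ℚ < ŵ) (ŵ≈ : ∣ ŵ * ŵ * v n - 1ℚ ∣ ≤ η₀ * η₀) where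

      1≤n : 1ℚ ≤ ι n
      1≤n = ι-mono {1} {n} (ℕ.≤-trans (ℕ.s≤s ℕ.z≤n) N≤n)

      0≤ŵ : 0ℚ ≤ ŵ
      0≤ŵ = <⇒≤ 0<ŵ

      η₀²≤ : η₀ * η₀ ≤ ½ * ½
      η₀²≤ = *-mono-≤ 0≤η₀ (<⇒≤ (positive⁻¹ ½)) η₀≤½ η₀≤½

      ŵ²v≤2 : ŵ * ŵ * v n ≤ ι 2
      ŵ²v≤2 = by (0≤-+ (gap (proj₁ (∣∣-≤ {ŵ * ŵ * v n - 1ℚ} ŵ≈))) (0≤-+ (gap η₀²≤) (nonNegative⁻¹ (1ℚ - ½ * ½))))
        (ring 2 (λ x y → con (ι 2) := x :+ (y :- (x :- con 1ℚ) :+ (con ½ :* con ½ :- y :+ (con 1ℚ :- con ½ :* con ½)))) (ŵ * ŵ * v n) (η₀ * η₀))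

      ½n≤ : ½ * ι n ≤ ι n - ι n₀
      ½n≤ = by (0≤* (<⇒≤ (positive⁻¹ ½)) (gap (≤-trans (≤-reflexive (sym (ι-homo-+ n₀ n₀))) (ι-mono (ℕ.≤-trans (ℕ.≤-trans (ℕ.n≤1+n (n₀ ℕ.+ n₀)) (ℕ.m≤m+n (suc (n₀ ℕ.+ n₀)) (proj₁ (archimedean (c₅ * (u₀ * u₀) ⁻¹))))) N≤n)))))
        (ring 2 (λ n m → n :- m := con ½ :* n :+ con ½ :* (n :- (m :+ m))) (ι n) (ι n₀))

      ŵ²n≤ : ŵ * ŵ * ι n ≤ c₄
      ŵ²n≤ = ≤/ {ŵ * ŵ * ι n} {ι 4} 0<c₃ (begin
        ŵ * ŵ * ι n * c₃                          ≡⟨ ring 3 (λ w n c → w :* n :* c := con (ι 2) :* (w :* (c :* (con ½ :* n)))) (ŵ * ŵ) (ι n) c₃ ⟩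
        ι 2 * (ŵ * ŵ * (c₃ * (½ * ι n)))          ≤⟨ *-monoˡ (0≤ι 2) (*-monoˡ (0≤sq ŵ) (≤-trans (*-monoˡ (<⇒≤ 0<c₃) ½n≤) (variance-growth n n ℕ.≤-refl))) ⟩
        ι 2 * (ŵ * ŵ * v n)                       ≤⟨ *-monoˡ (0≤ι 2) ŵ²v≤2 ⟩
        ι 2 * ι 2                                 ≡⟨ refl ⟩
        ι 4                                       ∎)
        where open ≤-Reasoning

      -- The smoothing has the standard deviation `hᵥ`, that is `η₀` in standardised units. `u` is
      -- twice its inverse, because the squares `ω l * ω l` are known only up to `εω`.
      u hᵥ V : ℚ
      u = ι 2 * ŵ * q
      hᵥ = η₀ * ŵ ⁻¹
      V = hᵥ * hᵥ

      0<u : 0ℚ < u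
      0<u = 0<* (0<* (0<ι 1) 0<ŵ) (⁻¹-pos 0<η₀)
      0≤u : 0ℚ ≤ u
      0≤u = <⇒≤ 0<u

      u²n≤ : u * u * ι n ≤ c₅
      u²n≤ = ≤-trans (≤-reflexive (ring 3 (λ w q n → con (ι 2) :* w :* q :* (con (ι 2) :* w :* q) :* n := con (ι 4) :* (w :* w :* n) :* (q :* q)) ŵ q (ι n)))
        (*-monoʳ (0≤sq q) (*-monoˡ (0≤ι 4) ŵ²n≤))

      u≤u₀ : u ≤ u₀
      u≤u₀ = sq-reflects-≤ (<⇒≤ 0<u₀) (*-cancelˡ {u * u} {u₀ * u₀} {ι n} (<-≤-trans 0<1 1≤n)
        (≤-trans (≤-reflexive (*-comm (ι n) (u * u))) (≤-trans u²n≤ (≤-trans (≤-reflexive (sym (/-cancel c₅ 0<u₀²)))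
          (≤-trans (*-monoˡ (<⇒≤ 0<u₀²) (≤-trans (proj₂ (archimedean (c₅ * (u₀ * u₀) ⁻¹))) (ι-mono (ℕ.≤-trans (ℕ.m≤n+m (proj₁ (archimedean (c₅ * (u₀ * u₀) ⁻¹))) (suc (n₀ ℕ.+ n₀))) N≤n))))
            (≤-reflexive (*-comm (u₀ * u₀) (ι n))))))))

      u≤1 : u ≤ 1ℚ
      u≤1 = ≤-trans u≤u₀ u₀≤1

      uh : u * hᵥ ≡ ι 2
      uh = trans (ring 4 (λ w q e i → con (ι 2) :* w :* q :* (e :* i) := con (ι 2) :* (w :* i) :* (e :* q)) ŵ q η₀ (ŵ ⁻¹)) (cong₂ (λ a b → ι 2 * a * b) (*-⁻¹ 0<ŵ) (*-⁻¹ 0<η₀))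

      ŵ≤η₀ : ŵ ≤ η₀
      ŵ≤η₀ = begin
        ŵ                   ≡⟨ sym (trans (cong (ŵ *_) (*-⁻¹ 0<η₀)) (*-identityʳ ŵ)) ⟩
        ŵ * (η₀ * q)        ≡⟨ ring 3 (λ w e q → w :* (e :* q) := e :* (w :* q)) ŵ η₀ q ⟩
        η₀ * (ŵ * q)        ≤⟨ *-monoˡ 0≤η₀ (by (0≤* 0≤ŵ 0≤q) (ring 2 (λ w q → con (ι 2) :* w :* q := w :* q :+ w :* q) ŵ q)) ⟩
        η₀ * u              ≤⟨ *-monoˡ 0≤η₀ u≤1 ⟩
        η₀ * 1ℚ             ≡⟨ *-identityʳ η₀ ⟩
        η₀                  ∎
        where open ≤-Reasoning

      0≤hᵥ : 0ℚ ≤ hᵥ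
      0≤hᵥ = 0≤* 0≤η₀ (0≤⁻¹ 0<ŵ)

      root : ∀ l → ∃[ x ] 0ℚ ≤ x × ∣ x * x - (v l + V) ∣ ≤ εω
      -- Exact at 0, so that `arg≡` holds with equality.
      root zero    = hᵥ , 0≤hᵥ , ≤-trans (≤-reflexive (cong ∣_∣ (trans (cong (λ x → hᵥ * hᵥ - (x + V)) v0) (ring 1 (λ x → x :- (con 0ℚ :+ x) := con 0ℚ) (hᵥ * hᵥ))))) (<⇒≤ 0<εω)
      root (suc l) = sqrt (v (suc l) + V) (0≤-+ (0≤v (suc l)) (0≤sq hᵥ)) εω 0<εω

      ω : ℕ → ℚ
      ω l = proj₁ (root l)

      ω-var : ∀ l → ∣ ω l * ω l - (v l + V) ∣ ≤ εω
      ω-var l = proj₂ (proj₂ (root l))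

      1≤uω : ∀ l → 1ℚ ≤ u * ω l
      1≤uω l = sq-reflects-≤ (0≤* 0≤u (proj₁ (proj₂ (root l)))) (begin
        1ℚ * 1ℚ
          ≤⟨ by (0≤-+ (0≤-+ (0≤* (0≤sq u) (0≤v l)) (0≤* (0≤sq u) (0≤-+ (gap (proj₂ (∣∣-≤ {ω l * ω l - (v l + V)} (ω-var l)))) (gap εω≤1)))) (0≤-+ (gap u²≤1) (0≤ι 2)))
               (trans (ring 5 (λ u w v e x → u :* w :* (u :* w) := u :* e :* (u :* e) :+ (u :* u :* v :+ u :* u :* (x :- :- (w :* w :- (v :+ e :* e)) :+ (con 1ℚ :- x))) :- u :* u) u (ω l) (v l) hᵥ εω)
                 (trans (cong (λ y → y * y + (u * u * v l + u * u * (εω - - (ω l * ω l - (v l + V)) + (1ℚ - εω))) - u * u) uh)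
                   (ring 2 (λ x y → con (ι 2) :* con (ι 2) :+ x :- y := con 1ℚ :* con 1ℚ :+ (x :+ (con 1ℚ :- y :+ con (ι 2)))) (u * u * v l + u * u * (εω - - (ω l * ω l - (v l + V)) + (1ℚ - εω))) (u * u)))) ⟩
        u * ω l * (u * ω l) ∎)
        where
        open ≤-Reasoning
        u²≤1 : u * u ≤ 1ℚ
        u²≤1 = *-mono-≤ 0≤u 0≤1 u≤1 u≤1

      0<ω : ∀ l → 0ℚ < ω l
      0<ω l = *-cancelˡ-<-nonNeg u {{nonNegative 0≤u}} (subst (_< u * ω l) (sym (*-zeroʳ u)) (<-≤-trans 0<1 (1≤uω l)))

      ω⁻≤u : ∀ l → ω l ⁻¹ ≤ u
      ω⁻≤u l = subst (_≤ u) (*-identityˡ (ω l ⁻¹)) (/≤ {u} {1ℚ} (0<ω l) (1≤uω l))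

      -- `a` is the threshold in the original scale, moved by `t` standard deviations of the
      -- smoothing.
      a Z : ℚ
      a = m n + (z + t * η₀) * ŵ ⁻¹
      Z = ∣ a ∣ + ι n

      A₀≥ : ∣ z + t * η₀ ∣ ≤ A₀
      A₀≥ = ∣+∣ {z} {t * η₀} ≤-refl (≤-trans (∣*∣ {t} {η₀} ≤-refl (∣≥0∣ 0≤η₀ (≤-trans η₀≤½ (p≤p+q {½} {½} (<⇒≤ (positive⁻¹ ½)))))) (≤-reflexive (*-identityʳ ∣ t ∣)))

      0≤Z : 0ℚ ≤ Z
      0≤Z = 0≤-+ (0≤∣p∣ a) (0≤ι n)

      ŵuu : ŵ ⁻¹ * (u * u) ≡ ι 2 * q * u
      ŵuu = trans (ring 4 (λ i w q u → i :* (con (ι 2) :* w :* q :* u) := con (ι 2) :* q :* u :* (w :* i)) (ŵ ⁻¹) ŵ q u)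
        (trans (cong (ι 2 * q * u *_) (*-⁻¹ 0<ŵ)) (*-identityʳ (ι 2 * q * u)))

      Zu²≤ : (Z + 1ℚ) * u * u ≤ Cʸ
      Zu²≤ = begin
        (Z + 1ℚ) * u * u
          ≡⟨ *-assoc (Z + 1ℚ) u u ⟩
        (Z + 1ℚ) * (u * u)
          ≤⟨ *-monoʳ (0≤sq u) (+-monoˡ-≤ 1ℚ (+-monoˡ-≤ (ι n) (∣+∣ {m n} {(z + t * η₀) * ŵ ⁻¹} (∣≥0∣ (0≤m n) (m≤p n n ℕ.≤-refl)) (∣*∣ {z + t * η₀} {ŵ ⁻¹} A₀≥ (∣∣-self (0≤⁻¹ 0<ŵ)))))) ⟩
        (p n + A₀ * ŵ ⁻¹ + ι n + 1ℚ) * (u * u)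
          ≤⟨ *-monoʳ (0≤sq u) (by {p n + A₀ * ŵ ⁻¹ + ι n + 1ℚ} {ι 4 * ι n + A₀ * ŵ ⁻¹} (0≤* (0≤ι 2) (gap 1≤n)) (trans (ring 2 (λ n a → con (ι 4) :* n :+ a := con 1ℚ :+ n :+ a :+ n :+ con 1ℚ :+ con (ι 2) :* (n :- con 1ℚ)) (ι n) (A₀ * ŵ ⁻¹))
               (cong (λ x → x + A₀ * ŵ ⁻¹ + ι n + 1ℚ + ι 2 * (ι n - 1ℚ)) (sym (ι-suc n))))) ⟩
        (ι 4 * ι n + A₀ * ŵ ⁻¹) * (u * u)
          ≡⟨ ring 4 (λ n a i u → (con (ι 4) :* n :+ a :* i) :* u := con (ι 4) :* (u :* n) :+ a :* (i :* u)) (ι n) A₀ (ŵ ⁻¹) (u * u) ⟩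
        ι 4 * (u * u * ι n) + A₀ * (ŵ ⁻¹ * (u * u))
          ≡⟨ cong (λ x → ι 4 * (u * u * ι n) + A₀ * x) ŵuu ⟩
        ι 4 * (u * u * ι n) + A₀ * (ι 2 * q * u)
          ≤⟨ +-mono-≤ (*-monoˡ (0≤ι 4) u²n≤) (*-monoˡ 0≤A₀ (*-monoˡ (0≤* (0≤ι 2) 0≤q) u≤1)) ⟩
        ι 4 * c₅ + A₀ * (ι 2 * q * 1ℚ)
          ≡⟨ ring 3 (λ c a q → c :+ a :* (con (ι 2) :* q :* con 1ℚ) := c :+ con (ι 2) :* a :* q) (ι 4 * c₅) A₀ q ⟩
        Cʸ ∎
        where open ≤-Reasoning

      τ : ℚ
      τ = ε₁ * inv n

      0<τ : 0ℚ < τ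
      0<τ = 0<* 0<ε₁ (0<inv n)

      nτ≤ : ι n * τ ≤ ε₁
      nτ≤ = ≤-trans (*-monoʳ (<⇒≤ 0<τ) (ι-mono (ℕ.n≤1+n n))) (≤-reflexive (trans (ring 3 (λ n e i → n :* (e :* i) := e :* (i :* n)) (ι (suc n)) ε₁ (inv n)) (trans (cong (ε₁ *_) (inv*ι n)) (*-identityʳ ε₁))))

      total-error : ι n * (ι 40 * E₁ * (Kᵛ⁴ * cube u) * D₄ + τ + ι 40 * (u * u) * εω) ≤ ε₁ + ε₁ + ε₁
      total-error = begin
        ι n * (ι 40 * E₁ * (Kᵛ⁴ * cube u) * D₄ + τ + ι 40 * (u * u) * εω)
          ≡⟨ ring 7 (λ n E K u D t e → n :* (con (ι 40) :* E :* (K :* (u :* u :* u)) :* D :+ t :+ con (ι 40) :* (u :* u) :* e) := con (ι 40) :* E :* K :* D :* (u :* u :* n) :* u :+ n :* t :+ con (ι 40) :* (u :* u :* n) :* e) (ι n) E₁ Kᵛ⁴ u D₄ τ εω ⟩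
        ι 40 * E₁ * Kᵛ⁴ * D₄ * (u * u * ι n) * u + ι n * τ + ι 40 * (u * u * ι n) * εω
          ≤⟨ +-mono-≤ (+-mono-≤ (≤-trans (*-mono-≤ 0≤u 0≤P₁ (*-monoˡ 0≤H u²n≤) u≤u₀) P₁u₀≤ε₁) nτ≤) (≤-trans (*-monoʳ (<⇒≤ 0<εω) (*-monoˡ (0≤ι 40) u²n≤)) 40c₅εω≤ε₁) ⟩
        ε₁ + ε₁ + ε₁ ∎
        where
        open ≤-Reasoning
        0≤H : 0ℚ ≤ ι 40 * E₁ * Kᵛ⁴ * D₄
        0≤H = 0≤* (0≤* (0≤* (0≤ι 40) (0≤-+ (0≤-+ (0≤-+ (0≤-+ 0≤1 0≤1) 0≤1) 0≤1) (0≤cube (0≤-+ 0≤1 0≤Cʸ)))) (0≤sq (Kᵛ * Kᵛ))) 0≤D₄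

      arg : ℕ → ℚ
      arg x = (z - (ι x - m n) * ŵ) * q + t

      hᵥ⁻¹ : ŵ * q ≡ hᵥ ⁻¹
      hᵥ⁻¹ = ⁻¹-unique {hᵥ} {ŵ * q} (0<* 0<η₀ (⁻¹-pos 0<ŵ)) (trans (ring 4 (λ e i w q → e :* i :* (w :* q) := e :* q :* (w :* i)) η₀ (ŵ ⁻¹) ŵ q)
        (trans (cong₂ _*_ (*-⁻¹ 0<η₀) (*-⁻¹ 0<ŵ)) (*-identityˡ 1ℚ)))

      arg≡ : ∀ x → (a - ι x) * ω 0 ⁻¹ ≡ arg x
      arg≡ x = trans (cong ((a - ι x) *_) (sym hᵥ⁻¹)) (trans
        (ring 8 (λ m z t e i x w q → (m :+ (z :+ t :* e) :* i :- x) :* (w :* q) := ((m :- x) :* w) :* q :+ (z :* q) :* (w :* i) :+ t :* ((e :* q) :* (w :* i))) (m n) z t η₀ (ŵ ⁻¹) (ι x) ŵ q)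
        (trans (cong₂ (λ α β → ((m n - ι x) * ŵ) * q + (z * q) * α + t * (β * α)) (*-⁻¹ 0<ŵ) (*-⁻¹ 0<η₀))
          (ring 6 (λ m x w z q t → ((m :- x) :* w) :* q :+ (z :* q) :* con 1ℚ :+ t :* (con 1ℚ :* con 1ℚ) := (z :- (x :- m) :* w) :* q :+ t) (m n) (ι x) ŵ z q t)))

      -- `ϱ` is close to 1, because ŵ² v is close to 1 and ŵ² V is η₀². So the smoothed variable is
      -- nearly standardised, and its threshold `z′` is close to `z`.
      ϱ r z′ : ℚ
      ϱ  = ŵ * ω n
      r  = ϱ ⁻¹
      z′ = (z + t * η₀) * r

      0<ϱ : 0ℚ < ϱ
      0<ϱ = 0<* 0<ŵ (0<ω n)

      z′≡ : (a - m n) * ω n ⁻¹ ≡ z′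
      z′≡ = trans (ring 4 (λ m x i o → (m :+ x :* i :- m) :* o := x :* (i :* o)) (m n) (z + t * η₀) (ŵ ⁻¹) (ω n ⁻¹))
        (cong ((z + t * η₀) *_) (⁻¹-unique {ϱ} {ŵ ⁻¹ * ω n ⁻¹} 0<ϱ (trans (ring 4 (λ w o i j → w :* o :* (i :* j) := w :* i :* (o :* j)) ŵ (ω n) (ŵ ⁻¹) (ω n ⁻¹))
          (trans (cong₂ _*_ (*-⁻¹ 0<ŵ) (*-⁻¹ (0<ω n))) (*-identityˡ 1ℚ)))))

      e₂ : ℚ
      e₂ = ι 3 * (η₀ * η₀)

      ϱ²≈ : ∣ ϱ * ϱ - 1ℚ ∣ ≤ e₂
      ϱ²≈ = begin
        ∣ ϱ * ϱ - 1ℚ ∣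
          ≡⟨ cong ∣_∣ (trans (ring 5 (λ w o v e i → w :* o :* (w :* o) :- con 1ℚ := (w :* w :* v :- con 1ℚ) :+ (w :* i :* (w :* i) :* (e :* e) :+ w :* w :* (o :* o :- (v :+ e :* i :* (e :* i))))) ŵ (ω n) (v n) η₀ (ŵ ⁻¹))
               (cong (λ x → (ŵ * ŵ * v n - 1ℚ) + (x * x * (η₀ * η₀) + ŵ * ŵ * (ω n * ω n - (v n + V)))) (*-⁻¹ 0<ŵ))) ⟩
        ∣ (ŵ * ŵ * v n - 1ℚ) + (1ℚ * 1ℚ * (η₀ * η₀) + ŵ * ŵ * (ω n * ω n - (v n + V))) ∣
          ≤⟨ ∣+∣ {ŵ * ŵ * v n - 1ℚ} ŵ≈ (∣+∣ {1ℚ * 1ℚ * (η₀ * η₀)} (≤-reflexive (trans (cong ∣_∣ (*-identityˡ (η₀ * η₀))) (0≤p⇒∣p∣≡p (0≤sq η₀))))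
               (∣*∣ {ŵ * ŵ} {ω n * ω n - (v n + V)} (∣≥0∣ (0≤sq ŵ) (*-mono-≤ 0≤ŵ 0≤η₀ ŵ≤η₀ ŵ≤η₀)) (≤-trans (ω-var n) εω≤1))) ⟩
        η₀ * η₀ + (η₀ * η₀ + η₀ * η₀ * 1ℚ)
          ≡⟨ ring 1 (λ x → x :+ (x :+ x :* con 1ℚ) := con (ι 3) :* x) (η₀ * η₀) ⟩
        e₂ ∎
        where open ≤-Reasoning

      r≤2 : r ≤ ι 2
      r≤2 = ≤-trans (⁻¹-anti {½} (positive⁻¹ ½) ½≤ϱ) (≤-reflexive (sym (⁻¹-unique {½} {ι 2} (positive⁻¹ ½) refl)))
        where
        ½≤ϱ : ½ ≤ ϱ
        ½≤ϱ = sq-reflects-≤ (<⇒≤ 0<ϱ) (by (0≤-+ (gap (proj₂ (∣∣-≤ {ϱ * ϱ - 1ℚ} ϱ²≈))) (0≤* (0≤ι 3) (gap η₀²≤)))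
          (ring 2 (λ x e → x := con ½ :* con ½ :+ (con (ι 3) :* e :- :- (x :- con 1ℚ) :+ con (ι 3) :* (con ½ :* con ½ :- e))) (ϱ * ϱ) (η₀ * η₀)))

      r≈1 : ∣ r - 1ℚ ∣ ≤ ι 6 * η₀
      r≈1 = begin
        ∣ r - 1ℚ ∣
          ≡⟨ cong ∣_∣ (trans (cong (λ x → r - x) (sym (*-⁻¹ 0<ϱ))) (ring 2 (λ r x → r :- x :* r := r :* (con 1ℚ :- x)) r ϱ)) ⟩
        ∣ r * (1ℚ - ϱ) ∣
          ≤⟨ ∣*∣ {r} {1ℚ - ϱ} (∣≥0∣ (0≤⁻¹ 0<ϱ) r≤2) 1-ϱ≤ ⟩
        ι 2 * e₂
          ≤⟨ ≤-trans (≤-reflexive (ring 1 (λ x → con (ι 2) :* (con (ι 3) :* (x :* x)) := con (ι 6) :* (x :* x)) η₀)) (*-monoˡ (0≤ι 6) (≤-trans (*-monoˡ 0≤η₀ (≤-trans η₀≤½ (p≤p+q {½} {½} (<⇒≤ (positive⁻¹ ½))))) (≤-reflexive (*-identityʳ η₀)))) ⟩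
        ι 6 * η₀ ∎
        where
        open ≤-Reasoning
        1-ϱ≤ : ∣ 1ℚ - ϱ ∣ ≤ e₂
        1-ϱ≤ = ≤-trans (≤-trans (≤-reflexive (sym (*-identityʳ ∣ 1ℚ - ϱ ∣))) (*-monoˡ (0≤∣p∣ (1ℚ - ϱ)) (p≤p+q {1ℚ} (<⇒≤ 0<ϱ))))
          (≤-trans (≤-reflexive (trans (cong (∣ 1ℚ - ϱ ∣ *_) (sym (0≤p⇒∣p∣≡p (0≤-+ 0≤1 (<⇒≤ 0<ϱ))))) (trans (sym (∣p*q∣≡∣p∣*∣q∣ (1ℚ - ϱ) (1ℚ + ϱ)))
            (cong ∣_∣ (ring 1 (λ x → (con 1ℚ :- x) :* (con 1ℚ :+ x) := :- (x :* x :- con 1ℚ)) ϱ))))) (∣neg∣ {ϱ * ϱ - 1ℚ} ϱ²≈))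

      z′≈z : ∣ z′ - z ∣ ≤ η₀ * (∣ t ∣ + ι 6 * A₀)
      z′≈z = ≤-trans (≤-reflexive (cong ∣_∣ (ring 4 (λ z t e r → (z :+ t :* e) :* r :- z := t :* e :+ (z :+ t :* e) :* (r :- con 1ℚ)) z t η₀ r)))
        (≤-trans (∣+∣ {t * η₀} (∣*∣ {t} {η₀} ≤-refl (∣∣-self 0≤η₀)) (∣*∣ {z + t * η₀} {r - 1ℚ} A₀≥ r≈1))
          (≤-reflexive (ring 3 (λ t e A → t :* e :+ A :* (con (ι 6) :* e) := e :* (t :+ con (ι 6) :* A)) ∣ t ∣ η₀ A₀)))

      Y : ℚ
      Y = (Z + 1ℚ) * u

      smoothed : Eventually λ k → ∣ E n (λ x → Gs k (arg x)) - Gs k z ∣ ≤ ε₁ + ε₁ + ε₁ + (η₀ * (∣ t ∣ + ι 6 * A₀) + ε₁)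
      smoothed = map-eventually (both-eventually (Gs-smooth {Y} (0≤* (0≤-+ 0≤Z 0≤1) 0≤u) τ 0<τ) (Gs-lip {∣ z ∣ + ∣ z′ ∣} (0≤-+ (0≤∣p∣ z) (0≤∣p∣ z′)) ε₁ 0<ε₁)) step
        where
        step : ∀ k → (∃[ φ ] Smooth (Gs k) φ (ι 40) τ Y) × (∀ x y → ∣ x ∣ ≤ ∣ z ∣ + ∣ z′ ∣ → ∣ y ∣ ≤ ∣ z ∣ + ∣ z′ ∣ → ∣ Gs k x - Gs k y ∣ ≤ ∣ x - y ∣ + ε₁) →
               ∣ E n (λ x → Gs k (arg x)) - Gs k z ∣ ≤ ε₁ + ε₁ + ε₁ + (η₀ * (∣ t ∣ + ι 6 * A₀) + ε₁)
        step k ((φ , smooth) , lip) = ∣sum∣ {E n (λ x → Gs k (arg x))} {Gs k z′} {Gs k z}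
          (≤-trans (≤-reflexive (cong₂ (λ A U → ∣ A - U ∣) (E-ext n λ x → cong (Gs k) (sym (arg≡ x))) (cong (Gs k) (sym z′≡))))
            (≤-trans (Cmp.comparison n n a ℕ.≤-refl ≤-refl) total-error))
          (≤-trans (lip z′ z (p≤q+p (0≤∣p∣ z)) (p≤p+q (0≤∣p∣ z′))) (+-monoˡ-≤ ε₁ z′≈z))
          where module Cmp = Comparison smooth ω V u εω Z Cʸ 0<ω ω⁻≤u u≤1 ω-var εω≤1 0≤Z (<⇒≤ 0<τ) ≤-refl Zu²≤

  -- The indicator of the event is enclosed between smooth functions. With the shift `Tˢ` the
  -- argument of `Gs k` is at least `Tˢ` where the event holds, with the shift `- Tˢ` it is at most
  -- `- Tˢ` where the event fails, and there `Gs k` is saturated. `Tˢ` depends on `ε` only;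
  -- afterwards `η₀` is taken so small that the shifts hardly move the threshold.
  module Core (z ε : ℚ) (0<ε : 0ℚ < ε) where
    open Total using (c; 0≤c; c≤2; cI; I; saturation)

    ε₂ : ℚ
    -- `above` and `below` lose `ι 7 * ε₂`, and `c k` is at most 2.
    ε₂ = ε * inv 13

    0<ε₂ : 0ℚ < ε₂
    0<ε₂ = 0<* 0<ε (0<inv 13)

    0≤ε₂ : 0ℚ ≤ ε₂
    0≤ε₂ = <⇒≤ 0<ε₂

    m₀ : ℕ
    m₀ = proj₁ (saturation ε₂ 0<ε₂)

    Tˢ Q η₀ : ℚ
    Tˢ = ι m₀
    Q  = Tˢ + ι 6 * (∣ z ∣ + Tˢ) + ι 2 * ε₂
    η₀ = ε₂ * Q ⁻¹

    0≤Tˢ : 0ℚ ≤ Tˢ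
    0≤Tˢ = 0≤ι m₀

    0≤Q′ : 0ℚ ≤ Tˢ + ι 6 * (∣ z ∣ + Tˢ)
    0≤Q′ = 0≤-+ 0≤Tˢ (0≤* (0≤ι 6) (0≤-+ (0≤∣p∣ z) 0≤Tˢ))

    0<Q : 0ℚ < Q
    0<Q = <-≤-trans (0<* (0<ι 1) 0<ε₂) (p≤q+p 0≤Q′)

    0<η₀ : 0ℚ < η₀
    0<η₀ = 0<* 0<ε₂ (⁻¹-pos 0<Q)

    η₀≤½ : η₀ ≤ ½
    η₀≤½ = /≤ {½} {ε₂} 0<Q (by (0≤* (<⇒≤ (positive⁻¹ ½)) 0≤Q′) (ring 2 (λ q e → con ½ :* (q :+ con (ι 2) :* e) := e :+ con ½ :* q) (Tˢ + ι 6 * (∣ z ∣ + Tˢ)) ε₂))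

    η₀Q≤ε₂ : η₀ * (Tˢ + ι 6 * (∣ z ∣ + Tˢ)) ≤ ε₂
    η₀Q≤ε₂ = ≤-trans (*-monoˡ (<⇒≤ 0<η₀) (p≤p+q {Tˢ + ι 6 * (∣ z ∣ + Tˢ)} (0≤* (0≤ι 2) 0≤ε₂))) (≤-reflexive (trans (*-comm η₀ Q) (/-cancel ε₂ 0<Q)))

    N⁺ N⁻ N : ℕ
    N⁺ = Shifted.N z Tˢ η₀ ε₂ 0<η₀ η₀≤½ 0<ε₂
    N⁻ = Shifted.N z (- Tˢ) η₀ ε₂ 0<η₀ η₀≤½ 0<ε₂
    N  = N⁺ ℕ.⊔ N⁻

    module For (n : ℕ) (N≤n : N ℕ.≤ n) (ŵ : ℚ) (0<ŵ : 0ℚ < ŵ) (ŵ≈ : ∣ ŵ * ŵ * v n - 1ℚ ∣ ≤ η₀ * η₀) where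
      q y B₁ : ℚ
      q  = η₀ ⁻¹
      y  = (∣ z ∣ + (ι (S n) + ∣ m n ∣) * ŵ) * q
      B₁ = y + Tˢ

      0≤q : 0ℚ ≤ q
      0≤q = 0≤⁻¹ 0<η₀

      0≤y : 0ℚ ≤ y
      0≤y = 0≤* (0≤-+ (0≤∣p∣ z) (0≤* (0≤-+ (0≤ι (S n)) (0≤∣p∣ (m n))) (<⇒≤ 0<ŵ))) 0≤q

      arg⁺ arg⁻ : ℕ → ℚ
      arg⁺ x = (z - (ι x - m n) * ŵ) * q + Tˢ
      arg⁻ x = (z - (ι x - m n) * ŵ) * q + - Tˢ

      smoothed⁺ : Eventually λ k → ∣ E n (λ x → Gs k (arg⁺ x)) - Gs k z ∣ ≤ ε₂ + ε₂ + ε₂ + (η₀ * (∣ Tˢ ∣ + ι 6 * (∣ z ∣ + ∣ Tˢ ∣)) + ε₂)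
      smoothed⁺ = Shifted.For.smoothed z Tˢ η₀ ε₂ 0<η₀ η₀≤½ 0<ε₂ n (ℕ.≤-trans (ℕ.m≤m⊔n N⁺ N⁻) N≤n) ŵ 0<ŵ ŵ≈

      smoothed⁻ : Eventually λ k → ∣ E n (λ x → Gs k (arg⁻ x)) - Gs k z ∣ ≤ ε₂ + ε₂ + ε₂ + (η₀ * (∣ - Tˢ ∣ + ι 6 * (∣ z ∣ + ∣ - Tˢ ∣)) + ε₂)
      smoothed⁻ = Shifted.For.smoothed z (- Tˢ) η₀ ε₂ 0<η₀ η₀≤½ 0<ε₂ n (ℕ.≤-trans (ℕ.m≤n⊔m N⁺ N⁻) N≤n) ŵ 0<ŵ ŵ≈

      -- The estimates for `Gs k` hold on bounded sets only; this is where the finite range `S n` of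
      -- the reward enters.
      arg-bound : ∀ t → ∣ t ∣ ≤ Tˢ → ∀ x → x ℕ.≤ S n → ∣ (z - (ι x - m n) * ŵ) * q + t ∣ ≤ B₁
      arg-bound t t≤ x x≤S = ∣+∣ {(z - (ι x - m n) * ŵ) * q} (∣*∣ {z - (ι x - m n) * ŵ} {q}
        (∣-∣ {z} {(ι x - m n) * ŵ} ≤-refl (∣*∣ {ι x - m n} {ŵ} (∣-∣ {ι x} {m n} (∣≥0∣ (0≤ι x) (ι-mono x≤S)) ≤-refl) (∣∣-self (<⇒≤ 0<ŵ)))) (∣∣-self 0≤q)) t≤

      T≤ : ∣ Tˢ ∣ ≤ Tˢ
      T≤ = ∣∣-self 0≤Tˢ
      -T≤ : ∣ - Tˢ ∣ ≤ Tˢ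
      -T≤ = ∣neg∣ {Tˢ} T≤

      event : ℕ → ℚ
      event x = indicator ((ι x - m n) * ŵ ≤? z)

      P : ℚ
      P = E n event

      event-cases : ∀ x (C : ℚ → Set) → ((ι x - m n) * ŵ ≤ z → C 1ℚ) → (z ≤ (ι x - m n) * ŵ → C 0ℚ) → C (event x)
      event-cases x C f g = go ((ι x - m n) * ŵ ≤? z)
        where
        go : (d : Dec ((ι x - m n) * ŵ ≤ z)) → C (indicator d)
        go (yes h) = f h
        go (no h)  = g (<⇒≤ (≰⇒> h))

      module At (k : ℕ)
        (sat : ∀ x → Tˢ ≤ x → x ≤ B₁ → ∣ Gs k x - I k ∣ ≤ ε₂)
        (inc : ∀ x y → ∣ x ∣ ≤ B₁ → ∣ y ∣ ≤ B₁ → x ≤ y → (Gs k x ≤ Gs k y + ε₂) × (Gs k y ≤ Gs k x + (y - x) + ε₂))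
        (right : ∣ E n (λ x → Gs k (arg⁺ x)) - Gs k z ∣ ≤ ε₂ + ε₂ + ε₂ + (η₀ * (∣ Tˢ ∣ + ι 6 * (∣ z ∣ + ∣ Tˢ ∣)) + ε₂))
        (left : ∣ E n (λ x → Gs k (arg⁻ x)) - Gs k z ∣ ≤ ε₂ + ε₂ + ε₂ + (η₀ * (∣ - Tˢ ∣ + ι 6 * (∣ z ∣ + ∣ - Tˢ ∣)) + ε₂))
        where

        J : ℚ
        J = I k

        B₁≤ : ∣ B₁ ∣ ≤ B₁
        B₁≤ = ∣∣-self (0≤-+ 0≤y 0≤Tˢ)

        T≤B₁ : Tˢ ≤ B₁
        T≤B₁ = p≤q+p 0≤y

        top : ∀ x → ∣ x ∣ ≤ B₁ → Gs k x ≤ J + ε₂ + ε₂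
        top x x≤B = ≤-trans (proj₁ (inc x B₁ x≤B B₁≤ (≤-trans (p≤∣p∣ x) x≤B)))
          (+-monoˡ-≤ ε₂ (p-q≤r⇒p≤q+r {Gs k B₁} {J} {ε₂} (proj₁ (∣∣-≤ {Gs k B₁ - J} (sat B₁ T≤B₁ ≤-refl)))))

        bottom : ∀ x → ∣ x ∣ ≤ B₁ → - (J + ε₂ + ε₂) ≤ Gs k x
        bottom x x≤B = subst (- (J + ε₂ + ε₂) ≤_) (trans (cong -_ (Gs-odd k x)) (ring 1 (λ g → :- :- g := g) (Gs k x))) (neg-antimono-≤ (top (- x) (∣neg∣ {x} x≤B)))

        close : ∀ t → ∣ t ∣ ≤ Tˢ → η₀ * (∣ t ∣ + ι 6 * (∣ z ∣ + ∣ t ∣)) ≤ ε₂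
        close t t≤ = ≤-trans (*-monoˡ (<⇒≤ 0<η₀) (+-mono-≤ t≤ (*-monoˡ (0≤ι 6) (+-monoʳ-≤ ∣ z ∣ t≤)))) η₀Q≤ε₂

        five : ∀ {x} → x ≤ ε₂ → ε₂ + ε₂ + ε₂ + (x + ε₂) ≤ ι 5 * ε₂
        five {x} h = by (gap h) (ring 2 (λ e x → con (ι 5) :* e := e :+ e :+ e :+ (x :+ e) :+ (e :- x)) ε₂ x)

        E-scaled : E n (λ x → (J + J) * event x) ≡ (J + J) * P
        E-scaled = E-* n (J + J) event

        E-plus : ∀ (f : ℕ → ℚ) d → E n (λ x → f x + d) ≡ E n f + d
        E-plus f d = trans (E-+ n f (λ _ → d)) (cong (E n f +_) (E-const n d))

        above : (J + J) * P ≤ Gs k z + J + ι 7 * ε₂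
        above = begin
          (J + J) * P
            ≡⟨ sym E-scaled ⟩
          E n (λ x → (J + J) * event x)
            ≤⟨ E-mono n (λ x x≤S → event-cases x (λ i → (J + J) * i ≤ Gs k (arg⁺ x) + (J + ι 2 * ε₂)) (yes′ x x≤S) (no′ x x≤S)) ⟩
          E n (λ x → Gs k (arg⁺ x) + (J + ι 2 * ε₂))
            ≡⟨ E-plus (λ x → Gs k (arg⁺ x)) (J + ι 2 * ε₂) ⟩
          E n (λ x → Gs k (arg⁺ x)) + (J + ι 2 * ε₂)
            ≤⟨ +-monoˡ-≤ (J + ι 2 * ε₂) (p-q≤r⇒p≤q+r {E n (λ x → Gs k (arg⁺ x))} (≤-trans (proj₁ (∣∣-≤ {E n (λ x → Gs k (arg⁺ x)) - Gs k z} right)) (five (close Tˢ T≤)))) ⟩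
          Gs k z + ι 5 * ε₂ + (J + ι 2 * ε₂)
            ≡⟨ ring 3 (λ g e J → g :+ con (ι 5) :* e :+ (J :+ con (ι 2) :* e) := g :+ J :+ con (ι 7) :* e) (Gs k z) ε₂ J ⟩
          Gs k z + J + ι 7 * ε₂ ∎
          where
          open ≤-Reasoning
          yes′ : ∀ x → x ℕ.≤ S n → (ι x - m n) * ŵ ≤ z → (J + J) * 1ℚ ≤ Gs k (arg⁺ x) + (J + ι 2 * ε₂)
          yes′ x x≤S h = by (0≤-+ (gap (proj₂ (∣∣-≤ {Gs k (arg⁺ x) - J} (sat (arg⁺ x) (p≤q+p (0≤* (gap h) 0≤q)) (≤-trans (p≤∣p∣ (arg⁺ x)) (arg-bound Tˢ T≤ x x≤S)))))) 0≤ε₂)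
            (ring 3 (λ g J e → g :+ (J :+ con (ι 2) :* e) := (J :+ J) :* con 1ℚ :+ (e :- :- (g :- J) :+ e)) (Gs k (arg⁺ x)) J ε₂)
          no′ : ∀ x → x ℕ.≤ S n → z ≤ (ι x - m n) * ŵ → (J + J) * 0ℚ ≤ Gs k (arg⁺ x) + (J + ι 2 * ε₂)
          no′ x x≤S _ = by (gap (bottom (arg⁺ x) (arg-bound Tˢ T≤ x x≤S)))
            (ring 3 (λ g J e → g :+ (J :+ con (ι 2) :* e) := (J :+ J) :* con 0ℚ :+ (g :- :- (J :+ e :+ e))) (Gs k (arg⁺ x)) J ε₂)

        below : Gs k z + J ≤ (J + J) * P + ι 7 * ε₂
        below = begin
          Gs k z + J
            ≤⟨ +-monoˡ-≤ J (p-q≤r⇒p≤q+r {Gs k z} {E n (λ x → Gs k (arg⁻ x))} (≤-trans (proj₁ (∣∣-≤ {Gs k z - E n (λ x → Gs k (arg⁻ x))} (∣flip∣ {E n (λ x → Gs k (arg⁻ x))} {Gs k z} left))) (five (close (- Tˢ) -T≤)))) ⟩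
          E n (λ x → Gs k (arg⁻ x)) + ι 5 * ε₂ + J
            ≡⟨ ring 3 (λ a e J → a :+ con (ι 5) :* e :+ J := a :+ (J :- con (ι 2) :* e) :+ con (ι 7) :* e) (E n (λ x → Gs k (arg⁻ x))) ε₂ J ⟩
          E n (λ x → Gs k (arg⁻ x)) + (J - ι 2 * ε₂) + ι 7 * ε₂
            ≡⟨ cong (_+ ι 7 * ε₂) (sym (E-plus (λ x → Gs k (arg⁻ x)) (J - ι 2 * ε₂))) ⟩
          E n (λ x → Gs k (arg⁻ x) + (J - ι 2 * ε₂)) + ι 7 * ε₂
            ≤⟨ +-monoˡ-≤ (ι 7 * ε₂) (E-mono n (λ x x≤S → event-cases x (λ i → Gs k (arg⁻ x) + (J - ι 2 * ε₂) ≤ (J + J) * i) (yes′ x x≤S) (no′ x x≤S))) ⟩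
          E n (λ x → (J + J) * event x) + ι 7 * ε₂
            ≡⟨ cong (_+ ι 7 * ε₂) E-scaled ⟩
          (J + J) * P + ι 7 * ε₂ ∎
          where
          open ≤-Reasoning
          yes′ : ∀ x → x ℕ.≤ S n → (ι x - m n) * ŵ ≤ z → Gs k (arg⁻ x) + (J - ι 2 * ε₂) ≤ (J + J) * 1ℚ
          yes′ x x≤S _ = by (gap (top (arg⁻ x) (arg-bound (- Tˢ) -T≤ x x≤S)))
            (ring 3 (λ g J e → (J :+ J) :* con 1ℚ := g :+ (J :- con (ι 2) :* e) :+ (J :+ e :+ e :- g)) (Gs k (arg⁻ x)) J ε₂)
          no′ : ∀ x → x ℕ.≤ S n → z ≤ (ι x - m n) * ŵ → Gs k (arg⁻ x) + (J - ι 2 * ε₂) ≤ (J + J) * 0ℚ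
          no′ x x≤S h = by (0≤-+ (gap near) 0≤ε₂)
            (ring 3 (λ g J e → (J :+ J) :* con 0ℚ := g :+ (J :- con (ι 2) :* e) :+ (e :- (g :+ J) :+ e)) (Gs k (arg⁻ x)) J ε₂)
            where
            x≤B = arg-bound (- Tˢ) -T≤ x x≤S
            -arg≥T : Tˢ ≤ - arg⁻ x
            -arg≥T = by (0≤* (gap h) 0≤q) (ring 4 (λ z y q t → :- ((z :- y) :* q :+ :- t) := t :+ (y :- z) :* q) z ((ι x - m n) * ŵ) q Tˢ)
            near : Gs k (arg⁻ x) + J ≤ ε₂
            near = ≤-trans (≤-reflexive (trans (ring 2 (λ g J → g :+ J := :- (:- g :- J)) (Gs k (arg⁻ x)) J) (cong (λ w → - (w - J)) (sym (Gs-odd k (arg⁻ x))))))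
              (proj₂ (∣∣-≤ {Gs k (- arg⁻ x) - J} (sat (- arg⁻ x) -arg≥T (≤-trans (proj₂ (∣∣-≤ {arg⁻ x} ≤-refl)) x≤B))))

        c2J : c k * (J + J) ≡ 1ℚ
        c2J = trans (*-distribˡ-+ (c k) J J) (trans (cong₂ _+_ (cI k) (cI k)) refl)

        14ε₂ : c k * (ι 7 * ε₂) ≤ ε
        14ε₂ = ≤-trans (*-monoʳ (0≤* (0≤ι 7) 0≤ε₂) (c≤2 k)) (≤-reflexive (trans (ring 2 (λ e i → con (ι 2) :* (con (ι 7) :* (e :* i)) := e :* (i :* con (ι 14))) ε (inv 13)) (trans (cong (ε *_) (inv*ι 13)) (*-identityʳ ε))))

        result : ∣ P - (½ + c k * Gs k z) ∣ ≤ ε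
        result = ∣p-q∣≤r {P} {½ + c k * Gs k z}
          (≤-trans (≤-trans (≤-reflexive (sym scaled)) (*-monoˡ (0≤c k) above)) (≤-trans (≤-reflexive (trans (ring 4 (λ c g J x → c :* (g :+ J :+ x) := c :* J :+ c :* g :+ c :* x) (c k) (Gs k z) J (ι 7 * ε₂)) (cong (λ h → h + c k * Gs k z + c k * (ι 7 * ε₂)) (cI k)))) (+-monoʳ-≤ (½ + c k * Gs k z) 14ε₂)))
          (≤-trans (≤-trans (≤-reflexive (trans (cong (_+ c k * Gs k z) (sym (cI k))) (ring 3 (λ c g J → c :* J :+ c :* g := c :* (g :+ J)) (c k) (Gs k z) J))) (*-monoˡ (0≤c k) below))
            (≤-trans (≤-reflexive (trans (*-distribˡ-+ (c k) ((J + J) * P) (ι 7 * ε₂)) (cong (_+ c k * (ι 7 * ε₂)) scaled))) (+-monoʳ-≤ P 14ε₂)))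
          where
          scaled : c k * ((J + J) * P) ≡ P
          scaled = trans (sym (*-assoc (c k) (J + J) P)) (trans (cong (_* P) c2J) (*-identityˡ P))

      core : Eventually λ k → ∣ P - (½ + c k * Gs k z) ∣ ≤ ε
      core = map-eventually (both-eventually (proj₂ (saturation ε₂ 0<ε₂) B₁) (both-eventually (Gs-increment {B₁} (0≤-+ 0≤y 0≤Tˢ) ε₂ 0<ε₂) (both-eventually smoothed⁺ smoothed⁻)))
        λ k → λ { (sat , inc , right , left) → At.result k sat inc right left }

  0<v : ∀ n → n₀ ℕ.< n → 0ℚ < v n
  0<v n n₀<n = <-≤-trans 0<c₃ (≤-trans (≤-trans (≤-reflexive (sym (*-identityʳ c₃)))
    (*-monoˡ (<⇒≤ 0<c₃) (by (gap (≤-trans (≤-reflexive (sym (ι-suc n₀))) (ι-mono n₀<n))) (ring 2 (λ a b → a :- b := con 1ℚ :+ (a :- (con 1ℚ :+ b))) (ι n) (ι n₀)))))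
    (variance-growth n n ℕ.≤-refl))

  central-limit : CentralLimit E m v
  central-limit z ε 0<ε = record
    { η₀ = Core.η₀ z ε 0<ε ; N = Core.N z ε 0<ε ; 0<η₀ = Core.0<η₀ z ε 0<ε ; η₀≤½ = Core.η₀≤½ z ε 0<ε
    ; core = Core.For.core z ε 0<ε }

-- The limit theorem

transport : ∀ {E E′ m m′ v v′} → (∀ n f → E n f ≡ E′ n f) → (∀ n → m n ≡ m′ n) → (∀ n → v n ≡ v′ n) →
  CentralLimit E m v → CentralLimit E′ m′ v′
transport {E} {E′} {m} {m′} {v} {v′} E≡ m≡ v≡ h z ε 0<ε = record
  { η₀ = η₀ ; N = N ; 0<η₀ = 0<η₀ ; η₀≤½ = η₀≤½
  ; core = λ n N≤n ŵ 0<ŵ ŵ≈ → map-eventually (core n N≤n ŵ 0<ŵ (subst (λ V → ∣ ŵ * ŵ * V - 1ℚ ∣ ≤ η₀ * η₀) (sym (v≡ n)) ŵ≈))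
      λ k → subst (λ P → ∣ P - (½ + Total.c k * Gs k z) ∣ ≤ ε)
        (trans (E≡ n (λ x → indicator ((ι x - m n) * ŵ ≤? z))) (cong (λ M → E′ n (λ x → indicator ((ι x - M) * ŵ ≤? z))) (m≡ n))) }
  where open LimitBound (h z ε 0<ε)

module Limit {A : ℕ → Set} (Ω : ∀ n → List (A n)) (χ : ∀ n → A n → ℕ) (S : ℕ → ℕ) (χ≤ : ∀ n a → χ n a ℕ.≤ S n)
  (0≤v : ∀ n → 0ℚ ≤ Var (Ω n) (λ a → ι (χ n a))) (n₀ : ℕ) (0<v : ∀ n → n₀ ℕ.< n → 0ℚ < Var (Ω n) (λ a → ι (χ n a)))
  (central-limit : CentralLimit (λ n f → 𝔼 (Ω n) (λ a → f (χ n a))) (λ n → 𝔼 (Ω n) (λ a → ι (χ n a))) (λ n → Var (Ω n) (λ a → ι (χ n a)))) where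

  m v : ℕ → ℚ
  m n = 𝔼 (Ω n) (λ a → ι (χ n a))
  v n = Var (Ω n) (λ a → ι (χ n a))

  open Total using (c; 0≤c; c≤2; Φ)

  module _ (x : ℝ) (ε : ℚ) (0<ε : 0ℚ < ε) where

    ε₁ : ℚ
    -- One `ε₁` for the limit law at rational thresholds and ten for moving the threshold, see
    -- `compare`.
    ε₁ = ε * inv 10

    0<ε₁ : 0ℚ < ε₁
    0<ε₁ = 0<* 0<ε (0<inv 10)

    K₀ : ℕ
    K₀ = proj₁ (cauchy x ε₁ 0<ε₁)

    x̂ z⁺ z⁻ : ℚ
    x̂  = approx x K₀
    z⁺ = x̂ + ι 3 * ε₁
    z⁻ = x̂ - ι 2 * ε₁

    x≈ : ∀ k → K₀ ℕ.≤ k → ∣ approx x k - x̂ ∣ ≤ ε₁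
    x≈ k K₀≤k = proj₂ (cauchy x ε₁ 0<ε₁) k K₀ K₀≤k ℕ.≤-refl

    module C⁺ = LimitBound (central-limit z⁺ ε₁ 0<ε₁)
    module C⁻ = LimitBound (central-limit z⁻ ε₁ 0<ε₁)

    -- The same `ŵ` serves both thresholds: a product of tolerances that are at most 1 is below
    -- either of them.
    t⁺ t⁻ t : ℚ
    t⁺ = C⁺.η₀ * C⁺.η₀
    t⁻ = C⁻.η₀ * C⁻.η₀
    t  = t⁺ * t⁻

    N : ℕ
    N = suc n₀ ℕ.⊔ (C⁺.N ℕ.⊔ C⁻.N)

    ¼≤1 : ½ * ½ ≤ 1ℚ
    ¼≤1 = *-mono-≤ 0≤½ 0≤1 ½≤1 ½≤1
      where
      0≤½ : 0ℚ ≤ ½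
      0≤½ = <⇒≤ (positive⁻¹ ½)
      ½≤1 : ½ ≤ 1ℚ
      ½≤1 = p≤p+q {½} {½} 0≤½

    0<t⁺ : 0ℚ < t⁺
    0<t⁺ = 0<* C⁺.0<η₀ C⁺.0<η₀
    0<t⁻ : 0ℚ < t⁻
    0<t⁻ = 0<* C⁻.0<η₀ C⁻.0<η₀
    t⁺≤¼ : t⁺ ≤ ½ * ½
    t⁺≤¼ = *-mono-≤ (<⇒≤ C⁺.0<η₀) (<⇒≤ (positive⁻¹ ½)) C⁺.η₀≤½ C⁺.η₀≤½
    t⁻≤1 : t⁻ ≤ 1ℚ
    t⁻≤1 = ≤-trans (*-mono-≤ (<⇒≤ C⁻.0<η₀) (<⇒≤ (positive⁻¹ ½)) C⁻.η₀≤½ C⁻.η₀≤½) ¼≤1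
    t≤t⁺ : t ≤ t⁺
    t≤t⁺ = ≤-trans (*-monoˡ (<⇒≤ 0<t⁺) t⁻≤1) (≤-reflexive (*-identityʳ t⁺))
    t≤t⁻ : t ≤ t⁻
    t≤t⁻ = ≤-trans (*-monoʳ (<⇒≤ 0<t⁻) (≤-trans t⁺≤¼ ¼≤1)) (≤-reflexive (*-identityˡ t⁻))
    0<t : 0ℚ < t
    0<t = 0<* 0<t⁺ 0<t⁻

    module For (n : ℕ) (N≤n : N ℕ.≤ n) where

      0<vₙ : 0ℚ < v n
      0<vₙ = 0<v n (ℕ.≤-trans (ℕ.m≤m⊔n (suc n₀) (C⁺.N ℕ.⊔ C⁻.N)) N≤n)

      -- Multiplied by the variance, `tol` becomes `t`. `R` bounds the centred reward, so an error
      -- `ε₁ * R ⁻¹` in the standardising factor costs at most `ε₁`.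
      i R tol : ℚ
      i   = v n ⁻¹
      R   = ι (S n) + ∣ m n ∣ + 1ℚ
      tol = t * i

      0<i : 0ℚ < i
      0<i = ⁻¹-pos 0<vₙ

      W : ℝ
      W = √ i

      0<R : 0ℚ < R
      0<R = <-≤-trans 0<1 (p≤q+p {1ℚ} {ι (S n) + ∣ m n ∣} (0≤-+ (0≤ι (S n)) (0≤∣p∣ (m n))))

      0<ρ : 0ℚ < ε₁ * R ⁻¹
      0<ρ = 0<* 0<ε₁ (⁻¹-pos 0<R)

      root : Eventually λ k → 0ℚ ≤ approx W k × ∣ approx W k * approx W k - i ∣ ≤ tol
      root = √-spec i (<⇒≤ 0<i) tol (0<* 0<t 0<i)

      K₁ K₃ : ℕ
      K₁ = proj₁ root ℕ.⊔ proj₁ (cauchy W (ε₁ * R ⁻¹) 0<ρ)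
      K₃  = K₀ ℕ.⊔ K₁

      ŵ : ℚ
      ŵ = approx W K₁

      0≤ŵ : 0ℚ ≤ ŵ
      0≤ŵ = proj₁ (proj₂ root K₁ (ℕ.m≤m⊔n (proj₁ root) (proj₁ (cauchy W (ε₁ * R ⁻¹) 0<ρ))))

      ŵ≈ : ∣ ŵ * ŵ * v n - 1ℚ ∣ ≤ t
      ŵ≈ = ≤-trans (≤-reflexive (cong ∣_∣ (trans (cong (λ z → ŵ * ŵ * v n - z) (sym (*-⁻¹ 0<vₙ))) (ring 3 (λ w v i → w :* w :* v :- v :* i := (w :* w :- i) :* v) ŵ (v n) i))))
        (≤-trans (∣*∣ {ŵ * ŵ - i} {v n} (proj₂ (proj₂ root K₁ (ℕ.m≤m⊔n (proj₁ root) (proj₁ (cauchy W (ε₁ * R ⁻¹) 0<ρ))))) (∣∣-self (0≤v n)))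
          (≤-reflexive (trans (ring 3 (λ t i v → t :* i :* v := t :* (v :* i)) t i (v n)) (trans (cong (t *_) (*-⁻¹ 0<vₙ)) (*-identityʳ t)))))

      0<ŵ : 0ℚ < ŵ
      0<ŵ = ≰⇒> λ ŵ≤0 → <⇒≢ (positive⁻¹ ½) (≤-antisym (<⇒≤ (positive⁻¹ ½)) (half≤0 (≤-antisym ŵ≤0 0≤ŵ)))
        where
        half≤0 : ŵ ≡ 0ℚ → ½ ≤ 0ℚ
        half≤0 ŵ≡0 = by {½} {0ℚ} (0≤-+ (0≤-+ (gap (proj₂ (∣∣-≤ {ŵ * ŵ * v n - 1ℚ} ŵ≈))) (gap (≤-trans t≤t⁺ t⁺≤¼))) (<⇒≤ (positive⁻¹ (½ * ½))))
          (trans (ring 2 (λ v t → con 0ℚ := con ½ :+ (t :- :- (con 0ℚ :* con 0ℚ :* v :- con 1ℚ) :+ (con ½ :* con ½ :- t) :+ con ½ :* con ½)) (v n) t)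
            (cong (λ w → ½ + (t - - (w * w * v n - 1ℚ) + (½ * ½ - t) + ½ * ½)) (sym ŵ≡0)))

      d : A n → ℚ
      d a = ι (χ n a) - m n

      W≈ : ∀ a k → K₃ ℕ.≤ k → ∣ d a * (approx W k - ŵ) ∣ ≤ ε₁
      W≈ a k K≤k = ≤-trans (∣*∣ {d a} {approx W k - ŵ}
          (≤-trans (∣-∣ {ι (χ n a)} {m n} (∣≥0∣ (0≤ι (χ n a)) (ι-mono (χ≤ n a))) ≤-refl) (p≤p+q {ι (S n) + ∣ m n ∣} {1ℚ} 0≤1))
          (proj₂ (cauchy W (ε₁ * R ⁻¹) 0<ρ) k K₁ (ℕ.≤-trans K₂≤K₁ (ℕ.≤-trans (ℕ.m≤n⊔m K₀ K₁) K≤k)) K₂≤K₁))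
        (≤-reflexive (/-cancel ε₁ 0<R))
        where
        K₂≤K₁ : proj₁ (cauchy W (ε₁ * R ⁻¹) 0<ρ) ℕ.≤ K₁
        K₂≤K₁ = ℕ.m≤n⊔m (proj₁ root) (proj₁ (cauchy W (ε₁ * R ⁻¹) 0<ρ))

      P⁺ P⁻ : ℚ
      P⁺ = 𝔼 (Ω n) λ a → indicator ((ι (χ n a) - m n) * ŵ ≤? z⁺)
      P⁻ = 𝔼 (Ω n) λ a → indicator ((ι (χ n a) - m n) * ŵ ≤? z⁻)

      core⁺ : Eventually λ k → ∣ P⁺ - (½ + c k * Gs k z⁺) ∣ ≤ ε₁
      core⁺ = C⁺.core n (ℕ.≤-trans (ℕ.≤-trans (ℕ.m≤m⊔n C⁺.N C⁻.N) (ℕ.m≤n⊔m (suc n₀) (C⁺.N ℕ.⊔ C⁻.N))) N≤n) ŵ 0<ŵ (≤-trans ŵ≈ t≤t⁺)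

      core⁻ : Eventually λ k → ∣ P⁻ - (½ + c k * Gs k z⁻) ∣ ≤ ε₁
      core⁻ = C⁻.core n (ℕ.≤-trans (ℕ.≤-trans (ℕ.m≤n⊔m C⁺.N C⁻.N) (ℕ.m≤n⊔m (suc n₀) (C⁺.N ℕ.⊔ C⁻.N))) N≤n) ŵ 0<ŵ (≤-trans ŵ≈ t≤t⁻)

      module _ (Y≤x? : Decidable (λ a → fromℚ (d a) *ᴿ W ≤ᴿ x)) where

        p : ℚ
        p = Pr (Ω n) Y≤x?

        x≈′ : ∀ k → K₃ ℕ.≤ k → ∣ approx x k - x̂ ∣ ≤ ε₁
        x≈′ k K≤k = x≈ k (ℕ.≤-trans (ℕ.m≤m⊔n K₀ K₁) K≤k)

        threshold⁺ : ∀ a → fromℚ (d a) *ᴿ W ≤ᴿ x → d a * ŵ ≤ z⁺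
        threshold⁺ a = Threshold.threshold⁺ x W x̂ ŵ ε₁ (d a) 0<ε₁ K₃ x≈′ (W≈ a)

        threshold⁻ : ∀ a → d a * ŵ ≤ z⁻ → fromℚ (d a) *ᴿ W ≤ᴿ x
        threshold⁻ a = Threshold.threshold⁻ x W x̂ ŵ ε₁ (d a) 0<ε₁ K₃ x≈′ (W≈ a)

        p≤ : p ≤ P⁺
        p≤ = 𝔼-mono (Ω n) λ a → indicator-mono (Y≤x? a) ((ι (χ n a) - m n) * ŵ ≤? z⁺) (threshold⁺ a)

        ≤p : P⁻ ≤ p
        ≤p = 𝔼-mono (Ω n) λ a → indicator-mono ((ι (χ n a) - m n) * ŵ ≤? z⁻) (Y≤x? a) (threshold⁻ a)

        Bx : ℚ
        Bx = ∣ x̂ ∣ + ι 3 * ε₁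

        0≤ε₁ : 0ℚ ≤ ε₁
        0≤ε₁ = <⇒≤ 0<ε₁

        0≤Bx : 0ℚ ≤ Bx
        0≤Bx = 0≤-+ (0≤∣p∣ x̂) (0≤* (0≤ι 3) 0≤ε₁)

        near-x : ∀ y → ∣ y - x̂ ∣ ≤ ι 3 * ε₁ → ∣ y ∣ ≤ Bx
        near-x y h = ≤-trans (≤-reflexive (cong ∣_∣ (ring 2 (λ y x → y := x :+ (y :- x)) y x̂))) (∣+∣ {x̂} {y - x̂} ≤-refl h)

        z⁺≈ : ∣ z⁺ - x̂ ∣ ≤ ι 3 * ε₁
        z⁺≈ = ≤-trans (≤-reflexive (cong ∣_∣ (ring 2 (λ x e → x :+ e :- x := e) x̂ (ι 3 * ε₁)))) (∣∣-self (0≤* (0≤ι 3) 0≤ε₁))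

        z⁻≈ : ∣ z⁻ - x̂ ∣ ≤ ι 3 * ε₁
        z⁻≈ = ≤-trans (≤-reflexive (cong ∣_∣ (ring 2 (λ x e → x :- e :- x := :- e) x̂ (ι 2 * ε₁))))
          (∣neg∣ {ι 2 * ε₁} (∣≥0∣ (0≤* (0≤ι 2) 0≤ε₁) (by 0≤ε₁ (ring 1 (λ e → con (ι 3) :* e := con (ι 2) :* e :+ e) ε₁))))

        compare : ∀ k y → ∣ y - x̂ ∣ ≤ ι 3 * ε₁ → ∣ approx x k - x̂ ∣ ≤ ε₁ →
          (∀ y y′ → ∣ y ∣ ≤ Bx → ∣ y′ ∣ ≤ Bx → ∣ Gs k y - Gs k y′ ∣ ≤ ∣ y - y′ ∣ + ε₁) →
          ∣ (½ + c k * Gs k y) - (½ + c k * Gs k (approx x k)) ∣ ≤ ι 10 * ε₁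
        compare k y y≈ xk≈ lip = ≤-trans (≤-reflexive (cong ∣_∣ (ring 4 (λ h c a b → (h :+ c :* a) :- (h :+ c :* b) := c :* (a :- b)) ½ (c k) (Gs k y) (Gs k (approx x k)))))
          (≤-trans (∣*∣ {c k} {Gs k y - Gs k (approx x k)} (∣≥0∣ (0≤c k) (c≤2 k))
              (≤-trans (lip y (approx x k) (near-x y y≈) (near-x (approx x k) (≤-trans xk≈ (by (0≤* (0≤ι 2) 0≤ε₁) (ring 1 (λ e → con (ι 3) :* e := e :+ con (ι 2) :* e) ε₁)))))
                (+-monoˡ-≤ ε₁ (∣sum∣ {y} {x̂} {approx x k} y≈ (∣flip∣ {approx x k} {x̂} xk≈)))))
            (≤-reflexive (ring 1 (λ e → con (ι 2) :* (con (ι 3) :* e :+ e :+ e) := con (ι 10) :* e) ε₁)))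

        converges : ∣ fromℚ p -ᴿ Φ x ∣ᴿ ≤ᴿ fromℚ ε
        converges ε′ 0<ε′ = map-eventually (both-eventually (both-eventually core⁺ core⁻) (both-eventually (K₀ , x≈) (Gs-lip {Bx} 0≤Bx ε₁ 0<ε₁)))
          λ { k ((hi , lo) , (xk≈ , lip)) →
            let F = ½ + c k * Gs k (approx x k)
                F⁺ = ½ + c k * Gs k z⁺
                F⁻ = ½ + c k * Gs k z⁻
                above = proj₁ (∣∣-≤ {P⁺ - F⁺} hi)
                above′ = proj₁ (∣∣-≤ {F⁺ - F} (compare k z⁺ z⁺≈ xk≈ lip))
                below = proj₂ (∣∣-≤ {P⁻ - F⁻} lo)
                below′ = proj₂ (∣∣-≤ {F⁻ - F} (compare k z⁻ z⁻≈ xk≈ lip))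
            in ≤-trans (∣p-q∣≤r {p} {F} {ι 11 * ε₁}
                 (by {p} {F + ι 11 * ε₁} (0≤-+ (gap p≤) (0≤-+ (gap above) (gap above′)))
                   (ring 5 (λ p P G F e → F :+ con (ι 11) :* e := p :+ (P :- p :+ (e :- (P :- G) :+ (con (ι 10) :* e :- (G :- F))))) p P⁺ F⁺ F ε₁))
                 (by {F} {p + ι 11 * ε₁} (0≤-+ (gap ≤p) (0≤-+ (gap below) (gap below′)))
                   (ring 5 (λ p P G F e → p :+ con (ι 11) :* e := F :+ (p :- P :+ (e :- :- (P :- G) :+ (con (ι 10) :* e :- :- (G :- F))))) p P⁻ F⁻ F ε₁)))
               (≤-trans (≤-reflexive (trans (ring 2 (λ e i → con (ι 11) :* (e :* i) := e :* (i :* con (ι 11))) ε (inv 10)) (trans (cong (ε *_) (inv*ι 10)) (*-identityʳ ε))))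
                 (p≤p+q {ε} {ε′} (<⇒≤ 0<ε′))) }

-- Stage `n` of the process corresponds to the sample space at `suc n`, hence all bounds start at
-- index 1.
asymptotics : ∀ (𝒫 : Process) {A : ℕ → Set} (Ω : ∀ n → List (A n)) (χ : ∀ n → A n → ℕ) →
  (∀ n f → Process.E 𝒫 n f ≡ 𝔼 (Ω (suc n)) (λ a → f (χ (suc n) a))) → (∀ n a → χ (suc n) a ℕ.≤ Process.S 𝒫 n) →
  ∃[ μ ] ∃[ σ² ]
    IsO[1] (λ n → fromℚ (𝔼 (Ω n) (λ a → ι (χ n a))) -ᴿ μ *ᴿ fromℚ (ι n))
  × IsO[1] (λ n → fromℚ (Var (Ω n) (λ a → ι (χ n a))) -ᴿ σ² *ᴿ fromℚ (ι n))
  × AsymptoticallyNormal Ω (λ n a → ι (χ n a))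
asymptotics 𝒫 Ω χ E≡ χ≤ = Steps.Mean.slope 𝒫 , Steps.Variance.slope 𝒫
  , Steps.Mean.slope-IsO[1] 𝒫 (λ n → 𝔼 (Ω n) (λ a → ι (χ n a))) (λ n → sym (m≡ n))
  , Steps.Variance.slope-IsO[1] 𝒫 (λ n → Var (Ω n) (λ a → ι (χ n a))) (λ n → sym (v≡ n))
  , Total.Φ , Φ-standard , λ x ε 0<ε → suc (L.N x ε 0<ε) , λ { (suc n) (ℕ.s≤s N≤n) Y≤x? → L.For.converges x ε 0<ε n N≤n Y≤x? }
  where
  m≡ : ∀ n → Steps.m 𝒫 n ≡ 𝔼 (Ω (suc n)) (λ a → ι (χ (suc n) a))
  m≡ n = E≡ n ι
  v≡ : ∀ n → Steps.v 𝒫 n ≡ Var (Ω (suc n)) (λ a → ι (χ (suc n) a))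
  v≡ n = trans (E≡ n (λ x → (ι x - Steps.m 𝒫 n) * (ι x - Steps.m 𝒫 n)))
    (cong (λ M → 𝔼 (Ω (suc n)) (λ a → (ι (χ (suc n) a) - M) * (ι (χ (suc n) a) - M))) (m≡ n))
  module L = Limit (λ n → Ω (suc n)) (λ n → χ (suc n)) (Process.S 𝒫) χ≤
    (λ n → subst (0ℚ ≤_) (v≡ n) (Steps.0≤v 𝒫 n)) (Steps.n₀ 𝒫) (λ n h → subst (0ℚ <_) (v≡ n) (Steps.0<v 𝒫 n h))
    (transport E≡ m≡ v≡ (Steps.central-limit 𝒫))

-- Splitting off the zeros of a composition

# : List ℕ → ℕ
# l = length (deduplicate ℕ._≟_ l)

#≤length : ∀ l → # l ℕ.≤ length l
#≤length []      = ℕ.z≤n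
#≤length (x ∷ l) = ℕ.s≤s (ℕ.≤-trans (length-filter _ (deduplicate ℕ._≟_ l)) (#≤length l))

-- Numbers of distinct parts are compared through membership alone, because deduplication keeps an
-- order that lowering the entries need not respect once 0 is put in front.
unique-length : ∀ {xs ys : List ℕ} → Unique xs → Unique ys → (∀ {x} → x ∈ xs ⇔ x ∈ ys) → length xs ≡ length ys
unique-length xs! ys! same = ↭-length (∼bag⇒↭ (unique∧set⇒bag xs! ys! same))

positive? : ℕ → ℕ
positive? zero    = 0
positive? (suc _) = 1

module Compositions (b : ℕ) .{{_ : NonTrivial b}} where

  ∈-lower⁻ : ∀ {x l} → x ∈ lower b l → suc x ∈ l
  ∈-lower⁻ {l = zero  ∷ l} h           = there (∈-lower⁻ {l = l} h)
  ∈-lower⁻ {l = suc y ∷ l} (here refl) = here refl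
  ∈-lower⁻ {l = suc y ∷ l} (there h)   = there (∈-lower⁻ {l = l} h)

  0∈⇒zeros : ∀ {l} → 0 ∈ l → positive? (zeros b l) ≡ 1
  0∈⇒zeros {zero  ∷ l} h         = refl
  0∈⇒zeros {suc _ ∷ l} (there h) = 0∈⇒zeros {l} h

  zeros⇒0∈ : ∀ l {a} → zeros b l ≡ suc a → 0 ∈ l
  zeros⇒0∈ (zero  ∷ l) e = here refl
  zeros⇒0∈ (suc _ ∷ l) e = there (zeros⇒0∈ l e)

  #-lower : ∀ l → # l ≡ positive? (zeros b l) ℕ.+ # (lower b l)
  #-lower l = go (zeros b l) refl
    where
    l′ : List ℕ
    l′ = map suc (deduplicate ℕ._≟_ (lower b l))
    l′! : Unique l′
    l′! = Unique.map⁺ ℕ.suc-injective (deduplicate-! (lower b l))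
    ∈⇒∈l′ : ∀ {x} → suc x ∈ deduplicate ℕ._≟_ l → suc x ∈ l′
    ∈⇒∈l′ h = ∈-map⁺ suc (∈-deduplicate⁺ ℕ._≟_ (∈-lower b (∈-deduplicate⁻ ℕ._≟_ l h)))
    ∈l′⇒∈ : ∀ {x} → x ∈ l′ → x ∈ deduplicate ℕ._≟_ l
    ∈l′⇒∈ h with ∈-map⁻ suc h
    ... | _ , h′ , refl = ∈-deduplicate⁺ ℕ._≟_ (∈-lower⁻ {l = l} (∈-deduplicate⁻ ℕ._≟_ (lower b l) h′))
    0∉l′ : ∀ {x} → x ∈ l′ → ¬ 0 ≡ x
    0∉l′ h refl with ∈-map⁻ suc h
    ... | _ , _ , ()
    go : ∀ a → zeros b l ≡ a → # l ≡ positive? a ℕ.+ # (lower b l)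
    go zero    e = trans (unique-length (deduplicate-! l) l′! (mk⇔ to ∈l′⇒∈)) (length-map suc (deduplicate ℕ._≟_ (lower b l)))
      where
      to : ∀ {x} → x ∈ deduplicate ℕ._≟_ l → x ∈ l′
      to {zero}  h = contradiction (trans (sym (0∈⇒zeros (∈-deduplicate⁻ ℕ._≟_ l h))) (cong positive? e)) λ ()
      to {suc x} h = ∈⇒∈l′ h
    go (suc a) e = trans (unique-length (deduplicate-! l) (All.tabulate 0∉l′ ∷ l′!) (mk⇔ to from)) (cong suc (length-map suc (deduplicate ℕ._≟_ (lower b l))))
      where
      to : ∀ {x} → x ∈ deduplicate ℕ._≟_ l → x ∈ 0 ∷ l′
      to {zero}  h = here refl
      to {suc x} h = there (∈⇒∈l′ h)
      from : ∀ {x} → x ∈ 0 ∷ l′ → x ∈ deduplicate ℕ._≟_ l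
      from (here refl) = ∈-deduplicate⁺ ℕ._≟_ (zeros⇒0∈ l e)
      from (there h)   = ∈l′⇒∈ h

  module S = Split b

  select : {P : Set} → Dec P → ℚ → ℚ
  select P? x = if does P? then x else 0ℚ

  select-⇔ : {P Q : Set} (P? : Dec P) (Q? : Dec Q) → P ⇔ Q → ∀ x → select P? x ≡ select Q? x
  select-⇔ P? Q? P⇔Q x = cong (if_then x else 0ℚ) (does-⇔ P⇔Q P? Q?)

  select-true : {P : Set} (P? : Dec P) → P → ∀ x → select P? x ≡ x
  select-true P? p x = cong (if_then x else 0ℚ) (dec-true P? p)

  select-false : {P : Set} (P? : Dec P) → ¬ P → ∀ x → select P? x ≡ 0ℚ
  select-false P? ¬p x = cong (if_then x else 0ℚ) (dec-false P? ¬p)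

  χ : ℕ → (ℕ → ℚ) → List ℕ → ℚ
  χ r g l = select (powerSum b l ≟ ι r) (g (# l))

  count : ℕ → ℕ → ℕ → (ℕ → ℚ) → ℚ
  count h m r g = weighted h m (χ r g)

  private
    b≢0 : ℕ.NonZero b
    b≢0 = ℕ.nonTrivial⇒nonZero b
    0<b : 0ℚ < ι b
    0<b = <-≤-trans 0<1 (1≤b b)

  scale-cancel : ∀ {x y} → ι b * x ≡ ι b * y → x ≡ y
  scale-cancel e = ≤-antisym (*-cancelˡ 0<b (≤-reflexive e)) (*-cancelˡ 0<b (≤-reflexive (sym e)))

  split-ι : ∀ {a r} → a ℕ.≤ r → ι b * ι r ≡ ι (b ℕ.* a) + ι (b ℕ.* (r ℕ.∸ a))
  split-ι {a} {r} a≤r = trans (sym (ι-homo-* b r)) (trans (cong ι (trans (cong (b ℕ.*_) (sym (ℕ.m+[n∸m]≡n a≤r))) (ℕ.*-distribˡ-+ b a (r ℕ.∸ a)))) (ι-homo-+ (b ℕ.* a) (b ℕ.* (r ℕ.∸ a))))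

  zeros≤ : ∀ l {r} → powerSum b l ≡ ι r → zeros b l ℕ.≤ r
  zeros≤ l {r} e = ℕ.*-cancelˡ-≤ b {{b≢0}} (ι-cancel-≤ (≤-trans (p≤p+q {ι (b ℕ.* zeros b l)} (powerSum-nonNeg b (lower b l)))
    (≤-reflexive (trans (sym (powerSum-lower b l)) (trans (cong (ι b *_) e) (sym (ι-homo-* b r)))))))

  +-cancelˡ : ∀ p {q r} → p + q ≡ p + r → q ≡ r
  +-cancelˡ p {q} {r} h = trans (sym (drop p q)) (trans (cong (λ t → - p + t) h) (drop p r))
    where
    drop : ∀ p q → - p + (p + q) ≡ q
    drop = ring 2 (λ p q → :- p :+ (p :+ q) := q)

  -- Multiplication by `b` turns each zero into a summand `b` and lowers every other exponent by 1.
  -- So with `a` zeros the power sum is `r` exactly if `a ≤ r` and the lowered entries sum to b (r -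
  -- a); the first condition guards the truncated subtraction.
  χ-split : ∀ r g l → χ r g l ≡ select (zeros b l ℕ.≤? r) (χ (b ℕ.* (r ℕ.∸ zeros b l)) (λ x → g (positive? (zeros b l) ℕ.+ x)) (lower b l))
  χ-split r g l = trans (cong (λ x → select (powerSum b l ≟ ι r) (g x)) (#-lower l)) ([ small , large ]′ (ℕ.≤-<-connex (zeros b l) r))
    where
    G : ℚ
    G = g (positive? (zeros b l) ℕ.+ # (lower b l))
    small : zeros b l ℕ.≤ r → select (powerSum b l ≟ ι r) G ≡ select (zeros b l ℕ.≤? r) (select (powerSum b (lower b l) ≟ ι (b ℕ.* (r ℕ.∸ zeros b l))) G)
    small a≤r = trans (select-⇔ (powerSum b l ≟ ι r) (powerSum b (lower b l) ≟ ι (b ℕ.* (r ℕ.∸ zeros b l)))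
        (mk⇔ (λ e → +-cancelˡ (ι (b ℕ.* zeros b l)) (trans (sym (powerSum-lower b l)) (trans (cong (ι b *_) e) (split-ι a≤r))))
             (λ e → scale-cancel (trans (powerSum-lower b l) (trans (cong (ι (b ℕ.* zeros b l) +_) e) (sym (split-ι a≤r)))))) G)
      (sym (select-true (zeros b l ℕ.≤? r) a≤r (select (powerSum b (lower b l) ≟ ι (b ℕ.* (r ℕ.∸ zeros b l))) G)))
    large : r ℕ.< zeros b l → select (powerSum b l ≟ ι r) G ≡ select (zeros b l ℕ.≤? r) (select (powerSum b (lower b l) ≟ ι (b ℕ.* (r ℕ.∸ zeros b l))) G)
    large r<a = trans (select-false (powerSum b l ≟ ι r) (λ e → ℕ.<⇒≱ r<a (zeros≤ l e)) G)
      (sym (select-false (zeros b l ℕ.≤? r) (ℕ.<⇒≱ r<a) (select (powerSum b (lower b l) ≟ ι (b ℕ.* (r ℕ.∸ zeros b l))) G)))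

  count-ext : ∀ h m r {f g} → (∀ x → f x ≡ g x) → count h m r f ≡ count h m r g
  count-ext h m r e = weighted-ext h m λ l → cong (select (powerSum b l ≟ ι r)) (e (# l))

  select-weighted : ∀ {P : Set} (P? : Dec P) h m G → weighted h m (λ l → select P? (G l)) ≡ select P? (weighted h m G)
  select-weighted (yes _) h m G = refl
  select-weighted (no _)  h m G = trans (cong (fac⁻¹ m *_) (∑-zero (vectors (upTo h) m) λ _ → refl)) (*-zeroʳ (fac⁻¹ m))

  count-suc : ∀ h m r g → count (suc h) m r g ≡
    conv m (λ a c → fac⁻¹ a * select (a ℕ.≤? r) (count h c (b ℕ.* (r ℕ.∸ a)) (λ x → g (positive? a ℕ.+ x))))
  count-suc h m r g = trans (weighted-ext (suc h) m (χ-split r g))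
    (trans (S.split-convolution h m (λ a l → select (a ℕ.≤? r) (χ (b ℕ.* (r ℕ.∸ a)) (λ x → g (positive? a ℕ.+ x)) l)))
      (conv-cong m λ a c _ → cong (fac⁻¹ a *_) (select-weighted (a ℕ.≤? r) h c (χ (b ℕ.* (r ℕ.∸ a)) (λ x → g (positive? a ℕ.+ x))))))

  count-zero : ∀ h m r g → (∀ l → length l ≡ m → ¬ powerSum b l ≡ ι r) → count h m r g ≡ 0ℚ
  count-zero h m r g h′ = trans (cong (fac⁻¹ m *_) (∑-zero (vectors (upTo h) m) λ v → select-false (powerSum b (toList v) ≟ ι r) (h′ (toList v) (length-toList v)) (g (# (toList v))))) (*-zeroʳ (fac⁻¹ m))

  count-short : ∀ h {m r} g → m ℕ.< r → count h m r g ≡ 0ℚ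
  count-short h {m} {r} g m<r = count-zero h m r g λ l len e → ℕ.<⇒≱ m<r (ι-cancel-≤ (≤-trans (≤-reflexive (sym e)) (subst (λ z → powerSum b l ≤ ι z) len (powerSum-≤-length b l))))

  count-empty : ∀ h m g → count h (suc m) 0 g ≡ 0ℚ
  count-empty h m g = count-zero h (suc m) 0 g λ where
    (x ∷ l) len e → <-irrefl (sym e) (powerSum-pos b {x} {x ∷ l} (here refl))

  count-00 : ∀ h g → count h 0 0 g ≡ g 0
  count-00 h g = trans (*-identityˡ (g 0 + 0ℚ)) (+-identityʳ (g 0))

-- The levels of a composition

conv-comm : ∀ n F → conv n F ≡ conv n (λ a c → F c a)
conv-comm zero    F = refl
conv-comm (suc n) F = trans (cong (F 0 (suc n) +_) (conv-comm n (λ a c → F (suc a) c)))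
  (trans (+-comm (F 0 (suc n)) (conv n (λ a c → F (suc c) a))) (sym (conv-snoc n (λ a c → F c a))))

conv-truncate : ∀ r d F → (∀ a c → r ℕ.< a → F a c ≡ 0ℚ) → conv (r ℕ.+ d) F ≡ conv r (λ a k → F a (k ℕ.+ d))
conv-truncate zero    zero    F h = refl
conv-truncate zero    (suc d) F h = trans (cong (F 0 (suc d) +_) (conv-zero d λ a c _ → h (suc a) c (ℕ.s≤s ℕ.z≤n))) (+-identityʳ (F 0 (suc d)))
conv-truncate (suc r) d       F h = cong (F 0 (suc r ℕ.+ d) +_) (conv-truncate r d (λ a c → F (suc a) c) λ a c r<a → h (suc a) c (ℕ.s≤s r<a))

module Levels (b : ℕ) .{{_ : NonTrivial b}} where
  open Compositions b

  c : ℕ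
  c = b ℕ.∸ 1

  b≡1+c : b ≡ suc c
  b≡1+c = sym (ℕ.suc-pred b {{ℕ.nonTrivial⇒nonZero b}})

  0<c : 0 ℕ.< c
  0<c = ℕ.m<n⇒0<n∸m (ℕ.nonTrivial⇒n>1 b)

  b* : ∀ k → b ℕ.* k ≡ k ℕ.+ c ℕ.* k
  b* k = cong (ℕ._* k) b≡1+c

  -- The weight of the forests of height below h with j b nodes on their first level and n inner nodes.
  T : ℕ → ℕ → ℕ → (ℕ → ℚ) → ℚ
  T h j n g = count h (c ℕ.* n ℕ.+ b ℕ.* j) (b ℕ.* j) g

  T-ext : ∀ h j n {f g} → (∀ x → f x ≡ g x) → T h j n f ≡ T h j n g
  T-ext h j n = count-ext h (c ℕ.* n ℕ.+ b ℕ.* j) (b ℕ.* j)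

  -- The exponential weight of the leaves on a level with `r` nodes, `k` of them inner.
  u : ℕ → ℕ → ℚ
  u r k = select (k ℕ.≤? r) (fac⁻¹ (r ℕ.∸ k))

  -- A forest with `r` roots and `n` inner nodes has c n + r leaves. Summation over the number `k`
  -- of inner roots instead of the number of zeros makes the recursion a convolution in `n`; the
  -- ranges can be exchanged because the terms with `k` beyond `r` or beyond `n` vanish.
  count-level : ∀ h n r g → count (suc h) (c ℕ.* n ℕ.+ r) r g ≡
    conv n (λ k t → u r k * T h k t (λ x → g (positive? (r ℕ.∸ k) ℕ.+ x)))
  count-level h n r g = begin
    count (suc h) (c ℕ.* n ℕ.+ r) r g            ≡⟨ trans (cong (λ m → count (suc h) m r g) (ℕ.+-comm (c ℕ.* n) r)) (count-suc h (r ℕ.+ c ℕ.* n) r g) ⟩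
    conv (r ℕ.+ c ℕ.* n) F                       ≡⟨ conv-truncate r (c ℕ.* n) F F-zero ⟩
    conv r (λ a k → F a (k ℕ.+ c ℕ.* n))         ≡⟨ trans (conv-cong r F≡term) (conv-comm r (λ a k → term k)) ⟩
    conv r (λ k _ → term k)                         ≡⟨ sym (conv-truncate r n (λ k _ → term k) λ k _ → term-large k) ⟩
    conv (r ℕ.+ n) (λ k _ → term k)                 ≡⟨ cong (λ m → conv m (λ k _ → term k)) (ℕ.+-comm r n) ⟩
    conv (n ℕ.+ r) (λ k _ → term k)                 ≡⟨ conv-truncate n r (λ k _ → term k) (λ k _ → term-short k) ⟩
    conv n (λ k _ → term k)                         ≡⟨ conv-cong n (λ k t e → cong (λ m → u r k * count h m (b ℕ.* k) (g′ k)) (size k t e)) ⟩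
    conv n (λ k t → u r k * T h k t (g′ k))      ∎
    where
    open ≡-Reasoning
    g′ : ℕ → ℕ → ℚ
    g′ k x = g (positive? (r ℕ.∸ k) ℕ.+ x)
    F : ℕ → ℕ → ℚ
    F a m = fac⁻¹ a * select (a ℕ.≤? r) (count h m (b ℕ.* (r ℕ.∸ a)) (λ x → g (positive? a ℕ.+ x)))
    term : ℕ → ℚ
    term k = u r k * count h (c ℕ.* n ℕ.+ k) (b ℕ.* k) (g′ k)
    F-zero : ∀ a m → r ℕ.< a → F a m ≡ 0ℚ
    F-zero a m r<a = trans (cong (fac⁻¹ a *_) (select-false (a ℕ.≤? r) (ℕ.<⇒≱ r<a) (count h m (b ℕ.* (r ℕ.∸ a)) (λ x → g (positive? a ℕ.+ x))))) (*-zeroʳ (fac⁻¹ a))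
    F≡term : ∀ a k → a ℕ.+ k ≡ r → F a (k ℕ.+ c ℕ.* n) ≡ term k
    F≡term a k refl = cong₂ _*_
      (sym (trans (select-true (k ℕ.≤? a ℕ.+ k) (ℕ.m≤n+m k a) (fac⁻¹ (a ℕ.+ k ℕ.∸ k))) (cong fac⁻¹ (ℕ.m+n∸n≡m a k))))
      (trans (select-true (a ℕ.≤? a ℕ.+ k) (ℕ.m≤m+n a k) (count h (k ℕ.+ c ℕ.* n) (b ℕ.* (a ℕ.+ k ℕ.∸ a)) (λ x → g (positive? a ℕ.+ x))))
        (trans (cong₂ (λ m z → count h m (b ℕ.* z) (λ x → g (positive? a ℕ.+ x))) (ℕ.+-comm k (c ℕ.* n)) (ℕ.m+n∸m≡n a k))
          (count-ext h (c ℕ.* n ℕ.+ k) (b ℕ.* k) λ x → cong (λ z → g (positive? z ℕ.+ x)) (sym (ℕ.m+n∸n≡m a k)))))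
    term-large : ∀ k → r ℕ.< k → term k ≡ 0ℚ
    term-large k r<k = trans (cong (_* count h (c ℕ.* n ℕ.+ k) (b ℕ.* k) (g′ k)) (select-false (k ℕ.≤? r) (ℕ.<⇒≱ r<k) (fac⁻¹ (r ℕ.∸ k)))) (*-zeroˡ (count h (c ℕ.* n ℕ.+ k) (b ℕ.* k) (g′ k)))
    term-short : ∀ k → n ℕ.< k → term k ≡ 0ℚ
    term-short k n<k = trans (cong (u r k *_) (count-short h (g′ k) (subst (c ℕ.* n ℕ.+ k ℕ.<_) (trans (ℕ.+-comm (c ℕ.* k) k) (sym (b* k)))
      (ℕ.+-monoˡ-< k (ℕ.*-monoʳ-< c {{ℕ.>-nonZero 0<c}} n<k))))) (*-zeroʳ (u r k))
    size : ∀ k t → k ℕ.+ t ≡ n → c ℕ.* n ℕ.+ k ≡ c ℕ.* t ℕ.+ b ℕ.* k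
    size k t refl = trans (cong (ℕ._+ k) (trans (ℕ.*-distribˡ-+ c k t) (ℕ.+-comm (c ℕ.* k) (c ℕ.* t))))
      (trans (ℕ.+-assoc (c ℕ.* t) (c ℕ.* k) k) (cong (c ℕ.* t ℕ.+_) (trans (ℕ.+-comm (c ℕ.* k) k) (sym (b* k)))))

  T-suc : ∀ h j n g → T (suc h) j n g ≡ conv n (λ k t → u (b ℕ.* j) k * T h k t (λ x → g (positive? (b ℕ.* j ℕ.∸ k) ℕ.+ x)))
  T-suc h j n = count-level h n (b ℕ.* j)

  T-00 : ∀ h g → T h 0 0 g ≡ g 0
  T-00 h g = trans (cong₂ (λ p q → count h (p ℕ.+ q) q g) (ℕ.*-zeroʳ c) (ℕ.*-zeroʳ b)) (count-00 h g)

  T-0suc : ∀ h n g → T h 0 (suc n) g ≡ 0ℚ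
  T-0suc h n g = trans (cong₂ (λ p q → count h (p ℕ.+ q) q g) c*≡ (ℕ.*-zeroʳ b)) (count-empty h (ℕ.pred (c ℕ.* suc n) ℕ.+ 0) g)
    where
    c*≡ : c ℕ.* suc n ≡ suc (ℕ.pred (c ℕ.* suc n))
    c*≡ = sym (ℕ.suc-pred (c ℕ.* suc n) {{ℕ.>-nonZero (ℕ.≤-trans 0<c (ℕ.m≤m*n c (suc n)))}})

  T-0 : ∀ h h′ n g → T h 0 n g ≡ T h′ 0 n g
  T-0 h h′ zero    g = trans (T-00 h g) (sym (T-00 h′ g))
  T-0 h h′ (suc n) g = trans (T-0suc h n g) (sym (T-0suc h′ n g))

  -- Each level except the last has an inner node, so the height is limited by the number of inner
  -- nodes.
  T-stable : ∀ h h′ j n g → n ℕ.< h → n ℕ.< h′ → T h j n g ≡ T h′ j n g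
  T-stable (suc h) (suc h′) j n g (ℕ.s≤s n≤h) (ℕ.s≤s n≤h′) = trans (T-suc h j n g) (trans
    (conv-cong n λ k t e → cong (u (b ℕ.* j) k *_) (stable k t e (λ x → g (positive? (b ℕ.* j ℕ.∸ k) ℕ.+ x)))) (sym (T-suc h′ j n g)))
    where
    stable : ∀ k t → k ℕ.+ t ≡ n → ∀ g → T h k t g ≡ T h′ k t g
    stable zero    t _    g = T-0 h h′ t g
    stable (suc k) t refl g = T-stable h h′ (suc k) t g (ℕ.≤-trans (ℕ.s≤s (ℕ.m≤n+m t k)) n≤h) (ℕ.≤-trans (ℕ.s≤s (ℕ.m≤n+m t k)) n≤h′)

  T-level : ∀ j n g → T (suc n) j n g ≡ conv n (λ k t → u (b ℕ.* j) k * T (suc t) k t (λ x → g (positive? (b ℕ.* j ℕ.∸ k) ℕ.+ x)))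
  T-level j n g = trans (T-suc n j n g) (conv-cong n λ k t e → cong (u (b ℕ.* j) k *_) (stable k t e (λ x → g (positive? (b ℕ.* j ℕ.∸ k) ℕ.+ x))))
    where
    stable : ∀ k t → k ℕ.+ t ≡ n → ∀ g → T n k t g ≡ T (suc t) k t g
    stable zero    t _    g = T-0 n (suc t) t g
    stable (suc k) t refl g = T-stable (suc (k ℕ.+ t)) (suc t) (suc k) t g (ℕ.s≤s (ℕ.m≤n+m t k)) ℕ.≤-refl

  -- This is c!. As a factor per inner node it gives weight 1 to the step from width 1 to width 1,
  -- which has `c` leaves.
  x : ℚ
  x = (fac⁻¹ c) ⁻¹

  0<x : 0ℚ < x
  0<x = ⁻¹-pos (0<fac⁻¹ c)

  0≤x : 0ℚ ≤ x
  0≤x = <⇒≤ 0<x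

  ω : ℕ → ℕ → ℚ
  ω j k = x ↑ k * u (b ℕ.* j) k

  θ : ℕ → ℕ → ℕ
  θ j k = positive? (b ℕ.* j ℕ.∸ k)

  τ : ℕ → ℕ → (ℕ → ℚ) → ℚ
  τ j n g = x ↑ n * T (suc n) j n g

  τ-ext : ∀ j n {f g} → (∀ x → f x ≡ g x) → τ j n f ≡ τ j n g
  τ-ext j n h = cong (x ↑ n *_) (T-ext (suc n) j n h)

  τ-level : ∀ j n g → τ j n g ≡ conv n (λ k t → ω j k * τ k t (λ x → g (θ j k ℕ.+ x)))
  τ-level j n g = trans (cong (x ↑ n *_) (T-level j n g)) (trans (sym (conv-* n (x ↑ n) (λ k t → u (b ℕ.* j) k * T (suc t) k t (λ x → g (θ j k ℕ.+ x)))))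
    (conv-cong n λ k t e → trans (cong (_* (u (b ℕ.* j) k * T (suc t) k t (λ x → g (θ j k ℕ.+ x)))) (trans (cong (x ↑_) (sym e)) (↑-+ x k t)))
      (ring 4 (λ a b c d → a :* b :* (c :* d) := a :* c :* (b :* d)) (x ↑ k) (x ↑ t) (u (b ℕ.* j) k) (T (suc t) k t (λ x → g (θ j k ℕ.+ x))))))

  τ-00 : ∀ g → τ 0 0 g ≡ g 0
  τ-00 g = trans (*-identityˡ (T 1 0 0 g)) (T-00 1 g)

  τ-0suc : ∀ n g → τ 0 (suc n) g ≡ 0ℚ
  τ-0suc n g = trans (cong (x ↑ suc n *_) (T-0suc (suc (suc n)) n g)) (*-zeroʳ (x ↑ suc n))

convL : {A : Set} → ℕ → (ℕ → ℕ → List A) → List A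
convL zero    F = F 0 0
convL (suc n) F = F 0 (suc n) ++ convL n (λ a c → F (suc a) c)

convL-cong : ∀ {A : Set} n {F G : ℕ → ℕ → List A} → (∀ a c → a ℕ.+ c ≡ n → F a c ≡ G a c) → convL n F ≡ convL n G
convL-cong zero    h = h 0 0 refl
convL-cong (suc n) h = cong₂ _++_ (h 0 (suc n) refl) (convL-cong n λ a c e → h (suc a) c (cong suc e))

∫-++ : ∀ {A : Set} (μ ν : Meas A) f → ∫ (μ ++ ν) f ≡ ∫ μ f + ∫ ν f
∫-++ []            ν f = sym (+-identityˡ (∫ ν f))
∫-++ ((p , a) ∷ μ) ν f = trans (cong (p * f a +_) (∫-++ μ ν f)) (sym (+-assoc (p * f a) (∫ μ f) (∫ ν f)))

∫-convL : ∀ {A : Set} n (F : ℕ → ℕ → Meas A) f → ∫ (convL n F) f ≡ conv n (λ a c → ∫ (F a c) f)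
∫-convL zero    F f = refl
∫-convL (suc n) F f = trans (∫-++ (F 0 (suc n)) (convL n (λ a c → F (suc a) c)) f) (cong (∫ (F 0 (suc n)) f +_) (∫-convL n (λ a c → F (suc a) c) f))

convL-on : ∀ {A : Set} {P : A → Set} n {F : ℕ → ℕ → Meas A} → (∀ a c → a ℕ.+ c ≡ n → Positive-on P (F a c)) → Positive-on P (convL n F)
convL-on zero    h = h 0 0 refl
convL-on (suc n) h = ++⁺ (h 0 (suc n) refl) (convL-on n λ a c e → h (suc a) c (cong suc e))

shift : ℚ → ℕ → Meas ℕ → Meas ℕ
shift p d = map λ (q , k) → p * q , d ℕ.+ k

∫-shift : ∀ p d μ f → ∫ (shift p d μ) f ≡ p * ∫ μ (λ k → f (d ℕ.+ k))
∫-shift p d []            f = sym (*-zeroʳ p)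
∫-shift p d ((q , k) ∷ μ) f = trans (cong (p * q * f (d ℕ.+ k) +_) (∫-shift p d μ f))
  (ring 4 (λ p q x i → p :* q :* x :+ p :* i := p :* (q :* x :+ i)) p q (f (d ℕ.+ k)) (∫ μ (λ k → f (d ℕ.+ k))))

shift-on : ∀ {P Q : ℕ → Set} {p d μ} → 0ℚ ≤ p → (∀ k → P k → Q (d ℕ.+ k)) → Positive-on P μ → Positive-on Q (shift p d μ)
shift-on 0≤p h []                             = []
shift-on {μ = (q , k) ∷ _} 0≤p h ((0≤q , Pk) ∷ ps) = (0≤* 0≤p 0≤q , h k Pk) ∷ shift-on 0≤p h ps

-- Chains of levels of widths j > k > …; those in β end in width 1 and those in e die out without having width 1 in between.
module Chains (ω : ℕ → ℕ → ℚ) (θ : ℕ → ℕ → ℕ) where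

  chains′ : (ℕ → Meas ℕ) → (ℕ → Meas ℕ) → ℕ → ℕ → ℕ → Meas ℕ
  chains′ e₀ e₁ h       j zero          = e₀ j
  chains′ e₀ e₁ h       j (suc zero)    = e₁ j
  chains′ e₀ e₁ zero    j (suc (suc n)) = []
  chains′ e₀ e₁ (suc h) j (suc (suc n)) = convL n λ k t → shift (ω j (2 ℕ.+ k)) (θ j (2 ℕ.+ k)) (chains′ e₀ e₁ h (2 ℕ.+ k) t)

  module _ (e₀ e₁ : ℕ → Meas ℕ) where

    chains : ℕ → ℕ → Meas ℕ
    chains j n = chains′ e₀ e₁ n j n

    rest≤ : ∀ {k t n} → k ℕ.+ t ≡ n → t ℕ.≤ n
    rest≤ {k} {t} refl = ℕ.m≤n+m t k

    chains-stable : ∀ h h′ j n → n ℕ.≤ h → n ℕ.≤ h′ → chains′ e₀ e₁ h j n ≡ chains′ e₀ e₁ h′ j n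
    chains-stable h       h′       j zero          p         q         = refl
    chains-stable h       h′       j (suc zero)    p         q         = refl
    chains-stable (suc h) (suc h′) j (suc (suc n)) (ℕ.s≤s p) (ℕ.s≤s q) = convL-cong n λ k t e →
      cong (shift (ω j (2 ℕ.+ k)) (θ j (2 ℕ.+ k))) (chains-stable h h′ (2 ℕ.+ k) t
        (ℕ.≤-trans (rest≤ e) (ℕ.≤-trans (ℕ.n≤1+n n) p)) (ℕ.≤-trans (rest≤ e) (ℕ.≤-trans (ℕ.n≤1+n n) q)))

    chains-suc : ∀ j n → chains j (suc (suc n)) ≡ convL n λ k t → shift (ω j (2 ℕ.+ k)) (θ j (2 ℕ.+ k)) (chains (2 ℕ.+ k) t)
    chains-suc j n = convL-cong n λ k t e → cong (shift (ω j (2 ℕ.+ k)) (θ j (2 ℕ.+ k))) (chains-stable (suc n) t (2 ℕ.+ k) t (ℕ.≤-trans (rest≤ e) (ℕ.n≤1+n n)) ℕ.≤-refl)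

    ∫-chains : ∀ j n f → ∫ (chains j (suc (suc n))) f ≡ conv n (λ k t → ω j (2 ℕ.+ k) * ∫ (chains (2 ℕ.+ k) t) (λ d → f (θ j (2 ℕ.+ k) ℕ.+ d)))
    ∫-chains j n f = trans (cong (λ μ → ∫ μ f) (chains-suc j n))
      (trans (∫-convL n (λ k t → shift (ω j (2 ℕ.+ k)) (θ j (2 ℕ.+ k)) (chains (2 ℕ.+ k) t)) f)
        (conv-cong n λ k t _ → ∫-shift (ω j (2 ℕ.+ k)) (θ j (2 ℕ.+ k)) (chains (2 ℕ.+ k) t) f))

    module _ (0≤ω : ∀ j k → 0ℚ ≤ ω j k) (θ≤1 : ∀ j k → θ j k ℕ.≤ 1)
             (e₀-on : ∀ j → Positive-on (ℕ._≤ 0) (e₀ j)) (e₁-on : ∀ j → Positive-on (ℕ._≤ 1) (e₁ j)) where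

      chains′-on : ∀ h j n → Positive-on (ℕ._≤ n) (chains′ e₀ e₁ h j n)
      chains′-on h       j zero          = e₀-on j
      chains′-on h       j (suc zero)    = e₁-on j
      chains′-on zero    j (suc (suc n)) = []
      chains′-on (suc h) j (suc (suc n)) = convL-on n λ k t e → shift-on (0≤ω j (2 ℕ.+ k))
        (λ d d≤t → ℕ.+-mono-≤ (θ≤1 j (2 ℕ.+ k)) (ℕ.≤-trans d≤t (ℕ.≤-trans (rest≤ e) (ℕ.n≤1+n n)))) (chains′-on h (2 ℕ.+ k) t)

      chains-on : ∀ j n → Positive-on (ℕ._≤ n) (chains j n)
      chains-on j n = chains′-on n j n

      -- `κ` is a supersolution for one step between widths at least 2, so the mass of the chains
      -- that avoid width 1 is bounded whatever their length.
      module Bounds (A : ℚ) (0≤A : 0ℚ ≤ A) (κ : ℕ → ℚ)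
        (κ-step : ∀ j s → conv s (λ k _ → ω (2 ℕ.+ j) (2 ℕ.+ k) * κ (2 ℕ.+ k)) ≤ κ (2 ℕ.+ j))
        (e₀≤ : ∀ j → mass (e₀ (2 ℕ.+ j)) ≤ A * κ (2 ℕ.+ j)) (e₁≤ : ∀ j → mass (e₁ (2 ℕ.+ j)) ≤ A * κ (2 ℕ.+ j)) where

        chains-step : ∀ h j n → (∀ k t → t ℕ.≤ h → mass (chains (2 ℕ.+ k) t) ≤ A * κ (2 ℕ.+ k)) → n ℕ.≤ h →
          mass (chains j (suc (suc n))) ≤ A * conv n (λ k _ → ω j (2 ℕ.+ k) * κ (2 ℕ.+ k))
        chains-step h j n hyp n≤h = ≤-trans (≤-reflexive (∫-chains j n (λ _ → 1ℚ)))
          (≤-trans (conv-mono n λ k t e → ≤-trans (*-monoˡ (0≤ω j (2 ℕ.+ k)) (hyp k t (ℕ.≤-trans (rest≤ e) n≤h)))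
              (≤-reflexive (ring 3 (λ o a z → o :* (a :* z) := a :* (o :* z)) (ω j (2 ℕ.+ k)) A (κ (2 ℕ.+ k)))))
            (≤-reflexive (conv-* n A (λ k _ → ω j (2 ℕ.+ k) * κ (2 ℕ.+ k)))))

        chains-bounded : ∀ h j n → n ℕ.≤ h → mass (chains (2 ℕ.+ j) n) ≤ A * κ (2 ℕ.+ j)
        chains-bounded h       j zero          n≤h                = e₀≤ j
        chains-bounded h       j (suc zero)    n≤h                = e₁≤ j
        chains-bounded (suc h) j (suc (suc n)) (ℕ.s≤s n<h) =
          ≤-trans (chains-step h (2 ℕ.+ j) n (λ k t → chains-bounded h k t) (ℕ.≤-trans (ℕ.n≤1+n n) n<h)) (*-monoˡ 0≤A (κ-step j n))

        chains-bounded₁ : ∀ n → mass (chains 1 (suc (suc n))) ≤ A * conv n (λ k _ → ω 1 (2 ℕ.+ k) * κ (2 ℕ.+ k))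
        chains-bounded₁ n = chains-step n 1 n (λ k t → chains-bounded n k t) ℕ.≤-refl

  module FirstPassage
    (τ : ℕ → ℕ → (ℕ → ℚ) → ℚ) (τ-ext : ∀ j n {f g} → (∀ x → f x ≡ g x) → τ j n f ≡ τ j n g)
    (τ-level : ∀ j n g → τ j n g ≡ conv n (λ k t → ω j k * τ k t (λ x → g (θ j k ℕ.+ x))))
    (τ-0suc : ∀ n g → τ 0 (suc n) g ≡ 0ℚ) (q : ℚ)
    (τ-last : ∀ j g → τ (suc j) 0 g ≡ ω (suc j) 0 * q * τ 1 0 g) where

    -- The final level, which has leaves only, gets reward 0 in `e`: its reward 1 is counted by
    -- `τ 1 0`, to which `τ-last` reduces it.
    β e : ℕ → ℕ → Meas ℕ
    β = chains (λ _ → []) (λ j → (ω j 1 , θ j 1) ∷ [])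
    e = chains (λ j → (ω j 0 * q , 0) ∷ []) (λ _ → [])

    Passage : ℕ → ℕ → (ℕ → ℚ) → ℚ
    Passage j n g = conv n (λ s t → ∫ (β j s) (λ d → τ 1 t (λ x → g (d ℕ.+ x)))) + ∫ (e j n) (λ d → τ 1 0 (λ x → g (d ℕ.+ x)))

    -- By the width of the next level: 0 is impossible while inner nodes remain, 1 ends the block,
    -- and a larger width is treated by induction, after which `conv-assoc` collects the lengths.
    -- `h` is fuel.
    first-passage : ∀ h j n g → n ℕ.≤ h → τ (suc j) n g ≡ Passage (suc j) n g
    first-passage h j zero g n≤h = trans (τ-last j g)
      (ring 2 (λ o t → o :* t := con 0ℚ :+ (o :* t :+ con 0ℚ)) (ω (suc j) 0 * q) (τ 1 0 g))
    first-passage h j (suc zero) g n≤h = trans (τ-level (suc j) 1 g)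
      (trans (cong (λ z → ω (suc j) 0 * z + Z) (τ-0suc 0 (λ x → g (θ (suc j) 0 ℕ.+ x))))
        (trans (ring 2 (λ o z → o :* con 0ℚ :+ z := con 0ℚ :+ (z :+ con 0ℚ) :+ con 0ℚ) (ω (suc j) 0) Z) refl))
      where
      Z : ℚ
      Z = ω (suc j) 1 * τ 1 0 (λ x → g (θ (suc j) 1 ℕ.+ x))
    first-passage (suc h) j (suc (suc n)) g (ℕ.s≤s n<h) = begin
      τ J (suc (suc n)) g
        ≡⟨ τ-level J (suc (suc n)) g ⟩
      ω J 0 * τ 0 (suc (suc n)) (λ x → g (θ J 0 ℕ.+ x)) + (Z + conv n (λ k t → ω J (2 ℕ.+ k) * τ (2 ℕ.+ k) t (g′ k)))
        ≡⟨ cong₂ (λ p q → ω J 0 * p + (Z + q)) (τ-0suc (suc n) (λ x → g (θ J 0 ℕ.+ x)))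
             (conv-cong n λ k t e → trans (cong (ω J (2 ℕ.+ k) *_) (first-passage h (suc k) t (g′ k) (ℕ.≤-trans (ℕ.m≤n+m t k) (ℕ.≤-trans (ℕ.≤-reflexive e) (ℕ.≤-trans (ℕ.n≤1+n n) n<h)))))
               (trans (*-distribˡ-+ (ω J (2 ℕ.+ k)) (conv t (F k)) (∫ (e′ k t) (f₀ (g′ k)))) (cong (_+ ω J (2 ℕ.+ k) * ∫ (e′ k t) (f₀ (g′ k))) (sym (conv-* t (ω J (2 ℕ.+ k)) (F k)))))) ⟩
      ω J 0 * 0ℚ + (Z + conv n (λ k t → conv t (λ s r → ω J (2 ℕ.+ k) * F k s r) + ω J (2 ℕ.+ k) * ∫ (e′ k t) (f₀ (g′ k))))
        ≡⟨ cong (λ q → ω J 0 * 0ℚ + (Z + q)) (trans (conv-+ n (λ k t → conv t (λ s r → ω J (2 ℕ.+ k) * F k s r)) (λ k t → ω J (2 ℕ.+ k) * ∫ (e′ k t) (f₀ (g′ k))))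
             (cong₂ _+_ (trans (conv-assoc n (λ k s r → ω J (2 ℕ.+ k) * F k s r)) (conv-cong n λ s r _ → outer s r)) last)) ⟩
      ω J 0 * 0ℚ + (Z + (V + ∫ (e J (suc (suc n))) (f₀ g)))
        ≡⟨ ring 4 (λ o z v i → o :* con 0ℚ :+ (z :+ (v :+ i)) := con 0ℚ :+ (z :+ con 0ℚ :+ v) :+ i) (ω J 0) Z V (∫ (e J (suc (suc n))) (f₀ g)) ⟩
      Passage J (suc (suc n)) g ∎
      where
      open ≡-Reasoning
      J : ℕ
      J = suc j
      Z V : ℚ
      Z = ω J 1 * τ 1 (suc n) (λ x → g (θ J 1 ℕ.+ x))
      g′ : ℕ → ℕ → ℚ
      g′ k x = g (θ J (2 ℕ.+ k) ℕ.+ x)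
      e′ : ℕ → ℕ → Meas ℕ
      e′ k = e (2 ℕ.+ k)
      f₀ : (ℕ → ℚ) → ℕ → ℚ
      f₀ g d = τ 1 0 (λ x → g (d ℕ.+ x))
      F : ℕ → ℕ → ℕ → ℚ
      F k s r = ∫ (β (2 ℕ.+ k) s) (λ d → τ 1 r (λ x → g′ k (d ℕ.+ x)))
      V = conv n (λ s r → ∫ (β J (2 ℕ.+ s)) (λ d → τ 1 r (λ x → g (d ℕ.+ x))))
      reassoc : ∀ k d x → g′ k (d ℕ.+ x) ≡ g (θ J (2 ℕ.+ k) ℕ.+ d ℕ.+ x)
      reassoc k d x = cong g (sym (ℕ.+-assoc (θ J (2 ℕ.+ k)) d x))
      outer : ∀ s r → conv s (λ k s → ω J (2 ℕ.+ k) * F k s r) ≡ ∫ (β J (2 ℕ.+ s)) (λ d → τ 1 r (λ x → g (d ℕ.+ x)))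
      outer s r = sym (trans (∫-chains (λ _ → []) (λ j → (ω j 1 , θ j 1) ∷ []) J s (λ d → τ 1 r (λ x → g (d ℕ.+ x))))
        (conv-cong s λ k s′ _ → cong (ω J (2 ℕ.+ k) *_) (∫-ext (β (2 ℕ.+ k) s′) λ d → τ-ext 1 r λ x → sym (reassoc k d x))))
      last : conv n (λ k t → ω J (2 ℕ.+ k) * ∫ (e′ k t) (f₀ (g′ k))) ≡ ∫ (e J (suc (suc n))) (f₀ g)
      last = sym (trans (∫-chains (λ j → (ω j 0 * q , 0) ∷ []) (λ _ → []) J n (f₀ g))
        (conv-cong n λ k t _ → cong (ω J (2 ℕ.+ k) *_) (∫-ext (e′ k t) λ d → τ-ext 1 0 λ x → sym (reassoc k d x))))

-- Bounds for the weights of the levels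

binomial : ℕ → ℚ
binomial N = conv N λ k m → fac⁻¹ k * fac⁻¹ m

-- The coefficients of the square of the exponential series, again by the product rule.
binomial-≡ : ∀ N → binomial N ≡ ι 2 ↑ N * fac⁻¹ N
binomial-≡ zero    = refl
binomial-≡ (suc N) = trans step (trans (cong (λ z → inv N * (ι 2 * z)) (binomial-≡ N))
  (ring 4 (λ i t p f → i :* (t :* (p :* f)) := t :* p :* (f :* i)) (inv N) (ι 2) (ι 2 ↑ N) (fac⁻¹ N)))
  where
  open ≡-Reasoning
  F : ℕ → ℕ → ℚ
  F k m = fac⁻¹ k * fac⁻¹ m
  derivative : ι (suc N) * binomial (suc N) ≡ ι 2 * binomial N
  derivative = begin
    ι (suc N) * conv (suc N) F
      ≡⟨ trans (sym (conv-* (suc N) (ι (suc N)) F)) (conv-cong (suc N) λ a c e → trans (cong (λ z → ι z * F a c) (sym e))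
           (trans (cong (_* F a c) (ι-homo-+ a c)) (*-distribʳ-+ (F a c) (ι a) (ι c)))) ⟩
    conv (suc N) (λ a c → ι a * F a c + ι c * F a c)
      ≡⟨ conv-+ (suc N) (λ a c → ι a * F a c) (λ a c → ι c * F a c) ⟩
    0ℚ * F 0 (suc N) + conv N (λ a c → ι (suc a) * F (suc a) c) + conv (suc N) (λ a c → ι c * F a c)
      ≡⟨ cong₂ _+_ (trans (cong (_+ conv N (λ a c → ι (suc a) * F (suc a) c)) (*-zeroˡ (F 0 (suc N)))) (trans (+-identityˡ (conv N (λ a c → ι (suc a) * F (suc a) c)))
             (conv-cong N λ a c _ → trans (sym (*-assoc (ι (suc a)) (fac⁻¹ (suc a)) (fac⁻¹ c))) (cong (_* fac⁻¹ c) (fac⁻¹-suc a)))))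
           (trans (conv-snoc N (λ a c → ι c * F a c)) (trans (cong (conv N (λ a c → ι (suc c) * F a (suc c)) +_) (*-zeroˡ (F (suc N) 0)))
             (trans (+-identityʳ (conv N (λ a c → ι (suc c) * F a (suc c)))) (conv-cong N λ a c _ →
               trans (ring 3 (λ n f g → n :* (f :* g) := f :* (n :* g)) (ι (suc c)) (fac⁻¹ a) (fac⁻¹ (suc c))) (cong (fac⁻¹ a *_) (fac⁻¹-suc c)))))) ⟩
    binomial N + binomial N
      ≡⟨ ring 1 (λ z → z :+ z := con (ι 2) :* z) (binomial N) ⟩
    ι 2 * binomial N ∎
  step : binomial (suc N) ≡ inv N * (ι 2 * binomial N)
  step = trans (sym (*-identityˡ (binomial (suc N)))) (trans (cong (_* binomial (suc N)) (sym (inv*ι N)))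
    (trans (*-assoc (inv N) (ι (suc N)) (binomial (suc N))) (cong (inv N *_) derivative)))

2*inv≤ : ∀ {i m} → 2 ℕ.* suc i ℕ.≤ suc m → ι 2 * inv m ≤ inv i
2*inv≤ {i} {m} h = begin
  ι 2 * inv m                            ≡⟨ trans (sym (*-identityʳ (ι 2 * inv m))) (cong (ι 2 * inv m *_) (sym (inv*ι i))) ⟩
  ι 2 * inv m * (inv i * ι (suc i))      ≡⟨ ring 4 (λ t m i s → t :* m :* (i :* s) := i :* m :* (t :* s)) (ι 2) (inv m) (inv i) (ι (suc i)) ⟩
  inv i * inv m * (ι 2 * ι (suc i))      ≤⟨ *-monoˡ (0≤* (0≤inv i) (0≤inv m)) (≤-trans (≤-reflexive (sym (ι-homo-* 2 (suc i)))) (ι-mono h)) ⟩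
  inv i * inv m * ι (suc m)              ≡⟨ trans (*-assoc (inv i) (inv m) (ι (suc m))) (trans (cong (inv i *_) (inv*ι m)) (*-identityʳ (inv i))) ⟩
  inv i                                  ∎
  where open ≤-Reasoning

-- The binomial coefficient of i + N over i is the product of the i factors (N + k) / k with k ≤ i,
-- each of which is at least 2.
2↑*fac⁻¹≤ : ∀ i N → i ℕ.≤ N → ι 2 ↑ i * fac⁻¹ (i ℕ.+ N) ≤ fac⁻¹ i * fac⁻¹ N
2↑*fac⁻¹≤ zero    N _   = ≤-refl
2↑*fac⁻¹≤ (suc i) N i<N = begin
  ι 2 * ι 2 ↑ i * (fac⁻¹ (i ℕ.+ N) * inv (i ℕ.+ N))     ≡⟨ ring 4 (λ t p f n → t :* p :* (f :* n) := p :* f :* (t :* n)) (ι 2) (ι 2 ↑ i) (fac⁻¹ (i ℕ.+ N)) (inv (i ℕ.+ N)) ⟩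
  ι 2 ↑ i * fac⁻¹ (i ℕ.+ N) * (ι 2 * inv (i ℕ.+ N))     ≤⟨ *-mono-≤ (0≤* (0≤ι 2) (0≤inv (i ℕ.+ N))) (0≤* (0≤fac⁻¹ i) (0≤fac⁻¹ N)) (2↑*fac⁻¹≤ i N (ℕ.<⇒≤ i<N))
                                                              (2*inv≤ (subst (ℕ._≤ suc (i ℕ.+ N)) (cong (suc i ℕ.+_) (sym (ℕ.+-identityʳ (suc i)))) (ℕ.s≤s (ℕ.+-monoʳ-≤ i i<N)))) ⟩
  fac⁻¹ i * fac⁻¹ N * inv i                             ≡⟨ ring 3 (λ f g n → f :* g :* n := f :* n :* g) (fac⁻¹ i) (fac⁻¹ N) (inv i) ⟩
  fac⁻¹ (suc i) * fac⁻¹ N                               ∎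
  where open ≤-Reasoning

conv-prefix : ∀ s d {φ : ℕ → ℚ} → (∀ k → 0ℚ ≤ φ k) → conv s (λ k _ → φ k) ≤ conv (s ℕ.+ d) (λ k _ → φ k)
conv-prefix zero    zero    h = ≤-refl
conv-prefix zero    (suc d) h = p≤p+q (0≤conv d λ a c _ → h (suc a))
conv-prefix (suc s) d {φ}   h = +-monoʳ-≤ (φ 0) (conv-prefix s d λ k → h (suc k))

module Contraction (b : ℕ) .{{_ : NonTrivial b}} where
  open Compositions b using (select; select-true; select-false)
  open Levels b

  y : ℚ
  y = fac⁻¹ c

  0≤y : 0ℚ ≤ y
  0≤y = 0≤fac⁻¹ c

  -- With this choice `x ↑ k` cancels in `ω j k * κ k`, and the sum over `k` becomes part of the
  -- binomial sum for `b ℕ.* j`. So `κ` is a supersolution at `j` once `D (b ℕ.* j) ≤ κ j`.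
  κ : ℕ → ℚ
  κ j = y ↑ j * fac⁻¹ j

  0≤u : ∀ r k → 0ℚ ≤ u r k
  0≤u r k = [ (λ k≤r → subst (0ℚ ≤_) (sym (select-true (k ℕ.≤? r) k≤r (fac⁻¹ (r ℕ.∸ k)))) (0≤fac⁻¹ (r ℕ.∸ k)))
            , (λ r<k → ≤-reflexive (sym (select-false (k ℕ.≤? r) (ℕ.<⇒≱ r<k) (fac⁻¹ (r ℕ.∸ k))))) ]′ (ℕ.≤-<-connex k r)

  0≤ω : ∀ j k → 0ℚ ≤ ω j k
  0≤ω j k = 0≤* (0≤↑ 0≤x k) (0≤u (b ℕ.* j) k)

  x*y : x * y ≡ 1ℚ
  x*y = trans (*-comm x y) (*-⁻¹ (0<fac⁻¹ c))

  ω*κ : ∀ j k → ω j k * κ k ≡ u (b ℕ.* j) k * fac⁻¹ k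
  ω*κ j k = trans (ring 4 (λ p u q f → p :* u :* (q :* f) := p :* q :* (u :* f)) (x ↑ k) (u (b ℕ.* j) k) (y ↑ k) (fac⁻¹ k))
    (trans (cong (_* (u (b ℕ.* j) k * fac⁻¹ k)) (trans (sym (↑-distrib x y k)) (trans (cong (_↑ k) x*y) (1↑ k)))) (*-identityˡ (u (b ℕ.* j) k * fac⁻¹ k)))

  tail : ℕ → ℚ
  tail M = conv M λ k m → fac⁻¹ (2 ℕ.+ k) * fac⁻¹ m

  tail≤binomial : ∀ M → tail M ≤ binomial (2 ℕ.+ M)
  tail≤binomial M = ≤-trans (p≤q+p {tail M} (0≤* (0≤fac⁻¹ 1) (0≤fac⁻¹ (suc M)))) (p≤q+p {fac⁻¹ 1 * fac⁻¹ (suc M) + tail M} (0≤* (0≤fac⁻¹ 0) (0≤fac⁻¹ (suc (suc M)))))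

  ωκ-tail : ∀ j M s → b ℕ.* j ≡ 2 ℕ.+ M → conv s (λ k _ → ω j (2 ℕ.+ k) * κ (2 ℕ.+ k)) ≤ tail M
  ωκ-tail j M s e = ≤-trans (conv-prefix s M {λ k → ω j (2 ℕ.+ k) * κ (2 ℕ.+ k)} λ k → 0≤* (0≤ω j (2 ℕ.+ k)) (0≤* (0≤↑ 0≤y (2 ℕ.+ k)) (0≤fac⁻¹ (2 ℕ.+ k))))
    (≤-reflexive (trans (cong (λ m → conv m (λ k _ → ω j (2 ℕ.+ k) * κ (2 ℕ.+ k))) (ℕ.+-comm s M))
      (trans (conv-cong (M ℕ.+ s) λ k _ _ → trans (ω*κ j (2 ℕ.+ k)) (cong (λ N → u N (2 ℕ.+ k) * fac⁻¹ (2 ℕ.+ k)) e))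
        (trans (conv-truncate M s (λ k _ → u (2 ℕ.+ M) (2 ℕ.+ k) * fac⁻¹ (2 ℕ.+ k)) λ k _ M<k →
            trans (cong (_* fac⁻¹ (2 ℕ.+ k)) (select-false (2 ℕ.+ k ℕ.≤? 2 ℕ.+ M) (λ h → ℕ.<⇒≱ M<k (ℕ.s≤s⁻¹ (ℕ.s≤s⁻¹ h))) (fac⁻¹ (M ℕ.∸ k)))) (*-zeroˡ (fac⁻¹ (2 ℕ.+ k))))
          (conv-cong M last)))))
    where
    last : ∀ k m → k ℕ.+ m ≡ M → u (2 ℕ.+ M) (2 ℕ.+ k) * fac⁻¹ (2 ℕ.+ k) ≡ fac⁻¹ (2 ℕ.+ k) * fac⁻¹ m
    last k m refl = trans (cong (_* fac⁻¹ (2 ℕ.+ k)) (trans (select-true (2 ℕ.+ k ℕ.≤? 2 ℕ.+ (k ℕ.+ m)) (ℕ.s≤s (ℕ.s≤s (ℕ.m≤m+n k m))) (fac⁻¹ (k ℕ.+ m ℕ.∸ k)))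
      (cong fac⁻¹ (ℕ.m+n∸m≡n k m)))) (*-comm (fac⁻¹ m) (fac⁻¹ (2 ℕ.+ k)))

  D : ℕ → ℚ
  D N = ι 2 ↑ N * fac⁻¹ N

  D-suc : ∀ N → D (suc N) ≡ D N * (ι 2 * inv N)
  D-suc N = ring 4 (λ t p f i → t :* p :* (f :* i) := p :* f :* (t :* i)) (ι 2) (ι 2 ↑ N) (fac⁻¹ N) (inv N)

  0≤D : ∀ N → 0ℚ ≤ D N
  0≤D N = 0≤* (0≤↑ (0≤ι 2) N) (0≤fac⁻¹ N)

  0≤κ : ∀ j → 0ℚ ≤ κ j
  0≤κ j = 0≤* (0≤↑ 0≤y j) (0≤fac⁻¹ j)

  2≤b : 2 ℕ.≤ b
  2≤b = ℕ.nonTrivial⇒n>1 b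

  -- Of the `b` factors that the factorial gains, `c` are compared with `y` by means of `2↑*fac⁻¹≤`,
  -- and the last one with `inv j`.
  D-level : ∀ j → c ℕ.≤ b ℕ.* j → D (b ℕ.* j) ≤ κ j → D (b ℕ.* suc j) ≤ κ (suc j)
  D-level j c≤N h = begin
    D (b ℕ.* suc j)                           ≡⟨ cong D size ⟩
    D (suc (c ℕ.+ N))                         ≡⟨ D-suc (c ℕ.+ N) ⟩
    D (c ℕ.+ N) * (ι 2 * inv (c ℕ.+ N))       ≤⟨ *-mono-≤ (0≤* (0≤ι 2) (0≤inv (c ℕ.+ N))) (0≤* 0≤y (0≤κ j)) first
                                                   (2*inv≤ (subst (2 ℕ.* suc j ℕ.≤_) size (ℕ.*-monoˡ-≤ (suc j) 2≤b))) ⟩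
    y * κ j * inv j                           ≡⟨ ring 4 (λ y p f i → y :* (p :* f) :* i := y :* p :* (f :* i)) y (y ↑ j) (fac⁻¹ j) (inv j) ⟩
    κ (suc j)                                 ∎
    where
    open ≤-Reasoning
    N : ℕ
    N = b ℕ.* j
    size : b ℕ.* suc j ≡ suc (c ℕ.+ N)
    size = trans (ℕ.*-suc b j) (cong (ℕ._+ N) b≡1+c)
    first : D (c ℕ.+ N) ≤ y * κ j
    first = begin
      ι 2 ↑ (c ℕ.+ N) * fac⁻¹ (c ℕ.+ N)               ≡⟨ trans (cong (_* fac⁻¹ (c ℕ.+ N)) (↑-+ (ι 2) c N)) (ring 3 (λ p q f → p :* q :* f := q :* (p :* f)) (ι 2 ↑ c) (ι 2 ↑ N) (fac⁻¹ (c ℕ.+ N))) ⟩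
      ι 2 ↑ N * (ι 2 ↑ c * fac⁻¹ (c ℕ.+ N))           ≤⟨ *-monoˡ (0≤↑ (0≤ι 2) N) (2↑*fac⁻¹≤ c N c≤N) ⟩
      ι 2 ↑ N * (y * fac⁻¹ N)                         ≡⟨ ring 3 (λ p y f → p :* (y :* f) := y :* (p :* f)) (ι 2 ↑ N) y (fac⁻¹ N) ⟩
      y * D N                                         ≤⟨ *-monoˡ 0≤y h ⟩
      y * κ j                                         ∎

  -- The base case at width 2 for b = 3 + a, where the right side is `κ 2`: when `a` grows by 1, the
  -- left side gains two factors `ι 2 * inv _`, neither larger than the corresponding
  -- `inv (2 ℕ.+ a)` on the right.
  D-double : ∀ a → D (6 ℕ.+ (a ℕ.+ a)) ≤ ½ * (fac⁻¹ (2 ℕ.+ a) * fac⁻¹ (2 ℕ.+ a))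
  D-double zero    = from-yes (D 6 ≤? ½ * (fac⁻¹ 2 * fac⁻¹ 2))
  D-double (suc a) = begin
    D (6 ℕ.+ (suc a ℕ.+ suc a))                                  ≡⟨ cong (λ z → D (7 ℕ.+ z)) (ℕ.+-suc a a) ⟩
    D (suc (suc N))                                              ≡⟨ trans (D-suc (suc N)) (cong (_* (ι 2 * inv (suc N))) (D-suc N)) ⟩
    D N * (ι 2 * inv N) * (ι 2 * inv (suc N))                    ≤⟨ *-mono-≤ (0≤* (0≤ι 2) (0≤inv (suc N))) (0≤* (0≤* (0≤½) (0≤* (0≤fac⁻¹ (2 ℕ.+ a)) (0≤fac⁻¹ (2 ℕ.+ a)))) (0≤inv (2 ℕ.+ a)))
                                                                      (*-mono-≤ (0≤* (0≤ι 2) (0≤inv N)) (0≤* 0≤½ (0≤* (0≤fac⁻¹ (2 ℕ.+ a)) (0≤fac⁻¹ (2 ℕ.+ a)))) (D-double a) (2*inv≤ {2 ℕ.+ a} {N} N-large))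
                                                                      (2*inv≤ {2 ℕ.+ a} {suc N} (ℕ.m≤n⇒m≤1+n N-large)) ⟩
    ½ * (fac⁻¹ (2 ℕ.+ a) * fac⁻¹ (2 ℕ.+ a)) * inv (2 ℕ.+ a) * inv (2 ℕ.+ a)
                                                                 ≡⟨ ring 3 (λ h f i → h :* (f :* f) :* i :* i := h :* (f :* i :* (f :* i))) ½ (fac⁻¹ (2 ℕ.+ a)) (inv (2 ℕ.+ a)) ⟩
    ½ * (fac⁻¹ (3 ℕ.+ a) * fac⁻¹ (3 ℕ.+ a))                      ∎
    where
    open ≤-Reasoning
    N : ℕ
    N = 6 ℕ.+ (a ℕ.+ a)
    0≤½ : 0ℚ ≤ ½
    0≤½ = <⇒≤ (positive⁻¹ ½)
    N-large : 2 ℕ.* suc (2 ℕ.+ a) ℕ.≤ suc N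
    N-large = ℕ.≤-trans (ℕ.≤-reflexive (cong (3 ℕ.+_) (trans (cong (a ℕ.+_) (ℕ.+-identityʳ (3 ℕ.+ a)))
      (trans (ℕ.+-suc a (2 ℕ.+ a)) (cong suc (trans (ℕ.+-suc a (1 ℕ.+ a)) (cong suc (ℕ.+-suc a a)))))))) (ℕ.n≤1+n N)

  -- The first component is for the steps to width 1 or 0, which end a block, the second for the
  -- steps to larger widths.
  Contracts : ℕ → Set
  Contracts j = fac⁻¹ (b ℕ.* j ℕ.∸ 1) ≤ κ j × (∀ s → conv s (λ k _ → ω j (2 ℕ.+ k) * κ (2 ℕ.+ k)) ≤ κ j)

  size₂ : ∀ j → ∃[ M ] b ℕ.* suc j ≡ 2 ℕ.+ M
  size₂ j = b ℕ.* suc j ℕ.∸ 2 , sym (ℕ.m+[n∸m]≡n (ℕ.≤-trans 2≤b (ℕ.m≤m*n b (suc j))))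

  D⇒contracts : ∀ j → D (b ℕ.* suc j) ≤ κ (suc j) → Contracts (suc j)
  D⇒contracts j h = go (size₂ j)
    where
    go : ∃[ M ] b ℕ.* suc j ≡ 2 ℕ.+ M → Contracts (suc j)
    go (M , e) = ≤-trans (≤-trans (≤-reflexive (cong (λ N → fac⁻¹ (N ℕ.∸ 1)) e)) second) binomial≤ , λ s → ≤-trans (ωκ-tail (suc j) M s e) (≤-trans (tail≤binomial M) binomial≤)
      where
      binomial≤ : binomial (2 ℕ.+ M) ≤ κ (suc j)
      binomial≤ = subst (_≤ κ (suc j)) (trans (cong D e) (sym (binomial-≡ (2 ℕ.+ M)))) h
      second : fac⁻¹ (1 ℕ.+ M) ≤ binomial (2 ℕ.+ M)
      second = ≤-trans (≤-reflexive (sym (*-identityˡ (fac⁻¹ (1 ℕ.+ M)))))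
        (≤-trans (p≤p+q {fac⁻¹ 1 * fac⁻¹ (suc M)} (0≤conv M λ k m _ → 0≤* (0≤fac⁻¹ (2 ℕ.+ k)) (0≤fac⁻¹ m)))
          (p≤q+p {fac⁻¹ 1 * fac⁻¹ (suc M) + tail M} (0≤* (0≤fac⁻¹ 0) (0≤fac⁻¹ (suc (suc M))))))

  c≤b* : ∀ j → c ℕ.≤ b ℕ.* suc j
  c≤b* j = ℕ.≤-trans (ℕ.m∸n≤m b 1) (ℕ.m≤m*n b (suc j))

  D-from : ∀ i → D (b ℕ.* suc i) ≤ κ (suc i) → ∀ j → D (b ℕ.* (suc j ℕ.+ i)) ≤ κ (suc j ℕ.+ i)
  D-from i h zero    = h
  D-from i h (suc j) = D-level (suc j ℕ.+ i) (c≤b* (j ℕ.+ i)) (D-from i h j)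

-- For b = 2 and width 2, the bound fails unless the two leading terms of the binomial sum are dropped.
contracts : ∀ b .{{_ : NonTrivial b}} j → Contraction.Contracts b (2 ℕ.+ j)
contracts 0 j = contradiction (ℕ.nonTrivial⇒n>1 0) λ ()
contracts 1 j = contradiction (ℕ.nonTrivial⇒n>1 1) λ { (ℕ.s≤s ()) }
contracts 2 zero = from-yes (fac⁻¹ 3 ≤? Contraction.κ 2 2) ,
  λ s → ≤-trans (Contraction.ωκ-tail 2 2 2 s refl) (from-yes (Contraction.tail 2 2 ≤? Contraction.κ 2 2))
contracts 2 (suc j) = Contraction.D⇒contracts 2 (2 ℕ.+ j) (subst (λ i → Contraction.D 2 (2 ℕ.* i) ≤ Contraction.κ 2 i) (ℕ.+-comm (suc j) 2)
  (Contraction.D-from 2 2 (from-yes (Contraction.D 2 6 ≤? Contraction.κ 2 3)) j))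
contracts b@(suc (suc (suc a))) j = Contraction.D⇒contracts b (1 ℕ.+ j) (subst (λ i → D (b ℕ.* i) ≤ κ i) (ℕ.+-comm (suc j) 1) (D-from 1 base j))
  where
  open Contraction b
  base : D (b ℕ.* 2) ≤ κ 2
  base = ≤-trans (≤-reflexive (cong D (trans (ℕ.*-comm b 2) (cong (3 ℕ.+_) (trans (cong (a ℕ.+_) (ℕ.+-identityʳ (3 ℕ.+ a)))
      (trans (ℕ.+-suc a (2 ℕ.+ a)) (cong suc (trans (ℕ.+-suc a (1 ℕ.+ a)) (cong suc (ℕ.+-suc a a))))))))))
    (≤-trans (D-double a) (≤-reflexive (ring 1 (λ f → con ½ :* (f :* f) := f :* (f :* con 1ℚ) :* con (fac⁻¹ 2)) (fac⁻¹ (2 ℕ.+ a)))))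

-- The renewal process of the compositions

module Trees (b : ℕ) .{{_ : NonTrivial b}} where
  open Compositions b using (χ; count; select-true; select-false; select-weighted)
  open Levels b
  open Contraction b using (κ; 0≤κ; 0≤u; 0≤ω; 0≤y; x*y; tail; ωκ-tail; size₂; 2≤b)

  Ω : ∀ n → List (Vec ℕ (parts b (suc n)))
  Ω n = compositions b (suc n)

  E : ℕ → (ℕ → ℚ) → ℚ
  E n f = 𝔼 (Ω n) (λ k → f (# (toList k)))

  z : ℕ → ℚ
  z n = x ↑ n * fac⁻¹ (parts b (suc n))

  ∑f : ℕ → (ℕ → ℚ) → ℚ
  ∑f n f = ∑ (Ω n) (λ k → f (# (toList k)))

  -- With `suc n` inner nodes the root is one of them, so the level of the root contributes only the
  -- term with one inner node and no leaves, of weight 1 and reward 0.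
  T-∑ : ∀ n f → T (suc n) 1 n f ≡ fac⁻¹ (parts b (suc n)) * ∑f n f
  T-∑ n f = trans (sym top) (cong (fac⁻¹ (parts b (suc n)) *_) (sym (∑-filter (λ k → powerSum b (toList k) ≟ 1ℚ) (vectors _ (parts b (suc n))) (λ k → f (# (toList k))))))
    where
    F : ℕ → ℕ → ℚ
    F k t = u 1 k * T (suc n) k t (λ x → f (positive? (1 ℕ.∸ k) ℕ.+ x))
    top : count (suc (suc n)) (parts b (suc n)) 1 f ≡ T (suc n) 1 n f
    top = begin
      count (suc (suc n)) (parts b (suc n)) 1 f     ≡⟨ count-level (suc n) (suc n) 1 f ⟩
      F 0 (suc n) + conv n (λ k t → F (suc k) t)    ≡⟨ cong₂ _+_ (trans (cong (u 1 0 *_) (T-0suc (suc n) n (λ x → f (1 ℕ.+ x)))) (*-zeroʳ (u 1 0)))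
                                                         (conv-truncate 0 n (λ k t → F (suc k) t) λ { (suc k) t (ℕ.s≤s ℕ.z≤n) → *-zeroˡ (T (suc n) (2 ℕ.+ k) t f) }) ⟩
      0ℚ + F 1 n                                    ≡⟨ trans (+-identityˡ (F 1 n)) (*-identityˡ (T (suc n) 1 n f)) ⟩
      T (suc n) 1 n f                               ∎
      where open ≡-Reasoning

  τ-∑ : ∀ n f → τ 1 n f ≡ z n * ∑f n f
  τ-∑ n f = trans (cong (x ↑ n *_) (T-∑ n f)) (sym (*-assoc (x ↑ n) (fac⁻¹ (parts b (suc n))) (∑f n f)))

  E-1 : ∀ n → E n (λ _ → 1ℚ) ≡ 1ℚ
  E-1 n = trans (𝔼-∑ (Ω n) (λ _ → 1ℚ)) (trans (cong (rate (Ω n) *_) (∑-1 (Ω n))) (rate*length (proj₂ (compositions-nonEmpty b (suc n)))))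

  -- Normalises `M 0` to 1.
  q : ℚ
  q = ω 1 0 ⁻¹

  M : ℕ → ℚ
  M n = q * τ 1 n (λ _ → 1ℚ)

  M*E : ∀ n f → M n * E n f ≡ q * τ 1 n f
  M*E n f = begin
    q * τ 1 n (λ _ → 1ℚ) * E n f                                  ≡⟨ cong₂ (λ s t → q * s * t) (τ-∑ n (λ _ → 1ℚ)) (𝔼-∑ (Ω n) (λ k → f (# (toList k)))) ⟩
    q * (z n * ∑f n (λ _ → 1ℚ)) * (rate (Ω n) * ∑f n f)           ≡⟨ ring 5 (λ q z s r t → q :* (z :* s) :* (r :* t) := q :* (r :* s) :* (z :* t)) q (z n) (∑f n (λ _ → 1ℚ)) (rate (Ω n)) (∑f n f) ⟩
    q * (rate (Ω n) * ∑f n (λ _ → 1ℚ)) * (z n * ∑f n f)           ≡⟨ cong₂ (λ s t → q * s * t) (trans (sym (𝔼-∑ (Ω n) (λ _ → 1ℚ))) (E-1 n)) (sym (τ-∑ n f)) ⟩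
    q * 1ℚ * τ 1 n f                                              ≡⟨ cong (_* τ 1 n f) (*-identityʳ q) ⟩
    q * τ 1 n f                                                   ∎
    where open ≡-Reasoning

  suc-pred* : ∀ j → ∃[ m ] b ℕ.* suc j ≡ suc m
  suc-pred* j = suc (proj₁ (size₂ j)) , proj₂ (size₂ j)

  u-true : ∀ {r k} → k ℕ.≤ r → u r k ≡ fac⁻¹ (r ℕ.∸ k)
  u-true {r} {k} k≤r = select-true (k ℕ.≤? r) k≤r (fac⁻¹ (r ℕ.∸ k))

  0<u : ∀ {r k} → k ℕ.≤ r → 0ℚ < u r k
  0<u {r} {k} k≤r = subst (0ℚ <_) (sym (u-true k≤r)) (0<fac⁻¹ (r ℕ.∸ k))

  0<ω : ∀ {j k} → k ℕ.≤ b ℕ.* j → 0ℚ < ω j k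
  0<ω {j} {k} h = 0<* (0<↑ 0<x k) (0<u h)

  0<ω₁₀ : 0ℚ < ω 1 0
  0<ω₁₀ = 0<ω {1} {0} ℕ.z≤n

  0<q : 0ℚ < q
  0<q = ⁻¹-pos 0<ω₁₀

  ω₁₀*q : ω 1 0 * q ≡ 1ℚ
  ω₁₀*q = *-⁻¹ 0<ω₁₀

  θ-0 : ∀ j → θ (suc j) 0 ≡ 1
  θ-0 j = cong positive? (proj₂ (suc-pred* j))

  τ-0 : ∀ j g → τ (suc j) 0 g ≡ ω (suc j) 0 * g 1
  τ-0 j g = trans (τ-level (suc j) 0 g) (cong (ω (suc j) 0 *_) (trans (τ-00 (λ x → g (θ (suc j) 0 ℕ.+ x))) (cong g (trans (ℕ.+-identityʳ (θ (suc j) 0)) (θ-0 j)))))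

  τ-last : ∀ j g → τ (suc j) 0 g ≡ ω (suc j) 0 * q * τ 1 0 g
  τ-last j g = trans (τ-0 j g) (trans (sym (*-identityʳ (ω (suc j) 0 * g 1))) (trans (cong (ω (suc j) 0 * g 1 *_) (sym ω₁₀*q))
    (trans (ring 4 (λ o g p q → o :* g :* (p :* q) := o :* q :* (p :* g)) (ω (suc j) 0) (g 1) (ω 1 0) q) (cong (ω (suc j) 0 * q *_) (sym (τ-0 0 g))))))

  open Chains ω θ
  module First = FirstPassage τ (λ j n → τ-ext j n) τ-level τ-0suc q τ-last

  β e : ℕ → Meas ℕ
  β = First.β 1
  e = First.e 1

  q*τ₀ : ∀ g → q * τ 1 0 g ≡ g 1
  q*τ₀ g = trans (cong (q *_) (τ-0 0 g)) (trans (ring 3 (λ q o g → q :* (o :* g) := o :* q :* g) q (ω 1 0) (g 1)) (trans (cong (_* g 1) ω₁₀*q) (*-identityˡ (g 1))))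

  E-0 : ∀ f → E 0 f ≡ f 1
  E-0 f = trans (sym (*-identityˡ (E 0 f))) (trans (cong (_* E 0 f) (sym (q*τ₀ (λ _ → 1ℚ)))) (trans (M*E 0 f) (q*τ₀ f)))

  -- This is `first-passage` at width 1, with `q * τ 1 t` rewritten as the mass times the
  -- expectation by `M*E`.
  E-rec : ∀ n f → M n * E n f ≡ conv n (λ s t → M t * ∫ (β s) (λ d → E t (λ x → f (d ℕ.+ x)))) + ∫ (e n) (λ d → E 0 (λ x → f (d ℕ.+ x)))
  E-rec n f = begin
    M n * E n f
      ≡⟨ trans (M*E n f) (cong (q *_) (First.first-passage n 0 n f ℕ.≤-refl)) ⟩
    q * (conv n F + ∫ (e n) (λ d → τ 1 0 (λ x → f (d ℕ.+ x))))
      ≡⟨ *-distribˡ-+ q (conv n F) (∫ (e n) (λ d → τ 1 0 (λ x → f (d ℕ.+ x)))) ⟩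
    q * conv n F + q * ∫ (e n) (λ d → τ 1 0 (λ x → f (d ℕ.+ x)))
      ≡⟨ cong₂ _+_ (trans (sym (conv-* n q F)) (conv-cong n λ s t _ → trans (sym (∫-* (β s) q (λ d → τ 1 t (λ x → f (d ℕ.+ x)))))
             (trans (∫-ext (β s) λ d → sym (M*E t (λ x → f (d ℕ.+ x)))) (∫-* (β s) (M t) (λ d → E t (λ x → f (d ℕ.+ x)))))))
           (trans (sym (∫-* (e n) q (λ d → τ 1 0 (λ x → f (d ℕ.+ x))))) (∫-ext (e n) λ d → trans (q*τ₀ (λ x → f (d ℕ.+ x))) (sym (E-0 (λ x → f (d ℕ.+ x)))))) ⟩
    conv n (λ s t → M t * ∫ (β s) (λ d → E t (λ x → f (d ℕ.+ x)))) + ∫ (e n) (λ d → E 0 (λ x → f (d ℕ.+ x))) ∎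
    where
    open ≡-Reasoning
    F : ℕ → ℕ → ℚ
    F s t = ∫ (β s) (λ d → τ 1 t (λ x → f (d ℕ.+ x)))

  θ≤1 : ∀ j k → θ j k ℕ.≤ 1
  θ≤1 j k = positive?≤1 (b ℕ.* j ℕ.∸ k)
    where
    positive?≤1 : ∀ m → positive? m ℕ.≤ 1
    positive?≤1 zero    = ℕ.z≤n
    positive?≤1 (suc _) = ℕ.≤-refl

  β₀ β₁ e₀ e₁ : ℕ → Meas ℕ
  β₀ _ = []
  β₁ j = (ω j 1 , θ j 1) ∷ []
  e₀ j = (ω j 0 * q , 0) ∷ []
  e₁ _ = []

  β₁-on : ∀ j → Positive-on (ℕ._≤ 1) (β₁ j)
  β₁-on j = (0≤ω j 1 , θ≤1 j 1) ∷ []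

  e₀-on : ∀ j → Positive-on (ℕ._≤ 0) (e₀ j)
  e₀-on j = (0≤* (0≤ω j 0) (<⇒≤ 0<q) , ℕ.z≤n) ∷ []

  A : ℚ
  A = x + q

  0≤A : 0ℚ ≤ A
  0≤A = 0≤-+ 0≤x (<⇒≤ 0<q)

  inv≤1 : ∀ k → inv k ≤ 1ℚ
  inv≤1 k = ≤-trans (≤-reflexive (sym (*-identityʳ (inv k)))) (≤-trans (*-monoˡ (0≤inv k) (ι-mono {1} {suc k} (ℕ.s≤s ℕ.z≤n))) (≤-reflexive (inv*ι k)))

  0≤Aκ : ∀ j → 0ℚ ≤ A * κ j
  0≤Aκ j = 0≤* 0≤A (0≤κ j)

  β₁≤ : ∀ j → mass (β₁ (2 ℕ.+ j)) ≤ A * κ (2 ℕ.+ j)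
  β₁≤ j = begin
    x ↑ 1 * u N 1 * 1ℚ + 0ℚ     ≡⟨ ring 2 (λ x u → x :* con 1ℚ :* u :* con 1ℚ :+ con 0ℚ := x :* u) x (u N 1) ⟩
    x * u N 1                   ≡⟨ cong (x *_) (u-true (ℕ.≤-trans (ℕ.s≤s ℕ.z≤n) (ℕ.≤-reflexive (sym (proj₂ (suc-pred* (suc j))))))) ⟩
    x * fac⁻¹ (N ℕ.∸ 1)         ≤⟨ *-monoˡ 0≤x (proj₁ (contracts b j)) ⟩
    x * κ (2 ℕ.+ j)             ≤⟨ *-monoʳ (0≤κ (2 ℕ.+ j)) (p≤p+q {x} {q} (<⇒≤ 0<q)) ⟩
    A * κ (2 ℕ.+ j)             ∎
    where
    open ≤-Reasoning
    N : ℕ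
    N = b ℕ.* (2 ℕ.+ j)

  e₀≤ : ∀ j → mass (e₀ (2 ℕ.+ j)) ≤ A * κ (2 ℕ.+ j)
  e₀≤ j = begin
    1ℚ * u N 0 * q * 1ℚ + 0ℚ    ≡⟨ ring 2 (λ q u → con 1ℚ :* u :* q :* con 1ℚ :+ con 0ℚ := q :* u) q (u N 0) ⟩
    q * u N 0                   ≤⟨ *-monoˡ (<⇒≤ 0<q) (≤-trans (≤-reflexive (u-true {N} {0} ℕ.z≤n)) (≤-trans (fac⁻¹-≤ (suc-pred* (suc j))) (proj₁ (contracts b j)))) ⟩
    q * κ (2 ℕ.+ j)             ≤⟨ *-monoʳ (0≤κ (2 ℕ.+ j)) (p≤q+p {q} {x} 0≤x) ⟩
    A * κ (2 ℕ.+ j)             ∎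
    where
    open ≤-Reasoning
    N : ℕ
    N = b ℕ.* (2 ℕ.+ j)
    fac⁻¹-≤ : ∀ {N} → ∃[ m ] N ≡ suc m → fac⁻¹ N ≤ fac⁻¹ (N ℕ.∸ 1)
    fac⁻¹-≤ (m , refl) = ≤-trans (*-monoˡ (0≤fac⁻¹ m) (inv≤1 m)) (≤-reflexive (*-identityʳ (fac⁻¹ m)))

  κ-step : ∀ j s → conv s (λ k _ → ω (2 ℕ.+ j) (2 ℕ.+ k) * κ (2 ℕ.+ k)) ≤ κ (2 ℕ.+ j)
  κ-step j = proj₂ (contracts b j)

  module Bβ = Bounds β₀ β₁ 0≤ω θ≤1 (λ _ → []) β₁-on A 0≤A κ κ-step (λ j → 0≤Aκ (2 ℕ.+ j)) β₁≤
  module Be = Bounds e₀ e₁ 0≤ω θ≤1 e₀-on (λ _ → []) A 0≤A κ κ-step e₀≤ (λ j → 0≤Aκ (2 ℕ.+ j))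

  tail₁ : ℚ
  tail₁ = tail (proj₁ (size₂ 0))

  tail₁-bound : ∀ s → conv s (λ k _ → ω 1 (2 ℕ.+ k) * κ (2 ℕ.+ k)) ≤ tail₁
  tail₁-bound s = ωκ-tail 1 (proj₁ (size₂ 0)) s (proj₂ (size₂ 0))

  0≤tail₁ : 0ℚ ≤ tail₁
  0≤tail₁ = ≤-trans (0≤* (0≤ω 1 2) (0≤κ 2)) (tail₁-bound 0)

  B : ℚ
  B = 1ℚ + A * tail₁

  1≤B : 1ℚ ≤ B
  1≤B = p≤p+q (0≤* 0≤A 0≤tail₁)

  0≤B : 0ℚ ≤ B
  0≤B = ≤-trans 0≤1 1≤B

  1≤b*1 : 1 ℕ.≤ b ℕ.* 1
  1≤b*1 = ℕ.≤-trans (ℕ.<⇒≤ 2≤b) (ℕ.≤-reflexive (sym (ℕ.*-identityʳ b)))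

  ω₁₁ : ω 1 1 ≡ 1ℚ
  ω₁₁ = trans (cong₂ _*_ (*-identityʳ x) (trans (u-true 1≤b*1) (cong (λ m → fac⁻¹ (m ℕ.∸ 1)) (ℕ.*-identityʳ b)))) x*y

  positive?-∸1 : ∀ {m} → 2 ℕ.≤ m → positive? (m ℕ.∸ 1) ≡ 1
  positive?-∸1 {suc zero}    (ℕ.s≤s ())
  positive?-∸1 {suc (suc m)} _ = refl

  β1 : ∀ f → ∫ (β 1) f ≡ f 1
  β1 f = trans (cong₂ (λ o k → o * f k + 0ℚ) ω₁₁ (positive?-∸1 (subst (2 ℕ.≤_) (sym (ℕ.*-identityʳ b)) 2≤b)))
    (trans (+-identityʳ (1ℚ * f 1)) (*-identityˡ (f 1)))

  e0 : ∀ f → ∫ (e 0) f ≡ f 0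
  e0 f = trans (cong (λ o → o * f 0 + 0ℚ) ω₁₀*q) (trans (+-identityʳ (1ℚ * f 0)) (*-identityˡ (f 0)))

  β≤B : ∀ s → mass (β s) ≤ B
  β≤B zero          = 0≤B
  β≤B (suc zero)    = ≤-trans (≤-reflexive (β1 (λ _ → 1ℚ))) 1≤B
  β≤B (suc (suc s)) = ≤-trans (Bβ.chains-bounded₁ s) (≤-trans (*-monoˡ 0≤A (tail₁-bound s)) (p≤q+p 0≤1))

  e≤B : ∀ n → mass (e n) ≤ B
  e≤B zero          = ≤-trans (≤-reflexive (e0 (λ _ → 1ℚ))) 1≤B
  e≤B (suc zero)    = 0≤B
  e≤B (suc (suc n)) = ≤-trans (Be.chains-bounded₁ n) (≤-trans (*-monoˡ 0≤A (tail₁-bound n)) (p≤q+p 0≤1))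

  -- The weight of the chain 1, b, 1, whose only leaves are those below its second level.
  η₀ η : ℚ
  η₀ = ω 1 b * ω b 1
  η  = η₀ * (1ℚ + η₀) ⁻¹

  0<η₀ : 0ℚ < η₀
  0<η₀ = 0<* (0<ω {1} {b} (ℕ.≤-reflexive (sym (ℕ.*-identityʳ b)))) (0<ω {b} {1} (ℕ.*-mono-≤ (ℕ.<⇒≤ 2≤b) (ℕ.<⇒≤ 2≤b)))

  0<1+η₀ : 0ℚ < 1ℚ + η₀
  0<1+η₀ = 0<-+ 0<1 (<⇒≤ 0<η₀)

  0<η : 0ℚ < η
  0<η = 0<* 0<η₀ (⁻¹-pos 0<1+η₀)

  η≤1 : η ≤ 1ℚ
  η≤1 = /≤ {1ℚ} {η₀} {1ℚ + η₀} 0<1+η₀ (≤-trans (p≤q+p {η₀} {1ℚ} 0≤1) (≤-reflexive (sym (*-identityˡ (1ℚ + η₀)))))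

  η≤η₀ : η ≤ η₀
  η≤η₀ = /≤ {η₀} {η₀} {1ℚ + η₀} 0<1+η₀ (≤-trans (≤-reflexive (sym (*-identityʳ η₀))) (*-monoˡ (<⇒≤ 0<η₀) (p≤p+q {1ℚ} {η₀} (<⇒≤ 0<η₀))))

  c≡ : ∃[ k ] c ≡ suc k × b ≡ 2 ℕ.+ k
  c≡ = ℕ.pred c , sym c≡suc , trans b≡1+c (cong suc (sym c≡suc))
    where
    c≡suc : suc (ℕ.pred c) ≡ c
    c≡suc = ℕ.suc-pred c {{ℕ.>-nonZero 0<c}}

  -- Only the chain through width `b` is kept. Its step from 1 to `b` has no leaves and its step
  -- from `b` to 1 has some, so its reward is 1, as for the block of length 1.
  η≤β : ∀ f → (∀ d → 0ℚ ≤ f d) → η * f 1 ≤ ∫ (β (suc (suc c))) f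
  η≤β f 0≤f = ≤-trans (*-monoʳ (0≤f 1) η≤η₀) (go c≡)
    where
    via : ℕ → ℕ → ℚ
    via k t = ω 1 (2 ℕ.+ k) * ∫ (First.β (2 ℕ.+ k) t) (λ d → f (θ 1 (2 ℕ.+ k) ℕ.+ d))
    0≤via : ∀ k t → 0ℚ ≤ via k t
    0≤via k t = 0≤* (0≤ω 1 (2 ℕ.+ k)) (0≤∫ (chains-on β₀ β₁ 0≤ω θ≤1 (λ _ → []) β₁-on (2 ℕ.+ k) t) (λ d _ → 0≤f (θ 1 (2 ℕ.+ k) ℕ.+ d)))
    θ₁b : ∀ {m} → b ≡ m → θ 1 m ≡ 0
    θ₁b refl = cong positive? (trans (cong (ℕ._∸ b) (ℕ.*-identityʳ b)) (ℕ.n∸n≡0 b))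
    θb₁ : ∀ {m} → b ≡ m → θ m 1 ≡ 1
    θb₁ refl = positive?-∸1 (ℕ.*-mono-≤ (ℕ.<⇒≤ 2≤b) 2≤b)
    go : ∃[ k ] c ≡ suc k × b ≡ 2 ℕ.+ k → η₀ * f 1 ≤ ∫ (β (suc (suc c))) f
    go (k , c≡ , b≡) = begin
      η₀ * f 1                                      ≡⟨ cong (λ m → ω 1 m * ω m 1 * f 1) b≡ ⟩
      ω 1 m * ω m 1 * f 1                           ≡⟨ ring 3 (λ o p f → o :* p :* f := o :* (p :* f :+ con 0ℚ)) (ω 1 m) (ω m 1) (f 1) ⟩
      ω 1 m * (ω m 1 * f 1 + 0ℚ)                    ≡⟨ cong (λ r → ω 1 m * (ω m 1 * f r + 0ℚ)) (sym (cong₂ ℕ._+_ (θ₁b b≡) (θb₁ b≡))) ⟩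
      via k 1                                         ≤⟨ conv-term c (λ k t _ → 0≤via k t) k 1 (trans (ℕ.+-comm k 1) (sym c≡)) ⟩
      conv c via                                      ≡⟨ sym (∫-chains β₀ β₁ 1 c f) ⟩
      ∫ (β (suc (suc c))) f                         ∎
      where
      open ≤-Reasoning
      m : ℕ
      m = 2 ℕ.+ k

  S : ℕ → ℕ
  S n = parts b (suc n)

  E-mono : ∀ n {f g} → (∀ x → x ℕ.≤ S n → f x ≤ g x) → E n f ≤ E n g
  E-mono n h = 𝔼-mono (Ω n) λ k → h (# (toList k)) (ℕ.≤-trans (#≤length (toList k)) (ℕ.≤-reflexive (length-toList k)))

  process : Process
  process = record
    { β = β ; e = e ; M = M ; E = E
    ; E-ext = λ n h → 𝔼-ext (Ω n) λ k → h (# (toList k)) ; E-+ = λ n f g → 𝔼-+ (Ω n) (λ k → f (# (toList k))) (λ k → g (# (toList k))) ; E-* = λ n c f → 𝔼-* (Ω n) c (λ k → f (# (toList k)))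
    ; S = S ; E-mono = E-mono ; E-1 = E-1 ; E-0 = E-0 ; E-rec = E-rec
    ; β-on = chains-on β₀ β₁ 0≤ω θ≤1 (λ _ → []) β₁-on 1 ; e-on = chains-on e₀ e₁ 0≤ω θ≤1 e₀-on (λ _ → []) 1
    ; β0 = refl ; β1 = β1 ; e0 = e0 ; B = B ; β≤B = β≤B ; e≤B = e≤B
    -- `suc (suc c)` is b + 1, the number of inner nodes that the chain 1, b, 1 adds.
    ; L′ = c ; η = η ; 0<η = 0<η ; η≤1 = η≤1 ; η≤β = η≤β }

theorem7 : (b : ℕ) .{{_ : NonTrivial b}} →
  ∃[ μ ] ∃[ σ² ]
    IsO[1] (λ n → fromℚ (𝔼 (compositions b n) distinctParts) -ᴿ μ *ᴿ fromℚ (ι n))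
  × IsO[1] (λ n → fromℚ (Var (compositions b n) distinctParts) -ᴿ σ² *ᴿ fromℚ (ι n))
  × AsymptoticallyNormal (compositions b) (λ n → distinctParts)
theorem7 b = asymptotics (Trees.process b) (compositions b) (λ n k → # (toList k)) (λ _ _ → refl)
  (λ n k → ℕ.≤-trans (#≤length (toList k)) (ℕ.≤-reflexive (length-toList k)))
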